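{- For every integer $n\ge 1$ let $c_2(n)$ denote the number of different $2$-dimensional polyominoes with $n$ cells (counted up to congruence) whose convex hull has the maximum possible area $n+\frac12\left\lfloor\frac{n-1}{2}\right\rfloor\left\lfloor\frac{n}{2}\right\rfloor$. Then $$c_2(n)=\begin{cases}\frac{n^3-2n^2+4n}{16} & \text{if } n\equiv 0 \pmod 4,\\[2pt] \frac{n^3-2n^2+13n+20}{32} & \text{if } n\equiv 1 \pmod 4,\\[2pt] \frac{n^3-2n^2+4n+8}{16} & \text{if } n\equiv 2 \pmod 4,\\[2pt] \frac{n^3-2n^2+5n+8}{32} & \text{if } n\equiv 3 \pmod 4.\end{cases}$$
   Context: A $2$-dimensional polyomino with $n$ cells is an edge-to-edge connected system of $n$ distinct unit squares of the integer grid in $\mathbb{R}^2$: any two of its squares are joined by a chain of squares of the system in which consecutive squares share a full edge. Its convex hull is the convex hull in $\mathbb{R}^2$ of the union of its (closed) squares. Two polyominoes are regarded as the same if one is obtained from the other by a translation, rotation or reflection of the grid. -}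

module Defs where

open import Data.Fin.Base using (Fin)
open import Data.Fin.Patterns using (0F; 1F; 2F; 3F)
open import Data.Integer.Base as ℤ using (ℤ; +_; 0ℤ; 1ℤ)
import Data.Integer.Properties as ℤ
open import Data.Integer.Tactic.RingSolver using (solve-∀)
open import Data.List.Base using (List; []; _∷_; length; map)
open import Data.List.Membership.Propositional using (_∈_)
open import Data.List.Properties using (map-id; map-∘; map-cong)
open import Data.List.Relation.Binary.Permutation.Propositional
  using (_↭_; ↭-trans; ↭-sym; ↭-reflexive)
open import Data.List.Relation.Binary.Permutation.Propositional.Properties using (map⁺)
open import Data.List.Relation.Unary.AllPairs using (AllPairs)
open import Data.List.Relation.Unary.Unique.Propositional using (Unique)
open import Data.Nat.Base as ℕ using (ℕ; ⌊_/2⌋)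
open import Data.Nat.DivMod using (_mod_)
open import Data.Product.Base using (Σ; ∃; ∃-syntax; _×_; _,_; proj₁)
open import Data.Rational.Base as ℚ using (ℚ; 0ℚ; 1ℚ; ½; _/_)
open import Data.Unit.Base using (⊤)
open import Function.Base using (id; _∘_)
open import Function.Bundles using (Inverse)
open import Level using (Level; 0ℓ)
open import Relation.Binary.Bundles using (Setoid)
open import Relation.Binary.Construct.Closure.ReflexiveTransitive using (Star)
import Relation.Binary.Construct.On as On
open import Relation.Binary.PropositionalEquality
  using (_≡_; _≗_; refl; sym; trans; cong; cong₂; setoid)
open import Relation.Unary using (Pred; _≐_)

-- The cell (x , y) is the closed unit square [x, x+1] × [y, y+1].

Cell : Set
Cell = ℤ × ℤ

-- Two unit squares share a full edge exactly when their lower left corners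
-- differ by one unit in one coordinate.

EdgeAdjacent : Cell → Cell → Set
EdgeAdjacent (x , y) (x′ , y′) = ℤ.∣ x ℤ.- x′ ∣ ℕ.+ ℤ.∣ y ℤ.- y′ ∣ ≡ 1

StepWithin : List Cell → Cell → Cell → Set
StepWithin cs c d = c ∈ cs × d ∈ cs × EdgeAdjacent c d

-- The order of the list carries no meaning; it is forgotten by Congruent below.

record Polyomino (n : ℕ) : Set where
  field
    cells     : List Cell
    unique    : Unique cells
    size      : length cells ≡ n
    connected : ∀ {c d} → c ∈ cells → d ∈ cells → Star (StepWithin cells) c d

open Polyomino public

-- Symmetries of the grid, generated by translations, the quarter turn
-- (x , y) ↦ (- y , x) of the plane and the reflection (x , y) ↦ (- x , y).

data GridSymmetry : Set where
  translation : ℤ → ℤ → GridSymmetry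
  quarterTurn : GridSymmetry
  reflection  : GridSymmetry
  _after_     : GridSymmetry → GridSymmetry → GridSymmetry

-- The action on lower left corners: for instance the quarter turn maps
-- [x, x+1] × [y, y+1] to [- y - 1, - y] × [x, x+1].

act : GridSymmetry → Cell → Cell
act (translation a b) (x , y) = x ℤ.+ a , y ℤ.+ b
act quarterTurn       (x , y) = ℤ.- y ℤ.- 1ℤ , x
act reflection        (x , y) = ℤ.- x ℤ.- 1ℤ , y
act (g after h)       c       = act g (act h c)

Congruent : ∀ {n} → Polyomino n → Polyomino n → Set
Congruent P Q = ∃[ g ] map (act g) (cells P) ↭ cells Q

inverse : GridSymmetry → GridSymmetry
inverse (translation a b) = translation (ℤ.- a) (ℤ.- b)
inverse quarterTurn       = quarterTurn after (quarterTurn after quarterTurn)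
inverse reflection        = reflection
inverse (g after h)       = inverse h after inverse g

private
  flip-flip : ∀ z → ℤ.- (ℤ.- z ℤ.- 1ℤ) ℤ.- 1ℤ ≡ z
  flip-flip = solve-∀

  shift-back : ∀ z a → z ℤ.+ a ℤ.+ ℤ.- a ≡ z
  shift-back = solve-∀

  act-identity : act (translation 0ℤ 0ℤ) ≗ id
  act-identity (x , y) = cong₂ _,_ (ℤ.+-identityʳ x) (ℤ.+-identityʳ y)

  act-inverse : ∀ g → act (inverse g) ∘ act g ≗ id
  act-inverse (translation a b) (x , y) = cong₂ _,_ (shift-back x a) (shift-back y b)
  act-inverse quarterTurn       (x , y) = cong₂ _,_ (flip-flip x) (flip-flip y)
  act-inverse reflection        (x , y) = cong (_, y) (flip-flip x)
  act-inverse (g after h)       c       =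
    trans (cong (act (inverse h)) (act-inverse g (act h c))) (act-inverse h c)

  map-inverse : ∀ g cs → map (act (inverse g)) (map (act g) cs) ≡ cs
  map-inverse g cs =
    trans (sym (map-∘ cs)) (trans (map-cong (act-inverse g) cs) (map-id cs))

congruence : ℕ → Setoid 0ℓ 0ℓ
congruence n = record
  { Carrier       = Polyomino n
  ; _≈_           = Congruent
  ; isEquivalence = record
    { refl  = λ {P} → translation 0ℤ 0ℤ ,
        ↭-reflexive (trans (map-cong act-identity (cells P)) (map-id (cells P)))
    ; sym   = λ {P} (g , gP↭Q) → inverse g ,
        ↭-sym (↭-trans (↭-reflexive (sym (map-inverse g (cells P))))
                       (map⁺ (act (inverse g)) gP↭Q))
    ; trans = λ {P} (g , gP↭Q) (h , hQ↭R) → h after g ,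
        ↭-trans (↭-reflexive (map-∘ (cells P))) (↭-trans (map⁺ (act h) gP↭Q) hQ↭R)
    }
  }

-- The convex hull of a polyomino is a polygon with integer vertices, so it is
-- determined by its points with rational coordinates.

Point : Set
Point = ℚ × ℚ

InUnion : List Cell → Pred Point 0ℓ
InUnion cs (a , b) = ∃[ c ] c ∈ cs × InSquare c
  where
  InSquare : Cell → Set
  InSquare (x , y) =
    (x / 1 ℚ.≤ a × a ℚ.≤ (x ℤ.+ 1ℤ) / 1) × (y / 1 ℚ.≤ b × b ℚ.≤ (y ℤ.+ 1ℤ) / 1)

pointBetween : ℚ → Point → Point → Point
pointBetween t (a , b) (a′ , b′) =
  (1ℚ ℚ.- t) ℚ.* a ℚ.+ t ℚ.* a′ , (1ℚ ℚ.- t) ℚ.* b ℚ.+ t ℚ.* b′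

-- The smallest convex set containing S.

data ConvexHull (S : Pred Point 0ℓ) : Pred Point 0ℓ where
  contains : ∀ {p} → S p → ConvexHull S p
  between  : ∀ {p q} t → 0ℚ ℚ.≤ t → t ℚ.≤ 1ℚ →
             ConvexHull S p → ConvexHull S q → ConvexHull S (pointBetween t p q)

hull : ∀ {n} → Polyomino n → Pred Point 0ℓ
hull P = ConvexHull (InUnion (cells P))

cross : Point → Point → ℚ
cross (a , b) (a′ , b′) = a ℚ.* b′ ℚ.- a′ ℚ.* b

-- Positive exactly when p, q, r make a strict left turn.

orientation : Point → Point → Point → ℚ
orientation p q r = cross p q ℚ.+ cross q r ℚ.+ cross r p

-- The points are the vertices of a convex polygon, listed once around
-- counterclockwise: every p, q, r occurring in this order make a left turn.

Counterclockwise : List Point → Set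
Counterclockwise []       = ⊤
Counterclockwise (p ∷ ps) =
  AllPairs (λ q r → 0ℚ ℚ.< orientation p q r) ps × Counterclockwise ps

-- The shoelace formula.

polygonArea : List Point → ℚ
polygonArea []       = 0ℚ
polygonArea (p ∷ ps) = ½ ℚ.* shoelace p ps
  where
  shoelace : Point → List Point → ℚ
  shoelace q []       = cross q p
  shoelace q (r ∷ rs) = cross q r ℚ.+ shoelace r rs

-- S is a convex polygon of area a.

HasArea : Pred Point 0ℓ → ℚ → Set
HasArea S a =
  ∃[ vs ] Counterclockwise vs × S ≐ ConvexHull (_∈ vs) × polygonArea vs ≡ a

IsMaximumHullArea : ℕ → ℚ → Set
IsMaximumHullArea n a =
  (Σ (Polyomino n) λ P → HasArea (hull P) a) ×
  (∀ (P : Polyomino n) b → HasArea (hull P) b → b ℚ.≤ a)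

polyominoesWithHullArea : ℕ → ℚ → Setoid 0ℓ 0ℓ
polyominoesWithHullArea n a =
  On.setoid {B = Σ (Polyomino n) λ P → HasArea (hull P) a} (congruence n) proj₁

HasCardinality : ∀ {a ℓ : Level} → Setoid a ℓ → ℕ → Set _
HasCardinality S k = Inverse S (setoid (Fin k))

maxHullArea : ℕ → ℚ
maxHullArea n = + n / 1 ℚ.+ ½ ℚ.* (+ (⌊ n ℕ.∸ 1 /2⌋ ℕ.* ⌊ n /2⌋) / 1)

countFormula : ℕ → ℚ
countFormula n = byResidue (n mod 4)
  where
  open import Data.Integer.Base using (_+_; _-_; _*_; _^_)
  N : ℤ
  N = + n
  byResidue : Fin 4 → ℚ
  byResidue 0F = (N ^ 3 - + 2 * N ^ 2 + + 4 * N) / 16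
  byResidue 1F = (N ^ 3 - + 2 * N ^ 2 + + 13 * N + + 20) / 32
  byResidue 2F = (N ^ 3 - + 2 * N ^ 2 + + 4 * N + + 8) / 16
  byResidue 3F = (N ^ 3 - + 2 * N ^ 2 + + 5 * N + + 8) / 32

-- The vertices of the hull are corners of cells, and by Green's formula its doubled
-- area is a sum over the rows of the grid.  A row is crossed upwards by one edge only,
-- so it contributes at most R↓ + R↑ - L↓ - L↑, where R↓ and L↓ bound the cells up to
-- the row and R↑ and L↑ those from the row on.  If the cells are added one at a time,
-- a of them horizontally and b vertically, the sum of these widths is at most
-- 2 (1 + a + b) + a b, and a b is largest when a and b are as equal as possible.
--
-- In the extremal case every added cell enlarges the bounding box, and the corners of
-- the box are cut off by the hull.  By induction on the cells this leaves only a row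
-- with one leg down and one leg up; conversely the hull of each such shape is an
-- octagon of the right area.  Up to congruence the shapes are crosses, whose legs meet
-- in one column, and proper Zs.  A cross is determined by its sorted arms and legs, and
-- also by exchanging them when both dimensions agree; a proper Z only has to be
-- identified with its half turn.  Counting the resulting canonical shapes gives a
-- quasi-polynomial in n of period 4.

module Submission where

open import Defs
open import Data.Bool.Base as Bool using (Bool; _∧_; _∨_; false; if_then_else_; not; true)
import Data.Bool.Properties as Bool
open import Data.Empty using (⊥; ⊥-elim)
open import Data.Fin.Base as Fin using (Fin; suc; toℕ; zero)
open import Data.Fin.Patterns using (0F; 1F; 2F; 3F)
import Data.Fin.Properties as Fin
open import Data.Integer.Base as ℤ using (+_; +≤+; -[1+_]; 0ℤ; 1ℤ; _⊓_; _⊔_; ℤ)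
import Data.Integer.Properties as ℤ
import Data.Integer.Tactic.RingSolver as ℤ
open import Data.List.Base as List using (List; []; _++_; _∷_; _∷ʳ_; concatMap; filter; filterᵇ; foldr; length; lookup; map; upTo)
open import Data.List.Membership.Propositional using (_∈_)
open import Data.List.Membership.Propositional.Properties using (∈-++⁺ʳ; ∈-++⁺ˡ; ∈-++⁻; ∈-cartesianProduct⁺; ∈-cartesianProduct⁻; ∈-filter⁺; ∈-lookup; ∈-map⁺; ∈-map⁻; ∈-upTo⁺; ∈-upTo⁻; ∈-∃++)
open import Data.List.Membership.Propositional.Properties.WithK using (unique∧set⇒bag)
open import Data.List.Properties using (++-assoc; ++-identityʳ; filter-++; length-++; length-map; length-upTo; map-++)
open import Data.List.Relation.Binary.BagAndSetEquality using (∼bag⇒↭)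
open import Data.List.Relation.Binary.Permutation.Propositional using (_↭_; ↭-refl; ↭-reflexive; ↭-sym; ↭-trans; ↭⇒↭ₛ)
open import Data.List.Relation.Binary.Permutation.Propositional.Properties using (++⁺ˡ; shift; ↭-length; ∈-resp-↭)
import Data.List.Relation.Binary.Permutation.Setoid.Properties as Permutation
open import Data.List.Relation.Unary.All as All using (All; []; _∷_)
import Data.List.Relation.Unary.All.Properties as All
open import Data.List.Relation.Unary.AllPairs as AllPairs using (AllPairs; []; _∷_)
import Data.List.Relation.Unary.AllPairs.Properties as AllPairs
open import Data.List.Relation.Unary.Any as Any using (here; there)
import Data.List.Relation.Unary.Any.Properties as Any
open import Data.List.Relation.Unary.Unique.Propositional using (Unique)
import Data.List.Relation.Unary.Unique.Propositional.Properties as Unique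
open import Data.Nat.Base as ℕ using (_<ᵇ_; _≡ᵇ_; _≤ᵇ_; _≥_; suc; zero; ℕ; ⌈_/2⌉; ⌊_/2⌋)
open import Data.Nat.DivMod using ([m+kn]%n≡m%n; _divMod_; _mod_; m%n<n; result)
import Data.Nat.Properties as ℕ
open import Data.Product.Base using (_,_; _×_; proj₁; proj₂; swap; ∃-syntax; ∃₂)
open import Data.Rational.Base as ℚ using (0ℚ; 1/_; 1ℚ; _/_; toℚᵘ; ½; ℚ)
import Data.Rational.Properties as ℚ
open import Data.Rational.Unnormalised.Base as ℚᵘ using (*<*; *≡*; *≤*; mkℚᵘ)
import Data.Rational.Unnormalised.Properties as ℚᵘ
open import Data.Sum.Base as Sum using (_⊎_; inj₁; inj₂)
open import Data.Unit.Base using (tt; ⊤)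
open import Function.Bundles using (mk⇔)
open import Level using (0ℓ)
open import Relation.Binary.Construct.Closure.ReflexiveTransitive using (Star; _◅_; _◅◅_)
import Relation.Binary.Construct.Closure.ReflexiveTransitive as Star
open import Relation.Binary.Definitions using (Tri; tri<; tri>; tri≈)
open import Relation.Binary.PropositionalEquality
open import Relation.Nullary using (Dec; does; no; yes; ¬_)
open import Relation.Nullary.Decidable using (_⊎-dec_; dec⇒maybe)
open import Relation.Unary using (Pred; _≐_; _⊆_)
open import Tactic.RingSolver using (solve-∀)
open import Tactic.RingSolver.Core.AlmostCommutativeRing using (AlmostCommutativeRing; fromCommutativeRing)

-- The hull itself is hard to follow while cells are added; the row widths replace it because they
-- change in a controlled way. A cell added sideways can widen the lower range only in its own row
-- and above, the upper range only in its own row and below, each by at most 1; so the gain is at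
-- most the number of rows plus 1. A cell beyond the top or the bottom creates one row of full
-- breadth and leaves the others alone. These are the increments of `2 (1 + a + b) + a b`. Enlarging
-- the box at every step does not determine the shape: a staircase does so too. The missing
-- information comes from the polygon. If the bound is attained, the edges that cross a row are
-- extreme among the corners below it and among those above it, so each corner of the box is cut off
-- by at most one edge. Such cuts survive the removal of the last cell, which makes the induction on
-- the cells run. The parameters of a shape can be read off its cells only where they matter: an
-- absent leg has no column, a single column no distinguished row. Hence the conditional invariants
-- in the proof of uniqueness.

infixl 6 _:+_ _:-_
infixl 7 _:*_
infix  8 :-_ #_
infix  5 _:≤_ _:<_ _:=_
infix  4 ⊢_
infixr 3 _⇒_

-- A reflective decision procedure for linear arithmetic over the integers.

data Exp : Set where
  var           : ℕ → Exp
  #_            : ℕ → Exp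
  _:+_ _:-_ _:*_ : Exp → Exp → Exp
  :-_           : Exp → Exp

data Expℕ : Set where
  var       : ℕ → Expℕ
  #_        : ℕ → Expℕ
  _:+_ _:*_ : Expℕ → Expℕ → Expℕ

data Rel (E : Set) : Set where
  _:≤_ _:<_ _:=_ : E → E → Rel E
  :⊥             : Rel E

data Sequent (E : Set) : Set where
  ⊢_  : Rel E → Sequent E
  _⇒_ : Rel E → Sequent E → Sequent E

Env : Set
Env = List ℤ

lookupEnv : Env → ℕ → ℤ
lookupEnv []      _       = 0ℤ
lookupEnv (z ∷ ρ) zero    = z
lookupEnv (z ∷ ρ) (suc i) = lookupEnv ρ i

⟦_⟧ : Exp → Env → ℤ
⟦ var i ⟧  ρ = lookupEnv ρ i
⟦ # k ⟧    ρ = + k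
⟦ a :+ b ⟧ ρ = ⟦ a ⟧ ρ ℤ.+ ⟦ b ⟧ ρ
⟦ a :- b ⟧ ρ = ⟦ a ⟧ ρ ℤ.- ⟦ b ⟧ ρ
⟦ a :* b ⟧ ρ = ⟦ a ⟧ ρ ℤ.* ⟦ b ⟧ ρ
⟦ :- a ⟧   ρ = ℤ.- ⟦ a ⟧ ρ

⟦_⟧ʳ : Rel Exp → Env → Set
⟦ a :≤ b ⟧ʳ ρ = ⟦ a ⟧ ρ ℤ.≤ ⟦ b ⟧ ρ
⟦ a :< b ⟧ʳ ρ = ⟦ a ⟧ ρ ℤ.< ⟦ b ⟧ ρ
⟦ a := b ⟧ʳ ρ = ⟦ a ⟧ ρ ≡ ⟦ b ⟧ ρ
⟦ :⊥ ⟧ʳ     ρ = ⊥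

⟦_⟧ˢ : Sequent Exp → Env → Set
⟦ ⊢ g ⟧ˢ   ρ = ⟦ g ⟧ʳ ρ
⟦ h ⇒ s ⟧ˢ ρ = ⟦ h ⟧ʳ ρ → ⟦ s ⟧ˢ ρ

Monomial Polynomial : Set
Monomial   = List ℕ
Polynomial = List (Monomial × ℤ)

⟦_⟧ᵐ : Monomial → Env → ℤ
⟦ [] ⟧ᵐ    ρ = 1ℤ
⟦ i ∷ m ⟧ᵐ ρ = lookupEnv ρ i ℤ.* ⟦ m ⟧ᵐ ρ

⟦_⟧ᵖ : Polynomial → Env → ℤ
⟦ [] ⟧ᵖ          ρ = 0ℤ
⟦ (m , c) ∷ p ⟧ᵖ ρ = c ℤ.* ⟦ m ⟧ᵐ ρ ℤ.+ ⟦ p ⟧ᵖ ρ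

eqᵐ : Monomial → Monomial → Bool
eqᵐ []      []      = true
eqᵐ (i ∷ m) (j ∷ n) = (i ≡ᵇ j) ∧ eqᵐ m n
eqᵐ _       _       = false

eqᵐ-sound : ∀ m n → Bool.T (eqᵐ m n) → m ≡ n
eqᵐ-sound []      []      _ = refl
eqᵐ-sound (i ∷ m) (j ∷ n) t with i ≡ᵇ j in eq
... | true = cong₂ _∷_ (ℕ.≡ᵇ⇒≡ i j (subst Bool.T (sym eq) tt)) (eqᵐ-sound m n t)

insertᵐ : ℕ → Monomial → Monomial
insertᵐ i []      = i ∷ []
insertᵐ i (j ∷ m) = if i ≤ᵇ j then i ∷ j ∷ m else j ∷ insertᵐ i m

insertᵐ-sound : ∀ ρ i m → ⟦ insertᵐ i m ⟧ᵐ ρ ≡ lookupEnv ρ i ℤ.* ⟦ m ⟧ᵐ ρ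
insertᵐ-sound ρ i []      = refl
insertᵐ-sound ρ i (j ∷ m) with i ≤ᵇ j
... | true  = refl
... | false = trans (cong (λ s → lookupEnv ρ j ℤ.* s) (insertᵐ-sound ρ i m)) (*-exchange (lookupEnv ρ j) (lookupEnv ρ i) (⟦ m ⟧ᵐ ρ))
  where
  *-exchange : ∀ x y z → x ℤ.* (y ℤ.* z) ≡ y ℤ.* (x ℤ.* z)
  *-exchange = ℤ.solve-∀

_∙ᵐ_ : Monomial → Monomial → Monomial
m ∙ᵐ n = foldr insertᵐ n m

∙ᵐ-sound : ∀ ρ m n → ⟦ m ∙ᵐ n ⟧ᵐ ρ ≡ ⟦ m ⟧ᵐ ρ ℤ.* ⟦ n ⟧ᵐ ρ
∙ᵐ-sound ρ []      n = sym (ℤ.*-identityˡ _)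
∙ᵐ-sound ρ (i ∷ m) n = begin
  ⟦ insertᵐ i (m ∙ᵐ n) ⟧ᵐ ρ               ≡⟨ insertᵐ-sound ρ i (m ∙ᵐ n) ⟩
  lookupEnv ρ i ℤ.* ⟦ m ∙ᵐ n ⟧ᵐ ρ         ≡⟨ cong (λ s → lookupEnv ρ i ℤ.* s) (∙ᵐ-sound ρ m n) ⟩
  lookupEnv ρ i ℤ.* (⟦ m ⟧ᵐ ρ ℤ.* ⟦ n ⟧ᵐ ρ) ≡⟨ sym (ℤ.*-assoc (lookupEnv ρ i) _ _) ⟩
  lookupEnv ρ i ℤ.* ⟦ m ⟧ᵐ ρ ℤ.* ⟦ n ⟧ᵐ ρ ∎
  where open ≡-Reasoning

isZero : ℤ → Bool
isZero (+ 0) = true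
isZero _     = false

isZero-sound : ∀ z → Bool.T (isZero z) → z ≡ 0ℤ
isZero-sound (+ 0) _ = refl

-- Vanishing coefficients are dropped, so that a polynomial that has become constant is literally
-- empty or a single term, the only forms that `negative` and `trivial` recognise.
addTerm : Monomial → ℤ → Polynomial → Polynomial
addTerm m c []            = if isZero c then [] else (m , c) ∷ []
addTerm m c ((n , d) ∷ p) with eqᵐ m n
... | false = (n , d) ∷ addTerm m c p
... | true  = if isZero (c ℤ.+ d) then p else (n , c ℤ.+ d) ∷ p

addTerm-sound : ∀ ρ m c p → ⟦ addTerm m c p ⟧ᵖ ρ ≡ c ℤ.* ⟦ m ⟧ᵐ ρ ℤ.+ ⟦ p ⟧ᵖ ρ
addTerm-sound ρ m c []            with isZero c in z
... | false = refl
... | true  = sym (cong (λ s → s ℤ.* ⟦ m ⟧ᵐ ρ ℤ.+ 0ℤ) (isZero-sound c (subst Bool.T (sym z) tt)))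
addTerm-sound ρ m c ((n , d) ∷ p) with eqᵐ m n in eq
... | false = trans (cong (λ s → d ℤ.* ⟦ n ⟧ᵐ ρ ℤ.+ s) (addTerm-sound ρ m c p))
                    (+-exchange (d ℤ.* ⟦ n ⟧ᵐ ρ) (c ℤ.* ⟦ m ⟧ᵐ ρ) (⟦ p ⟧ᵖ ρ))
  where
  +-exchange : ∀ x y z → x ℤ.+ (y ℤ.+ z) ≡ y ℤ.+ (x ℤ.+ z)
  +-exchange = ℤ.solve-∀
... | true with eqᵐ-sound m n (subst Bool.T (sym eq) tt)
...   | refl with isZero (c ℤ.+ d) in z
...     | false = distrib c d (⟦ m ⟧ᵐ ρ) (⟦ p ⟧ᵖ ρ)
  where
  distrib : ∀ c d x y → (c ℤ.+ d) ℤ.* x ℤ.+ y ≡ c ℤ.* x ℤ.+ (d ℤ.* x ℤ.+ y)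
  distrib = ℤ.solve-∀
...     | true  = begin
  ⟦ p ⟧ᵖ ρ                                     ≡⟨ sym (ℤ.+-identityˡ _) ⟩
  0ℤ ℤ.* ⟦ m ⟧ᵐ ρ ℤ.+ ⟦ p ⟧ᵖ ρ                 ≡⟨ cong (λ s → s ℤ.* ⟦ m ⟧ᵐ ρ ℤ.+ ⟦ p ⟧ᵖ ρ) (sym (isZero-sound (c ℤ.+ d) (subst Bool.T (sym z) tt))) ⟩
  (c ℤ.+ d) ℤ.* ⟦ m ⟧ᵐ ρ ℤ.+ ⟦ p ⟧ᵖ ρ          ≡⟨ distrib c d (⟦ m ⟧ᵐ ρ) (⟦ p ⟧ᵖ ρ) ⟩
  c ℤ.* ⟦ m ⟧ᵐ ρ ℤ.+ (d ℤ.* ⟦ m ⟧ᵐ ρ ℤ.+ ⟦ p ⟧ᵖ ρ) ∎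
  where
  open ≡-Reasoning
  distrib : ∀ c d x y → (c ℤ.+ d) ℤ.* x ℤ.+ y ≡ c ℤ.* x ℤ.+ (d ℤ.* x ℤ.+ y)
  distrib = ℤ.solve-∀

addScaled : Monomial → ℤ → Polynomial → Polynomial → Polynomial
addScaled n k []            q = q
addScaled n k ((m , c) ∷ p) q = addTerm (n ∙ᵐ m) (k ℤ.* c) (addScaled n k p q)

addScaled-sound : ∀ ρ n k p q →
  ⟦ addScaled n k p q ⟧ᵖ ρ ≡ k ℤ.* ⟦ n ⟧ᵐ ρ ℤ.* ⟦ p ⟧ᵖ ρ ℤ.+ ⟦ q ⟧ᵖ ρ
addScaled-sound ρ n k []            q =
  sym (trans (cong (λ s → s ℤ.+ ⟦ q ⟧ᵖ ρ) (ℤ.*-zeroʳ (k ℤ.* ⟦ n ⟧ᵐ ρ))) (ℤ.+-identityˡ _))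
addScaled-sound ρ n k ((m , c) ∷ p) q = begin
  ⟦ addTerm (n ∙ᵐ m) (k ℤ.* c) (addScaled n k p q) ⟧ᵖ ρ
    ≡⟨ addTerm-sound ρ (n ∙ᵐ m) (k ℤ.* c) (addScaled n k p q) ⟩
  k ℤ.* c ℤ.* ⟦ n ∙ᵐ m ⟧ᵐ ρ ℤ.+ ⟦ addScaled n k p q ⟧ᵖ ρ
    ≡⟨ cong₂ (λ s t → k ℤ.* c ℤ.* s ℤ.+ t) (∙ᵐ-sound ρ n m) (addScaled-sound ρ n k p q) ⟩
  k ℤ.* c ℤ.* (⟦ n ⟧ᵐ ρ ℤ.* ⟦ m ⟧ᵐ ρ) ℤ.+ (k ℤ.* ⟦ n ⟧ᵐ ρ ℤ.* ⟦ p ⟧ᵖ ρ ℤ.+ ⟦ q ⟧ᵖ ρ)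
    ≡⟨ regroup k c (⟦ n ⟧ᵐ ρ) (⟦ m ⟧ᵐ ρ) (⟦ p ⟧ᵖ ρ) (⟦ q ⟧ᵖ ρ) ⟩
  k ℤ.* ⟦ n ⟧ᵐ ρ ℤ.* (c ℤ.* ⟦ m ⟧ᵐ ρ ℤ.+ ⟦ p ⟧ᵖ ρ) ℤ.+ ⟦ q ⟧ᵖ ρ ∎
  where
  open ≡-Reasoning
  regroup : ∀ k c n m p q →
    k ℤ.* c ℤ.* (n ℤ.* m) ℤ.+ (k ℤ.* n ℤ.* p ℤ.+ q) ≡ k ℤ.* n ℤ.* (c ℤ.* m ℤ.+ p) ℤ.+ q
  regroup = ℤ.solve-∀

product : Polynomial → Polynomial → Polynomial
product []            q = []
product ((m , c) ∷ p) q = addScaled m c q (product p q)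

product-sound : ∀ ρ p q → ⟦ product p q ⟧ᵖ ρ ≡ ⟦ p ⟧ᵖ ρ ℤ.* ⟦ q ⟧ᵖ ρ
product-sound ρ []            q = refl
product-sound ρ ((m , c) ∷ p) q = begin
  ⟦ addScaled m c q (product p q) ⟧ᵖ ρ                         ≡⟨ addScaled-sound ρ m c q (product p q) ⟩
  c ℤ.* ⟦ m ⟧ᵐ ρ ℤ.* ⟦ q ⟧ᵖ ρ ℤ.+ ⟦ product p q ⟧ᵖ ρ           ≡⟨ cong (λ s → c ℤ.* ⟦ m ⟧ᵐ ρ ℤ.* ⟦ q ⟧ᵖ ρ ℤ.+ s) (product-sound ρ p q) ⟩
  c ℤ.* ⟦ m ⟧ᵐ ρ ℤ.* ⟦ q ⟧ᵖ ρ ℤ.+ ⟦ p ⟧ᵖ ρ ℤ.* ⟦ q ⟧ᵖ ρ        ≡⟨ sym (ℤ.*-distribʳ-+ (⟦ q ⟧ᵖ ρ) (c ℤ.* ⟦ m ⟧ᵐ ρ) (⟦ p ⟧ᵖ ρ)) ⟩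
  (c ℤ.* ⟦ m ⟧ᵐ ρ ℤ.+ ⟦ p ⟧ᵖ ρ) ℤ.* ⟦ q ⟧ᵖ ρ                   ∎
  where open ≡-Reasoning

plus : ℤ → Polynomial → Polynomial → Polynomial
plus k p q = addScaled [] k p q

plus-sound : ∀ ρ k p q → ⟦ plus k p q ⟧ᵖ ρ ≡ k ℤ.* ⟦ p ⟧ᵖ ρ ℤ.+ ⟦ q ⟧ᵖ ρ
plus-sound ρ k p q = trans (addScaled-sound ρ [] k p q)
  (cong (λ s → s ℤ.* ⟦ p ⟧ᵖ ρ ℤ.+ ⟦ q ⟧ᵖ ρ) (ℤ.*-identityʳ k))

normal : Exp → Polynomial
normal (var i)  = (i ∷ [] , 1ℤ) ∷ []
normal (# zero) = []
normal (# k)    = ([] , + k) ∷ []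
normal (a :+ b) = plus 1ℤ (normal b) (normal a)
normal (a :- b) = plus -[1+ 0 ] (normal b) (normal a)
normal (a :* b) = product (normal a) (normal b)
normal (:- a)   = plus -[1+ 0 ] (normal a) []

normal-sound : ∀ ρ a → ⟦ normal a ⟧ᵖ ρ ≡ ⟦ a ⟧ ρ
normal-sound ρ (var i)   = unit (lookupEnv ρ i)
  where
  unit : ∀ x → 1ℤ ℤ.* (x ℤ.* 1ℤ) ℤ.+ 0ℤ ≡ x
  unit = ℤ.solve-∀
normal-sound ρ (# zero)  = refl
normal-sound ρ (# suc k) = unit (+ suc k)
  where
  unit : ∀ x → x ℤ.* 1ℤ ℤ.+ 0ℤ ≡ x
  unit = ℤ.solve-∀
normal-sound ρ (a :+ b)  = trans (plus-sound ρ 1ℤ (normal b) (normal a))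
  (trans (cong₂ (λ x y → 1ℤ ℤ.* x ℤ.+ y) (normal-sound ρ b) (normal-sound ρ a)) (flip (⟦ a ⟧ ρ) (⟦ b ⟧ ρ)))
  where
  flip : ∀ x y → 1ℤ ℤ.* y ℤ.+ x ≡ x ℤ.+ y
  flip = ℤ.solve-∀
normal-sound ρ (a :- b)  = trans (plus-sound ρ -[1+ 0 ] (normal b) (normal a))
  (trans (cong₂ (λ x y → -[1+ 0 ] ℤ.* x ℤ.+ y) (normal-sound ρ b) (normal-sound ρ a)) (flip (⟦ a ⟧ ρ) (⟦ b ⟧ ρ)))
  where
  flip : ∀ x y → -[1+ 0 ] ℤ.* y ℤ.+ x ≡ x ℤ.- y
  flip = ℤ.solve-∀
normal-sound ρ (a :* b)  = trans (product-sound ρ (normal a) (normal b))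
  (cong₂ ℤ._*_ (normal-sound ρ a) (normal-sound ρ b))
normal-sound ρ (:- a)    = trans (plus-sound ρ -[1+ 0 ] (normal a) [])
  (trans (cong (λ x → -[1+ 0 ] ℤ.* x ℤ.+ 0ℤ) (normal-sound ρ a)) (negate (⟦ a ⟧ ρ)))
  where
  negate : ∀ x → -[1+ 0 ] ℤ.* x ℤ.+ 0ℤ ≡ ℤ.- x
  negate = ℤ.solve-∀

coefficient : Monomial → Polynomial → ℤ
coefficient m []            = 0ℤ
coefficient m ((n , c) ∷ p) = if eqᵐ m n then c else coefficient m p

IsNonNeg IsZero : Env → Polynomial → Set
IsNonNeg ρ p = 0ℤ ℤ.≤ ⟦ p ⟧ᵖ ρ
IsZero   ρ p = ⟦ p ⟧ᵖ ρ ≡ 0ℤ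

-- Only coefficients 1 and -1 are accepted: they are their own inverses, so the monomial can be
-- eliminated without leaving the integers. The list holds at most one term and serves as an
-- optional value.
unitPivot : Polynomial → Polynomial
unitPivot []                          = []
unitPivot (([] , c) ∷ p)              = unitPivot p
unitPivot ((m , + 1) ∷ p)             = (m , + 1) ∷ []
unitPivot ((m , -[1+ 0 ]) ∷ p)        = (m , -[1+ 0 ]) ∷ []
unitPivot (_ ∷ p)                     = unitPivot p

negative : Polynomial → Bool
negative (([] , -[1+ _ ]) ∷ []) = true
negative _                      = false

negative-sound : ∀ ρ p → Bool.T (negative p) → ¬ IsNonNeg ρ p
negative-sound ρ (([] , -[1+ n ]) ∷ []) _ 0≤p
  rewrite ℤ.*-identityʳ -[1+ n ] with 0≤p
... | ()

trivial : Polynomial → Bool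
trivial []                  = true
trivial (([] , + _) ∷ [])   = true
trivial _                   = false

-- The number of pairs that eliminating the monomial produces.

cost : Monomial → List Polynomial → ℕ
cost m ps = count 0 0 ps
  where
  count : ℕ → ℕ → List Polynomial → ℕ
  count a b []       = a ℕ.* b
  count a b (p ∷ ps) with coefficient m p
  ... | + 0      = count a b ps
  ... | + suc _  = count (suc a) b ps
  ... | -[1+ _ ] = count a (suc b) ps

-- A greedy choice that keeps the number of new inequalities small; 1000000 stands for infinity. The
-- choice affects only success, since `eliminate-sound` holds for every monomial.
bestPivot : List Polynomial → Monomial
bestPivot ps = proj₁ (foldr (λ p best → foldr choose best p) ([] , 1000000) ps)
  where
  choose : Monomial × ℤ → Monomial × ℕ → Monomial × ℕ
  choose ([] , _) best    = best
  choose (m , _)  (n , k) = if cost m ps <ᵇ k then (m , cost m ps) else (n , k)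

-- Coefficients of opposite signs at `m` cancel in this sum. The multipliers are absolute values, so
-- nonnegativity is preserved whatever the signs are.
combine : Monomial → Polynomial → Polynomial → Polynomial
combine m p q = plus (+ ℤ.∣ coefficient m q ∣) p (plus (+ ℤ.∣ coefficient m p ∣) q [])

combine-sound : ∀ ρ m p q → IsNonNeg ρ p → IsNonNeg ρ q → IsNonNeg ρ (combine m p q)
combine-sound ρ m p q 0≤p 0≤q
  rewrite plus-sound ρ (+ ℤ.∣ coefficient m q ∣) p (plus (+ ℤ.∣ coefficient m p ∣) q [])
        | plus-sound ρ (+ ℤ.∣ coefficient m p ∣) q [] =
  ℤ.+-mono-≤ (scale ℤ.∣ coefficient m q ∣ 0≤p)
    (ℤ.+-mono-≤ (scale ℤ.∣ coefficient m p ∣ 0≤q) ℤ.≤-refl)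
  where
  scale : ∀ k {z} → 0ℤ ℤ.≤ z → 0ℤ ℤ.≤ + k ℤ.* z
  scale k {z} 0≤z = subst (ℤ._≤ + k ℤ.* z) (ℤ.*-zeroʳ (+ k)) (ℤ.*-monoˡ-≤-nonNeg (+ k) 0≤z)

module _ (m : Monomial) where

  positives negatives others : List Polynomial → List Polynomial
  positives = filterᵇ λ p → 0< (coefficient m p)
    where
    0< : ℤ → Bool
    0< (+ suc _) = true
    0< _         = false
  negatives = filterᵇ λ p → <0 (coefficient m p)
    where
    <0 : ℤ → Bool
    <0 -[1+ _ ] = true
    <0 _        = false
  others = filterᵇ λ p → isZero (coefficient m p)

  pairs : List Polynomial → List Polynomial → List Polynomial
  pairs ps qs = concatMap (λ p → map (combine m p) qs) ps

  eliminate : List Polynomial → List Polynomial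
  eliminate ps = filterᵇ (λ p → not (trivial p)) (pairs (positives ps) (negatives ps)) ++ others ps

filterᵇ-All : ∀ {P : Polynomial → Set} f {ps} → All P ps → All P (filterᵇ f ps)
filterᵇ-All f []                 = []
filterᵇ-All f {p ∷ _} (px ∷ pxs) with f p
... | true  = px ∷ filterᵇ-All f pxs
... | false = filterᵇ-All f pxs

eliminate-sound : ∀ ρ m {ps} → All (IsNonNeg ρ) ps → All (IsNonNeg ρ) (eliminate m ps)
eliminate-sound ρ m {ps} h =
  All.++⁺ (filterᵇ-All _ (pairs-sound (filterᵇ-All _ h) (filterᵇ-All _ h))) (filterᵇ-All _ h)
  where
  row : ∀ {p qs} → IsNonNeg ρ p → All (IsNonNeg ρ) qs → All (IsNonNeg ρ) (map (combine m p) qs)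
  row         hp []        = []
  row {p} {q ∷ _} hp (hq ∷ hs) = combine-sound ρ m p q hp hq ∷ row {p} hp hs
  pairs-sound : ∀ {ps qs} → All (IsNonNeg ρ) ps → All (IsNonNeg ρ) qs → All (IsNonNeg ρ) (pairs m ps qs)
  pairs-sound []        hs = []
  pairs-sound {p ∷ _} (hp ∷ hps) hs = All.++⁺ (row {p} hp hs) (pairs-sound hps hs)

anyNegative : List Polynomial → Bool
anyNegative []       = false
anyNegative (p ∷ ps) = negative p ∨ anyNegative ps

anyNegative-sound : ∀ ρ ps → Bool.T (anyNegative ps) → ¬ All (IsNonNeg ρ) ps
anyNegative-sound ρ (p ∷ ps) t (hp ∷ hps) with negative p in eq
... | true  = negative-sound ρ p (subst Bool.T (sym eq) tt) hp
... | false = anyNegative-sound ρ ps t hps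

-- Fourier–Motzkin elimination, with monomials in the role of variables.

refuteInequalities : ℕ → List Polynomial → Bool
refuteInequalities zero       ps = false
refuteInequalities (suc fuel) ps =
  if anyNegative ps then true else refuteInequalities fuel (eliminate (bestPivot ps) ps)

refuteInequalities-sound : ∀ ρ fuel ps → Bool.T (refuteInequalities fuel ps) → ¬ All (IsNonNeg ρ) ps
refuteInequalities-sound ρ (suc fuel) ps t h with anyNegative ps in eq
... | true  = anyNegative-sound ρ ps (subst Bool.T (sym eq) tt) h
... | false = refuteInequalities-sound ρ fuel (eliminate (bestPivot ps) ps) t
                (eliminate-sound ρ (bestPivot ps) h)

-- A multiple of an equation does not change the value. This multiple cancels `m`, because `u` is 1
-- or -1 and hence its own inverse.
reduce : Monomial → ℤ → Polynomial → Polynomial → Polynomial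
reduce m u e p = plus (ℤ.- (u ℤ.* coefficient m p)) e p

reduce-sound : ∀ ρ m u e p → IsZero ρ e → ⟦ reduce m u e p ⟧ᵖ ρ ≡ ⟦ p ⟧ᵖ ρ
reduce-sound ρ m u e p e≡0 = trans (plus-sound ρ k e p)
  (trans (cong (λ s → k ℤ.* s ℤ.+ ⟦ p ⟧ᵖ ρ) e≡0) (trans (cong (λ s → s ℤ.+ ⟦ p ⟧ᵖ ρ) (ℤ.*-zeroʳ k)) (ℤ.+-identityˡ _)))
  where k = ℤ.- (u ℤ.* coefficient m p)

-- Equations with a unit coefficient are used for substitution, the others as
-- two inequalities.

refute : ℕ → ℕ → List Polynomial → List Polynomial → Bool
refute k zero       es       ps = false
refute k (suc fuel) []       ps = refuteInequalities k (filterᵇ (λ p → not (trivial p)) ps)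
refute k (suc fuel) (e ∷ es) ps with unitPivot e
... | (m , u) ∷ _ = refute k fuel (map (reduce m u e) es) (map (reduce m u e) ps)
... | []          = refute k fuel es (e ∷ plus -[1+ 0 ] e [] ∷ ps)

refute-sound : ∀ ρ k fuel es ps → Bool.T (refute k fuel es ps) → All (IsZero ρ) es → ¬ All (IsNonNeg ρ) ps
refute-sound ρ k (suc fuel) []       ps t _ h = refuteInequalities-sound ρ k _ t (filterᵇ-All _ h)
refute-sound ρ k (suc fuel) (e ∷ es) ps t (z ∷ zs) h with unitPivot e
... | (m , u) ∷ _ = refute-sound ρ k fuel _ _ t
  (All.map⁺ (All.map (λ {p} → trans (reduce-sound ρ m u e p z)) zs))
  (All.map⁺ (All.map (λ {p} → subst (0ℤ ℤ.≤_) (sym (reduce-sound ρ m u e p z))) h))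
... | []          = refute-sound ρ k fuel _ _ t zs
  (ℤ.≤-reflexive (sym z) ∷
   ℤ.≤-reflexive (sym (trans (plus-sound ρ -[1+ 0 ] e []) (cong (λ s → -[1+ 0 ] ℤ.* s ℤ.+ 0ℤ) z))) ∷ h)

System : Set
System = List Polynomial × List Polynomial

assume : Rel Exp → System → System
assume (a :≤ b) (es , ps) = es , normal (b :- a) ∷ ps
-- Over the integers a strict inequality leaves room for 1, which makes the rational elimination
-- strong enough for integer arguments.
assume (a :< b) (es , ps) = es , normal (b :- a :- # 1) ∷ ps
assume (a := b) (es , ps) = normal (b :- a) ∷ es , ps
assume :⊥       (es , ps) = es , normal (# 0 :- # 1) ∷ ps

Holds : Env → System → Set
Holds ρ (es , ps) = All (IsZero ρ) es × All (IsNonNeg ρ) ps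

private
  <⇒0≤ : ∀ {i j} → i ℤ.< j → 0ℤ ℤ.≤ j ℤ.- i ℤ.- 1ℤ
  <⇒0≤ {i} {j} i<j = subst (0ℤ ℤ.≤_) (regroup i j) (ℤ.i≤j⇒0≤j-i (ℤ.i<j⇒suc[i]≤j i<j))
    where
    regroup : ∀ i j → j ℤ.- (1ℤ ℤ.+ i) ≡ j ℤ.- i ℤ.- 1ℤ
    regroup = ℤ.solve-∀

assume-sound : ∀ ρ r s → ⟦ r ⟧ʳ ρ → Holds ρ s → Holds ρ (assume r s)
assume-sound ρ (a :≤ b) s h (zs , hs) =
  zs , subst (0ℤ ℤ.≤_) (sym (normal-sound ρ (b :- a))) (ℤ.i≤j⇒0≤j-i h) ∷ hs
assume-sound ρ (a :< b) s h (zs , hs) =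
  zs , subst (0ℤ ℤ.≤_) (sym (normal-sound ρ (b :- a :- # 1))) (<⇒0≤ h) ∷ hs
assume-sound ρ (a := b) s h (zs , hs) =
  trans (normal-sound ρ (b :- a)) (ℤ.i≡j⇒i-j≡0 (sym h)) ∷ zs , hs

checkSystem : ℕ → System → Bool
-- The same fuel bounds the equations to be processed and the rounds of elimination; running out of
-- it only yields `false`.
checkSystem k (es , ps) = refute k k es ps

decideGoal : ℕ → Rel Exp → System → Bool
decideGoal k (a :≤ b) s = checkSystem k (assume (b :< a) s)
decideGoal k (a :< b) s = checkSystem k (assume (b :≤ a) s)
decideGoal k (a := b) s = decideGoal k (a :≤ b) s ∧ decideGoal k (b :≤ a) s
decideGoal k :⊥       s = checkSystem k s

T-∧ : ∀ {a b} → Bool.T (a ∧ b) → Bool.T a × Bool.T b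
T-∧ {true} {true} _ = tt , tt

decideGoal-sound : ∀ ρ k g s → Bool.T (decideGoal k g s) → Holds ρ s → ⟦ g ⟧ʳ ρ
checkSystem-sound : ∀ ρ k s → Bool.T (checkSystem k s) → ¬ Holds ρ s
checkSystem-sound ρ k (es , ps) t (zs , hs) = refute-sound ρ k k es ps t zs hs
decideGoal-sound ρ k (a :≤ b) s t h with ⟦ a ⟧ ρ ℤ.≤? ⟦ b ⟧ ρ
... | yes a≤b = a≤b
... | no  a≰b = ⊥-elim (checkSystem-sound ρ k _ t (assume-sound ρ (b :< a) s (ℤ.≰⇒> a≰b) h))
decideGoal-sound ρ k (a :< b) s t h with ⟦ a ⟧ ρ ℤ.<? ⟦ b ⟧ ρ
... | yes a<b = a<b
... | no  a≮b = ⊥-elim (checkSystem-sound ρ k _ t (assume-sound ρ (b :≤ a) s (ℤ.≮⇒≥ a≮b) h))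
decideGoal-sound ρ k (a := b) s t h =
  ℤ.≤-antisym (decideGoal-sound ρ k (a :≤ b) s (proj₁ (T-∧ t)) h)
              (decideGoal-sound ρ k (b :≤ a) s (proj₂ (T-∧ {decideGoal k (a :≤ b) s} t)) h)
decideGoal-sound ρ k :⊥       s t h = ⊥-elim (checkSystem-sound ρ k s t h)

decideFrom : ℕ → Sequent Exp → System → Bool
decideFrom k (⊢ g)   s = decideGoal k g s
decideFrom k (r ⇒ q) s = decideFrom k q (assume r s)

decideFrom-sound : ∀ ρ k q s → Bool.T (decideFrom k q s) → Holds ρ s → ⟦ q ⟧ˢ ρ
decideFrom-sound ρ k (⊢ g)   s t h = decideGoal-sound ρ k g s t h
decideFrom-sound ρ k (r ⇒ q) s t h = λ hr → decideFrom-sound ρ k q (assume r s) t (assume-sound ρ r s hr h)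

decide : ℕ → Sequent Exp → Bool
decide k q = decideFrom k q ([] , [])

decide-sound : ∀ ρ k q → Bool.T (decide k q) → ⟦ q ⟧ˢ ρ
decide-sound ρ k q t = decideFrom-sound ρ k q ([] , []) t ([] , [])

-- Sequents are written as functions of their variables, so that a use of `lia` can name them;
-- `instantiate` puts numbered variables in.
Template : Set → ℕ → Set
Template E zero    = Sequent E
Template E (suc n) = E → Template E n

instantiate : ∀ {E} → (ℕ → E) → ∀ n → ℕ → Template E n → Sequent E
instantiate v zero    i f = f
instantiate v (suc n) i f = instantiate v n (suc i) (f (v i))

ForAll : ∀ {A : Set} → ℕ → (List A → Set) → Set
ForAll     zero    P = P []
ForAll {A} (suc n) P = (z : A) → ForAll n (λ ρ → P (z ∷ ρ))

curryEnv : ∀ {A : Set} n {P : List A → Set} → (∀ ρ → P ρ) → ForAll n P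
curryEnv zero    f = f []
curryEnv (suc n) f = λ z → curryEnv n (λ ρ → f (z ∷ ρ))

-- lia n (λ x₁ … xₙ → h₁ ⇒ … ⇒ ⊢ g) refl proves the sequent for all integers; nonlinear
-- monomials are treated as atoms, and disjunctions have to be split beforehand.

abstract

  lia : ∀ n (f : Template Exp n) → decide 40 (instantiate var n 0 f) ≡ true →
        ForAll n ⟦ instantiate var n 0 f ⟧ˢ
  lia n f t = curryEnv n (λ ρ → decide-sound ρ 40 (instantiate var n 0 f) (subst Bool.T (sym t) tt))

-- The same procedure for natural numbers, by embedding them into the integers.

lookupEnvℕ : List ℕ → ℕ → ℕ
lookupEnvℕ []      _       = 0
lookupEnvℕ (z ∷ ρ) zero    = z
lookupEnvℕ (z ∷ ρ) (suc i) = lookupEnvℕ ρ i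

⟦_⟧ℕ : Expℕ → List ℕ → ℕ
⟦ var i ⟧ℕ  ρ = lookupEnvℕ ρ i
⟦ # k ⟧ℕ    ρ = k
⟦ a :+ b ⟧ℕ ρ = ⟦ a ⟧ℕ ρ ℕ.+ ⟦ b ⟧ℕ ρ
⟦ a :* b ⟧ℕ ρ = ⟦ a ⟧ℕ ρ ℕ.* ⟦ b ⟧ℕ ρ

⟦_⟧ʳℕ : Rel Expℕ → List ℕ → Set
⟦ a :≤ b ⟧ʳℕ ρ = ⟦ a ⟧ℕ ρ ℕ.≤ ⟦ b ⟧ℕ ρ
⟦ a :< b ⟧ʳℕ ρ = ⟦ a ⟧ℕ ρ ℕ.< ⟦ b ⟧ℕ ρ
⟦ a := b ⟧ʳℕ ρ = ⟦ a ⟧ℕ ρ ≡ ⟦ b ⟧ℕ ρ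
⟦ :⊥ ⟧ʳℕ     ρ = ⊥

⟦_⟧ˢℕ : Sequent Expℕ → List ℕ → Set
⟦ ⊢ g ⟧ˢℕ   ρ = ⟦ g ⟧ʳℕ ρ
⟦ h ⇒ s ⟧ˢℕ ρ = ⟦ h ⟧ʳℕ ρ → ⟦ s ⟧ˢℕ ρ

exp : Expℕ → Exp
exp (var i)  = var i
exp (# k)    = # k
exp (a :+ b) = exp a :+ exp b
exp (a :* b) = exp a :* exp b

rel : Rel Expℕ → Rel Exp
rel (a :≤ b) = exp a :≤ exp b
rel (a :< b) = exp a :< exp b
rel (a := b) = exp a := exp b
rel :⊥       = :⊥

lookupEnv-+ : ∀ ρ i → lookupEnv (map +_ ρ) i ≡ + lookupEnvℕ ρ i
lookupEnv-+ []      i       = refl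
lookupEnv-+ (z ∷ ρ) zero    = refl
lookupEnv-+ (z ∷ ρ) (suc i) = lookupEnv-+ ρ i

exp-sound : ∀ ρ a → ⟦ exp a ⟧ (map +_ ρ) ≡ + ⟦ a ⟧ℕ ρ
exp-sound ρ (var i)  = lookupEnv-+ ρ i
exp-sound ρ (# k)    = refl
exp-sound ρ (a :+ b) = cong₂ ℤ._+_ (exp-sound ρ a) (exp-sound ρ b)
exp-sound ρ (a :* b) = trans (cong₂ ℤ._*_ (exp-sound ρ a) (exp-sound ρ b)) (sym (ℤ.pos-* (⟦ a ⟧ℕ ρ) (⟦ b ⟧ℕ ρ)))

rel⁺ : ∀ ρ r → ⟦ r ⟧ʳℕ ρ → ⟦ rel r ⟧ʳ (map +_ ρ)
rel⁺ ρ (a :≤ b) h rewrite exp-sound ρ a | exp-sound ρ b = +≤+ h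
rel⁺ ρ (a :< b) h rewrite exp-sound ρ a | exp-sound ρ b = ℤ.+<+ h
rel⁺ ρ (a := b) h rewrite exp-sound ρ a | exp-sound ρ b = cong +_ h

rel⁻ : ∀ ρ r → ⟦ rel r ⟧ʳ (map +_ ρ) → ⟦ r ⟧ʳℕ ρ
rel⁻ ρ (a :≤ b) h rewrite exp-sound ρ a | exp-sound ρ b = ℤ.drop‿+≤+ h
rel⁻ ρ (a :< b) h rewrite exp-sound ρ a | exp-sound ρ b = ℤ.drop‿+<+ h
rel⁻ ρ (a := b) h rewrite exp-sound ρ a | exp-sound ρ b = ℤ.+-injective h

monomial-nonNeg : ∀ ρ m → IsNonNeg (map +_ ρ) ((m , 1ℤ) ∷ [])
monomial-nonNeg ρ m = subst (0ℤ ℤ.≤_) (sym (unit (⟦ m ⟧ᵐ (map +_ ρ)))) (go m)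
  where
  unit : ∀ x → 1ℤ ℤ.* x ℤ.+ 0ℤ ≡ x
  unit = ℤ.solve-∀
  go : ∀ m → 0ℤ ℤ.≤ ⟦ m ⟧ᵐ (map +_ ρ)
  go []      = +≤+ ℕ.z≤n
  go (i ∷ m) rewrite lookupEnv-+ ρ i with ⟦ m ⟧ᵐ (map +_ ρ) | go m
  ... | + k | _ rewrite sym (ℤ.pos-* (lookupEnvℕ ρ i) k) = +≤+ ℕ.z≤n

-- A product of natural numbers is nonnegative, which is invisible where products are mere atoms.
-- Every monomial that occurs is therefore collected and supplied as a nonnegative quantity.
monomials : Sequent Expℕ → List Monomial
monomials (⊢ g)   = atoms g
  where
  atoms : Rel Expℕ → List Monomial
  atoms (a :≤ b) = map proj₁ (normal (exp a :- exp b))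
  atoms (a :< b) = map proj₁ (normal (exp a :- exp b))
  atoms (a := b) = map proj₁ (normal (exp a :- exp b))
  atoms :⊥       = []
monomials (h ⇒ s) = monomials (⊢ h) ++ monomials s

decideFromℕ : ℕ → Sequent Expℕ → System → Bool
decideFromℕ k (⊢ g)   s = decideGoal k (rel g) s
decideFromℕ k (r ⇒ q) s = decideFromℕ k q (assume (rel r) s)

decideFromℕ-sound : ∀ ρ k q s → Bool.T (decideFromℕ k q s) → Holds (map +_ ρ) s → ⟦ q ⟧ˢℕ ρ
decideFromℕ-sound ρ k (⊢ g)   s t h = rel⁻ ρ g (decideGoal-sound (map +_ ρ) k (rel g) s t h)
decideFromℕ-sound ρ k (r ⇒ q) s t h = λ hr →
  decideFromℕ-sound ρ k q _ t (assume-sound (map +_ ρ) (rel r) s (rel⁺ ρ r hr) h)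

nonNegatives : List Monomial → List Polynomial
nonNegatives = map (λ m → (m , 1ℤ) ∷ [])

nonNegatives-sound : ∀ ρ ms → All (IsNonNeg (map +_ ρ)) (nonNegatives ms)
nonNegatives-sound ρ []       = []
nonNegatives-sound ρ (m ∷ ms) = monomial-nonNeg ρ m ∷ nonNegatives-sound ρ ms

abstract

  liaℕ : ∀ n (f : Template Expℕ n) (let q = instantiate var n 0 f) →
    decideFromℕ 40 q ([] , nonNegatives (monomials q)) ≡ true → ForAll n ⟦ q ⟧ˢℕ
  liaℕ n f t = curryEnv n (λ ρ → let q = instantiate var n 0 f in
    decideFromℕ-sound ρ 40 q ([] , nonNegatives (monomials q)) (subst Bool.T (sym t) tt)
      ([] , nonNegatives-sound ρ (monomials q)))

-- Rational points and integer points

ι : ℤ → ℚ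
ι z = z / 1

private
  -- Normalised fractions compute through greatest common divisors; over unnormalised fractions with
  -- denominator 1 the homomorphism laws become identities of integers.
  ι-toℚᵘ : ∀ z → toℚᵘ (ι z) ℚᵘ.≃ mkℚᵘ z 0
  ι-toℚᵘ z = ℚ.toℚᵘ-fromℚᵘ (mkℚᵘ z 0)

ι-+ : ∀ x y → ι (x ℤ.+ y) ≡ ι x ℚ.+ ι y
ι-+ x y = ℚ.toℚᵘ-injective (ℚᵘ.≃-trans (ι-toℚᵘ (x ℤ.+ y)) (ℚᵘ.≃-sym
  (ℚᵘ.≃-trans (ℚ.toℚᵘ-homo-+ (ι x) (ι y)) (ℚᵘ.≃-trans (ℚᵘ.+-cong (ι-toℚᵘ x) (ι-toℚᵘ y)) (*≡* (eq x y))))))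
  where
  eq : ∀ x y → (x ℤ.* 1ℤ ℤ.+ y ℤ.* 1ℤ) ℤ.* 1ℤ ≡ (x ℤ.+ y) ℤ.* 1ℤ
  eq = ℤ.solve-∀

ι-* : ∀ x y → ι (x ℤ.* y) ≡ ι x ℚ.* ι y
ι-* x y = ℚ.toℚᵘ-injective (ℚᵘ.≃-trans (ι-toℚᵘ (x ℤ.* y)) (ℚᵘ.≃-sym
  (ℚᵘ.≃-trans (ℚ.toℚᵘ-homo-* (ι x) (ι y)) (ℚᵘ.*-cong (ι-toℚᵘ x) (ι-toℚᵘ y)))))

ι-neg : ∀ x → ι (ℤ.- x) ≡ ℚ.- ι x
ι-neg x = ℚ.toℚᵘ-injective (ℚᵘ.≃-trans (ι-toℚᵘ (ℤ.- x)) (ℚᵘ.≃-sym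
  (ℚᵘ.≃-trans (ℚ.toℚᵘ-homo‿- (ι x)) (ℚᵘ.-‿cong (ι-toℚᵘ x)))))

ι-- : ∀ x y → ι (x ℤ.- y) ≡ ι x ℚ.- ι y
ι-- x y = trans (ι-+ x (ℤ.- y)) (cong (λ z → ι x ℚ.+ z) (ι-neg y))

ι-mono-≤ : ∀ {x y} → x ℤ.≤ y → ι x ℚ.≤ ι y
ι-mono-≤ {x} {y} x≤y = ℚ.toℚᵘ-cancel-≤ (ℚᵘ.≤-respˡ-≃ (ℚᵘ.≃-sym (ι-toℚᵘ x))
  (ℚᵘ.≤-respʳ-≃ (ℚᵘ.≃-sym (ι-toℚᵘ y)) (*≤* (ℤ.*-monoʳ-≤-nonNeg 1ℤ x≤y))))

ι-cancel-≤ : ∀ {x y} → ι x ℚ.≤ ι y → x ℤ.≤ y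
ι-cancel-≤ {x} {y} h with ℚᵘ.≤-respˡ-≃ (ι-toℚᵘ x) (ℚᵘ.≤-respʳ-≃ (ι-toℚᵘ y) (ℚ.toℚᵘ-mono-≤ h))
... | *≤* x1≤y1 = subst₂ ℤ._≤_ (ℤ.*-identityʳ x) (ℤ.*-identityʳ y) x1≤y1

ι-mono-< : ∀ {x y} → x ℤ.< y → ι x ℚ.< ι y
ι-mono-< x<y = ℚ.≰⇒> λ h → ℤ.<⇒≱ x<y (ι-cancel-≤ h)

ι-cancel-< : ∀ {x y} → ι x ℚ.< ι y → x ℤ.< y
ι-cancel-< h = ℤ.≰⇒> λ y≤x → ℚ.<-irrefl refl (ℚ.<-≤-trans h (ι-mono-≤ y≤x))

ι-injective : ∀ {x y} → ι x ≡ ι y → x ≡ y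
ι-injective h = ℤ.≤-antisym (ι-cancel-≤ (ℚ.≤-reflexive h)) (ι-cancel-≤ (ℚ.≤-reflexive (sym h)))

ℚ-ring : AlmostCommutativeRing 0ℓ 0ℓ
ℚ-ring = fromCommutativeRing ℚ.+-*-commutativeRing (λ x → dec⇒maybe (0ℚ ℚ.≟ x))

ιP : ℤ × ℤ → Point
ιP (x , y) = ι x , ι y

crossℤ : ℤ × ℤ → ℤ × ℤ → ℤ
crossℤ (a , b) (a′ , b′) = a ℤ.* b′ ℤ.- a′ ℤ.* b

orientationℤ : ℤ × ℤ → ℤ × ℤ → ℤ × ℤ → ℤ
orientationℤ p q r = crossℤ p q ℤ.+ crossℤ q r ℤ.+ crossℤ r p

cross-ι : ∀ p q → cross (ιP p) (ιP q) ≡ ι (crossℤ p q)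
cross-ι (a , b) (a′ , b′) = sym (trans (ι-- (a ℤ.* b′) (a′ ℤ.* b)) (cong₂ ℚ._-_ (ι-* a b′) (ι-* a′ b)))

orientation-ι : ∀ p q r → orientation (ιP p) (ιP q) (ιP r) ≡ ι (orientationℤ p q r)
orientation-ι p q r =
  trans (cong₂ ℚ._+_ (cong₂ ℚ._+_ (cross-ι p q) (cross-ι q r)) (cross-ι r p))
  (sym (trans (ι-+ (crossℤ p q ℤ.+ crossℤ q r) (crossℤ r p))
    (cong (ℚ._+ ι (crossℤ r p)) (ι-+ (crossℤ p q) (crossℤ q r)))))

*½-cancel : ∀ {x y} → ½ ℚ.* x ≡ ½ ℚ.* y → x ≡ y
*½-cancel {x} {y} h = trans (double x) (trans (cong (λ z → (1ℚ ℚ.+ 1ℚ) ℚ.* z) h) (sym (double y)))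
  where
  double : ∀ x → x ≡ (1ℚ ℚ.+ 1ℚ) ℚ.* (½ ℚ.* x)
  double x = trans (sym (ℚ.*-identityˡ x)) (ℚ.*-assoc (1ℚ ℚ.+ 1ℚ) ½ x)

shoelaceFrom : Point → Point → List Point → ℚ
shoelaceFrom p q []       = cross q p
shoelaceFrom p q (r ∷ rs) = cross q r ℚ.+ shoelaceFrom p r rs

private
  -- The local function of polygonArea has no name outside Defs; s stands for it.
  unfold : ∀ p q r rs → ∃[ s ] polygonArea (p ∷ q ∷ r ∷ rs) ≡ ½ ℚ.* (cross p q ℚ.+ (cross q r ℚ.+ s)) ×
                               polygonArea (p ∷ r ∷ rs) ≡ ½ ℚ.* (cross p r ℚ.+ s)
  unfold p q r rs = _ , refl , refl

  +-cancel : ∀ z {x y} → z ℚ.+ x ≡ z ℚ.+ y → x ≡ y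
  +-cancel z {x} {y} h = trans (lemma z x) (trans (cong (ℚ._- z) h) (sym (lemma z y)))
    where
    lemma : ∀ z x → x ≡ z ℚ.+ x ℚ.- z
    lemma = solve-∀ ℚ-ring

-- By induction on the vertices. The two equations of `unfold` share the unnamed rest of the sum;
-- the induction hypothesis, for the polygon without `q`, identifies it once ½ and `cross p r` are
-- cancelled.
polygonArea-shoelace : ∀ p ps → polygonArea (p ∷ ps) ≡ ½ ℚ.* shoelaceFrom p p ps
polygonArea-shoelace p []           = refl
polygonArea-shoelace p (q ∷ [])     = refl
polygonArea-shoelace p (q ∷ r ∷ rs) =
  let s , eq₁ , eq₂ = unfold p q r rs
  in trans eq₁ (cong (λ t → ½ ℚ.* (cross p q ℚ.+ (cross q r ℚ.+ t)))
       (+-cancel (cross p r) (*½-cancel (trans (sym eq₂) (polygonArea-shoelace p (r ∷ rs))))))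

doubleAreaFrom : ℤ × ℤ → ℤ × ℤ → List (ℤ × ℤ) → ℤ
doubleAreaFrom p q []       = crossℤ q p
doubleAreaFrom p q (r ∷ rs) = crossℤ q r ℤ.+ doubleAreaFrom p r rs

doubleArea : List (ℤ × ℤ) → ℤ
doubleArea []       = 0ℤ
doubleArea (p ∷ ps) = doubleAreaFrom p p ps

polygonArea-ι : ∀ ws → polygonArea (map ιP ws) ≡ ½ ℚ.* ι (doubleArea ws)
polygonArea-ι []       = refl
polygonArea-ι (p ∷ ps) = trans (polygonArea-shoelace (ιP p) (map ιP ps)) (cong (½ ℚ.*_) (go p ps))
  where
  go : ∀ q rs → shoelaceFrom (ιP p) (ιP q) (map ιP rs) ≡ ι (doubleAreaFrom p q rs)
  go q []       = cross-ι q p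
  go q (r ∷ rs) = trans (cong₂ ℚ._+_ (cross-ι q r) (go r rs)) (sym (ι-+ (crossℤ q r) (doubleAreaFrom p r rs)))

-- Extreme points

Affine : (Point → ℚ) → Set
Affine g = ∀ t p q → g (pointBetween t p q) ≡ (1ℚ ℚ.- t) ℚ.* g p ℚ.+ t ℚ.* g q

orientation-affine : ∀ p q → Affine (orientation p q)
orientation-affine (a , b) (a′ , b′) t (c , d) (c′ , d′) = identity a b a′ b′ t c d c′ d′
  where
  identity : ∀ a b a′ b′ t c d c′ d′ →
    let x = (1ℚ ℚ.- t) ℚ.* c ℚ.+ t ℚ.* c′
        y = (1ℚ ℚ.- t) ℚ.* d ℚ.+ t ℚ.* d′
    in (a ℚ.* b′ ℚ.- a′ ℚ.* b) ℚ.+ (a′ ℚ.* y ℚ.- x ℚ.* b′) ℚ.+ (x ℚ.* b ℚ.- a ℚ.* y) ≡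
       (1ℚ ℚ.- t) ℚ.* ((a ℚ.* b′ ℚ.- a′ ℚ.* b) ℚ.+ (a′ ℚ.* d ℚ.- c ℚ.* b′) ℚ.+ (c ℚ.* b ℚ.- a ℚ.* d)) ℚ.+
       t ℚ.* ((a ℚ.* b′ ℚ.- a′ ℚ.* b) ℚ.+ (a′ ℚ.* d′ ℚ.- c′ ℚ.* b′) ℚ.+ (c′ ℚ.* b ℚ.- a ℚ.* d′))
  identity = solve-∀ ℚ-ring

affine-+ : ∀ {f g} → Affine f → Affine g → Affine (λ p → f p ℚ.+ g p)
affine-+ {f} {g} af ag t p q = trans (cong₂ ℚ._+_ (af t p q) (ag t p q)) (regroup (1ℚ ℚ.- t) t (f p) (f q) (g p) (g q))
  where
  regroup : ∀ s t a b c d → s ℚ.* a ℚ.+ t ℚ.* b ℚ.+ (s ℚ.* c ℚ.+ t ℚ.* d) ≡ s ℚ.* (a ℚ.+ c) ℚ.+ t ℚ.* (b ℚ.+ d)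
  regroup = solve-∀ ℚ-ring

private
  0≤1-t : ∀ {t} → t ℚ.≤ 1ℚ → 0ℚ ℚ.≤ 1ℚ ℚ.- t
  0≤1-t {t} t≤1 = subst (ℚ._≤ 1ℚ ℚ.- t) (ℚ.+-inverseʳ t) (ℚ.+-monoˡ-≤ (ℚ.- t) t≤1)

  0≤* : ∀ {s x} → 0ℚ ℚ.≤ s → 0ℚ ℚ.≤ x → 0ℚ ℚ.≤ s ℚ.* x
  0≤* {s} {x} 0≤s 0≤x = subst (ℚ._≤ s ℚ.* x) (ℚ.*-zeroʳ s)
    (ℚ.*-monoˡ-≤-nonNeg s {{ℚ.nonNegative 0≤s}} 0≤x)

  0<* : ∀ {s x} → 0ℚ ℚ.< s → 0ℚ ℚ.< x → 0ℚ ℚ.< s ℚ.* x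
  0<* {s} {x} 0<s 0<x = subst (ℚ._< s ℚ.* x) (ℚ.*-zeroʳ s)
    (ℚ.*-monoʳ-<-pos s {{ℚ.positive 0<s}} 0<x)

  0<+ : ∀ {x y} → 0ℚ ℚ.< x → 0ℚ ℚ.≤ y → 0ℚ ℚ.< x ℚ.+ y
  0<+ = ℚ.+-mono-<-≤

  0≤∧≢0⇒0< : ∀ {x} → 0ℚ ℚ.≤ x → x ≢ 0ℚ → 0ℚ ℚ.< x
  0≤∧≢0⇒0< {x} 0≤x x≢0 with 0ℚ ℚ.<? x
  ... | yes 0<x = 0<x
  ... | no  0≮x = ⊥-elim (x≢0 (ℚ.≤-antisym (ℚ.≮⇒≥ 0≮x) 0≤x))

  1-t≡0⇒t≡1 : ∀ t → 1ℚ ℚ.- t ≡ 0ℚ → t ≡ 1ℚ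
  1-t≡0⇒t≡1 t h = trans (identity t) (trans (cong (λ z → 1ℚ ℚ.- z) h) refl)
    where
    identity : ∀ t → t ≡ 1ℚ ℚ.- (1ℚ ℚ.- t)
    identity = solve-∀ ℚ-ring

between-0 : ∀ p q → pointBetween 0ℚ p q ≡ p
between-0 (a , b) (c , d) = cong₂ _,_ (identity a c) (identity b d)
  where
  identity : ∀ a c → (1ℚ ℚ.- 0ℚ) ℚ.* a ℚ.+ 0ℚ ℚ.* c ≡ a
  identity a c = trans (cong₂ ℚ._+_ (ℚ.*-identityˡ a) (ℚ.*-zeroˡ c)) (ℚ.+-identityʳ a)

between-1 : ∀ p q → pointBetween 1ℚ p q ≡ q
between-1 (a , b) (c , d) = cong₂ _,_ (identity a c) (identity b d)
  where
  identity : ∀ a c → (1ℚ ℚ.- 1ℚ) ℚ.* a ℚ.+ 1ℚ ℚ.* c ≡ c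
  identity a c = trans (cong₂ ℚ._+_ (ℚ.*-zeroˡ a) (ℚ.*-identityˡ c)) (ℚ.+-identityˡ c)

between-same : ∀ t p → pointBetween t p p ≡ p
between-same t (a , b) = cong₂ _,_ (identity t a) (identity t b)
  where
  identity : ∀ t a → (1ℚ ℚ.- t) ℚ.* a ℚ.+ t ℚ.* a ≡ a
  identity = solve-∀ ℚ-ring

combination-positive : ∀ {t x y} → 0ℚ ℚ.≤ t → t ℚ.≤ 1ℚ → 0ℚ ℚ.< x → 0ℚ ℚ.< y →
                       0ℚ ℚ.< (1ℚ ℚ.- t) ℚ.* x ℚ.+ t ℚ.* y
combination-positive {t} {x} {y} 0≤t t≤1 0<x 0<y with t ℚ.≟ 0ℚ
... | yes refl = 0<+ (0<* {1ℚ ℚ.- 0ℚ} {x} (ℚ.*<* (ℤ.+<+ (ℕ.s≤s ℕ.z≤n))) 0<x) (0≤* {0ℚ} {y} 0≤t (ℚ.<⇒≤ 0<y))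
... | no  t≢0  = subst (0ℚ ℚ.<_) (ℚ.+-comm (t ℚ.* y) ((1ℚ ℚ.- t) ℚ.* x))
  (0<+ (0<* (0≤∧≢0⇒0< 0≤t t≢0) 0<y) (0≤* (0≤1-t t≤1) (ℚ.<⇒≤ 0<x)))

-- The point p is the only one of its set at which g, elsewhere positive, vanishes.

record Exposed (g : Point → ℚ) (p : Point) : Set where
  field
    affine : Affine g
    vanish : g p ≡ 0ℚ

open Exposed

Beyond : (Point → ℚ) → Point → Pred Point 0ℓ
Beyond g p q = q ≡ p ⊎ 0ℚ ℚ.< g q

beyond-between : ∀ {g p} → Exposed g p → ∀ {q r} t → 0ℚ ℚ.≤ t → t ℚ.≤ 1ℚ →
                 Beyond g p q → Beyond g p r → Beyond g p (pointBetween t q r)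
beyond-between {g} {p} e t 0≤t t≤1 (inj₁ refl) (inj₁ refl) = inj₁ (between-same t p)
beyond-between {g} {p} e {q} {r} t 0≤t t≤1 (inj₁ refl) (inj₂ 0<r) with t ℚ.≟ 0ℚ
... | yes refl = inj₁ (between-0 p r)
... | no  t≢0  = inj₂ (subst (0ℚ ℚ.<_)
  (sym (trans (affine e t p r) (trans (cong (λ z → (1ℚ ℚ.- t) ℚ.* z ℚ.+ t ℚ.* g r) (vanish e))
    (trans (cong (ℚ._+ t ℚ.* g r) (ℚ.*-zeroʳ (1ℚ ℚ.- t))) (ℚ.+-identityˡ (t ℚ.* g r))))))
  (0<* (0≤∧≢0⇒0< 0≤t t≢0) 0<r))
beyond-between {g} {p} e {q} {r} t 0≤t t≤1 (inj₂ 0<q) (inj₁ refl) with 1ℚ ℚ.- t ℚ.≟ 0ℚ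
... | yes 1-t≡0 = inj₁ (trans (cong (λ t → pointBetween t q p) (1-t≡0⇒t≡1 t 1-t≡0)) (between-1 q p))
... | no  1-t≢0 = inj₂ (subst (0ℚ ℚ.<_)
  (sym (trans (affine e t q p) (trans (cong (λ z → (1ℚ ℚ.- t) ℚ.* g q ℚ.+ t ℚ.* z) (vanish e))
    (trans (cong (λ z → (1ℚ ℚ.- t) ℚ.* g q ℚ.+ z) (ℚ.*-zeroʳ t)) (ℚ.+-identityʳ _)))))
  (0<* (0≤∧≢0⇒0< (0≤1-t t≤1) 1-t≢0) 0<q))
beyond-between {g} {p} e {q} {r} t 0≤t t≤1 (inj₂ 0<q) (inj₂ 0<r) = inj₂ (subst (0ℚ ℚ.<_)
  (sym (affine e t q r)) (combination-positive 0≤t t≤1 0<q 0<r))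

hull-beyond : ∀ {g p S} → Exposed g p → S ⊆ Beyond g p → ConvexHull S ⊆ Beyond g p
hull-beyond e h (contains s)            = h s
hull-beyond e h (between t 0≤t t≤1 x y) =
  beyond-between e t 0≤t t≤1 (hull-beyond e h x) (hull-beyond e h y)

-- A point at which `g` vanishes cannot lie between two points at which `g` is positive. Hence one
-- end of every segment that produces it is the point itself, down to a generating point.
exposed-∈ : ∀ {g p S} → Exposed g p → S ⊆ Beyond g p → ∀ {x} → ConvexHull S x → x ≡ p → S p
exposed-∈ e h (contains s) refl = s
exposed-∈ {g} {p} {S} e h (between {q} {r} t 0≤t t≤1 x y) eq
  with hull-beyond e h x | hull-beyond e h y
... | inj₁ q≡p | _        = exposed-∈ e h x q≡p
... | inj₂ _   | inj₁ r≡p = exposed-∈ e h y r≡p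
... | inj₂ 0<q | inj₂ 0<r = ⊥-elim (ℚ.<-irrefl
  (sym (trans (sym (affine e t q r)) (trans (cong g eq) (vanish e)))) (combination-positive 0≤t t≤1 0<q 0<r))

-- The vertices of a polygon are corners of cells

Corner : List Cell → ℤ × ℤ → Set
Corner cs (X , Y) = ∃[ c ] c ∈ cs × (X ≡ proj₁ c ⊎ X ≡ proj₁ c ℤ.+ 1ℤ) × (Y ≡ proj₂ c ⊎ Y ≡ proj₂ c ℤ.+ 1ℤ)

private
  ι-suc : ∀ x → ι (x ℤ.+ 1ℤ) ≡ ι x ℚ.+ 1ℚ
  ι-suc x = ι-+ x 1ℤ

  offset : ∀ {x a} → ι x ℚ.≤ a → a ℚ.≤ ι (x ℤ.+ 1ℤ) → 0ℚ ℚ.≤ a ℚ.- ι x × a ℚ.- ι x ℚ.≤ 1ℚ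
  offset {x} {a} h k =
    subst (ℚ._≤ a ℚ.- ι x) (ℚ.+-inverseʳ (ι x)) (ℚ.+-monoˡ-≤ (ℚ.- ι x) h) ,
    subst (a ℚ.- ι x ℚ.≤_) (trans (cong (ℚ._- ι x) (ι-suc x)) (cancel (ι x) 1ℚ)) (ℚ.+-monoˡ-≤ (ℚ.- ι x) k)
    where
    cancel : ∀ x y → x ℚ.+ y ℚ.- x ≡ y
    cancel = solve-∀ ℚ-ring

  interpolate : ∀ x a → (1ℚ ℚ.- (a ℚ.- ι x)) ℚ.* ι x ℚ.+ (a ℚ.- ι x) ℚ.* ι (x ℤ.+ 1ℤ) ≡ a
  interpolate x a = trans (cong (λ z → (1ℚ ℚ.- (a ℚ.- ι x)) ℚ.* ι x ℚ.+ (a ℚ.- ι x) ℚ.* z) (ι-suc x)) (identity (ι x) a)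
    where
    identity : ∀ x a → (1ℚ ℚ.- (a ℚ.- x)) ℚ.* x ℚ.+ (a ℚ.- x) ℚ.* (x ℚ.+ 1ℚ) ≡ a
    identity = solve-∀ ℚ-ring

  constant : ∀ t a → (1ℚ ℚ.- t) ℚ.* a ℚ.+ t ℚ.* a ≡ a
  constant = solve-∀ ℚ-ring

-- Otherwise the point would lie inside a horizontal or vertical segment of its square with `g`
-- positive at both ends, and so at the point as well. This is where the coordinates become
-- integers.
exposed-corner : ∀ {g p cs} → Exposed g p → InUnion cs ⊆ Beyond g p → InUnion cs p →
                 ∃[ w ] Corner cs w × p ≡ ιP w
exposed-corner {g} {a , b} {cs} e h ((x , y) , c∈ , ((x≤a , a≤x′) , (y≤b , b≤y′))) =
  let X , X∈ , a≡ = horizontal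
      Y , Y∈ , b≡ = vertical
  in (X , Y) , ((x , y) , c∈ , X∈ , Y∈) , cong₂ _,_ a≡ b≡
  where
  x≤x′ : ∀ z → ι z ℚ.≤ ι (z ℤ.+ 1ℤ)
  x≤x′ z = ι-mono-≤ (ℤ.i≤i+j z 1ℤ)
  contradict : ∀ {q r} t → 0ℚ ℚ.≤ t → t ℚ.≤ 1ℚ → pointBetween t q r ≡ (a , b) → 0ℚ ℚ.< g q → ¬ 0ℚ ℚ.< g r
  contradict {q} {r} t 0≤t t≤1 eq 0<q 0<r = ℚ.<-irrefl
    (sym (trans (sym (affine e t q r)) (trans (cong g eq) (vanish e)))) (combination-positive 0≤t t≤1 0<q 0<r)
  horizontal : ∃[ X ] (X ≡ x ⊎ X ≡ x ℤ.+ 1ℤ) × a ≡ ι X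
  horizontal with h {ι x , b} ((x , y) , c∈ , ((ℚ.≤-refl , x≤x′ x) , (y≤b , b≤y′)))
                | h {ι (x ℤ.+ 1ℤ) , b} ((x , y) , c∈ , ((x≤x′ x , ℚ.≤-refl) , (y≤b , b≤y′)))
  ... | inj₁ eq | _       = x , inj₁ refl , sym (cong proj₁ eq)
  ... | inj₂ _  | inj₁ eq = x ℤ.+ 1ℤ , inj₂ refl , sym (cong proj₁ eq)
  ... | inj₂ l  | inj₂ r  = let 0≤t , t≤1 = offset {x} x≤a a≤x′ in
    ⊥-elim (contradict (a ℚ.- ι x) 0≤t t≤1 (cong₂ _,_ (interpolate x a) (constant (a ℚ.- ι x) b)) l r)
  vertical : ∃[ Y ] (Y ≡ y ⊎ Y ≡ y ℤ.+ 1ℤ) × b ≡ ι Y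
  vertical with h {a , ι y} ((x , y) , c∈ , ((x≤a , a≤x′) , (ℚ.≤-refl , x≤x′ y)))
              | h {a , ι (y ℤ.+ 1ℤ)} ((x , y) , c∈ , ((x≤a , a≤x′) , (x≤x′ y , ℚ.≤-refl)))
  ... | inj₁ eq | _       = y , inj₁ refl , sym (cong proj₂ eq)
  ... | inj₂ _  | inj₁ eq = y ℤ.+ 1ℤ , inj₂ refl , sym (cong proj₂ eq)
  ... | inj₂ l  | inj₂ r  = let 0≤t , t≤1 = offset {y} y≤b b≤y′ in
    ⊥-elim (contradict (b ℚ.- ι y) 0≤t t≤1 (cong₂ _,_ (constant (b ℚ.- ι y) a) (interpolate y b)) l r)

private
  orientation-rotate : ∀ p q r → orientation p q r ≡ orientation q r p
  orientation-rotate p q r = rotate (cross p q) (cross q r) (cross r p)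
    where
    rotate : ∀ x y z → x ℚ.+ y ℚ.+ z ≡ y ℚ.+ z ℚ.+ x
    rotate = solve-∀ ℚ-ring

  orientation-same : ∀ p q → orientation p q q ≡ 0ℚ
  orientation-same (a , b) (c , d) = identity a b c d
    where
    identity : ∀ a b c d → (a ℚ.* d ℚ.- c ℚ.* b) ℚ.+ (c ℚ.* d ℚ.- c ℚ.* d) ℚ.+ (c ℚ.* b ℚ.- a ℚ.* d) ≡ 0ℚ
    identity a b c d = trans (lemma a b c d) refl
      where
      lemma : ∀ a b c d → (a ℚ.* d ℚ.- c ℚ.* b) ℚ.+ (c ℚ.* d ℚ.- c ℚ.* d) ℚ.+ (c ℚ.* b ℚ.- a ℚ.* d) ≡ 0ℚ
      lemma = solve-∀ ℚ-ring

  last : Point → List Point → Point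
  last u []       = u
  last u (v ∷ vs) = last v vs

  last-∈ : ∀ u vs → last u vs ∈ u ∷ vs
  last-∈ u []       = here refl
  last-∈ u (v ∷ vs) = there (last-∈ v vs)

  before-last : ∀ {R : Point → Point → Set} u vs → AllPairs R (u ∷ vs) →
                ∀ {q} → q ∈ u ∷ vs → q ≡ last u vs ⊎ R q (last u vs)
  before-last u []       _        (here refl) = inj₁ refl
  before-last u (v ∷ vs) (h ∷ _)  (here refl) = inj₂ (All.lookup h (last-∈ v vs))
  before-last u (v ∷ vs) (_ ∷ hs) (there q∈)  = before-last v vs hs q∈

-- With w and u the two neighbours of the vertex p, the line through p parallel
-- to w u supports the polygon at p only.

module _ {p w u : Point} {vs : List Point} where

  support : Point → ℚ
  support q = orientation p w q ℚ.+ orientation (last u vs) p q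

  support-exposed : Exposed support p
  support-exposed = record
    { affine = affine-+ {orientation p w} {orientation (last u vs) p}
        (orientation-affine p w) (orientation-affine (last u vs) p)
    ; vanish = trans (cong₂ ℚ._+_ (trans (orientation-rotate p w p) (trans (orientation-rotate w p p) (trans (sym (orientation-rotate w p p)) (orientation-same w p))))
        (orientation-same (last u vs) p)) (ℚ.+-identityˡ 0ℚ)
    }

  support-beyond : Counterclockwise (p ∷ w ∷ u ∷ vs) → (_∈ p ∷ w ∷ u ∷ vs) ⊆ Beyond support p
  support-beyond _ (here refl) = inj₁ refl
  support-beyond ((hw ∷ _) , _) (there (here refl)) = inj₂ (subst (0ℚ ℚ.<_)
    (sym (trans (cong₂ ℚ._+_ (orientation-same p w) (trans (orientation-rotate (last u vs) p w) refl))
      (ℚ.+-identityˡ (orientation p w (last u vs))))) (All.lookup hw (last-∈ u vs)))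
  support-beyond ((hw ∷ hs) , _) {q} (there (there q∈)) with before-last u vs hs q∈
  ... | inj₁ refl = inj₂ (subst (0ℚ ℚ.<_) (sym (trans (cong (λ z → orientation p w q ℚ.+ z)
    (trans (orientation-rotate q p q) (orientation-same p q))) (ℚ.+-identityʳ (orientation p w q))))
    (All.lookup hw q∈))
  ... | inj₂ h    = inj₂ (0<+ (All.lookup hw q∈) (ℚ.<⇒≤ (subst (0ℚ ℚ.<_) (sym (orientation-rotate (last u vs) p q)) h)))

ccw-rotate : ∀ p ps → Counterclockwise (p ∷ ps) → Counterclockwise (ps ∷ʳ p)
ccw-rotate p ps (h , k) = go ps h k
  where
  go : ∀ qs → AllPairs (λ q r → 0ℚ ℚ.< orientation p q r) qs → Counterclockwise qs → Counterclockwise (qs ∷ʳ p)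
  go []       _        _         = [] , tt
  go (q ∷ qs) (h ∷ hs) (k , ks) =
    AllPairs.++⁺ k ([] ∷ []) (All.map (λ {r} pos → subst (0ℚ ℚ.<_) (orientation-rotate p q r) pos ∷ []) h) , go qs hs ks

-- The supporting line is constructed at the head of the list only; a cyclic rotation brings any
-- vertex there.
rotations : ∀ us {v ws} → Counterclockwise (us ++ v ∷ ws) → Counterclockwise (v ∷ ws ++ us)
rotations []       {v} {ws} c = subst Counterclockwise (sym (++-identityʳ (v ∷ ws))) c
rotations (u ∷ us) {v} {ws} c = subst Counterclockwise (cong (v ∷_) (++-assoc ws (u ∷ []) us))
  (rotations us {v} {ws ∷ʳ u} (subst Counterclockwise (++-assoc us (v ∷ ws) (u ∷ [])) (ccw-rotate u (us ++ v ∷ ws) c)))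

private
  rotation-∈ : ∀ us (v : Point) ws {q} → q ∈ us ++ v ∷ ws → q ∈ v ∷ ws ++ us
  rotation-∈ us v ws q∈ with ∈-++⁻ us q∈
  ... | inj₁ q∈us         = there (∈-++⁺ʳ ws q∈us)
  ... | inj₂ (here eq)    = here eq
  ... | inj₂ (there q∈ws) = there (∈-++⁺ˡ q∈ws)

  rotation-length : ∀ us (v : Point) ws → length (v ∷ ws ++ us) ≡ length (us ++ v ∷ ws)
  rotation-length us v ws = trans (cong ℕ.suc (length-++ ws)) (trans (ℕ.+-comm (length (v ∷ ws)) (length us)) (sym (length-++ us)))

IntegralCorner : List Cell → Point → Set
IntegralCorner cs p = ∃[ w ] Corner cs w × p ≡ ιP w

head-corner : ∀ {cs p ps} → 3 ℕ.≤ length (p ∷ ps) → Counterclockwise (p ∷ ps) →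
              InUnion cs ⊆ ConvexHull (_∈ p ∷ ps) → ConvexHull (InUnion cs) p → IntegralCorner cs p
head-corner {ps = []}          (ℕ.s≤s ()) _ _ _
head-corner {ps = _ ∷ []}      (ℕ.s≤s (ℕ.s≤s ())) _ _ _
head-corner {cs} {p} {w ∷ u ∷ vs} _ ccw h p∈ = exposed-corner e (λ {x} → beyond {x}) (exposed-∈ e (λ {x} → beyond {x}) p∈ refl)
  where
  e = support-exposed {p} {w} {u} {vs}
  beyond : InUnion cs ⊆ Beyond (support {p} {w} {u} {vs}) p
  beyond {x} i = hull-beyond e (support-beyond {p} {w} {u} {vs} ccw) (h {x} i)

vertices-corners : ∀ {cs vs} → 3 ℕ.≤ length vs → Counterclockwise vs →
                   ConvexHull (InUnion cs) ≐ ConvexHull (_∈ vs) → All (IntegralCorner cs) vs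
vertices-corners {cs} {vs} 3≤ ccw (to , from) = All.tabulate λ v∈ → corner v∈
  where
  hull-mono : ∀ {S T : Pred Point 0ℓ} → S ⊆ T → ConvexHull S ⊆ ConvexHull T
  hull-mono h (contains s)            = contains (h s)
  hull-mono h (between t 0≤t t≤1 x y) = between t 0≤t t≤1 (hull-mono h x) (hull-mono h y)
  corner : ∀ {v} → v ∈ vs → IntegralCorner cs v
  corner {v} v∈ with ∈-∃++ v∈
  ... | us , ws , refl = head-corner (subst (3 ℕ.≤_) (sym (rotation-length us v ws)) 3≤) (rotations us ccw)
    (λ {x} i → hull-mono (rotation-∈ us v ws) (to {x} (contains i))) (from (contains v∈))

Counterclockwiseℤ : List (ℤ × ℤ) → Set
Counterclockwiseℤ []       = ⊤
Counterclockwiseℤ (p ∷ ps) = AllPairs (λ q r → 0ℤ ℤ.< orientationℤ p q r) ps × Counterclockwiseℤ ps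

ccw-ι⁻ : ∀ ws → Counterclockwise (map ιP ws) → Counterclockwiseℤ ws
ccw-ι⁻ []       _       = tt
ccw-ι⁻ (p ∷ ps) (h , k) =
  AllPairs.map (λ {q} {r} pos → ι-cancel-< (subst (0ℚ ℚ.<_) (orientation-ι p q r) pos)) (AllPairs.map⁻ h) , ccw-ι⁻ ps k

record LatticePolygon (cs : List Cell) (area : ℚ) : Set where
  field
    vertices         : List (ℤ × ℤ)
    counterclockwise : Counterclockwiseℤ vertices
    corners          : All (Corner cs) vertices
    area≡            : area ≡ ½ ℚ.* ι (doubleArea vertices)

-- The supporting line at a vertex requires two neighbours. Lists of at most two vertices have area
-- 0 and are replaced by the empty polygon of the same area.
latticePolygon : ∀ {cs a} → HasArea (ConvexHull (InUnion cs)) a → LatticePolygon cs a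
latticePolygon ([] , _ , _ , refl) = record
  { vertices = [] ; counterclockwise = tt ; corners = [] ; area≡ = refl }
latticePolygon ((p ∷ []) , _ , _ , refl) = record
  { vertices = [] ; counterclockwise = tt ; corners = [] ; area≡ = trans (polygonArea-shoelace p []) (cong (½ ℚ.*_) (lemma (proj₁ p) (proj₂ p))) }
  where
  lemma : ∀ x y → x ℚ.* y ℚ.- x ℚ.* y ≡ 0ℚ
  lemma = solve-∀ ℚ-ring
latticePolygon ((p ∷ q ∷ []) , _ , _ , refl) = record
  { vertices = [] ; counterclockwise = tt ; corners = [] ; area≡ = trans (polygonArea-shoelace p (q ∷ [])) (cong (½ ℚ.*_) (lemma (proj₁ p) (proj₂ p) (proj₁ q) (proj₂ q))) }
  where
  lemma : ∀ a b c d → (a ℚ.* d ℚ.- c ℚ.* b) ℚ.+ (c ℚ.* b ℚ.- a ℚ.* d) ≡ 0ℚ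
  lemma = solve-∀ ℚ-ring
latticePolygon {cs} (vs@(_ ∷ _ ∷ _ ∷ _) , ccw , hull≐ , refl) with integral (vertices-corners (ℕ.s≤s (ℕ.s≤s (ℕ.s≤s ℕ.z≤n))) ccw hull≐)
  where
  integral : ∀ {vs} → All (IntegralCorner cs) vs → ∃[ ws ] All (Corner cs) ws × vs ≡ map ιP ws
  integral []                     = [] , [] , refl
  integral ((w , c , refl) ∷ all) = let ws , cs , eq = integral all in w ∷ ws , c ∷ cs , cong (ιP w ∷_) eq
... | ws , cs , eq = record
  { vertices = ws ; counterclockwise = ccw-ι⁻ ws (subst Counterclockwise eq ccw) ; corners = cs
  ; area≡ = trans (cong polygonArea eq) (polygonArea-ι ws) }

-- Sums along closed polygons and over rows

Pt : Set
Pt = ℤ × ℤ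

edgesFrom : ∀ {A : Set} → A → A → List A → List (A × A)
edgesFrom p q []       = (q , p) ∷ []
edgesFrom p q (r ∷ rs) = (q , r) ∷ edgesFrom p r rs

edges : ∀ {A : Set} → List A → List (A × A)
edges []       = []
edges (p ∷ ps) = edgesFrom p p ps

sumOver : ∀ {A : Set} → (A → ℤ) → List A → ℤ
sumOver f []       = 0ℤ
sumOver f (x ∷ xs) = f x ℤ.+ sumOver f xs

sumOver-cong : ∀ {A : Set} {f g : A → ℤ} xs → (∀ {x} → x ∈ xs → f x ≡ g x) → sumOver f xs ≡ sumOver g xs
sumOver-cong []       h = refl
sumOver-cong (x ∷ xs) h = cong₂ ℤ._+_ (h (here refl)) (sumOver-cong xs (λ x∈ → h (there x∈)))

sumOver-+ : ∀ {A : Set} {f g : A → ℤ} xs →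
            sumOver (λ x → f x ℤ.+ g x) xs ≡ sumOver f xs ℤ.+ sumOver g xs
sumOver-+         []       = refl
sumOver-+ {_} {f} {g} (x ∷ xs) = trans (cong (λ s → f x ℤ.+ g x ℤ.+ s) (sumOver-+ {f = f} {g} xs))
  (lia 4 (λ a b s t → ⊢ a :+ b :+ (s :+ t) := a :+ s :+ (b :+ t)) refl (f x) (g x) (sumOver f xs) (sumOver g xs))

sumOver-0 : ∀ {A : Set} (xs : List A) → sumOver (λ _ → 0ℤ) xs ≡ 0ℤ
sumOver-0 []       = refl
sumOver-0 (x ∷ xs) = trans (ℤ.+-identityˡ _) (sumOver-0 xs)

sumOver-swap : ∀ {A B : Set} (f : A → B → ℤ) xs ys →
  sumOver (λ x → sumOver (f x) ys) xs ≡ sumOver (λ y → sumOver (λ x → f x y) xs) ys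
sumOver-swap f []       ys = sym (sumOver-0 ys)
sumOver-swap f (x ∷ xs) ys = trans (cong (λ s → sumOver (f x) ys ℤ.+ s) (sumOver-swap f xs ys))
  (sym (sumOver-+ {f = f x} {λ y → sumOver (λ x → f x y) xs} ys))

sumOver-mono : ∀ {A : Set} {f g : A → ℤ} xs → (∀ {x} → x ∈ xs → f x ℤ.≤ g x) → sumOver f xs ℤ.≤ sumOver g xs
sumOver-mono []       h = ℤ.≤-refl
sumOver-mono (x ∷ xs) h = ℤ.+-mono-≤ (h (here refl)) (sumOver-mono xs (λ x∈ → h (there x∈)))

-- Carries equality in the bound for the whole area down to every single row.
sumOver-tight : ∀ {A : Set} {f g : A → ℤ} xs → (∀ {x} → x ∈ xs → f x ℤ.≤ g x) →
                sumOver g xs ℤ.≤ sumOver f xs → ∀ {x} → x ∈ xs → f x ≡ g x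
sumOver-tight {_} {f} {g} (x ∷ xs) h k (here refl) = ℤ.≤-antisym (h (here refl))
  (lia 4 (λ a b s t → s :≤ t ⇒ b :+ t :≤ a :+ s ⇒ ⊢ b :≤ a) refl (f x) (g x) _ _ (sumOver-mono xs (λ x∈ → h (there x∈))) k)
sumOver-tight {_} {f} {g} (x ∷ xs) h k (there x∈) = sumOver-tight xs (λ x∈ → h (there x∈))
  (lia 4 (λ a b s t → a :≤ b ⇒ b :+ t :≤ a :+ s ⇒ ⊢ t :≤ s) refl (f x) (g x) _ _ (h (here refl)) k) x∈

interval : ℤ → ℕ → List ℤ
interval y zero    = []
interval y (suc n) = y ∷ interval (y ℤ.+ 1ℤ) n

∈-interval⁺ : ∀ {y z} n → y ℤ.≤ z → z ℤ.< y ℤ.+ + n → z ∈ interval y n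
∈-interval⁺ {y} {z} zero    h k = ⊥-elim (lia 2 (λ y z → y :≤ z ⇒ z :< y :+ # 0 ⇒ ⊢ :⊥) refl y z h k)
∈-interval⁺ {y} {z} (suc n) h k with y ℤ.≟ z
... | yes refl = here refl
... | no  y≢z  = there (∈-interval⁺ n
  (lia 2 (λ y z → y :< z ⇒ ⊢ y :+ # 1 :≤ z) refl y z (ℤ.≤∧≢⇒< h y≢z))
  (lia 3 (λ y z n → z :< y :+ (# 1 :+ n) ⇒ ⊢ z :< y :+ # 1 :+ n) refl y z (+ n) k))

∈-interval⁻ : ∀ {y z} n → z ∈ interval y n → y ℤ.≤ z × z ℤ.< y ℤ.+ + n
∈-interval⁻ {y} (suc n) (here refl) = ℤ.≤-refl ,
  lia 2 (λ y n → # 0 :≤ n ⇒ ⊢ y :< y :+ (# 1 :+ n)) refl y (+ n) (ℤ.+≤+ ℕ.z≤n)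
∈-interval⁻ {y} {z} (suc n) (there z∈) =
  let h , k = ∈-interval⁻ n z∈ in
  lia 2 (λ y z → y :+ # 1 :≤ z ⇒ ⊢ y :≤ z) refl y z h ,
  lia 3 (λ y z n → z :< y :+ # 1 :+ n ⇒ ⊢ z :< y :+ (# 1 :+ n)) refl y z (+ n) k

isLow : ℤ → ℤ → Bool
isLow Y y = does (y ℤ.≤? Y)

isLow-true : ∀ {Y y} → isLow Y y ≡ true → y ℤ.≤ Y
isLow-true {Y} {y} h with y ℤ.≤? Y
... | yes y≤Y = y≤Y

isLow-false : ∀ {Y y} → isLow Y y ≡ false → Y ℤ.< y
isLow-false {Y} {y} h with y ℤ.≤? Y
... | no y≰Y = ℤ.≰⇒> y≰Y

-- Summed over the rows from `y₀` on, this indicator counts `y - y₀`; in this way a difference of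
-- heights is distributed over the rows.
above : ℤ → ℤ → ℤ
above Y y = if isLow Y y then 0ℤ else 1ℤ

above-low : ∀ {Y y} → y ℤ.≤ Y → above Y y ≡ 0ℤ
above-low {Y} {y} h with y ℤ.≤? Y
... | yes _   = refl
... | no  y≰Y = ⊥-elim (y≰Y h)

above-high : ∀ {Y y} → Y ℤ.< y → above Y y ≡ 1ℤ
above-high {Y} {y} h with y ℤ.≤? Y
... | yes y≤Y = ⊥-elim (ℤ.<⇒≱ h y≤Y)
... | no  _   = refl

sum-above-0 : ∀ {y₀ y} n → y ℤ.≤ y₀ → sumOver (λ Y → above Y y) (interval y₀ n) ≡ 0ℤ
sum-above-0 zero    h = refl
sum-above-0 {y₀} {y} (suc n) h = cong₂ ℤ._+_ (above-low h)
  (sum-above-0 n (lia 2 (λ a b → b :≤ a ⇒ ⊢ b :≤ a :+ # 1) refl y₀ y h))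

sum-above : ∀ {y₀ y} n → y₀ ℤ.≤ y → y ℤ.≤ y₀ ℤ.+ + n → sumOver (λ Y → above Y y) (interval y₀ n) ≡ y ℤ.- y₀
sum-above {y₀} {y} zero    h k = lia 2 (λ a b → a :≤ b ⇒ b :≤ a :+ # 0 ⇒ ⊢ # 0 := b :- a) refl y₀ y h k
sum-above {y₀} {y} (suc n) h k with y₀ ℤ.≟ y
... | yes refl = trans (cong₂ ℤ._+_ (above-low {y₀} {y} h)
  (sum-above-0 {y₀ ℤ.+ 1ℤ} {y} n (lia 1 (λ a → ⊢ a :≤ a :+ # 1) refl y₀))) (sym (ℤ.+-inverseʳ y₀))
... | no  y₀≢y = trans (cong₂ ℤ._+_ (above-high (ℤ.≤∧≢⇒< h y₀≢y))
  (sum-above {y₀ ℤ.+ 1ℤ} {y} n (lia 2 (λ y z → y :< z ⇒ ⊢ y :+ # 1 :≤ z) refl y₀ y (ℤ.≤∧≢⇒< h y₀≢y))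
    (lia 3 (λ y z n → z :≤ y :+ (# 1 :+ n) ⇒ ⊢ z :≤ y :+ # 1 :+ n) refl y₀ y (+ n) k)))
  (lia 2 (λ a b → ⊢ # 1 :+ (b :- (a :+ # 1)) := b :- a) refl y₀ y)

-- The contribution of an edge to a row in Green's formula ∮ x dy.

rowTerm : ℤ → Pt × Pt → ℤ
rowTerm Y ((x , y) , (x′ , y′)) = (x ℤ.+ x′) ℤ.* (above Y y′ ℤ.- above Y y)

private
  trapezoid : Pt × Pt → ℤ
  trapezoid ((x , y) , (x′ , y′)) = (x ℤ.+ x′) ℤ.* (y′ ℤ.- y)

  crossEdge : Pt × Pt → ℤ
  crossEdge (p , q) = crossℤ p q

  doubleArea-edges : ∀ p q rs → doubleAreaFrom p q rs ≡ sumOver crossEdge (edgesFrom p q rs)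
  doubleArea-edges p q []       = sym (ℤ.+-identityʳ _)
  doubleArea-edges p q (r ∷ rs) = cong (λ s → crossℤ q r ℤ.+ s) (doubleArea-edges p r rs)

  -- Each cross product is its trapezoid plus the product of the coordinates at the source minus
  -- that at the target. These products telescope, and their remainder vanishes on a closed path.
  cross-trapezoid : ∀ p q rs → sumOver crossEdge (edgesFrom p q rs) ≡
    sumOver trapezoid (edgesFrom p q rs) ℤ.+ (proj₁ q ℤ.* proj₂ q ℤ.- proj₁ p ℤ.* proj₂ p)
  cross-trapezoid (x , y) (x′ , y′) [] =
    lia 4 (λ x y x′ y′ → ⊢ x′ :* y :- x :* y′ :+ # 0 := (x′ :+ x) :* (y :- y′) :+ # 0 :+ (x′ :* y′ :- x :* y)) refl x y x′ y′
  cross-trapezoid p@(x , y) q@(x′ , y′) (r@(x″ , y″) ∷ rs) =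
    trans (cong (λ s → crossℤ q r ℤ.+ s) (cross-trapezoid p r rs))
      (lia 7 (λ x y x′ y′ x″ y″ s → ⊢ x′ :* y″ :- x″ :* y′ :+ (s :+ (x″ :* y″ :- x :* y)) :=
                (x′ :+ x″) :* (y″ :- y′) :+ s :+ (x′ :* y′ :- x :* y)) refl x y x′ y′ x″ y″
         (sumOver trapezoid (edgesFrom p r rs)))

  sum-*ˡ : ∀ c {f : ℤ → ℤ} ys → sumOver (λ Y → c ℤ.* f Y) ys ≡ c ℤ.* sumOver f ys
  sum-*ˡ c []       = sym (ℤ.*-zeroʳ c)
  sum-*ˡ c {f} (y ∷ ys) = trans (cong (λ s → c ℤ.* f y ℤ.+ s) (sum-*ˡ c ys)) (sym (ℤ.*-distribˡ-+ c (f y) _))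

  sum-difference : ∀ {f g : ℤ → ℤ} ys → sumOver (λ Y → f Y ℤ.- g Y) ys ≡ sumOver f ys ℤ.- sumOver g ys
  sum-difference []       = refl
  sum-difference {f} {g} (y ∷ ys) = trans (cong (λ s → f y ℤ.- g y ℤ.+ s) (sum-difference {f} {g} ys))
    (lia 4 (λ a b s t → ⊢ a :- b :+ (s :- t) := a :+ s :- (b :+ t)) refl (f y) (g y) (sumOver f ys) (sumOver g ys))

InRows : ℤ → ℕ → Pt → Set
InRows y₀ n (x , y) = y₀ ℤ.≤ y × y ℤ.≤ y₀ ℤ.+ + n

private
  trapezoid-rows : ∀ {y₀ n} u w → InRows y₀ n u → InRows y₀ n w →
    trapezoid (u , w) ≡ sumOver (λ Y → rowTerm Y (u , w)) (interval y₀ n)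
  trapezoid-rows {y₀} {n} (x , y) (x′ , y′) (h , k) (h′ , k′) = sym (begin
    sumOver (λ Y → (x ℤ.+ x′) ℤ.* (above Y y′ ℤ.- above Y y)) Ys
      ≡⟨ sum-*ˡ (x ℤ.+ x′) Ys ⟩
    (x ℤ.+ x′) ℤ.* sumOver (λ Y → above Y y′ ℤ.- above Y y) Ys
      ≡⟨ cong (λ s → (x ℤ.+ x′) ℤ.* s) (trans (sum-difference Ys) (cong₂ ℤ._-_ (sum-above n h′ k′) (sum-above n h k))) ⟩
    (x ℤ.+ x′) ℤ.* (y′ ℤ.- y₀ ℤ.- (y ℤ.- y₀))
      ≡⟨ lia 5 (λ x x′ y y′ z → ⊢ (x :+ x′) :* (y′ :- z :- (y :- z)) := (x :+ x′) :* (y′ :- y)) refl x x′ y y′ y₀ ⟩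
    (x ℤ.+ x′) ℤ.* (y′ ℤ.- y) ∎)
    where
    open ≡-Reasoning
    Ys = interval y₀ n

edge-∈ : ∀ {A : Set} (p q : A) rs {e} → e ∈ edgesFrom p q rs → proj₁ e ∈ q ∷ rs × proj₂ e ∈ p ∷ rs
edge-∈ p q []       (here refl) = here refl , here refl
edge-∈ p q (r ∷ rs) (here refl) = here refl , there (here refl)
edge-∈ p q (r ∷ rs) (there e∈)  with edge-∈ p r rs e∈
... | u∈ , here eq  = there u∈ , here eq
... | u∈ , there w∈ = there u∈ , there (there w∈)

edges-∈ : ∀ {A : Set} (ps : List A) {e} → e ∈ edges ps → proj₁ e ∈ ps × proj₂ e ∈ ps
edges-∈ (p ∷ ps) = edge-∈ p p ps

doubleArea-rows : ∀ {y₀ n} ps → All (InRows y₀ n) ps →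
  doubleArea ps ≡ sumOver (λ Y → sumOver (rowTerm Y) (edges ps)) (interval y₀ n)
doubleArea-rows {y₀} {n} []       _   = sym (sumOver-0 (interval y₀ n))
doubleArea-rows {y₀} {n} (p ∷ ps) all = begin
  doubleAreaFrom p p ps
    ≡⟨ trans (doubleArea-edges p p ps) (cross-trapezoid p p ps) ⟩
  sumOver trapezoid es ℤ.+ (proj₁ p ℤ.* proj₂ p ℤ.- proj₁ p ℤ.* proj₂ p)
    ≡⟨ trans (cong (λ s → sumOver trapezoid es ℤ.+ s) (ℤ.+-inverseʳ (proj₁ p ℤ.* proj₂ p))) (ℤ.+-identityʳ _) ⟩
  sumOver trapezoid es
    ≡⟨ sumOver-cong es (λ {e} e∈ → let u∈ , w∈ = edges-∈ (p ∷ ps) e∈ in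
         trapezoid-rows (proj₁ e) (proj₂ e) (All.lookup all u∈) (All.lookup all w∈)) ⟩
  sumOver (λ e → sumOver (λ Y → rowTerm Y e) (interval y₀ n)) es
    ≡⟨ sumOver-swap (λ e Y → rowTerm Y e) es (interval y₀ n) ⟩
  sumOver (λ Y → sumOver (rowTerm Y) es) (interval y₀ n) ∎
  where
  open ≡-Reasoning
  es = edgesFrom p p ps

-- A closed sequence in which no two-coloured pattern alternates four times crosses
-- between the colours at most twice.

module Scan {A : Set} (colour : A → Bool) (t : A × A → ℤ)
            (t-same : ∀ {u w} → colour u ≡ colour w → t (u , w) ≡ 0ℤ) (p : A) where

  Same Other : A → Set
  Same q  = colour q ≡ colour p
  Other q = colour q ≢ colour p

  NoReturn : List A → Set
  NoReturn = AllPairs (λ c d → Same c → Other d → ⊥)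

  -- Once a vertex of the other colour has occurred, the list may return to the colour of `p` but
  -- not leave it again. Around the polygon the colours thus form at most two blocks.
  Tame : List A → Set
  Tame []       = ⊤
  Tame (q ∷ qs) = (Other q → NoReturn qs) × Tame qs

  other-other : ∀ {c d} → Other c → Other d → colour c ≡ colour d
  other-other {c} {d} h k with colour c | colour d | colour p
  ... | true  | true  | _     = refl
  ... | false | false | _     = refl
  ... | true  | false | true  = ⊥-elim (h refl)
  ... | true  | false | false = ⊥-elim (k refl)
  ... | false | true  | true  = ⊥-elim (k refl)
  ... | false | true  | false = ⊥-elim (h refl)

  Crosses : A × A → Set
  Crosses (u , w) = colour u ≢ colour w

  flat : ∀ q rs → Same q → All Same rs →
         sumOver t (edgesFrom p q rs) ≡ 0ℤ × (∀ {e} → e ∈ edgesFrom p q rs → ¬ Crosses e)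
  flat q []       h []       = cong (λ s → s ℤ.+ 0ℤ) (t-same h) , λ where (here refl) k → k h
  flat q (r ∷ rs) h (k ∷ ks) =
    let s , uncrossed = flat r rs k ks
    in cong₂ ℤ._+_ (t-same (trans h (sym k))) s , λ where
      (here refl) c → c (trans h (sym k))
      (there e∈)  c → uncrossed e∈ c

  record Back (q : A) (rs : List A) : Set where
    field
      back     : A × A
      back∈    : back ∈ edgesFrom p q rs
      from     : Other (proj₁ back)
      to       : Same (proj₂ back)
      sum      : sumOver t (edgesFrom p q rs) ≡ t back
      only     : ∀ {e} → e ∈ edgesFrom p q rs → Crosses e → e ≡ back

  goBack : ∀ q rs → Other q → NoReturn rs → Back q rs
  goBack q []       h _        = record
    { back = q , p ; back∈ = here refl ; from = h ; to = refl ; sum = ℤ.+-identityʳ _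
    ; only = λ where (here refl) _ → refl }
  goBack q (r ∷ rs) h (k ∷ ks) with colour r Bool.≟ colour p
  ... | yes r-same = let s , uncrossed = flat r rs r-same (All.map (λ {d} f → stable d (f r-same)) k) in record
    { back = q , r ; back∈ = here refl ; from = h ; to = r-same
    ; sum = trans (cong (λ z → t (q , r) ℤ.+ z) s) (ℤ.+-identityʳ _)
    ; only = λ where
        (here refl) _ → refl
        (there e∈)  c → ⊥-elim (uncrossed e∈ c) }
    where
    stable : ∀ d → ¬ Other d → Same d
    stable d f with colour d Bool.≟ colour p
    ... | yes d-same  = d-same
    ... | no  d-other = ⊥-elim (f d-other)
  ... | no  r-other = let open Back (goBack r rs r-other ks) in record
    { back = back ; back∈ = there back∈ ; from = from ; to = to
    ; sum = trans (cong (λ z → z ℤ.+ sumOver t (edgesFrom p r rs)) (t-same (other-other h r-other))) (trans (ℤ.+-identityˡ _) sum)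
    ; only = λ where
        (here refl) c → ⊥-elim (c (other-other h r-other))
        (there e∈)  c → only e∈ c }

  record Forth (q : A) (rs : List A) : Set where
    field
      forth back : A × A
      forth∈     : forth ∈ edgesFrom p q rs
      back∈      : back ∈ edgesFrom p q rs
      forth-from : Same (proj₁ forth)
      forth-to   : Other (proj₂ forth)
      back-from  : Other (proj₁ back)
      back-to    : Same (proj₂ back)
      sum        : sumOver t (edgesFrom p q rs) ≡ t forth ℤ.+ t back
      only       : ∀ {e} → e ∈ edgesFrom p q rs → Crosses e → e ≡ forth ⊎ e ≡ back

  scan : ∀ q rs → Same q → Tame rs → sumOver t (edgesFrom p q rs) ≡ 0ℤ ⊎ Forth q rs
  scan q []       h _        = inj₁ (cong (λ s → s ℤ.+ 0ℤ) (t-same h))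
  scan q (r ∷ rs) h (k , ks) with colour r Bool.≟ colour p
  ... | yes r-same with scan r rs r-same ks
  ...   | inj₁ s = inj₁ (cong₂ ℤ._+_ (t-same (trans h (sym r-same))) s)
  ...   | inj₂ f = let open Forth f in inj₂ record
    { forth = forth ; back = back ; forth∈ = there forth∈ ; back∈ = there back∈
    ; forth-from = forth-from ; forth-to = forth-to ; back-from = back-from ; back-to = back-to
    ; sum = trans (cong (λ z → z ℤ.+ sumOver t (edgesFrom p r rs)) (t-same (trans h (sym r-same)))) (trans (ℤ.+-identityˡ _) sum)
    ; only = λ where
        (here refl) c → ⊥-elim (c (trans h (sym r-same)))
        (there e∈)  c → only e∈ c }
  scan q (r ∷ rs) h (k , ks) | no r-other = let open Back (goBack r rs r-other (k r-other)) in inj₂ record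
    { forth = q , r ; back = back ; forth∈ = here refl ; back∈ = there back∈
    ; forth-from = h ; forth-to = r-other ; back-from = from ; back-to = to
    ; sum = cong (λ z → t (q , r) ℤ.+ z) sum
    ; only = λ where
        (here refl) _ → inj₁ refl
        (there e∈)  c → inj₂ (only e∈ c) }

private
  0≤*0≤ : ∀ {a b} → 0ℤ ℤ.< a → 0ℤ ℤ.≤ b → 0ℤ ℤ.≤ a ℤ.* b
  0≤*0≤ {a} {b} 0<a 0≤b = subst (ℤ._≤ a ℤ.* b) (ℤ.*-zeroʳ a)
    (ℤ.*-monoˡ-≤-nonNeg a {{ℤ.nonNegative (ℤ.<⇒≤ 0<a)}} 0≤b)

  -- The diagonals of a convex quadrilateral cross, so they cannot lie on
  -- different sides of a line.
  weights-contradict : ∀ {A B C D a b c d Y} → A ℤ.+ B ≡ C ℤ.+ D →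
    A ℤ.* a ℤ.+ B ℤ.* c ≡ C ℤ.* b ℤ.+ D ℤ.* d →
    0ℤ ℤ.< A → 0ℤ ℤ.< B → 0ℤ ℤ.< C → 0ℤ ℤ.< D →
    a ℤ.≤ Y → c ℤ.≤ Y → Y ℤ.< b → Y ℤ.< d → ⊥
  weights-contradict {A} {B} {C} {D} {a} {b} {c} {d} {Y} e₁ e₂ A> B> C> D> a≤ c≤ b> d> =
    lia 9 (λ A B C D a b c d Y →
        A :* Y :+ B :* Y := C :* Y :+ D :* Y ⇒ A :* a :+ B :* c := C :* b :+ D :* d ⇒
        # 0 :< C ⇒ # 0 :< D ⇒
        # 0 :≤ A :* (Y :- a) ⇒ # 0 :≤ B :* (Y :- c) ⇒
        # 0 :≤ C :* (b :- Y :- # 1) ⇒ # 0 :≤ D :* (d :- Y :- # 1) ⇒ ⊢ :⊥) refl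
      A B C D a b c d Y
      (trans (sym (ℤ.*-distribʳ-+ Y A B)) (trans (cong (ℤ._* Y) e₁) (ℤ.*-distribʳ-+ Y C D))) e₂ C> D>
      (0≤*0≤ A> (ℤ.i≤j⇒0≤j-i a≤)) (0≤*0≤ B> (ℤ.i≤j⇒0≤j-i c≤))
      (0≤*0≤ C> (low b b>)) (0≤*0≤ D> (low d d>))
    where
    low : ∀ b → Y ℤ.< b → 0ℤ ℤ.≤ b ℤ.- Y ℤ.- 1ℤ
    low b = lia 2 (λ Y b → Y :< b ⇒ ⊢ # 0 :≤ b :- Y :- # 1) refl Y b

  -- The four oriented triangles are the coefficients of the affine dependence between four points
  -- of the plane. In a convex quadrilateral they are all positive, so the diagonals `a c` and `b d`
  -- have a common weighted point; `quadrilateral-heights` is its second coordinate.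
  quadrilateral-weights : ∀ a b c d →
    orientationℤ b c d ℤ.+ orientationℤ a b d ≡ orientationℤ a c d ℤ.+ orientationℤ a b c
  quadrilateral-weights (xa , ya) (xb , yb) (xc , yc) (xd , yd) =
    lia 8 (λ xa ya xb yb xc yc xd yd →
      let o = λ xp yp xq yq xr yr → (xp :* yq :- xq :* yp) :+ (xq :* yr :- xr :* yq) :+ (xr :* yp :- xp :* yr) in
      ⊢ o xb yb xc yc xd yd :+ o xa ya xb yb xd yd := o xa ya xc yc xd yd :+ o xa ya xb yb xc yc) refl
      xa ya xb yb xc yc xd yd

  quadrilateral-heights : ∀ a b c d →
    orientationℤ b c d ℤ.* proj₂ a ℤ.+ orientationℤ a b d ℤ.* proj₂ c ≡
    orientationℤ a c d ℤ.* proj₂ b ℤ.+ orientationℤ a b c ℤ.* proj₂ d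
  quadrilateral-heights (xa , ya) (xb , yb) (xc , yc) (xd , yd) =
    lia 8 (λ xa ya xb yb xc yc xd yd →
      let o = λ xp yp xq yq xr yr → (xp :* yq :- xq :* yp) :+ (xq :* yr :- xr :* yq) :+ (xr :* yp :- xp :* yr) in
      ⊢ o xb yb xc yc xd yd :* ya :+ o xa ya xb yb xd yd :* yc := o xa ya xc yc xd yd :* yb :+ o xa ya xb yb xc yc :* yd) refl
      xa ya xb yb xc yc xd yd

private
  low : ℤ → Pt → Bool
  low Y v = isLow Y (proj₂ v)

  rowTerm-same : ∀ Y {u w} → low Y u ≡ low Y w → rowTerm Y (u , w) ≡ 0ℤ
  rowTerm-same Y {x , y} {x′ , y′} h with isLow Y y | isLow Y y′
  ... | true  | true  = ℤ.*-zeroʳ (x ℤ.+ x′)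
  ... | false | false = ℤ.*-zeroʳ (x ℤ.+ x′)
  rowTerm-same Y {x , y} {x′ , y′} () | true  | false
  rowTerm-same Y {x , y} {x′ , y′} () | false | true

  -- The points `p`, `q`, `c`, `d` form a convex quadrilateral in this order, and the colours would
  -- separate its diagonals `p c` and `q d` by the row. Which diagonal is the lower one depends on
  -- the colour of `p`.
  crossing-free : ∀ Y p q c d → 0ℤ ℤ.< orientationℤ p q c → 0ℤ ℤ.< orientationℤ p q d →
    0ℤ ℤ.< orientationℤ p c d → 0ℤ ℤ.< orientationℤ q c d →
    low Y q ≢ low Y p → low Y c ≡ low Y p → low Y d ≢ low Y p → ⊥
  crossing-free Y p q c d pqc pqd pcd qcd q≢ c≡ d≢ = cases _ _ _ _ refl refl refl refl q≢ c≡ d≢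
    where
    cases : ∀ p′ q′ c′ d′ → low Y p ≡ p′ → low Y q ≡ q′ → low Y c ≡ c′ → low Y d ≡ d′ → q′ ≢ p′ → c′ ≡ p′ → d′ ≢ p′ → ⊥
    cases true  true  _     _     _ _ _ _ q≢ _ _ = q≢ refl
    cases false false _     _     _ _ _ _ q≢ _ _ = q≢ refl
    cases true  false _     true  _ _ _ _ _ _ d≢ = d≢ refl
    cases false true  _     false _ _ _ _ _ _ d≢ = d≢ refl
    cases true  false false false _ _ _ _ _ () _
    cases false true  true  true  _ _ _ _ _ () _
    cases true  false true  false p≡ q≡ c≡ d≡ _ _ _ = weights-contradict
      (quadrilateral-weights p q c d) (quadrilateral-heights p q c d) qcd pqd pcd pqc
      (isLow-true p≡) (isLow-true c≡) (isLow-false q≡) (isLow-false d≡)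
    cases false true  false true  p≡ q≡ c≡ d≡ _ _ _ = weights-contradict
      (sym (quadrilateral-weights p q c d)) (sym (quadrilateral-heights p q c d)) pcd pqc qcd pqd
      (isLow-true q≡) (isLow-true d≡) (isLow-false p≡) (isLow-false c≡)

module RowScan (Y : ℤ) = Scan (low Y) (rowTerm Y) (λ {u} {w} → rowTerm-same Y {u} {w})

private
  tame : ∀ Y p qs → AllPairs (λ q r → 0ℤ ℤ.< orientationℤ p q r) qs → Counterclockwiseℤ qs → RowScan.Tame Y p qs
  tame Y p []       _        _        = tt
  tame Y p (q ∷ qs) (h ∷ hs) (k , ks) = (λ q-other → go q-other qs h hs k) , tame Y p qs hs ks
    where
    go : RowScan.Other Y p q → ∀ rs → All (λ r → 0ℤ ℤ.< orientationℤ p q r) rs →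
         AllPairs (λ c d → 0ℤ ℤ.< orientationℤ p c d) rs →
         AllPairs (λ c d → 0ℤ ℤ.< orientationℤ q c d) rs → RowScan.NoReturn Y p rs
    go o []       _        _        _        = []
    go o (c ∷ rs) (a ∷ as) (b ∷ bs) (e ∷ es) =
      All.map (λ {d} (x , y , z) s t → crossing-free Y p q c d a x y z o s t)
        (All.zip (as , All.zip (b , e))) ∷ go o rs as bs es

record RowCrossing (Y : ℤ) (ws : List Pt) : Set where
  field
    rise fall : Pt × Pt
    rise∈       : rise ∈ edges ws
    fall∈     : fall ∈ edges ws
    rise-low    : proj₂ (proj₁ rise) ℤ.≤ Y
    rise-high   : Y ℤ.< proj₂ (proj₂ rise)
    fall-high : Y ℤ.< proj₂ (proj₁ fall)
    fall-low  : proj₂ (proj₂ fall) ℤ.≤ Y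
    sum       : sumOver (rowTerm Y) (edges ws) ≡
                (proj₁ (proj₁ rise) ℤ.+ proj₁ (proj₂ rise)) ℤ.- (proj₁ (proj₁ fall) ℤ.+ proj₁ (proj₂ fall))
    only-rise   : ∀ {e} → e ∈ edges ws → proj₂ (proj₁ e) ℤ.≤ Y → Y ℤ.< proj₂ (proj₂ e) → e ≡ rise
    only-fall : ∀ {e} → e ∈ edges ws → Y ℤ.< proj₂ (proj₁ e) → proj₂ (proj₂ e) ℤ.≤ Y → e ≡ fall

private
  low⁺ : ∀ {Y v} → proj₂ v ℤ.≤ Y → low Y v ≡ true
  low⁺ {Y} {v} h with proj₂ v ℤ.≤? Y
  ... | yes _ = refl
  ... | no  k = ⊥-elim (k h)

  high⁺ : ∀ {Y v} → Y ℤ.< proj₂ v → low Y v ≡ false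
  high⁺ {Y} {v} h with proj₂ v ℤ.≤? Y
  ... | yes k = ⊥-elim (ℤ.<⇒≱ h k)
  ... | no  _ = refl

  not-true : ∀ {b} → b ≢ true → b ≡ false
  not-true {true}  h = ⊥-elim (h refl)
  not-true {false} h = refl

  not-false : ∀ {b} → b ≢ false → b ≡ true
  not-false {true}  h = refl
  not-false {false} h = ⊥-elim (h refl)

  true≢false : true ≢ false
  true≢false ()

  rowTerm-up : ∀ {Y u w} → proj₂ u ℤ.≤ Y → Y ℤ.< proj₂ w → rowTerm Y (u , w) ≡ proj₁ u ℤ.+ proj₁ w
  rowTerm-up {Y} {u} {w} h k = trans (cong₂ (λ a b → (proj₁ u ℤ.+ proj₁ w) ℤ.* (a ℤ.- b)) (above-high k) (above-low h))
    (ℤ.*-identityʳ _)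

  rowTerm-down : ∀ {Y u w} → Y ℤ.< proj₂ u → proj₂ w ℤ.≤ Y → rowTerm Y (u , w) ≡ ℤ.- (proj₁ u ℤ.+ proj₁ w)
  rowTerm-down {Y} {u} {w} h k = trans (cong₂ (λ a b → (proj₁ u ℤ.+ proj₁ w) ℤ.* (a ℤ.- b)) (above-low k) (above-high h))
    (lia 1 (λ s → ⊢ s :* (# 0 :- # 1) := :- s) refl (proj₁ u ℤ.+ proj₁ w))

  crossed-once : ∀ {Y ws} (rise fall : Pt × Pt) → rise ∈ edges ws → fall ∈ edges ws →
    low Y (proj₁ rise) ≡ true → low Y (proj₂ rise) ≡ false →
    low Y (proj₁ fall) ≡ false → low Y (proj₂ fall) ≡ true →
    sumOver (rowTerm Y) (edges ws) ≡ rowTerm Y rise ℤ.+ rowTerm Y fall →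
    (∀ {e} → e ∈ edges ws → low Y (proj₁ e) ≢ low Y (proj₂ e) → e ≡ rise ⊎ e ≡ fall) → RowCrossing Y ws
  crossed-once {Y} {ws} rise fall rise∈ fall∈ a b c d sum only = record
    { rise = rise ; fall = fall ; rise∈ = rise∈ ; fall∈ = fall∈
    ; rise-low = isLow-true a ; rise-high = isLow-false b ; fall-high = isLow-false c ; fall-low = isLow-true d
    ; sum = trans sum (cong₂ ℤ._+_ (rowTerm-up {Y} {proj₁ rise} {proj₂ rise} (isLow-true a) (isLow-false b))
              (rowTerm-down {Y} {proj₁ fall} {proj₂ fall} (isLow-false c) (isLow-true d)))
    ; only-rise = only-rise ; only-fall = only-fall }
    where
    only-rise : ∀ {e} → e ∈ edges ws → proj₂ (proj₁ e) ℤ.≤ Y → Y ℤ.< proj₂ (proj₂ e) → e ≡ rise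
    only-rise {u , w} e∈ l h with only e∈ (λ eq → true≢false (trans (sym (low⁺ {Y} {u} l)) (trans eq (high⁺ {Y} {w} h))))
    ... | inj₁ eq   = eq
    ... | inj₂ refl = ⊥-elim (true≢false (trans (sym (low⁺ {Y} {u} l)) c))
    only-fall : ∀ {e} → e ∈ edges ws → Y ℤ.< proj₂ (proj₁ e) → proj₂ (proj₂ e) ℤ.≤ Y → e ≡ fall
    only-fall {u , w} e∈ h l with only e∈ (λ eq → true≢false (trans (sym (low⁺ {Y} {w} l)) (trans (sym eq) (high⁺ {Y} {u} h))))
    ... | inj₂ eq   = eq
    ... | inj₁ refl = ⊥-elim (true≢false (trans (sym a) (high⁺ {Y} {u} h)))

-- The scan is relative to the colour of the first vertex, and that colour decides which of the two
-- crossings found is the rise.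
rowCrossing : ∀ Y ws → Counterclockwiseℤ ws → sumOver (rowTerm Y) (edges ws) ≡ 0ℤ ⊎ RowCrossing Y ws
rowCrossing Y []       _        = inj₁ refl
rowCrossing Y ws@(p ∷ ps) (h , hs) with RowScan.scan Y p p ps refl (tame Y p ps h hs)
... | inj₁ s = inj₁ s
... | inj₂ f = inj₂ (cases (low Y p) refl)
  where
  open Scan.Forth f
  cases : ∀ b → low Y p ≡ b → RowCrossing Y (p ∷ ps)
  cases true  eq = crossed-once forth back forth∈ back∈ (trans forth-from eq) (not-true (λ e → forth-to (trans e (sym eq))))
    (not-true (λ e → back-from (trans e (sym eq)))) (trans back-to eq) sum only
  cases false eq = crossed-once back forth back∈ forth∈ (not-false (λ e → back-from (trans e (sym eq)))) (trans back-to eq)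
    (trans forth-from eq) (not-false (λ e → forth-to (trans e (sym eq))))
    (trans sum (ℤ.+-comm (rowTerm Y forth) (rowTerm Y back))) (λ e∈ c → Sum.swap (only e∈ c))

-- Area bounds row by row, and what equality says about the corners of the bounding box.

data Direction : Set where
  right left up down : Direction

coordinate : Direction → Cell → ℤ
coordinate right (x , y) = x
coordinate left  (x , y) = ℤ.- x
coordinate up    (x , y) = y
coordinate down  (x , y) = ℤ.- y

Extreme : Direction → (Cell → Set) → Cell → Set
Extreme δ S d = S d × (∀ {e} → S e → coordinate δ e ℤ.≤ coordinate δ d)

-- The corner of the bounding box in the directions δ and ε is cut off by a
-- rectangle that meets no cell.

CornerCut : Direction → Direction → (Cell → Set) → Set
CornerCut δ ε S = ∀ {c} → S c →
  (∃[ d ] Extreme ε S d × coordinate δ c ℤ.≤ coordinate δ d) ⊎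
  (∃[ d ] Extreme δ S d × coordinate ε c ℤ.≤ coordinate ε d)

-- Common to the right boundary (`ξ` is x) and the left boundary (`ξ` is -x) of a polygon that
-- attains every row bound. `Link Y u w` is the edge across row `Y` with lower end `u` and upper end
-- `w`; equality makes `u` furthest out among the corners up to height `Y` and `w` among those
-- beyond. Consequently a lower end is at the bottom of the box or in the outermost column, and an
-- upper end at the top or in that column.
module Chain (y₀ : ℤ) (n : ℕ) (C : Pt → Set) (C-rows : ∀ {v} → C v → InRows y₀ n v) (ξ : Pt → ℤ)
  (Link : ℤ → Pt → Pt → Set)
  (link : ∀ {Y} → y₀ ℤ.≤ Y → Y ℤ.< y₀ ℤ.+ + n → ∃₂ (Link Y))
  (corners : ∀ {Y u w} → Link Y u w → C u × C w)
  (low : ∀ {Y u w} → Link Y u w → proj₂ u ℤ.≤ Y)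
  (high : ∀ {Y u w} → Link Y u w → Y ℤ.< proj₂ w)
  (max-low : ∀ {Y u w v} → Link Y u w → C v → proj₂ v ℤ.≤ Y → ξ v ℤ.≤ ξ u)
  (max-high : ∀ {Y u w v} → Link Y u w → C v → Y ℤ.< proj₂ v → ξ v ℤ.≤ ξ w)
  (single : ∀ {Y Y′ u w u′ w′} → Link Y u w → Link Y′ u′ w′ → proj₂ u ℤ.≤ Y′ → Y′ ℤ.< proj₂ w → u ≡ u′ × w ≡ w′)
  where

  -- If `u` is not at the bottom, the edge across the row just beneath ends at the height of `u`.
  -- Its upper end is furthest out among all corners from that height on, yet not further than `u`;
  -- so `u` is furthest out altogether.
  bottom-or-max : ∀ {Y u w} → Link Y u w → proj₂ u ≡ y₀ ⊎ (∀ {v} → C v → ξ v ℤ.≤ ξ u)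
  bottom-or-max {Y} {u} {w} l with proj₂ u ℤ.≟ y₀
  ... | yes eq = inj₁ eq
  ... | no  y₀≢ = inj₂ max
    where
    y₀≤u = proj₁ (C-rows (proj₁ (corners l)))
    w≤ = proj₂ (C-rows (proj₂ (corners l)))
    below : y₀ ℤ.≤ proj₂ u ℤ.- 1ℤ
    below = lia 2 (λ a b → a :< b ⇒ ⊢ a :≤ b :- # 1) refl y₀ (proj₂ u) (ℤ.≤∧≢⇒< y₀≤u (λ e → y₀≢ (sym e)))
    inside : proj₂ u ℤ.- 1ℤ ℤ.< y₀ ℤ.+ + n
    inside = lia 4 (λ u Y w t → u :≤ Y ⇒ Y :< w ⇒ w :≤ t ⇒ ⊢ u :- # 1 :< t) refl (proj₂ u) Y (proj₂ w) _ (low l) (high l) w≤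
    here-inside : proj₂ u ℤ.< y₀ ℤ.+ + n
    here-inside = ℤ.≤-<-trans (low l) (ℤ.<-≤-trans (high l) w≤)
    -- A higher end would let this edge cross the row just above `u` too, and then it would coincide
    -- with the edge that starts at `u`.
    level : ∀ {u₂ w₂} → Link (proj₂ u ℤ.- 1ℤ) u₂ w₂ → proj₂ w₂ ≡ proj₂ u
    level {u₂} {w₂} l₂ with proj₂ w₂ ℤ.≤? proj₂ u
    ... | yes h = ℤ.≤-antisym h (lia 2 (λ a b → a :- # 1 :< b ⇒ ⊢ a :≤ b) refl (proj₂ u) (proj₂ w₂) (high l₂))
    ... | no  h = let u₃ , w₃ , l₃ = link y₀≤u here-inside
                      e₂ , _ = single l₂ l₃ (lia 2 (λ a b → b :≤ a :- # 1 ⇒ ⊢ b :≤ a) refl (proj₂ u) (proj₂ u₂) (low l₂)) (ℤ.≰⇒> h)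
                      e , _  = single l l₃ ℤ.≤-refl (ℤ.≤-<-trans (low l) (high l))
                  in ⊥-elim (lia 2 (λ a b → b :≤ a :- # 1 ⇒ a := b ⇒ ⊢ :⊥) refl (proj₂ u) (proj₂ u₂) (low l₂)
                       (cong proj₂ (trans e (sym e₂))))
    max : ∀ {v} → C v → ξ v ℤ.≤ ξ u
    max {v} cv with proj₂ v ℤ.≤? Y
    ... | yes h = max-low l cv h
    ... | no  h with link below inside
    ...   | u₂ , w₂ , l₂ = ℤ.≤-trans
      (max-high l₂ cv (lia 3 (λ u Y v → u :≤ Y ⇒ Y :< v ⇒ ⊢ u :- # 1 :< v) refl (proj₂ u) Y (proj₂ v) (low l) (ℤ.≰⇒> h)))
      (max-low l (proj₂ (corners l₂)) (subst (ℤ._≤ Y) (sym (level l₂)) (low l)))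

  top-or-max : ∀ {Y u w} → Link Y u w → proj₂ w ≡ y₀ ℤ.+ + n ⊎ (∀ {v} → C v → ξ v ℤ.≤ ξ w)
  top-or-max {Y} {u} {w} l with proj₂ w ℤ.≟ y₀ ℤ.+ + n
  ... | yes eq = inj₁ eq
  ... | no  ≢top = inj₂ max
    where
    y₀≤u = proj₁ (C-rows (proj₁ (corners l)))
    w≤ = proj₂ (C-rows (proj₂ (corners l)))
    inside : proj₂ w ℤ.< y₀ ℤ.+ + n
    inside = ℤ.≤∧≢⇒< w≤ ≢top
    below : y₀ ℤ.≤ proj₂ w
    below = ℤ.≤-trans y₀≤u (ℤ.≤-trans (low l) (ℤ.<⇒≤ (high l)))
    pred-below : y₀ ℤ.≤ proj₂ w ℤ.- 1ℤ
    pred-below = lia 4 (λ y u Y w → y :≤ u ⇒ u :≤ Y ⇒ Y :< w ⇒ ⊢ y :≤ w :- # 1) refl y₀ (proj₂ u) Y (proj₂ w) y₀≤u (low l) (high l)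
    pred-inside : proj₂ w ℤ.- 1ℤ ℤ.< y₀ ℤ.+ + n
    pred-inside = lia 2 (λ w t → w :≤ t ⇒ ⊢ w :- # 1 :< t) refl (proj₂ w) _ w≤
    pred-low : proj₂ u ℤ.≤ proj₂ w ℤ.- 1ℤ
    pred-low = lia 3 (λ u Y w → u :≤ Y ⇒ Y :< w ⇒ ⊢ u :≤ w :- # 1) refl (proj₂ u) Y (proj₂ w) (low l) (high l)
    pred-high : proj₂ w ℤ.- 1ℤ ℤ.< proj₂ w
    pred-high = lia 1 (λ w → ⊢ w :- # 1 :< w) refl (proj₂ w)
    level : ∀ {u₂ w₂} → Link (proj₂ w) u₂ w₂ → proj₂ u₂ ≡ proj₂ w
    level {u₂} {w₂} l₂ with proj₂ w ℤ.≤? proj₂ u₂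
    ... | yes h = ℤ.≤-antisym (low l₂) h
    ... | no  h = let u₃ , w₃ , l₃ = link pred-below pred-inside
                      _ , e₂ = single l₂ l₃ (lia 2 (λ a b → b :< a ⇒ ⊢ b :≤ a :- # 1) refl (proj₂ w) (proj₂ u₂) (ℤ.≰⇒> h))
                                 (ℤ.<-trans pred-high (high l₂))
                      _ , e  = single l l₃ pred-low pred-high
                  in ⊥-elim (ℤ.<-irrefl (cong proj₂ (trans e (sym e₂))) (high l₂))
    max : ∀ {v} → C v → ξ v ℤ.≤ ξ w
    max {v} cv with Y ℤ.<? proj₂ v
    ... | yes h = max-high l cv h
    ... | no  h with link below inside
    ...   | u₂ , w₂ , l₂ = ℤ.≤-trans
      (max-low l₂ cv (ℤ.≤-trans (ℤ.≮⇒≥ h) (ℤ.<⇒≤ (high l))))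
      (max-high l (proj₁ (corners l₂)) (subst (Y ℤ.<_) (sym (level l₂)) (high l)))

-- R↓ Y and L↓ Y bound the cells in and below row Y, R↑ Y and L↑ Y those in and above it.

record Profile (cs : List Cell) : Set where
  field
    bottom      : ℤ
    height      : ℕ
    R↓ L↓ R↑ L↑ : ℤ → ℤ
    inside      : ∀ {c} → c ∈ cs → bottom ℤ.≤ proj₂ c × proj₂ c ℤ.< bottom ℤ.+ + height
    below       : ∀ {c Y} → c ∈ cs → proj₂ c ℤ.≤ Y → L↓ Y ℤ.≤ proj₁ c × proj₁ c ℤ.≤ R↓ Y
    above′      : ∀ {c Y} → c ∈ cs → Y ℤ.≤ proj₂ c → L↑ Y ℤ.≤ proj₁ c × proj₁ c ℤ.≤ R↑ Y
    L≤R↓        : ∀ Y → L↓ Y ℤ.≤ R↓ Y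
    L≤R↑        : ∀ Y → L↑ Y ℤ.≤ R↑ Y

  -- The bounds are columns of cells, and the right side of a column is one unit further; this
  -- happens at both right ends, hence `+ 2`.
  width : ℤ → ℤ
  width Y = R↓ Y ℤ.- L↓ Y ℤ.+ (R↑ Y ℤ.- L↑ Y) ℤ.+ + 2

  rowList : List ℤ
  rowList = interval bottom height

  total : ℤ
  total = sumOver width rowList

module _ {cs : List Cell} (P : Profile cs) where

  open Profile P

  corner-rows : ∀ {v} → Corner cs v → InRows bottom height v
  corner-rows {X , Y} ((x , y) , c∈ , _ , inj₁ refl) = let h , k = inside c∈ in h , ℤ.<⇒≤ k
  corner-rows {X , Y} ((x , y) , c∈ , _ , inj₂ refl) = let h , k = inside c∈ in
    lia 2 (λ b y → b :≤ y ⇒ ⊢ b :≤ y :+ # 1) refl bottom y h ,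
    lia 2 (λ y t → y :< t ⇒ ⊢ y :+ # 1 :≤ t) refl y (bottom ℤ.+ + height) k

  private
    spread : ∀ {X x L R} → X ≡ x ⊎ X ≡ x ℤ.+ 1ℤ → L ℤ.≤ x × x ℤ.≤ R → L ℤ.≤ X × X ℤ.≤ R ℤ.+ 1ℤ
    spread {X} {x} {L} {R} (inj₁ refl) (h , k) = h , lia 2 (λ x R → x :≤ R ⇒ ⊢ x :≤ R :+ # 1) refl x R k
    spread {X} {x} {L} {R} (inj₂ refl) (h , k) = lia 2 (λ L x → L :≤ x ⇒ ⊢ L :≤ x :+ # 1) refl L x h ,
      lia 2 (λ x R → x :≤ R ⇒ ⊢ x :+ # 1 :≤ R :+ # 1) refl x R k

  -- Row `Y` lies between the heights `Y` and `Y + 1`. A corner up to height `Y` belongs to a cell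
  -- in or below the row, a corner beyond to a cell in or above it, so the row itself counts on both
  -- sides.
  corner-below : ∀ {v Y} → Corner cs v → proj₂ v ℤ.≤ Y → L↓ Y ℤ.≤ proj₁ v × proj₁ v ℤ.≤ R↓ Y ℤ.+ 1ℤ
  corner-below {X , Y′} {Y} ((x , y) , c∈ , hx , inj₁ refl) h = spread hx (below c∈ h)
  corner-below {X , Y′} {Y} ((x , y) , c∈ , hx , inj₂ refl) h =
    spread hx (below c∈ (lia 2 (λ y Y → y :+ # 1 :≤ Y ⇒ ⊢ y :≤ Y) refl y Y h))

  corner-above : ∀ {v Y} → Corner cs v → Y ℤ.< proj₂ v → L↑ Y ℤ.≤ proj₁ v × proj₁ v ℤ.≤ R↑ Y ℤ.+ 1ℤ
  corner-above {X , Y′} {Y} ((x , y) , c∈ , hx , inj₁ refl) h = spread hx (above′ c∈ (ℤ.<⇒≤ h))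
  corner-above {X , Y′} {Y} ((x , y) , c∈ , hx , inj₂ refl) h =
    spread hx (above′ c∈ (lia 2 (λ y Y → Y :< y :+ # 1 ⇒ ⊢ Y :≤ y) refl y Y h))

  module _ {ws : List Pt} (ccw : Counterclockwiseℤ ws) (corners : All (Corner cs) ws) where

    private
      source : ∀ {e} → e ∈ edges ws → Corner cs (proj₁ e)
      source e∈ = All.lookup corners (proj₁ (edges-∈ ws e∈))

      target : ∀ {e} → e ∈ edges ws → Corner cs (proj₂ e)
      target e∈ = All.lookup corners (proj₂ (edges-∈ ws e∈))

    module _ {Y : ℤ} (r : RowCrossing Y ws) where

      open RowCrossing r

      crossing-≤ : proj₁ (proj₁ rise) ℤ.≤ R↓ Y ℤ.+ 1ℤ × proj₁ (proj₂ rise) ℤ.≤ R↑ Y ℤ.+ 1ℤ ×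
                   L↑ Y ℤ.≤ proj₁ (proj₁ fall) × L↓ Y ℤ.≤ proj₁ (proj₂ fall)
      crossing-≤ = proj₂ (corner-below (source rise∈) rise-low) , proj₂ (corner-above (target rise∈) rise-high) ,
                   proj₁ (corner-above (source fall∈) fall-high) , proj₁ (corner-below (target fall∈) fall-low)

      crossing-≡ : sumOver (rowTerm Y) (edges ws) ≡ width Y →
        (proj₁ (proj₁ rise) ≡ R↓ Y ℤ.+ 1ℤ × proj₁ (proj₂ rise) ≡ R↑ Y ℤ.+ 1ℤ) ×
        (proj₁ (proj₁ fall) ≡ L↑ Y × proj₁ (proj₂ fall) ≡ L↓ Y)
      crossing-≡ eq with crossing-≤ | trans (sym sum) eq
      ... | a , b , c , d | e =
        (lia 8 (λ u w w′ u′ R↓ L↓ R↑ L↑ → u :≤ R↓ :+ # 1 ⇒ w :≤ R↑ :+ # 1 ⇒ L↑ :≤ w′ ⇒ L↓ :≤ u′ ⇒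
           u :+ w :- (w′ :+ u′) := R↓ :- L↓ :+ (R↑ :- L↑) :+ # 2 ⇒ ⊢ u := R↓ :+ # 1) refl x₁ x₂ x₃ x₄ (R↓ Y) (L↓ Y) (R↑ Y) (L↑ Y) a b c d e ,
         lia 8 (λ u w w′ u′ R↓ L↓ R↑ L↑ → u :≤ R↓ :+ # 1 ⇒ w :≤ R↑ :+ # 1 ⇒ L↑ :≤ w′ ⇒ L↓ :≤ u′ ⇒
           u :+ w :- (w′ :+ u′) := R↓ :- L↓ :+ (R↑ :- L↑) :+ # 2 ⇒ ⊢ w := R↑ :+ # 1) refl x₁ x₂ x₃ x₄ (R↓ Y) (L↓ Y) (R↑ Y) (L↑ Y) a b c d e) ,
        (lia 8 (λ u w w′ u′ R↓ L↓ R↑ L↑ → u :≤ R↓ :+ # 1 ⇒ w :≤ R↑ :+ # 1 ⇒ L↑ :≤ w′ ⇒ L↓ :≤ u′ ⇒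
           u :+ w :- (w′ :+ u′) := R↓ :- L↓ :+ (R↑ :- L↑) :+ # 2 ⇒ ⊢ w′ := L↑) refl x₁ x₂ x₃ x₄ (R↓ Y) (L↓ Y) (R↑ Y) (L↑ Y) a b c d e ,
         lia 8 (λ u w w′ u′ R↓ L↓ R↑ L↑ → u :≤ R↓ :+ # 1 ⇒ w :≤ R↑ :+ # 1 ⇒ L↑ :≤ w′ ⇒ L↓ :≤ u′ ⇒
           u :+ w :- (w′ :+ u′) := R↓ :- L↓ :+ (R↑ :- L↑) :+ # 2 ⇒ ⊢ u′ := L↓) refl x₁ x₂ x₃ x₄ (R↓ Y) (L↓ Y) (R↑ Y) (L↑ Y) a b c d e)
        where
        x₁ = proj₁ (proj₁ rise)
        x₂ = proj₁ (proj₂ rise)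
        x₃ = proj₁ (proj₁ fall)
        x₄ = proj₁ (proj₂ fall)

    0<width : ∀ Y → 0ℤ ℤ.< width Y
    0<width Y = lia 4 (λ R↓ L↓ R↑ L↑ → L↓ :≤ R↓ ⇒ L↑ :≤ R↑ ⇒ ⊢ # 0 :< R↓ :- L↓ :+ (R↑ :- L↑) :+ # 2) refl
      (R↓ Y) (L↓ Y) (R↑ Y) (L↑ Y) (L≤R↓ Y) (L≤R↑ Y)

    row-≤ : ∀ Y → sumOver (rowTerm Y) (edges ws) ℤ.≤ width Y
    row-≤ Y with rowCrossing Y ws ccw
    ... | inj₁ eq = subst (ℤ._≤ width Y) (sym eq) (ℤ.<⇒≤ (0<width Y))
    ... | inj₂ r  with crossing-≤ r
    ...   | a , b , c , d = subst (ℤ._≤ width Y) (sym (RowCrossing.sum r))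
      (lia 8 (λ u w w′ u′ R↓ L↓ R↑ L↑ → u :≤ R↓ :+ # 1 ⇒ w :≤ R↑ :+ # 1 ⇒ L↑ :≤ w′ ⇒ L↓ :≤ u′ ⇒
           ⊢ u :+ w :- (w′ :+ u′) :≤ R↓ :- L↓ :+ (R↑ :- L↑) :+ # 2) refl (proj₁ (proj₁ (RowCrossing.rise r))) (proj₁ (proj₂ (RowCrossing.rise r))) (proj₁ (proj₁ (RowCrossing.fall r))) (proj₁ (proj₂ (RowCrossing.fall r)))
        (R↓ Y) (L↓ Y) (R↑ Y) (L↑ Y) a b c d)

    private
      rows≡ : doubleArea ws ≡ sumOver (λ Y → sumOver (rowTerm Y) (edges ws)) rowList
      rows≡ = doubleArea-rows ws (All.map corner-rows corners)

    doubleArea-≤ : doubleArea ws ℤ.≤ total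
    doubleArea-≤ = subst (ℤ._≤ total) (sym rows≡) (sumOver-mono rowList (λ {Y} _ → row-≤ Y))

    module _ (tight : total ℤ.≤ doubleArea ws) where

      private
        row-≡ : ∀ {Y} → Y ∈ rowList → sumOver (rowTerm Y) (edges ws) ≡ width Y
        row-≡ = sumOver-tight rowList (λ {Y} _ → row-≤ Y) (subst (total ℤ.≤_) rows≡ tight)

        crossed : ∀ {Y} → Y ∈ rowList → RowCrossing Y ws
        crossed {Y} Y∈ with rowCrossing Y ws ccw
        ... | inj₁ eq = ⊥-elim (ℤ.<-irrefl (trans (sym eq) (row-≡ Y∈)) (0<width Y))
        ... | inj₂ r  = r

        RightLink LeftLink : ℤ → Pt → Pt → Set
        RightLink Y u w = Y ∈ rowList × (u , w) ∈ edges ws × proj₂ u ℤ.≤ Y × Y ℤ.< proj₂ w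
        LeftLink  Y u w = Y ∈ rowList × (w , u) ∈ edges ws × proj₂ u ℤ.≤ Y × Y ℤ.< proj₂ w

        right-≡ : ∀ {Y u w} → RightLink Y u w → proj₁ u ≡ R↓ Y ℤ.+ 1ℤ × proj₁ w ≡ R↑ Y ℤ.+ 1ℤ
        right-≡ (Y∈ , e∈ , l , h) with crossed Y∈
        ... | r with RowCrossing.only-rise r e∈ l h
        ...   | refl = proj₁ (crossing-≡ r (row-≡ Y∈))

        left-≡ : ∀ {Y u w} → LeftLink Y u w → proj₁ w ≡ L↑ Y × proj₁ u ≡ L↓ Y
        left-≡ (Y∈ , e∈ , l , h) with crossed Y∈
        ... | r with RowCrossing.only-fall r e∈ h l
        ...   | refl = proj₂ (crossing-≡ r (row-≡ Y∈))

        right-single : ∀ {Y Y′ u w u′ w′} → RightLink Y u w → RightLink Y′ u′ w′ →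
          proj₂ u ℤ.≤ Y′ → Y′ ℤ.< proj₂ w → u ≡ u′ × w ≡ w′
        right-single (_ , e∈ , _) (Y′∈ , e′∈ , l′ , h′) l h with crossed Y′∈
        ... | r with trans (RowCrossing.only-rise r e∈ l h) (sym (RowCrossing.only-rise r e′∈ l′ h′))
        ...   | refl = refl , refl

        left-single : ∀ {Y Y′ u w u′ w′} → LeftLink Y u w → LeftLink Y′ u′ w′ →
          proj₂ u ℤ.≤ Y′ → Y′ ℤ.< proj₂ w → u ≡ u′ × w ≡ w′
        left-single (_ , e∈ , _) (Y′∈ , e′∈ , l′ , h′) l h with crossed Y′∈
        ... | r with trans (RowCrossing.only-fall r e∈ h l) (sym (RowCrossing.only-fall r e′∈ h′ l′))
        ...   | refl = refl , refl

        right-link : ∀ {Y} → bottom ℤ.≤ Y → Y ℤ.< bottom ℤ.+ + height → ∃₂ (RightLink Y)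
        right-link h k = let Y∈ = ∈-interval⁺ height h k
                             open RowCrossing (crossed Y∈)
                         in _ , _ , Y∈ , rise∈ , rise-low , rise-high

        left-link : ∀ {Y} → bottom ℤ.≤ Y → Y ℤ.< bottom ℤ.+ + height → ∃₂ (LeftLink Y)
        left-link h k = let Y∈ = ∈-interval⁺ height h k
                            open RowCrossing (crossed Y∈)
                        in _ , _ , Y∈ , fall∈ , fall-low , fall-high

        module Right = Chain bottom height (Corner cs) corner-rows proj₁ RightLink right-link
          (λ (_ , e∈ , _) → source e∈ , target e∈) (λ (_ , _ , l , _) → l) (λ (_ , _ , _ , h) → h)
          (λ {_} {_} {_} {v} l cv h → subst (proj₁ v ℤ.≤_) (sym (proj₁ (right-≡ l))) (proj₂ (corner-below cv h)))
          (λ {_} {_} {_} {v} l cv h → subst (proj₁ v ℤ.≤_) (sym (proj₂ (right-≡ l))) (proj₂ (corner-above cv h)))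
          right-single

        module Left = Chain bottom height (Corner cs) corner-rows (λ v → ℤ.- proj₁ v) LeftLink left-link
          (λ (_ , e∈ , _) → target e∈ , source e∈) (λ (_ , _ , l , _) → l) (λ (_ , _ , _ , h) → h)
          (λ {_} {_} {_} {v} l cv h → ℤ.neg-mono-≤ (subst (ℤ._≤ proj₁ v) (sym (proj₂ (left-≡ l))) (proj₁ (corner-below cv h))))
          (λ {_} {_} {_} {v} l cv h → ℤ.neg-mono-≤ (subst (ℤ._≤ proj₁ v) (sym (proj₁ (left-≡ l))) (proj₁ (corner-above cv h))))
          left-single

        -- The corners of a cell on the side towards δ have ξ equal to coordinate δ plus k.
        record Side (δ : Direction) : Set₁ where
          field
            ξ             : Pt → ℤ
            k             : ℤ
            ξ-corner      : ∀ {x y X Y} → X ≡ x ⊎ X ≡ x ℤ.+ 1ℤ → ξ (X , Y) ℤ.≤ coordinate δ (x , y) ℤ.+ k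
            attained      : ∀ x y Y → ∃[ X ] (X ≡ x ⊎ X ≡ x ℤ.+ 1ℤ) × ξ (X , Y) ≡ coordinate δ (x , y) ℤ.+ k
            Link          : ℤ → Pt → Pt → Set
            link          : ∀ {Y} → bottom ℤ.≤ Y → Y ℤ.< bottom ℤ.+ + height → ∃₂ (Link Y)
            link-corners  : ∀ {Y u w} → Link Y u w → Corner cs u × Corner cs w
            link-low      : ∀ {Y u w} → Link Y u w → proj₂ u ℤ.≤ Y
            link-high     : ∀ {Y u w} → Link Y u w → Y ℤ.< proj₂ w
            max-low       : ∀ {Y u w v} → Link Y u w → Corner cs v → proj₂ v ℤ.≤ Y → ξ v ℤ.≤ ξ u
            max-high      : ∀ {Y u w v} → Link Y u w → Corner cs v → Y ℤ.< proj₂ v → ξ v ℤ.≤ ξ w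
            bottom-or-max : ∀ {Y u w} → Link Y u w → proj₂ u ≡ bottom ⊎ (∀ {v} → Corner cs v → ξ v ℤ.≤ ξ u)
            top-or-max    : ∀ {Y u w} → Link Y u w → proj₂ w ≡ bottom ℤ.+ + height ⊎ (∀ {v} → Corner cs v → ξ v ℤ.≤ ξ w)

        rightSide : Side right
        rightSide = record
          { ξ = proj₁ ; k = 1ℤ
          ; ξ-corner = λ { {x} (inj₁ refl) → lia 1 (λ x → ⊢ x :≤ x :+ # 1) refl x ; (inj₂ refl) → ℤ.≤-refl }
          ; attained = λ x y Y → x ℤ.+ 1ℤ , inj₂ refl , refl
          ; Link = RightLink ; link = right-link
          ; link-corners = λ (_ , e∈ , _) → source e∈ , target e∈ ; link-low = λ (_ , _ , l , _) → l
          ; link-high = λ (_ , _ , _ , h) → h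
          ; max-low = λ {_} {_} {_} {v} l cv h → subst (proj₁ v ℤ.≤_) (sym (proj₁ (right-≡ l))) (proj₂ (corner-below cv h))
          ; max-high = λ {_} {_} {_} {v} l cv h → subst (proj₁ v ℤ.≤_) (sym (proj₂ (right-≡ l))) (proj₂ (corner-above cv h))
          ; bottom-or-max = Right.bottom-or-max ; top-or-max = Right.top-or-max }

        leftSide : Side left
        leftSide = record
          { ξ = λ v → ℤ.- proj₁ v ; k = 0ℤ
          ; ξ-corner = λ { {x} (inj₁ refl) → lia 1 (λ x → ⊢ :- x :≤ :- x :+ # 0) refl x
                         ; {x} (inj₂ refl) → lia 1 (λ x → ⊢ :- (x :+ # 1) :≤ :- x :+ # 0) refl x }
          ; attained = λ x y Y → x , inj₁ refl , sym (ℤ.+-identityʳ (ℤ.- x))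
          ; Link = LeftLink ; link = left-link
          ; link-corners = λ (_ , e∈ , _) → target e∈ , source e∈ ; link-low = λ (_ , _ , l , _) → l
          ; link-high = λ (_ , _ , _ , h) → h
          ; max-low = λ {_} {_} {_} {v} l cv h → ℤ.neg-mono-≤ (subst (ℤ._≤ proj₁ v) (sym (proj₂ (left-≡ l))) (proj₁ (corner-below cv h)))
          ; max-high = λ {_} {_} {_} {v} l cv h → ℤ.neg-mono-≤ (subst (ℤ._≤ proj₁ v) (sym (proj₁ (left-≡ l))) (proj₁ (corner-above cv h)))
          ; bottom-or-max = Left.bottom-or-max ; top-or-max = Left.top-or-max }

        cancel-k : ∀ {a b k} → a ℤ.+ k ℤ.≤ b ℤ.+ k → a ℤ.≤ b
        cancel-k {a} {b} {k} = lia 3 (λ a b k → a :+ k :≤ b :+ k ⇒ ⊢ a :≤ b) refl a b k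

        module _ {δ : Direction} (side : Side δ) where

          open Side side

          extreme : ∀ {X Y} {d} → (∀ {v} → Corner cs v → ξ v ℤ.≤ ξ (X , Y)) → d ∈ cs →
            X ≡ proj₁ d ⊎ X ≡ proj₁ d ℤ.+ 1ℤ → Extreme δ (_∈ cs) d
          extreme {X} {Y} {x , y} max d∈ hx = d∈ , λ { {x′ , y′} e∈ →
            let X′ , hx′ , eq = attained x′ y′ y′
            in cancel-k {k = k} (ℤ.≤-trans (ℤ.≤-reflexive (sym eq)) (ℤ.≤-trans (max ((x′ , y′) , e∈ , hx′ , inj₁ refl)) (ξ-corner {y = y} {Y = Y} hx))) }

          -- The edge across the row of the given cell decides. By `bottom-or-max` its lower end is
          -- a corner of a cell that is lowest or furthest out, and in the other coordinate that
          -- cell is not behind the given one.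
          cut-down : CornerCut δ down (_∈ cs)
          cut-down {x , y} c∈ with link (proj₁ (inside c∈)) (proj₂ (inside c∈))
          ... | (X , Y) , w , l with proj₁ (link-corners l)
          ...   | (x′ , y′) , d∈ , hx , hy with bottom-or-max l
          ...     | inj₁ refl = let X″ , hx″ , eq = attained x y y in inj₁ ((x′ , y′) ,
            (d∈ , λ {e} e∈ → ℤ.neg-mono-≤ (ℤ.≤-trans (y′≤ hy) (proj₁ (inside e∈)))) ,
            cancel-k {k = k} (ℤ.≤-trans (ℤ.≤-reflexive (sym eq))
              (ℤ.≤-trans (max-low l ((x , y) , c∈ , hx″ , inj₁ refl) ℤ.≤-refl) (ξ-corner {y = y′} {Y = Y} hx))))
            where
            y′≤ : bottom ≡ y′ ⊎ bottom ≡ y′ ℤ.+ 1ℤ → y′ ℤ.≤ bottom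
            y′≤ (inj₁ eq) = ℤ.≤-reflexive (sym eq)
            y′≤ (inj₂ eq) = lia 2 (λ b y → b := y :+ # 1 ⇒ ⊢ y :≤ b) refl bottom y′ eq
          ...     | inj₂ max = inj₂ ((x′ , y′) , extreme {X} {Y} max d∈ hx , ℤ.neg-mono-≤ (ℤ.≤-trans (y′≤ hy) (link-low l)))
            where
            y′≤ : Y ≡ y′ ⊎ Y ≡ y′ ℤ.+ 1ℤ → y′ ℤ.≤ Y
            y′≤ (inj₁ eq) = ℤ.≤-reflexive (sym eq)
            y′≤ (inj₂ eq) = lia 2 (λ b y → b := y :+ # 1 ⇒ ⊢ y :≤ b) refl Y y′ eq

          cut-up : CornerCut δ up (_∈ cs)
          cut-up {x , y} c∈ with link (proj₁ (inside c∈)) (proj₂ (inside c∈))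
          ... | u , (X , Y) , l with proj₂ (link-corners l)
          ...   | (x′ , y′) , d∈ , hx , hy with top-or-max l
          -- A corner on the upper side of the cell is taken, since `max-high` compares only corners
          -- above height `y`.
          ...     | inj₁ refl = let X″ , hx″ , eq = attained x y (y ℤ.+ 1ℤ) in inj₁ ((x′ , y′) ,
            (d∈ , λ {e} e∈ → lia 3 (λ e t y → e :< t ⇒ t :≤ y :+ # 1 ⇒ ⊢ e :≤ y) refl (proj₂ e) _ y′ (proj₂ (inside e∈)) (≤y′ hy)) ,
            cancel-k {k = k} (ℤ.≤-trans (ℤ.≤-reflexive (sym eq))
              (ℤ.≤-trans (max-high l ((x , y) , c∈ , hx″ , inj₂ refl) (lia 1 (λ y → ⊢ y :< y :+ # 1) refl y)) (ξ-corner {y = y′} {Y = Y} hx))))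
            where
            ≤y′ : Y ≡ y′ ⊎ Y ≡ y′ ℤ.+ 1ℤ → Y ℤ.≤ y′ ℤ.+ 1ℤ
            ≤y′ (inj₁ eq) = lia 2 (λ b y → b := y ⇒ ⊢ b :≤ y :+ # 1) refl Y y′ eq
            ≤y′ (inj₂ eq) = ℤ.≤-reflexive eq
          ...     | inj₂ max = inj₂ ((x′ , y′) , extreme {X} {Y} max d∈ hx ,
            lia 3 (λ a Y y → a :< Y ⇒ Y :≤ y :+ # 1 ⇒ ⊢ a :≤ y) refl y Y y′ (link-high l) (≤y′ hy))
            where
            ≤y′ : Y ≡ y′ ⊎ Y ≡ y′ ℤ.+ 1ℤ → Y ℤ.≤ y′ ℤ.+ 1ℤ
            ≤y′ (inj₁ eq) = lia 2 (λ b y → b := y ⇒ ⊢ b :≤ y :+ # 1) refl Y y′ eq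
            ≤y′ (inj₂ eq) = ℤ.≤-reflexive eq

      corners-cut : CornerCut right down (_∈ cs) × CornerCut right up (_∈ cs) × CornerCut left down (_∈ cs) × CornerCut left up (_∈ cs)
      corners-cut = cut-down rightSide , cut-up rightSide , cut-down leftSide , cut-up leftSide

-- Growing a polyomino cell by cell

step : Direction → Cell → Cell
step right (x , y) = x ℤ.+ 1ℤ , y
step left  (x , y) = x ℤ.- 1ℤ , y
step up    (x , y) = x , y ℤ.+ 1ℤ
step down  (x , y) = x , y ℤ.- 1ℤ

across along : Direction → ℕ → ℕ
across right a = suc a
across left  a = suc a
across up    a = a
across down  a = a
along right b = b
along left  b = b
along up    b = suc b
along down  b = suc b

data Grown : List Cell → ℕ → ℕ → Set where
  seed : ∀ c → Grown (c ∷ []) 0 0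
  grow : ∀ δ {cs a b c} → Grown cs a b → c ∈ cs → Grown (step δ c ∷ cs) (across δ a) (along δ b)

-- Each new cell continues an extreme cell outwards and so leaves the bounding box, which in the end
-- has a + 1 columns and b + 1 rows.
data Tight : List Cell → ℕ → ℕ → Set where
  seed : ∀ c → Tight (c ∷ []) 0 0
  grow : ∀ δ {cs a b c} → Tight cs a b → Extreme δ (_∈ cs) c → Tight (step δ c ∷ cs) (across δ a) (along δ b)

-- Twice an area: that of the 1 + a + b cells, and that of the triangles between a row and its legs,
-- whose doubled areas add up to a b. It rises by b + 2 with a and by a + 2 with b, which are the
-- largest gains of a horizontal and a vertical step.
bound : ℕ → ℕ → ℤ
bound a b = + 2 ℤ.* (1ℤ ℤ.+ + a ℤ.+ + b) ℤ.+ + a ℤ.* + b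

private
  at-least : ℤ → ℤ → ℤ → ℤ → ℤ
  at-least y Y a b = if does (y ℤ.≤? Y) then a else b

  at-least-yes : ∀ {y Y a b} → y ℤ.≤ Y → at-least y Y a b ≡ a
  at-least-yes {y} {Y} h with y ℤ.≤? Y
  ... | yes _ = refl
  ... | no  k = ⊥-elim (k h)

  at-least-no : ∀ {y Y a b} → Y ℤ.< y → at-least y Y a b ≡ b
  at-least-no {y} {Y} h with y ℤ.≤? Y
  ... | yes k = ⊥-elim (ℤ.<⇒≱ h k)
  ... | no  _ = refl

  at-least-elim : ∀ (P : ℤ → Set) {y Y a b} → P a → P b → P (at-least y Y a b)
  at-least-elim P {y} {Y} pa pb with y ℤ.≤? Y
  ... | yes _ = pa
  ... | no  _ = pb

  at-least-elim₂ : ∀ (P : ℤ → ℤ → Set) {y Y a b a′ b′} → P a a′ → P b b′ → P (at-least y Y a b) (at-least y Y a′ b′)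
  at-least-elim₂ P {y} {Y} pa pb with y ℤ.≤? Y
  ... | yes _ = pa
  ... | no  _ = pb

  indicator : ℤ → ℤ → ℤ → ℤ
  indicator k y Y = if does (Y ℤ.≟ y) then k else 0ℤ

  indicator-yes : ∀ {k y Y} → Y ≡ y → indicator k y Y ≡ k
  indicator-yes {k} {y} {Y} eq with Y ℤ.≟ y
  ... | yes _ = refl
  ... | no  n = ⊥-elim (n eq)

  indicator-no : ∀ {k y Y} → Y ≢ y → indicator k y Y ≡ 0ℤ
  indicator-no {k} {y} {Y} n with Y ℤ.≟ y
  ... | yes eq = ⊥-elim (n eq)
  ... | no  _  = refl

  sum-indicator-0 : ∀ {k y b} n → y ℤ.< b → sumOver (indicator k y) (interval b n) ≡ 0ℤ
  sum-indicator-0 zero    h = refl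
  sum-indicator-0 {k} {y} {b} (suc n) h = cong₂ ℤ._+_ (indicator-no {k} {y} {b} (λ eq → ℤ.<-irrefl (sym eq) h))
    (sum-indicator-0 n (lia 2 (λ y b → y :< b ⇒ ⊢ y :< b :+ # 1) refl y b h))

  sum-indicator : ∀ {k y b} n → b ℤ.≤ y → y ℤ.< b ℤ.+ + n → sumOver (indicator k y) (interval b n) ≡ k
  sum-indicator {k} {y} {b} zero    h t = ⊥-elim (lia 2 (λ y b → b :≤ y ⇒ y :< b :+ # 0 ⇒ ⊢ :⊥) refl y b h t)
  sum-indicator {k} {y} {b} (suc n) h t with b ℤ.≟ y
  ... | yes refl = trans (cong (λ s → k ℤ.+ s) (sum-indicator-0 n (lia 1 (λ b → ⊢ b :< b :+ # 1) refl b))) (ℤ.+-identityʳ k)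
  ... | no  b≢y  = trans (ℤ.+-identityˡ _) (sum-indicator n
    (lia 2 (λ b y → b :< y ⇒ ⊢ b :+ # 1 :≤ y) refl b y (ℤ.≤∧≢⇒< h b≢y))
    (lia 3 (λ b y n → y :< b :+ (# 1 :+ n) ⇒ ⊢ y :< b :+ # 1 :+ n) refl b y (+ n) t))

  sum-1 : ∀ b n → sumOver (λ _ → 1ℤ) (interval b n) ≡ + n
  sum-1 b zero    = refl
  sum-1 b (suc n) = cong (λ s → 1ℤ ℤ.+ s) (sum-1 (b ℤ.+ 1ℤ) n)

  sumOver-snoc : ∀ (f : ℤ → ℤ) b n → sumOver f (interval b (suc n)) ≡ sumOver f (interval b n) ℤ.+ f (b ℤ.+ + n)
  sumOver-snoc f b zero    = trans (ℤ.+-comm (f b) 0ℤ) (cong (λ z → 0ℤ ℤ.+ f z) (sym (ℤ.+-identityʳ b)))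
  sumOver-snoc f b (suc n) = trans (cong (λ s → f b ℤ.+ s) (sumOver-snoc f (b ℤ.+ 1ℤ) n))
    (trans (sym (ℤ.+-assoc (f b) (sumOver f (interval (b ℤ.+ 1ℤ) n)) _))
      (cong (λ z → f b ℤ.+ sumOver f (interval (b ℤ.+ 1ℤ) n) ℤ.+ f z)
        (lia 2 (λ b n → ⊢ b :+ # 1 :+ n := b :+ (# 1 :+ n)) refl b (+ n))))

-- All cells lie in or above the bottom row, so its upper range is the full range of columns; the
-- case of equality rests on this. `measure` joins the bound with its case of equality, so that a
-- single induction proves both.
record Tracked (cs : List Cell) (a b : ℕ) : Set where
  field
    profile   : Profile cs
    xmin xmax : ℤ
  open Profile profile public
  field
    R↓≤xmax   : ∀ Y → R↓ Y ℤ.≤ xmax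
    R↑≤xmax   : ∀ Y → R↑ Y ℤ.≤ xmax
    xmin≤L↓   : ∀ Y → xmin ℤ.≤ L↓ Y
    xmin≤L↑   : ∀ Y → xmin ℤ.≤ L↑ Y
    R↑-bottom : R↑ bottom ≡ xmax
    L↑-bottom : L↑ bottom ≡ xmin
    breadth   : xmax ℤ.- xmin ℤ.≤ + a
    tallness  : + height ℤ.≤ + b ℤ.+ 1ℤ
    measure   : total ℤ.< bound a b ⊎ (total ≡ bound a b × Tight cs a b)

  measure-≤ : total ℤ.≤ bound a b
  measure-≤ with measure
  ... | inj₁ h       = ℤ.<⇒≤ h
  ... | inj₂ (h , _) = ℤ.≤-reflexive h

  measure-tight : bound a b ℤ.≤ total → Tight cs a b
  measure-tight h with measure
  ... | inj₁ k       = ⊥-elim (ℤ.<⇒≱ k h)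
  ... | inj₂ (_ , t) = t

  cell-range : ∀ {c} → c ∈ cs → xmin ℤ.≤ proj₁ c × proj₁ c ℤ.≤ xmax
  cell-range c∈ = let l , r = below {Y = _} c∈ ℤ.≤-refl in
    ℤ.≤-trans (xmin≤L↓ _) l , ℤ.≤-trans r (R↓≤xmax _)

seeded : ∀ c → Tracked (c ∷ []) 0 0
seeded (x , y) = record
  { profile = record
    { bottom = y ; height = 1 ; R↓ = λ _ → x ; L↓ = λ _ → x ; R↑ = λ _ → x ; L↑ = λ _ → x
    ; inside = λ { (here refl) → ℤ.≤-refl , lia 1 (λ y → ⊢ y :< y :+ # 1) refl y }
    ; below = λ { (here refl) _ → ℤ.≤-refl , ℤ.≤-refl }
    ; above′ = λ { (here refl) _ → ℤ.≤-refl , ℤ.≤-refl }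
    ; L≤R↓ = λ _ → ℤ.≤-refl ; L≤R↑ = λ _ → ℤ.≤-refl }
  ; xmin = x ; xmax = x
  ; R↓≤xmax = λ _ → ℤ.≤-refl ; R↑≤xmax = λ _ → ℤ.≤-refl ; xmin≤L↓ = λ _ → ℤ.≤-refl ; xmin≤L↑ = λ _ → ℤ.≤-refl
  ; R↑-bottom = refl ; L↑-bottom = refl
  ; breadth = ℤ.≤-reflexive (ℤ.+-inverseʳ x) ; tallness = ℤ.≤-refl
  ; measure = inj₂ (lia 1 (λ x → ⊢ x :- x :+ (x :- x) :+ # 2 :+ # 0 := # 2) refl x , seed (x , y)) }

module _ {cs a b} (T : Tracked cs a b) (d : Cell) where

  open Tracked T

  private
    x = proj₁ d
    y = proj₂ d

  module Insert (in-row : bottom ℤ.≤ y × y ℤ.< bottom ℤ.+ + height) where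

    R↓′ L↓′ R↑′ L↑′ : ℤ → ℤ
    R↓′ Y = at-least y Y (R↓ Y ⊔ x) (R↓ Y)
    L↓′ Y = at-least y Y (L↓ Y ⊓ x) (L↓ Y)
    R↑′ Y = at-least Y y (R↑ Y ⊔ x) (R↑ Y)
    L↑′ Y = at-least Y y (L↑ Y ⊓ x) (L↑ Y)

    private
      R↓≤ : ∀ Y → R↓ Y ℤ.≤ R↓′ Y
      R↓≤ Y = at-least-elim (R↓ Y ℤ.≤_) {y} {Y} (ℤ.i≤i⊔j (R↓ Y) x) ℤ.≤-refl
      ≤L↓ : ∀ Y → L↓′ Y ℤ.≤ L↓ Y
      ≤L↓ Y = at-least-elim (ℤ._≤ L↓ Y) {y} {Y} (ℤ.i⊓j≤i (L↓ Y) x) ℤ.≤-refl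
      R↑≤ : ∀ Y → R↑ Y ℤ.≤ R↑′ Y
      R↑≤ Y = at-least-elim (R↑ Y ℤ.≤_) {Y} {y} (ℤ.i≤i⊔j (R↑ Y) x) ℤ.≤-refl
      ≤L↑ : ∀ Y → L↑′ Y ℤ.≤ L↑ Y
      ≤L↑ Y = at-least-elim (ℤ._≤ L↑ Y) {Y} {y} (ℤ.i⊓j≤i (L↑ Y) x) ℤ.≤-refl

    profile′ : Profile (d ∷ cs)
    profile′ = record
      { bottom = bottom ; height = height ; R↓ = R↓′ ; L↓ = L↓′ ; R↑ = R↑′ ; L↑ = L↑′
      ; inside = λ { (here refl) → in-row ; (there c∈) → inside c∈ }
      ; below = λ
        { {_} {Y} (here refl) h → subst (ℤ._≤ x) (sym (at-least-yes h)) (ℤ.i⊓j≤j (L↓ Y) x) ,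
                                   subst (x ℤ.≤_) (sym (at-least-yes h)) (ℤ.i≤j⊔i (R↓ Y) x)
        ; {_} {Y} (there c∈)  h → let l , r = below c∈ h in ℤ.≤-trans (≤L↓ Y) l , ℤ.≤-trans r (R↓≤ Y) }
      ; above′ = λ
        { {_} {Y} (here refl) h → subst (ℤ._≤ x) (sym (at-least-yes h)) (ℤ.i⊓j≤j (L↑ Y) x) ,
                                   subst (x ℤ.≤_) (sym (at-least-yes h)) (ℤ.i≤j⊔i (R↑ Y) x)
        ; {_} {Y} (there c∈)  h → let l , r = above′ c∈ h in ℤ.≤-trans (≤L↑ Y) l , ℤ.≤-trans r (R↑≤ Y) }
      ; L≤R↓ = λ Y → ℤ.≤-trans (≤L↓ Y) (ℤ.≤-trans (L≤R↓ Y) (R↓≤ Y))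
      ; L≤R↑ = λ Y → ℤ.≤-trans (≤L↑ Y) (ℤ.≤-trans (L≤R↑ Y) (R↑≤ Y)) }

    module P′ = Profile profile′

    xmax′ = xmax ⊔ x
    xmin′ = xmin ⊓ x

    total-grows : ∀ g → (∀ {Y} → Y ∈ rowList → P′.width Y ℤ.≤ width Y ℤ.+ g Y) → P′.total ℤ.≤ total ℤ.+ sumOver g rowList
    total-grows g h = ℤ.≤-trans (sumOver-mono rowList h) (ℤ.≤-reflexive (sumOver-+ {f = width} {g} rowList))

    inserted : ∀ {a′ b′} → xmax′ ℤ.- xmin′ ℤ.≤ + a′ → + height ℤ.≤ + b′ ℤ.+ 1ℤ →
      (P′.total ℤ.< bound a′ b′ ⊎ (P′.total ≡ bound a′ b′ × Tight (d ∷ cs) a′ b′)) → Tracked (d ∷ cs) a′ b′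
    inserted br ta me = record
      { profile = profile′ ; xmin = xmin′ ; xmax = xmax′
      ; R↓≤xmax = λ Y → at-least-elim (ℤ._≤ xmax′) {y} {Y} (ℤ.⊔-monoˡ-≤ x (R↓≤xmax Y)) (ℤ.≤-trans (R↓≤xmax Y) (ℤ.i≤i⊔j xmax x))
      ; R↑≤xmax = λ Y → at-least-elim (ℤ._≤ xmax′) {Y} {y} (ℤ.⊔-monoˡ-≤ x (R↑≤xmax Y)) (ℤ.≤-trans (R↑≤xmax Y) (ℤ.i≤i⊔j xmax x))
      ; xmin≤L↓ = λ Y → at-least-elim (xmin′ ℤ.≤_) {y} {Y} (ℤ.⊓-monoˡ-≤ x (xmin≤L↓ Y)) (ℤ.≤-trans (ℤ.i⊓j≤i xmin x) (xmin≤L↓ Y))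
      ; xmin≤L↑ = λ Y → at-least-elim (xmin′ ℤ.≤_) {Y} {y} (ℤ.⊓-monoˡ-≤ x (xmin≤L↑ Y)) (ℤ.≤-trans (ℤ.i⊓j≤i xmin x) (xmin≤L↑ Y))
      ; R↑-bottom = trans (at-least-yes (proj₁ in-row)) (cong (_⊔ x) R↑-bottom)
      ; L↑-bottom = trans (at-least-yes (proj₁ in-row)) (cong (_⊓ x) L↑-bottom)
      ; breadth = br ; tallness = ta ; measure = me }

-- A step sideways adds at most 1 to the two widths of each row, and only one of
-- them changes unless the row is that of the new cell.

module _ {cs a b} (T : Tracked cs a b) {c d : Cell} (c∈ : c ∈ cs) where

  open Tracked T

  private
    x = proj₁ c
    y = proj₂ c
    x′ = proj₁ d
    y′ = proj₂ d

    -- The new cell is at most one column away from an occupied one, so it exceeds the range on one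
    -- side only, and by at most 1.
    stretch : ∀ {L R} → L ℤ.≤ x → x ℤ.≤ R → x ℤ.- 1ℤ ℤ.≤ x′ → x′ ℤ.≤ x ℤ.+ 1ℤ →
              (R ⊔ x′) ℤ.- (L ⊓ x′) ℤ.≤ R ℤ.- L ℤ.+ 1ℤ
    stretch {L} {R} l r h k with ℤ.≤-total R x′ | ℤ.≤-total L x′
    ... | inj₁ R≤ | inj₁ L≤ rewrite ℤ.i≤j⇒i⊔j≡j R≤ | ℤ.i≤j⇒i⊓j≡i L≤ =
      lia 4 (λ L R x x′ → x :≤ R ⇒ x′ :≤ x :+ # 1 ⇒ ⊢ x′ :- L :≤ R :- L :+ # 1) refl L R x x′ r k
    ... | inj₁ R≤ | inj₂ ≤L rewrite ℤ.i≤j⇒i⊔j≡j R≤ | ℤ.i≥j⇒i⊓j≡j ≤L =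
      lia 4 (λ L R x x′ → x :≤ R ⇒ L :≤ x ⇒ ⊢ x′ :- x′ :≤ R :- L :+ # 1) refl L R x x′ r l
    ... | inj₂ ≤R | inj₁ L≤ rewrite ℤ.i≥j⇒i⊔j≡i ≤R | ℤ.i≤j⇒i⊓j≡i L≤ =
      lia 2 (λ L R → ⊢ R :- L :≤ R :- L :+ # 1) refl L R
    ... | inj₂ ≤R | inj₂ ≤L rewrite ℤ.i≥j⇒i⊔j≡i ≤R | ℤ.i≥j⇒i⊓j≡j ≤L =
      lia 4 (λ L R x x′ → L :≤ x ⇒ x :- # 1 :≤ x′ ⇒ ⊢ R :- x′ :≤ R :- L :+ # 1) refl L R x x′ l h

    keep : ∀ {L R} → L ℤ.≤ x′ → x′ ℤ.≤ R → (R ⊔ x′) ℤ.- (L ⊓ x′) ≡ R ℤ.- L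
    keep L≤ ≤R = cong₂ ℤ._-_ (ℤ.i≥j⇒i⊔j≡i ≤R) (ℤ.i≤j⇒i⊓j≡i L≤)

  sideways : x ℤ.- 1ℤ ℤ.≤ x′ → x′ ℤ.≤ x ℤ.+ 1ℤ → y′ ≡ y →
             (xmax ℤ.< x′ ⊎ x′ ℤ.< xmin → Tight cs a b → Tight (d ∷ cs) (suc a) b) → Tracked (d ∷ cs) (suc a) b
  sideways h k refl next = inserted
    (ℤ.≤-trans (stretch (proj₁ (cell-range c∈)) (proj₂ (cell-range c∈)) h k)
      (lia 2 (λ w a → w :≤ a ⇒ ⊢ w :+ # 1 :≤ # 1 :+ a) refl (xmax ℤ.- xmin) (+ a) breadth))
    tallness measure′
    where
    open Insert T d (inside c∈)
    g : ℤ → ℤ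
    g Y = 1ℤ ℤ.+ indicator 1ℤ y Y
    gain : ∀ {Y} → Y ∈ rowList → P′.width Y ℤ.≤ width Y ℤ.+ g Y
    gain {Y} _ with ℤ.<-cmp Y y
    ... | tri< Y<y Y≢y _ rewrite at-least-no {y} {Y} {R↓ Y ⊔ x′} {R↓ Y} Y<y | at-least-no {y} {Y} {L↓ Y ⊓ x′} {L↓ Y} Y<y
                      | at-least-yes {Y} {y} {R↑ Y ⊔ x′} {R↑ Y} (ℤ.<⇒≤ Y<y) | at-least-yes {Y} {y} {L↑ Y ⊓ x′} {L↑ Y} (ℤ.<⇒≤ Y<y)
                      | indicator-no {1ℤ} Y≢y =
      let l , r = above′ c∈ (ℤ.<⇒≤ Y<y) in
      lia 3 (λ s t t′ → t′ :≤ t :+ # 1 ⇒ ⊢ s :+ t′ :+ # 2 :≤ s :+ t :+ # 2 :+ (# 1 :+ # 0)) refl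
        (R↓ Y ℤ.- L↓ Y) (R↑ Y ℤ.- L↑ Y) ((R↑ Y ⊔ x′) ℤ.- (L↑ Y ⊓ x′)) (stretch l r h k)
    ... | tri> _ Y≢y y<Y rewrite at-least-yes {y} {Y} {R↓ Y ⊔ x′} {R↓ Y} (ℤ.<⇒≤ y<Y) | at-least-yes {y} {Y} {L↓ Y ⊓ x′} {L↓ Y} (ℤ.<⇒≤ y<Y)
                      | at-least-no {Y} {y} {R↑ Y ⊔ x′} {R↑ Y} y<Y | at-least-no {Y} {y} {L↑ Y ⊓ x′} {L↑ Y} y<Y
                      | indicator-no {1ℤ} Y≢y =
      let l , r = below c∈ (ℤ.<⇒≤ y<Y) in
      lia 3 (λ s t s′ → s′ :≤ s :+ # 1 ⇒ ⊢ s′ :+ t :+ # 2 :≤ s :+ t :+ # 2 :+ (# 1 :+ # 0)) refl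
        (R↓ Y ℤ.- L↓ Y) (R↑ Y ℤ.- L↑ Y) ((R↓ Y ⊔ x′) ℤ.- (L↓ Y ⊓ x′)) (stretch l r h k)
    ... | tri≈ _ refl _ rewrite at-least-yes {y} {y} {R↓ y ⊔ x′} {R↓ y} ℤ.≤-refl | at-least-yes {y} {y} {L↓ y ⊓ x′} {L↓ y} ℤ.≤-refl
                      | at-least-yes {y} {y} {R↑ y ⊔ x′} {R↑ y} ℤ.≤-refl | at-least-yes {y} {y} {L↑ y ⊓ x′} {L↑ y} ℤ.≤-refl
                      | indicator-yes {1ℤ} {y} {y} refl =
      let l , r = below c∈ ℤ.≤-refl ; l′ , r′ = above′ c∈ ℤ.≤-refl in
      lia 4 (λ s t s′ t′ → s′ :≤ s :+ # 1 ⇒ t′ :≤ t :+ # 1 ⇒ ⊢ s′ :+ t′ :+ # 2 :≤ s :+ t :+ # 2 :+ (# 1 :+ # 1)) refl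
        (R↓ y ℤ.- L↓ y) (R↑ y ℤ.- L↑ y) ((R↓ y ⊔ x′) ℤ.- (L↓ y ⊓ x′)) ((R↑ y ⊔ x′) ℤ.- (L↑ y ⊓ x′))
        (stretch l r h k) (stretch l′ r′ h k)
    sum-g : sumOver g rowList ≡ + height ℤ.+ 1ℤ
    sum-g = trans (sumOver-+ {f = λ _ → 1ℤ} {indicator 1ℤ y} rowList)
      (cong₂ ℤ._+_ (sum-1 bottom height) (sum-indicator height (proj₁ (inside c∈)) (proj₂ (inside c∈))))
    total≤ : P′.total ℤ.≤ total ℤ.+ (+ height ℤ.+ 1ℤ)
    total≤ = ℤ.≤-trans (total-grows g gain) (ℤ.≤-reflexive (cong (λ s → total ℤ.+ s) sum-g))
    bound-suc : bound (suc a) b ≡ bound a b ℤ.+ (+ b ℤ.+ + 2)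
    bound-suc = lia 2 (λ a b → ⊢ # 2 :* (# 1 :+ (# 1 :+ a) :+ b) :+ (# 1 :+ a) :* b := # 2 :* (# 1 :+ a :+ b) :+ a :* b :+ (b :+ # 2)) refl (+ a) (+ b)
    measure′ : P′.total ℤ.< bound (suc a) b ⊎ (P′.total ≡ bound (suc a) b × Tight (d ∷ cs) (suc a) b)
    measure′ with P′.total ℤ.<? bound (suc a) b
    ... | yes lt = inj₁ lt
    ... | no  ge = inj₂ (ℤ.≤-antisym le (ℤ.≮⇒≥ ge) , next extending (measure-tight back))
      where
      ge′ : bound a b ℤ.+ (+ b ℤ.+ + 2) ℤ.≤ P′.total
      ge′ = subst (ℤ._≤ P′.total) bound-suc (ℤ.≮⇒≥ ge)
      le : P′.total ℤ.≤ bound (suc a) b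
      le = subst (P′.total ℤ.≤_) (sym bound-suc)
        (lia 5 (λ p t h B b → p :≤ t :+ (h :+ # 1) ⇒ t :≤ B ⇒ h :≤ b :+ # 1 ⇒ ⊢ p :≤ B :+ (b :+ # 2)) refl
          P′.total total (+ height) (bound a b) (+ b) total≤ measure-≤ tallness)
      back : bound a b ℤ.≤ total
      back = lia 5 (λ p t h B b → p :≤ t :+ (h :+ # 1) ⇒ B :+ (b :+ # 2) :≤ p ⇒ h :≤ b :+ # 1 ⇒ ⊢ B :≤ t) refl
          P′.total total (+ height) (bound a b) (+ b) total≤ ge′ tallness
      -- Were the new cell within the columns already used, the upper width of the bottom row, being
      -- the full breadth, could not grow; the total would miss one unit, contrary to equality.
      extending : xmax ℤ.< x′ ⊎ x′ ℤ.< xmin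
      extending with xmax ℤ.<? x′ | x′ ℤ.<? xmin
      ... | yes r | _     = inj₁ r
      ... | no  _ | yes l = inj₂ l
      ... | no  r | no  l = ⊥-elim (lia 5 (λ p t h B b → p :≤ t :+ (h :+ # 1 :- # 1) ⇒ t :≤ B ⇒ h :≤ b :+ # 1 ⇒ B :+ (b :+ # 2) :≤ p ⇒ ⊢ :⊥) refl
          P′.total total (+ height) (bound a b) (+ b) total≤′ measure-≤ tallness ge′)
        where
        0<height : bottom ℤ.< bottom ℤ.+ + height
        0<height = ℤ.≤-<-trans (proj₁ (inside c∈)) (proj₂ (inside c∈))
        g′ : ℤ → ℤ
        g′ Y = g Y ℤ.+ indicator (ℤ.- 1ℤ) bottom Y
        gain′ : ∀ {Y} → Y ∈ rowList → P′.width Y ℤ.≤ width Y ℤ.+ g′ Y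
        gain′ {Y} Y∈ with Y ℤ.≟ bottom
        ... | no  _    = subst (λ s → P′.width Y ℤ.≤ width Y ℤ.+ s) (sym (ℤ.+-identityʳ (g Y))) (gain Y∈)
        ... | yes refl rewrite at-least-yes {bottom} {y} {R↑ bottom ⊔ x′} {R↑ bottom} (proj₁ (inside c∈))
                             | at-least-yes {bottom} {y} {L↑ bottom ⊓ x′} {L↑ bottom} (proj₁ (inside c∈))
                             | keep {L↑ bottom} {R↑ bottom} (subst (ℤ._≤ x′) (sym L↑-bottom) (ℤ.≮⇒≥ l)) (subst (x′ ℤ.≤_) (sym R↑-bottom) (ℤ.≮⇒≥ r))
                             with ℤ.<-cmp bottom y
        ...   | tri> _ _ y<b = ⊥-elim (ℤ.<⇒≱ y<b (proj₁ (inside c∈)))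
        ...   | tri< b<y b≢y _ rewrite at-least-no {y} {bottom} {R↓ bottom ⊔ x′} {R↓ bottom} b<y
                                     | at-least-no {y} {bottom} {L↓ bottom ⊓ x′} {L↓ bottom} b<y
                                     | indicator-no {1ℤ} b≢y =
          ℤ.≤-reflexive (lia 1 (λ w → ⊢ w := w :+ (# 1 :+ # 0 :+ :- # 1)) refl (width bottom))
        ...   | tri≈ _ refl _ rewrite at-least-yes {y} {y} {R↓ y ⊔ x′} {R↓ y} ℤ.≤-refl
                                    | at-least-yes {y} {y} {L↓ y ⊓ x′} {L↓ y} ℤ.≤-refl
                                    | indicator-yes {1ℤ} {y} {y} refl =
          let l , r = below c∈ ℤ.≤-refl in
          lia 3 (λ s t s′ → s′ :≤ s :+ # 1 ⇒ ⊢ s′ :+ t :+ # 2 :≤ s :+ t :+ # 2 :+ (# 1 :+ # 1 :+ :- # 1)) refl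
            (R↓ y ℤ.- L↓ y) (R↑ y ℤ.- L↑ y) ((R↓ y ⊔ x′) ℤ.- (L↓ y ⊓ x′)) (stretch l r h k)
        total≤′ : P′.total ℤ.≤ total ℤ.+ (+ height ℤ.+ 1ℤ ℤ.- 1ℤ)
        total≤′ = ℤ.≤-trans (total-grows g′ gain′) (ℤ.≤-reflexive (cong (λ s → total ℤ.+ s)
          (trans (sumOver-+ {f = g} {indicator (ℤ.- 1ℤ) bottom} rowList)
            (cong₂ ℤ._+_ sum-g (sum-indicator {ℤ.- 1ℤ} height ℤ.≤-refl 0<height)))))

  -- A vertical step to a row that is already occupied changes one width only.

  inward : x′ ≡ x → (y′ ≡ y ℤ.+ 1ℤ ⊎ y′ ≡ y ℤ.- 1ℤ) → bottom ℤ.≤ y′ × y′ ℤ.< bottom ℤ.+ + height → Tracked (d ∷ cs) a (suc b)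
  inward refl vertical in-row = inserted
    (subst (ℤ._≤ + a) (sym (keep (proj₁ (cell-range c∈)) (proj₂ (cell-range c∈)))) breadth)
    (lia 2 (λ h b → h :≤ b :+ # 1 ⇒ ⊢ h :≤ # 1 :+ b :+ # 1) refl (+ height) (+ b) tallness)
    -- The total gains at most `a`, whereas the bound rises by `a + 2`: such a step is never tight.
    (inj₁ (lia 4 (λ p t a b → p :≤ t :+ a ⇒ t :≤ # 2 :* (# 1 :+ a :+ b) :+ a :* b ⇒
        ⊢ p :< # 2 :* (# 1 :+ a :+ (# 1 :+ b)) :+ a :* (# 1 :+ b)) refl P′.total total (+ a) (+ b) total≤ measure-≤))
    where
    open Insert T d in-row
    g : ℤ → ℤ
    g Y = indicator (+ a) y′ Y
    keep-↓ : ∀ {Y} → y ℤ.≤ Y → R↓′ Y ℤ.- L↓′ Y ≡ R↓ Y ℤ.- L↓ Y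
    keep-↓ {Y} h with y′ ℤ.≤? Y
    ... | yes _ = keep (proj₁ (below c∈ h)) (proj₂ (below c∈ h))
    ... | no  _ = refl
    keep-↑ : ∀ {Y} → Y ℤ.≤ y → R↑′ Y ℤ.- L↑′ Y ≡ R↑ Y ℤ.- L↑ Y
    keep-↑ {Y} h with Y ℤ.≤? y′
    ... | yes _ = keep (proj₁ (above′ c∈ h)) (proj₂ (above′ c∈ h))
    ... | no  _ = refl
    skip-↓ : ∀ {Y} → Y ℤ.< y′ → R↓′ Y ℤ.- L↓′ Y ≡ R↓ Y ℤ.- L↓ Y
    skip-↓ h = cong₂ ℤ._-_ (at-least-no h) (at-least-no h)
    skip-↑ : ∀ {Y} → y′ ℤ.< Y → R↑′ Y ℤ.- L↑′ Y ≡ R↑ Y ℤ.- L↑ Y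
    skip-↑ h = cong₂ ℤ._-_ (at-least-no h) (at-least-no h)
    wide : ∀ {L R L′ R′} → L ℤ.≤ R → xmin ℤ.≤ L′ → R′ ℤ.≤ xmax → R′ ℤ.- L′ ℤ.≤ R ℤ.- L ℤ.+ + a
    wide {L} {R} {L′} {R′} h l r = lia 7 (λ L R L′ R′ m M a → L :≤ R ⇒ m :≤ L′ ⇒ R′ :≤ M ⇒ M :- m :≤ a ⇒ ⊢ R′ :- L′ :≤ R :- L :+ a) refl
      L R L′ R′ xmin xmax (+ a) h l r breadth
    xmax≡ : xmax′ ≡ xmax
    xmax≡ = ℤ.i≥j⇒i⊔j≡i (proj₂ (cell-range c∈))
    xmin≡ : xmin′ ≡ xmin
    xmin≡ = ℤ.i≤j⇒i⊓j≡i (proj₁ (cell-range c∈))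
    wide-↓ : ∀ Y → R↓′ Y ℤ.- L↓′ Y ℤ.≤ R↓ Y ℤ.- L↓ Y ℤ.+ + a
    wide-↓ Y = wide (L≤R↓ Y)
      (subst (ℤ._≤ L↓′ Y) xmin≡ (at-least-elim (xmin′ ℤ.≤_) {y′} {Y} (ℤ.⊓-monoˡ-≤ x (xmin≤L↓ Y)) (ℤ.≤-trans (ℤ.i⊓j≤i xmin x) (xmin≤L↓ Y))))
      (subst (R↓′ Y ℤ.≤_) xmax≡ (at-least-elim (ℤ._≤ xmax′) {y′} {Y} (ℤ.⊔-monoˡ-≤ x (R↓≤xmax Y)) (ℤ.≤-trans (R↓≤xmax Y) (ℤ.i≤i⊔j xmax x))))
    wide-↑ : ∀ Y → R↑′ Y ℤ.- L↑′ Y ℤ.≤ R↑ Y ℤ.- L↑ Y ℤ.+ + a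
    wide-↑ Y = wide (L≤R↑ Y)
      (subst (ℤ._≤ L↑′ Y) xmin≡ (at-least-elim (xmin′ ℤ.≤_) {Y} {y′} (ℤ.⊓-monoˡ-≤ x (xmin≤L↑ Y)) (ℤ.≤-trans (ℤ.i⊓j≤i xmin x) (xmin≤L↑ Y))))
      (subst (R↑′ Y ℤ.≤_) xmax≡ (at-least-elim (ℤ._≤ xmax′) {Y} {y′} (ℤ.⊔-monoˡ-≤ x (R↑≤xmax Y)) (ℤ.≤-trans (R↑≤xmax Y) (ℤ.i≤i⊔j xmax x))))
    same : ∀ {Y} → R↓′ Y ℤ.- L↓′ Y ≡ R↓ Y ℤ.- L↓ Y → R↑′ Y ℤ.- L↑′ Y ≡ R↑ Y ℤ.- L↑ Y → Y ≢ y′ → P′.width Y ℤ.≤ width Y ℤ.+ g Y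
    same {Y} e f n = ℤ.≤-reflexive (trans (cong₂ (λ s t → s ℤ.+ t ℤ.+ + 2) e f)
      (sym (trans (cong (λ s → width Y ℤ.+ s) (indicator-no {+ a} n)) (ℤ.+-identityʳ (width Y)))))
    gain : ∀ {Y} → Y ∈ rowList → P′.width Y ℤ.≤ width Y ℤ.+ g Y
    gain {Y} _ = cases (ℤ.<-cmp Y y′) vertical
      where
      cases : Tri (Y ℤ.< y′) (Y ≡ y′) (y′ ℤ.< Y) → y′ ≡ y ℤ.+ 1ℤ ⊎ y′ ≡ y ℤ.- 1ℤ → P′.width Y ℤ.≤ width Y ℤ.+ g Y
      cases (tri≈ _ Y≡ _) (inj₁ eq) = subst (λ s → P′.width Y ℤ.≤ width Y ℤ.+ s) (sym (indicator-yes {+ a} Y≡))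
        (lia 5 (λ s t s′ t′ a → s′ := s ⇒ t′ :≤ t :+ a ⇒ ⊢ s′ :+ t′ :+ # 2 :≤ s :+ t :+ # 2 :+ a) refl
          (R↓ Y ℤ.- L↓ Y) (R↑ Y ℤ.- L↑ Y) (R↓′ Y ℤ.- L↓′ Y) (R↑′ Y ℤ.- L↑′ Y) (+ a)
          (keep-↓ (lia 3 (λ y y′ Y → Y := y′ ⇒ y′ := y :+ # 1 ⇒ ⊢ y :≤ Y) refl y y′ Y Y≡ eq)) (wide-↑ Y))
      cases (tri≈ _ Y≡ _) (inj₂ eq) = subst (λ s → P′.width Y ℤ.≤ width Y ℤ.+ s) (sym (indicator-yes {+ a} Y≡))
        (lia 5 (λ s t s′ t′ a → t′ := t ⇒ s′ :≤ s :+ a ⇒ ⊢ s′ :+ t′ :+ # 2 :≤ s :+ t :+ # 2 :+ a) refl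
          (R↓ Y ℤ.- L↓ Y) (R↑ Y ℤ.- L↑ Y) (R↓′ Y ℤ.- L↓′ Y) (R↑′ Y ℤ.- L↑′ Y) (+ a)
          (keep-↑ (lia 3 (λ y y′ Y → Y := y′ ⇒ y′ := y :- # 1 ⇒ ⊢ Y :≤ y) refl y y′ Y Y≡ eq)) (wide-↓ Y))
      cases (tri< Y< n _) (inj₁ eq) = same (skip-↓ Y<) (keep-↑ (lia 3 (λ y y′ Y → Y :< y′ ⇒ y′ := y :+ # 1 ⇒ ⊢ Y :≤ y) refl y y′ Y Y< eq)) n
      cases (tri< Y< n _) (inj₂ eq) = same (skip-↓ Y<) (keep-↑ (lia 3 (λ y y′ Y → Y :< y′ ⇒ y′ := y :- # 1 ⇒ ⊢ Y :≤ y) refl y y′ Y Y< eq)) n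
      cases (tri> _ n y′<) (inj₁ eq) = same (keep-↓ (lia 3 (λ y y′ Y → y′ :< Y ⇒ y′ := y :+ # 1 ⇒ ⊢ y :≤ Y) refl y y′ Y y′< eq)) (skip-↑ y′<) n
      cases (tri> _ n y′<) (inj₂ eq) = same (keep-↓ (lia 3 (λ y y′ Y → y′ :< Y ⇒ y′ := y :- # 1 ⇒ ⊢ y :≤ Y) refl y y′ Y y′< eq)) (skip-↑ y′<) n
    total≤ : P′.total ℤ.≤ total ℤ.+ + a
    total≤ = ℤ.≤-trans (total-grows g gain) (ℤ.≤-reflexive (cong (λ s → total ℤ.+ s) (sum-indicator height (proj₁ in-row) (proj₂ in-row))))

module _ {cs a b} (T : Tracked cs a b) {x y : ℤ} (c∈ : (x , y) ∈ cs) where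

  open Tracked T

  private
    range = cell-range c∈

    measured : ∀ {t t′ d} → t′ ≡ t ℤ.+ (xmax ℤ.- xmin ℤ.+ + 2) → t ≡ total → (Tight cs a b → Tight (d ∷ cs) a (suc b)) →
      t′ ℤ.< bound a (suc b) ⊎ (t′ ≡ bound a (suc b) × Tight (d ∷ cs) a (suc b))
    measured {t} {t′} eq refl next with t′ ℤ.<? bound a (suc b)
    ... | yes lt = inj₁ lt
    ... | no  ge = inj₂
      (lia 6 (λ t t′ m M a b → t′ := t :+ (M :- m :+ # 2) ⇒ M :- m :≤ a ⇒ t :≤ # 2 :* (# 1 :+ a :+ b) :+ a :* b ⇒
          # 2 :* (# 1 :+ a :+ (# 1 :+ b)) :+ a :* (# 1 :+ b) :≤ t′ ⇒ ⊢ t′ := # 2 :* (# 1 :+ a :+ (# 1 :+ b)) :+ a :* (# 1 :+ b)) refl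
          t t′ xmin xmax (+ a) (+ b) eq breadth measure-≤ (ℤ.≮⇒≥ ge) ,
       next (measure-tight (lia 6 (λ t t′ m M a b → t′ := t :+ (M :- m :+ # 2) ⇒ M :- m :≤ a ⇒
          # 2 :* (# 1 :+ a :+ (# 1 :+ b)) :+ a :* (# 1 :+ b) :≤ t′ ⇒ ⊢ # 2 :* (# 1 :+ a :+ b) :+ a :* b :≤ t) refl
          t t′ xmin xmax (+ a) (+ b) eq breadth (ℤ.≮⇒≥ ge))))

    taller : + suc height ℤ.≤ + suc b ℤ.+ 1ℤ
    taller = lia 2 (λ h b → h :≤ b :+ # 1 ⇒ ⊢ # 1 :+ h :≤ # 1 :+ b :+ # 1) refl (+ height) (+ b) tallness

    xmin≤xmax : xmin ℤ.≤ xmax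
    xmin≤xmax = ℤ.≤-trans (proj₁ range) (proj₂ range)

  -- The new row has the full range of columns as its lower range and only `x` as its upper one. In
  -- the old rows the upper range contains `x` already, because of the cell underneath. So the total
  -- rises by exactly the breadth plus 2, which is at most `a + 2`.
  upward : y ℤ.+ 1ℤ ≡ bottom ℤ.+ + height → (Tight cs a b → Tight ((x , y ℤ.+ 1ℤ) ∷ cs) a (suc b)) →
           Tracked ((x , y ℤ.+ 1ℤ) ∷ cs) a (suc b)
  upward top next = record
    { profile = profile′ ; xmin = xmin ; xmax = xmax
    ; R↓≤xmax = λ Y → at-least-elim (ℤ._≤ xmax) {t} {Y} ℤ.≤-refl (R↓≤xmax Y)
    ; R↑≤xmax = λ Y → at-least-elim (ℤ._≤ xmax) {t} {Y} (proj₂ range) (R↑≤xmax Y)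
    ; xmin≤L↓ = λ Y → at-least-elim (xmin ℤ.≤_) {t} {Y} ℤ.≤-refl (xmin≤L↓ Y)
    ; xmin≤L↑ = λ Y → at-least-elim (xmin ℤ.≤_) {t} {Y} (proj₁ range) (xmin≤L↑ Y)
    ; R↑-bottom = trans (at-least-no bottom<t) R↑-bottom
    ; L↑-bottom = trans (at-least-no bottom<t) L↑-bottom
    ; breadth = breadth ; tallness = taller
    ; measure = measured {sumOver P′.width rowList} (trans (sumOver-snoc P′.width bottom height) (cong (λ s → sumOver P′.width rowList ℤ.+ s) top-width))
        (sumOver-cong rowList old-width) next }
    where
    t = y ℤ.+ 1ℤ
    y<t : y ℤ.< t
    y<t = lia 1 (λ y → ⊢ y :< y :+ # 1) refl y
    bottom<t : bottom ℤ.< t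
    bottom<t = ℤ.≤-<-trans (proj₁ (inside c∈)) y<t
    old : ∀ {c} → c ∈ cs → proj₂ c ℤ.< t
    old c∈ = subst (_ ℤ.<_) (sym top) (proj₂ (inside c∈))
    old≤y : ∀ {Y} → Y ℤ.< t → Y ℤ.≤ y
    old≤y {Y} = lia 2 (λ Y y → Y :< y :+ # 1 ⇒ ⊢ Y :≤ y) refl Y y
    profile′ : Profile ((x , t) ∷ cs)
    profile′ = record
      { bottom = bottom ; height = suc height
      ; R↓ = λ Y → at-least t Y xmax (R↓ Y) ; L↓ = λ Y → at-least t Y xmin (L↓ Y)
      ; R↑ = λ Y → at-least t Y x (R↑ Y) ; L↑ = λ Y → at-least t Y x (L↑ Y)
      ; inside = λ where
          (here refl) → ℤ.<⇒≤ bottom<t , lia 3 (λ b h t → t := b :+ h ⇒ ⊢ t :< b :+ (# 1 :+ h)) refl bottom (+ height) t top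
          (there {c} c∈) → proj₁ (inside c∈) , lia 3 (λ b h y → y :< b :+ h ⇒ ⊢ y :< b :+ (# 1 :+ h)) refl bottom (+ height) _ (proj₂ (inside c∈))
      ; below = λ where
          (here refl) h → subst (ℤ._≤ x) (sym (at-least-yes h)) (proj₁ range) , subst (x ℤ.≤_) (sym (at-least-yes h)) (proj₂ range)
          {_} {Y} (there c′∈) h → at-least-elim (ℤ._≤ _) {t} {Y} (proj₁ (cell-range c′∈)) (proj₁ (below c′∈ h)) ,
                               at-least-elim (_ ℤ.≤_) {t} {Y} (proj₂ (cell-range c′∈)) (proj₂ (below c′∈ h))
      ; above′ = λ
        { {_} {Y} (here refl) h → above-new Y
        ; {_} {Y} (there c′∈) h → let Y<t = ℤ.≤-<-trans h (old c′∈) in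
            subst (ℤ._≤ _) (sym (at-least-no Y<t)) (proj₁ (above′ c′∈ h)) , subst (_ ℤ.≤_) (sym (at-least-no Y<t)) (proj₂ (above′ c′∈ h)) }
      ; L≤R↓ = λ Y → at-least-elim₂ ℤ._≤_ {t} {Y} xmin≤xmax (L≤R↓ Y)
      ; L≤R↑ = λ Y → at-least-elim₂ ℤ._≤_ {t} {Y} ℤ.≤-refl (L≤R↑ Y) }
      where
      above-new : ∀ Y → at-least t Y x (L↑ Y) ℤ.≤ x × x ℤ.≤ at-least t Y x (R↑ Y)
      above-new Y with t ℤ.≤? Y
      ... | yes _  = ℤ.≤-refl , ℤ.≤-refl
      ... | no t≰Y = above′ c∈ (old≤y (ℤ.≰⇒> t≰Y))
    module P′ = Profile profile′
    top-width : P′.width (bottom ℤ.+ + height) ≡ xmax ℤ.- xmin ℤ.+ + 2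
    top-width = trans (cong P′.width (sym top)) (trans
      (cong₂ (λ p q → p ℤ.+ q ℤ.+ + 2) (cong₂ ℤ._-_ (at-least-yes {t} {t} ℤ.≤-refl) (at-least-yes {t} {t} ℤ.≤-refl)) (cong₂ ℤ._-_ (at-least-yes {t} {t} ℤ.≤-refl) (at-least-yes {t} {t} ℤ.≤-refl)))
      (lia 3 (λ m M x → ⊢ M :- m :+ (x :- x) :+ # 2 := M :- m :+ # 2) refl xmin xmax x))
    old-width : ∀ {Y} → Y ∈ rowList → P′.width Y ≡ width Y
    old-width {Y} Y∈ = cong₂ (λ p q → p ℤ.+ q ℤ.+ + 2) (cong₂ ℤ._-_ (at-least-no Y<t) (at-least-no Y<t)) (cong₂ ℤ._-_ (at-least-no Y<t) (at-least-no Y<t))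
      where
      Y<t : Y ℤ.< t
      Y<t = subst (Y ℤ.<_) (sym top) (proj₂ (∈-interval⁻ height Y∈))

  downward : y ≡ bottom → (Tight cs a b → Tight ((x , y ℤ.- 1ℤ) ∷ cs) a (suc b)) →
             Tracked ((x , y ℤ.- 1ℤ) ∷ cs) a (suc b)
  downward refl next = record
    { profile = profile′ ; xmin = xmin ; xmax = xmax
    ; R↓≤xmax = λ Y → at-least-elim (ℤ._≤ xmax) {y} {Y} (R↓≤xmax Y) (proj₂ range)
    ; R↑≤xmax = λ Y → at-least-elim (ℤ._≤ xmax) {y} {Y} (R↑≤xmax Y) ℤ.≤-refl
    ; xmin≤L↓ = λ Y → at-least-elim (xmin ℤ.≤_) {y} {Y} (xmin≤L↓ Y) (proj₁ range)
    ; xmin≤L↑ = λ Y → at-least-elim (xmin ℤ.≤_) {y} {Y} (xmin≤L↑ Y) ℤ.≤-refl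
    ; R↑-bottom = at-least-no t<y
    ; L↑-bottom = at-least-no t<y
    ; breadth = breadth ; tallness = taller
    ; measure = measured {sumOver P′.width rowList}
        (trans (cong₂ (λ u v → u ℤ.+ sumOver P′.width (interval v height)) bottom-width (lia 1 (λ y → ⊢ y :- # 1 :+ # 1 := y) refl y))
          (ℤ.+-comm (xmax ℤ.- xmin ℤ.+ + 2) (sumOver P′.width rowList)))
        (sumOver-cong rowList old-width) next }
    where
    t = y ℤ.- 1ℤ
    t<y : t ℤ.< y
    t<y = lia 1 (λ y → ⊢ y :- # 1 :< y) refl y
    profile′ : Profile ((x , t) ∷ cs)
    profile′ = record
      { bottom = t ; height = suc height
      ; R↓ = λ Y → at-least y Y (R↓ Y) x ; L↓ = λ Y → at-least y Y (L↓ Y) x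
      ; R↑ = λ Y → at-least y Y (R↑ Y) xmax ; L↑ = λ Y → at-least y Y (L↑ Y) xmin
      ; inside = λ where
          (here refl) → ℤ.≤-refl , lia 2 (λ y h → # 0 :≤ h ⇒ ⊢ y :- # 1 :< y :- # 1 :+ (# 1 :+ h)) refl y (+ height) (ℤ.+≤+ ℕ.z≤n)
          (there c∈) → ℤ.≤-trans (ℤ.<⇒≤ t<y) (proj₁ (inside c∈)) ,
            lia 3 (λ b h y → y :< b :+ h ⇒ ⊢ y :< b :- # 1 :+ (# 1 :+ h)) refl bottom (+ height) _ (proj₂ (inside c∈))
      ; below = λ
        { {_} {Y} (here refl) h → below-new Y
        ; {_} {Y} (there c′∈) h → let y≤Y = ℤ.≤-trans (proj₁ (inside c′∈)) h in
            subst (ℤ._≤ _) (sym (at-least-yes y≤Y)) (proj₁ (below c′∈ h)) , subst (_ ℤ.≤_) (sym (at-least-yes y≤Y)) (proj₂ (below c′∈ h)) }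
      ; above′ = λ where
          (here refl) h → subst (ℤ._≤ x) (sym (at-least-no (ℤ.≤-<-trans h t<y))) (proj₁ range) , subst (x ℤ.≤_) (sym (at-least-no (ℤ.≤-<-trans h t<y))) (proj₂ range)
          {_} {Y} (there c′∈) h → at-least-elim (ℤ._≤ _) {y} {Y} (proj₁ (above′ c′∈ h)) (proj₁ (cell-range c′∈)) ,
                               at-least-elim (_ ℤ.≤_) {y} {Y} (proj₂ (above′ c′∈ h)) (proj₂ (cell-range c′∈))
      ; L≤R↓ = λ Y → at-least-elim₂ ℤ._≤_ {y} {Y} (L≤R↓ Y) ℤ.≤-refl
      ; L≤R↑ = λ Y → at-least-elim₂ ℤ._≤_ {y} {Y} (L≤R↑ Y) xmin≤xmax }
      where
      below-new : ∀ Y → at-least y Y (L↓ Y) x ℤ.≤ x × x ℤ.≤ at-least y Y (R↓ Y) x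
      below-new Y with y ℤ.≤? Y
      ... | yes h = below c∈ h
      ... | no  _ = ℤ.≤-refl , ℤ.≤-refl
    module P′ = Profile profile′
    bottom-width : P′.width t ≡ xmax ℤ.- xmin ℤ.+ + 2
    bottom-width = trans
      (cong₂ (λ p q → p ℤ.+ q ℤ.+ + 2) (cong₂ ℤ._-_ (at-least-no t<y) (at-least-no t<y)) (cong₂ ℤ._-_ (at-least-no t<y) (at-least-no t<y)))
      (lia 3 (λ m M x → ⊢ x :- x :+ (M :- m) :+ # 2 := M :- m :+ # 2) refl xmin xmax x)
    old-width : ∀ {Y} → Y ∈ rowList → P′.width Y ≡ width Y
    old-width {Y} Y∈ = cong₂ (λ p q → p ℤ.+ q ℤ.+ + 2) (cong₂ ℤ._-_ (at-least-yes y≤Y) (at-least-yes y≤Y)) (cong₂ ℤ._-_ (at-least-yes y≤Y) (at-least-yes y≤Y))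
      where
      y≤Y : y ℤ.≤ Y
      y≤Y = proj₁ (∈-interval⁻ height Y∈)

tracked : ∀ {cs a b} → Grown cs a b → Tracked cs a b
tracked (seed c) = seeded c
tracked (grow right {c = x , y} g c∈) = sideways T c∈
  (lia 1 (λ x → ⊢ x :- # 1 :≤ x :+ # 1) refl x) ℤ.≤-refl refl λ where
    (inj₁ h) t → grow right t (c∈ , λ {e} e∈ → lia 3 (λ e M x → e :≤ M ⇒ M :< x :+ # 1 ⇒ ⊢ e :≤ x) refl (proj₁ e) (Tracked.xmax T) x (proj₂ (Tracked.cell-range T e∈)) h)
    (inj₂ h) t → ⊥-elim (lia 2 (λ m x → m :≤ x ⇒ x :+ # 1 :< m ⇒ ⊢ :⊥) refl (Tracked.xmin T) x (proj₁ (Tracked.cell-range T c∈)) h)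
  where T = tracked g
tracked (grow left {c = x , y} g c∈) = sideways T c∈
  ℤ.≤-refl (lia 1 (λ x → ⊢ x :- # 1 :≤ x :+ # 1) refl x) refl λ where
    (inj₂ h) t → grow left t (c∈ , λ {e} e∈ → lia 3 (λ e m x → m :≤ e ⇒ x :- # 1 :< m ⇒ ⊢ :- e :≤ :- x) refl (proj₁ e) (Tracked.xmin T) x (proj₁ (Tracked.cell-range T e∈)) h)
    (inj₁ h) t → ⊥-elim (lia 2 (λ M x → x :≤ M ⇒ M :< x :- # 1 ⇒ ⊢ :⊥) refl (Tracked.xmax T) x (proj₂ (Tracked.cell-range T c∈)) h)
  where T = tracked g
tracked (grow up {c = x , y} g c∈) with y ℤ.+ 1ℤ ℤ.<? Tracked.bottom (tracked g) ℤ.+ + Tracked.height (tracked g)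
... | yes h = inward T c∈ refl (inj₁ refl)
  (ℤ.≤-trans (proj₁ (Tracked.inside T c∈)) (lia 1 (λ y → ⊢ y :≤ y :+ # 1) refl y) , h)
  where T = tracked g
... | no  h = upward T c∈ top λ t → grow up t (c∈ , λ {e} e∈ →
    lia 3 (λ e y t → e :< t ⇒ y :+ # 1 := t ⇒ ⊢ e :≤ y) refl (proj₂ e) y _ (proj₂ (Tracked.inside T e∈)) top)
  where
  T = tracked g
  top = ℤ.≤-antisym (lia 2 (λ y t → y :< t ⇒ ⊢ y :+ # 1 :≤ t) refl y _ (proj₂ (Tracked.inside T c∈))) (ℤ.≮⇒≥ h)
tracked (grow down {c = x , y} g c∈) with y ℤ.≟ Tracked.bottom (tracked g)
... | yes eq = downward T c∈ eq λ t → grow down t (c∈ , λ {e} e∈ →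
    ℤ.neg-mono-≤ (subst (ℤ._≤ proj₂ e) (sym eq) (proj₁ (Tracked.inside T e∈))))
  where T = tracked g
... | no  ≢b = inward T c∈ refl (inj₂ refl)
  (lia 2 (λ b y → b :< y ⇒ ⊢ b :≤ y :- # 1) refl _ y (ℤ.≤∧≢⇒< (proj₁ (Tracked.inside T c∈)) (λ eq → ≢b (sym eq))) ,
   lia 2 (λ y t → y :< t ⇒ ⊢ y :- # 1 :< t) refl y _ (proj₂ (Tracked.inside T c∈)))
  where T = tracked g

-- Classification of the shapes by induction on the cells.

-- A row of cells in the columns from l to r at height h, with a leg down to height b
-- in column i and a leg up to height t in column j.

record Zed : Set where
  constructor zed
  field
    l r h b t i j : ℤ

record Valid (z : Zed) : Set where
  constructor valid
  open Zed z
  field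
    l≤i : l ℤ.≤ i
    i≤r : i ℤ.≤ r
    l≤j : l ℤ.≤ j
    j≤r : j ℤ.≤ r
    b≤h : b ℤ.≤ h
    h≤t : h ℤ.≤ t

InZed : Zed → Cell → Set
InZed (zed l r h b t i j) (x , y) =
  (y ≡ h × l ℤ.≤ x × x ℤ.≤ r) ⊎ (x ≡ i × b ℤ.≤ y × y ℤ.≤ h) ⊎ (x ≡ j × h ℤ.≤ y × y ℤ.≤ t)

pattern row y≡ l≤ ≤r = inj₁ (y≡ , l≤ , ≤r)
pattern lower x≡ b≤ ≤h = inj₂ (inj₁ (x≡ , b≤ , ≤h))
pattern upper x≡ h≤ ≤t = inj₂ (inj₂ (x≡ , h≤ , ≤t))

record IsZed (S : Cell → Set) (m n : ℤ) : Set where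
  constructor isZed
  field
    z      : Zed
    ok     : Valid z
    width≡ : Zed.r z ℤ.- Zed.l z ≡ m
    tall≡  : Zed.t z ℤ.- Zed.b z ≡ n
    to     : ∀ {c} → S c → InZed z c
    from   : ∀ {c} → InZed z c → S c

-- A new cell can turn a full column into the row and the old row into a leg. The induction is
-- therefore up to transposition, which exchanges the two dimensions.
IsZed± : (Cell → Set) → ℤ → ℤ → Set
IsZed± S m n = IsZed S m n ⊎ IsZed (λ c → S (swap c)) n m

flipX flipY : Cell → Cell
flipX (x , y) = ℤ.- x , y
flipY (x , y) = x , ℤ.- y

private
  flipX-zed flipY-zed : Zed → Zed
  flipX-zed (zed l r h b t i j) = zed (ℤ.- r) (ℤ.- l) h b t (ℤ.- i) (ℤ.- j)
  flipY-zed (zed l r h b t i j) = zed l r (ℤ.- h) (ℤ.- t) (ℤ.- b) j i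

  neg-≤ : ∀ x y → x ℤ.≤ ℤ.- y → y ℤ.≤ ℤ.- x
  neg-≤ = λ x y → lia 2 (λ x y → x :≤ :- y ⇒ ⊢ y :≤ :- x) refl x y

  neg-≤′ : ∀ x y → ℤ.- x ℤ.≤ y → ℤ.- y ℤ.≤ x
  neg-≤′ = λ x y → lia 2 (λ x y → :- x :≤ y ⇒ ⊢ :- y :≤ x) refl x y

  neg-≡ : ∀ x y → ℤ.- x ≡ y → x ≡ ℤ.- y
  neg-≡ = λ x y → lia 2 (λ x y → :- x := y ⇒ ⊢ x := :- y) refl x y

  neg-≡′ : ∀ x y → x ≡ ℤ.- y → ℤ.- x ≡ y
  neg-≡′ = λ x y → lia 2 (λ x y → x := :- y ⇒ ⊢ :- x := y) refl x y

  flipX-to : ∀ z c → InZed z (flipX c) → InZed (flipX-zed z) c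
  flipX-to z (x , y) (row e p q)   = row e (neg-≤′ x _ q) (neg-≤ _ x p)
  flipX-to z (x , y) (lower e p q) = lower (neg-≡ x _ e) p q
  flipX-to z (x , y) (upper e p q) = upper (neg-≡ x _ e) p q

  flipX-from : ∀ z c → InZed (flipX-zed z) c → InZed z (flipX c)
  flipX-from z (x , y) (row e p q)   = row e (neg-≤ x _ q) (neg-≤′ _ x p)
  flipX-from z (x , y) (lower e p q) = lower (neg-≡′ x _ e) p q
  flipX-from z (x , y) (upper e p q) = upper (neg-≡′ x _ e) p q

  flipY-to : ∀ z c → InZed z (flipY c) → InZed (flipY-zed z) c
  flipY-to z (x , y) (row e p q)   = row (neg-≡ y _ e) p q
  flipY-to z (x , y) (lower e p q) = upper e (neg-≤′ y _ q) (neg-≤ _ y p)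
  flipY-to z (x , y) (upper e p q) = lower e (neg-≤′ y _ q) (neg-≤ _ y p)

  flipY-from : ∀ z c → InZed (flipY-zed z) c → InZed z (flipY c)
  flipY-from z (x , y) (row e p q)   = row (neg-≡′ y _ e) p q
  flipY-from z (x , y) (lower e p q) = upper e (neg-≤ y _ q) (neg-≤′ _ y p)
  flipY-from z (x , y) (upper e p q) = lower e (neg-≤ y _ q) (neg-≤′ _ y p)

  neg-difference : ∀ l r {m} → r ℤ.- l ≡ m → ℤ.- l ℤ.- (ℤ.- r) ≡ m
  neg-difference l r = trans (lia 2 (λ l r → ⊢ :- l :- :- r := r :- l) refl l r)

isZed-flipX : ∀ {S m n} → IsZed S m n → IsZed (λ c → S (flipX c)) m n
isZed-flipX (isZed z@(zed l r h b t i j) (valid a c d e f g) w tl to from) = isZed (flipX-zed z)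
  (valid (ℤ.neg-mono-≤ c) (ℤ.neg-mono-≤ a) (ℤ.neg-mono-≤ e) (ℤ.neg-mono-≤ d) f g)
  (neg-difference l r w) tl (λ {p} s → flipX-to z p (to s)) (λ {p} s → from (flipX-from z p s))

isZed-flipY : ∀ {S m n} → IsZed S m n → IsZed (λ c → S (flipY c)) m n
isZed-flipY (isZed z@(zed l r h b t i j) (valid a c d e f g) w tl to from) = isZed (flipY-zed z)
  (valid d e a c (ℤ.neg-mono-≤ g) (ℤ.neg-mono-≤ f))
  w (neg-difference b t tl) (λ {p} s → flipY-to z p (to s)) (λ {p} s → from (flipY-from z p s))

isZed±-flipX : ∀ {S m n} → IsZed± S m n → IsZed± (λ c → S (flipX c)) m n
isZed±-flipX (inj₁ s) = inj₁ (isZed-flipX s)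
isZed±-flipX (inj₂ s) = inj₂ (isZed-flipY s)

isZed±-flipY : ∀ {S m n} → IsZed± S m n → IsZed± (λ c → S (flipY c)) m n
isZed±-flipY (inj₁ s) = inj₁ (isZed-flipY s)
isZed±-flipY (inj₂ s) = inj₂ (isZed-flipX s)

isZed-resp : ∀ {S T : Cell → Set} {m n} → (∀ {c} → S c → T c) → (∀ {c} → T c → S c) → IsZed S m n → IsZed T m n
isZed-resp f g (isZed z v w tl to from) = isZed z v w tl (λ t → to (g t)) (λ s → f (from s))

isZed±-resp : ∀ {S T : Cell → Set} {m n} → (∀ {c} → S c → T c) → (∀ {c} → T c → S c) → IsZed± S m n → IsZed± T m n
isZed±-resp f g (inj₁ s) = inj₁ (isZed-resp f g s)
isZed±-resp f g (inj₂ s) = inj₂ (isZed-resp f g s)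

infixl 5 _⊕_

_⊕_ : (Cell → Set) → Cell → Cell → Set
(S ⊕ d) c = c ≡ d ⊎ S c

private
  suc-difference : ∀ {l r m} → r ℤ.- l ≡ m → r ℤ.+ 1ℤ ℤ.- l ≡ 1ℤ ℤ.+ m
  suc-difference {l} {r} {m} = lia 3 (λ l r m → r :- l := m ⇒ ⊢ r :+ # 1 :- l := # 1 :+ m) refl l r m

  ≤-suc : ∀ {x y} → x ℤ.≤ y → x ℤ.≤ y ℤ.+ 1ℤ
  ≤-suc {x} {y} = lia 2 (λ x y → x :≤ y ⇒ ⊢ x :≤ y :+ # 1) refl x y

  ≤-suc⁻ : ∀ {x y} → x ℤ.≤ y ℤ.+ 1ℤ → x ≢ y ℤ.+ 1ℤ → x ℤ.≤ y
  ≤-suc⁻ {x} {y} h n = lia 2 (λ x y → x :< y :+ # 1 ⇒ ⊢ x :≤ y) refl x y (ℤ.≤∧≢⇒< h n)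

  ⊥-< : ∀ {A : Set} {x y} → x ℤ.≤ y → y ℤ.< x → A
  ⊥-< h k = ⊥-elim (ℤ.<⇒≱ k h)

-- If there is an upper leg, its tip is the only topmost cell and the leg gets longer. If there is
-- none, all of the row is topmost and a leg may start anywhere: `x` replaces the meaningless column
-- `j`.
extend-up : ∀ {S m n c} → IsZed S m n → Extreme up S c → IsZed (S ⊕ step up c) m (1ℤ ℤ.+ n)
extend-up {S} {m} {n} {x , y} (isZed z@(zed l r h b t i j) (valid l≤i i≤r l≤j j≤r b≤h h≤t) w tl to from) (c∈ , max)
  with h ℤ.≟ t
... | no  h≢t = isZed (zed l r h b (t ℤ.+ 1ℤ) i j) (valid l≤i i≤r l≤j j≤r b≤h (≤-suc h≤t)) w (suc-difference {b} {t} tl) to′ from′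
  where
  h<t : h ℤ.< t
  h<t = ℤ.≤∧≢⇒< h≤t h≢t
  t≤y : t ℤ.≤ y
  t≤y = max (from (upper refl h≤t ℤ.≤-refl))
  c≡ : x ≡ j × y ≡ t
  c≡ with to c∈
  ... | row refl _ _   = ⊥-< t≤y h<t
  ... | lower _ _ y≤h  = ⊥-< (ℤ.≤-trans t≤y y≤h) h<t
  ... | upper e _ y≤t  = e , ℤ.≤-antisym y≤t t≤y
  to′ : ∀ {c} → (S ⊕ (x , y ℤ.+ 1ℤ)) c → InZed (zed l r h b (t ℤ.+ 1ℤ) i j) c
  to′ (inj₁ refl) = upper (proj₁ c≡) (≤-suc (ℤ.≤-trans h≤t t≤y)) (ℤ.≤-reflexive (cong (ℤ._+ 1ℤ) (proj₂ c≡)))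
  to′ (inj₂ s) with to s
  ... | row e p q   = row e p q
  ... | lower e p q = lower e p q
  ... | upper e p q = upper e p (≤-suc q)
  from′ : ∀ {c} → InZed (zed l r h b (t ℤ.+ 1ℤ) i j) c → (S ⊕ (x , y ℤ.+ 1ℤ)) c
  from′ (row e p q)   = inj₂ (from (row e p q))
  from′ (lower e p q) = inj₂ (from (lower e p q))
  from′ {x′ , y′} (upper e p q) with y′ ℤ.≟ t ℤ.+ 1ℤ
  ... | yes e′ = inj₁ (cong₂ _,_ (trans e (sym (proj₁ c≡))) (trans e′ (cong (ℤ._+ 1ℤ) (sym (proj₂ c≡)))))
  ... | no  n  = inj₂ (from (upper e p (≤-suc⁻ q n)))
... | yes refl = isZed (zed l r h b (h ℤ.+ 1ℤ) i x) (valid l≤i i≤r (proj₁ x-range) (proj₂ x-range) b≤h (≤-suc ℤ.≤-refl)) w (suc-difference {b} {h} tl) to′ from′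
  where
  y≡h : y ≡ h
  y≡h with to c∈
  ... | row e _ _     = e
  ... | lower _ _ y≤h = ℤ.≤-antisym y≤h (max (from (row refl l≤i i≤r)))
  ... | upper _ h≤y q = ℤ.≤-antisym q h≤y
  x-range : l ℤ.≤ x × x ℤ.≤ r
  x-range with to c∈
  ... | row _ p q        = p , q
  ... | lower refl _ _   = l≤i , i≤r
  ... | upper refl _ _   = l≤j , j≤r
  to′ : ∀ {c} → (S ⊕ (x , y ℤ.+ 1ℤ)) c → InZed (zed l r h b (h ℤ.+ 1ℤ) i x) c
  to′ (inj₁ refl) = upper refl (≤-suc (ℤ.≤-reflexive (sym y≡h))) (ℤ.≤-reflexive (cong (ℤ._+ 1ℤ) y≡h))
  to′ (inj₂ s) with to s
  ... | row e p q       = row e p q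
  ... | lower e p q     = lower e p q
  ... | upper refl p q  = row (ℤ.≤-antisym q p) l≤j j≤r
  from′ : ∀ {c} → InZed (zed l r h b (h ℤ.+ 1ℤ) i x) c → (S ⊕ (x , y ℤ.+ 1ℤ)) c
  from′ (row e p q)   = inj₂ (from (row e p q))
  from′ (lower e p q) = inj₂ (from (lower e p q))
  from′ {x′ , y′} (upper refl p q) with y′ ℤ.≟ h ℤ.+ 1ℤ
  ... | yes e′ = inj₁ (cong (x′ ,_) (trans e′ (cong (ℤ._+ 1ℤ) (sym y≡h))))
  ... | no  n  = inj₂ (from (row (ℤ.≤-antisym (≤-suc⁻ q n) p) (proj₁ x-range) (proj₂ x-range)))

-- At the height of the row the row gets longer. Otherwise `c` is on a leg in the last column, and
-- the corner cuts force the other leg to be in that column or absent. The last column is then the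
-- row of a transposed shape, with the old row and the new cell as its legs.
extend-right : ∀ {S m n c} → IsZed S m n → Extreme right S c →
  CornerCut right up (S ⊕ step right c) → CornerCut right down (S ⊕ step right c) →
  IsZed± (S ⊕ step right c) (1ℤ ℤ.+ m) n
extend-right {S} {m} {n} {x , y} (isZed z@(zed l r h b t i j) (valid l≤i i≤r l≤j j≤r b≤h h≤t) w tl to from) (c∈ , max) cut-up cut-down =
  cases (ℤ.<-cmp y h)
  where
  l≤r : l ℤ.≤ r
  l≤r = ℤ.≤-trans l≤i i≤r
  r≤x : r ℤ.≤ x
  r≤x = max (from (row refl l≤r ℤ.≤-refl))
  in-box : ∀ {x y} → S (x , y) → x ℤ.≤ r × b ℤ.≤ y × y ℤ.≤ t
  in-box s with to s
  ... | row refl _ q    = q , b≤h , h≤t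
  ... | lower refl p q  = i≤r , p , ℤ.≤-trans q h≤t
  ... | upper refl p q  = j≤r , ℤ.≤-trans b≤h p , q
  x≡r : x ≡ r
  x≡r = ℤ.≤-antisym (proj₁ (in-box c∈)) r≤x
  x<x+1 : ∀ {x} → x ℤ.< x ℤ.+ 1ℤ
  x<x+1 {x} = lia 1 (λ x → ⊢ x :< x :+ # 1) refl x
  old : ∀ {d} → Extreme right (S ⊕ (x ℤ.+ 1ℤ , y)) d → proj₂ d ≡ y
  old (inj₁ refl , _) = refl
  old (inj₂ s , max′) = ⊥-< (max′ (inj₁ refl)) (ℤ.≤-<-trans (max s) x<x+1)
  wide : y ≡ h → IsZed (S ⊕ (x ℤ.+ 1ℤ , y)) (1ℤ ℤ.+ m) n
  wide refl = isZed (zed l (r ℤ.+ 1ℤ) h b t i j) (valid l≤i (≤-suc i≤r) l≤j (≤-suc j≤r) b≤h h≤t) (suc-difference {l} {r} w) tl to′ from′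
    where
    to′ : ∀ {c} → (S ⊕ (x ℤ.+ 1ℤ , h)) c → InZed (zed l (r ℤ.+ 1ℤ) h b t i j) c
    to′ (inj₁ refl) = row refl (≤-suc (ℤ.≤-trans l≤r r≤x)) (ℤ.≤-reflexive (cong (ℤ._+ 1ℤ) x≡r))
    to′ (inj₂ s) with to s
    ... | row e p q   = row e p (≤-suc q)
    ... | lower e p q = lower e p q
    ... | upper e p q = upper e p q
    from′ : ∀ {c} → InZed (zed l (r ℤ.+ 1ℤ) h b t i j) c → (S ⊕ (x ℤ.+ 1ℤ , h)) c
    from′ (lower e p q) = inj₂ (from (lower e p q))
    from′ (upper e p q) = inj₂ (from (upper e p q))
    from′ {x′ , _} (row refl p q) with x′ ℤ.≟ r ℤ.+ 1ℤ
    ... | yes e = inj₁ (cong (_, h) (trans e (cong (ℤ._+ 1ℤ) (sym x≡r))))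
    ... | no  k = inj₂ (from (row refl p (≤-suc⁻ q k)))

  -- If the new cell is not at the end of the row, the column of its neighbour is full.
  full : (∀ {y′} → b ℤ.≤ y′ → y′ ℤ.≤ t → S (r , y′)) → i ≡ r ⊎ b ≡ h → j ≡ r ⊎ t ≡ h →
         IsZed (λ c → (S ⊕ (x ℤ.+ 1ℤ , y)) (swap c)) n (1ℤ ℤ.+ m)
  full column i≡ j≡ = isZed (zed b t r l (r ℤ.+ 1ℤ) h y)
    (valid b≤h h≤t (proj₁ (proj₂ (in-box c∈))) (proj₂ (proj₂ (in-box c∈))) l≤r (≤-suc ℤ.≤-refl)) tl (suc-difference {l} {r} w) to′ from′
    where
    to′ : ∀ {c} → (S ⊕ (x ℤ.+ 1ℤ , y)) (swap c) → InZed (zed b t r l (r ℤ.+ 1ℤ) h y) c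
    to′ (inj₁ refl) = upper refl (≤-suc r≤x) (ℤ.≤-reflexive (cong (ℤ._+ 1ℤ) x≡r))
    to′ (inj₂ s) = place (to s) i≡ j≡
      where
      place : ∀ {c} → InZed z (swap c) → i ≡ r ⊎ b ≡ h → j ≡ r ⊎ t ≡ h → InZed (zed b t r l (r ℤ.+ 1ℤ) h y) c
      place (row e p q)      _           _           = lower e p q
      place (lower refl p q) (inj₁ refl) _           = row refl p (ℤ.≤-trans q h≤t)
      place (lower refl p q) (inj₂ refl) _           = lower (ℤ.≤-antisym q p) l≤i i≤r
      place (upper refl p q) _           (inj₁ refl) = row refl (ℤ.≤-trans b≤h p) q
      place (upper refl p q) _           (inj₂ refl) = lower (ℤ.≤-antisym q p) l≤j j≤r
    from′ : ∀ {c} → InZed (zed b t r l (r ℤ.+ 1ℤ) h y) c → (S ⊕ (x ℤ.+ 1ℤ , y)) (swap c)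
    from′ (row refl p q)   = inj₂ (column p q)
    from′ (lower refl p q) = inj₂ (from (row refl p q))
    from′ {_ , x′} (upper refl p q) with x′ ℤ.≟ r ℤ.+ 1ℤ
    ... | yes e = inj₁ (cong (_, y) (trans e (cong (ℤ._+ 1ℤ) (sym x≡r))))
    ... | no  k = inj₂ (subst (λ x → S (x , y)) (trans x≡r (ℤ.≤-antisym p (≤-suc⁻ q k))) c∈)

  cases : Tri (y ℤ.< h) (y ≡ h) (h ℤ.< y) → IsZed± (S ⊕ (x ℤ.+ 1ℤ , y)) (1ℤ ℤ.+ m) n
  cases (tri≈ _ y≡h _) = inj₁ (wide y≡h)
  cases (tri< y<h _ _) = inj₂ (full column (inj₁ i≡r) top)
    where
    i≡r : i ≡ r
    i≡r with to c∈
    ... | row refl _ _  = ⊥-elim (ℤ.<-irrefl refl y<h)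
    ... | lower e _ _   = trans (sym e) x≡r
    ... | upper _ p _   = ⊥-< p y<h
    top : j ≡ r ⊎ t ≡ h
    -- The cut is applied to the end of the row. The only rightmost cell is the new one, which is
    -- too low, so a topmost cell must reach column `r`.
    top with cut-up {r , h} (inj₂ (from (row refl l≤r ℤ.≤-refl)))
    ... | inj₂ (d , e , h≤) = ⊥-< (subst (h ℤ.≤_) (old e) h≤) y<h
    ... | inj₁ (_ , (inj₁ refl , top) , _) = ⊥-< (top (inj₂ (from (row refl l≤r ℤ.≤-refl)))) y<h
    ... | inj₁ ((x′ , y′) , (inj₂ s , top) , r≤) with to s | top (inj₂ (from (upper refl h≤t ℤ.≤-refl)))
    ...   | row refl _ _   | t≤h = inj₂ (ℤ.≤-antisym t≤h h≤t)
    ...   | lower _ _ ≤h   | t≤  = inj₂ (ℤ.≤-antisym (ℤ.≤-trans t≤ ≤h) h≤t)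
    ...   | upper refl _ _ | _   = inj₁ (ℤ.≤-antisym j≤r r≤)
    column : ∀ {y′} → b ℤ.≤ y′ → y′ ℤ.≤ t → S (r , y′)
    column {y′} p q with ℤ.≤-total y′ h
    ... | inj₁ ≤h = from (lower (sym i≡r) p ≤h)
    ... | inj₂ h≤ with top
    ...   | inj₁ refl = from (upper refl h≤ q)
    ...   | inj₂ refl = from (row (ℤ.≤-antisym q h≤) l≤r ℤ.≤-refl)
  cases (tri> _ _ h<y) = inj₂ (full column bot (inj₁ j≡r))
    where
    j≡r : j ≡ r
    j≡r with to c∈
    ... | row refl _ _  = ⊥-elim (ℤ.<-irrefl refl h<y)
    ... | lower _ _ q   = ⊥-< q h<y
    ... | upper e _ _   = trans (sym e) x≡r
    bot : i ≡ r ⊎ b ≡ h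
    bot with cut-down {r , h} (inj₂ (from (row refl l≤r ℤ.≤-refl)))
    ... | inj₂ (d , e , h≤) = ⊥-< (subst (ℤ._≤ h) (old e) (ℤ.neg-cancel-≤ h≤)) h<y
    ... | inj₁ (_ , (inj₁ refl , top) , _) = ⊥-< (ℤ.neg-cancel-≤ (top (inj₂ (from (row refl l≤r ℤ.≤-refl))))) h<y
    ... | inj₁ ((x′ , y′) , (inj₂ s , top) , r≤) with to s | ℤ.neg-cancel-≤ (top (inj₂ (from (lower refl ℤ.≤-refl b≤h))))
    ...   | row refl _ _   | h≤b = inj₂ (ℤ.≤-antisym b≤h h≤b)
    ...   | upper _ h≤ _   | ≤b  = inj₂ (ℤ.≤-antisym b≤h (ℤ.≤-trans h≤ ≤b))
    ...   | lower refl _ _ | _   = inj₁ (ℤ.≤-antisym i≤r r≤)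
    column : ∀ {y′} → b ℤ.≤ y′ → y′ ℤ.≤ t → S (r , y′)
    column {y′} p q with ℤ.≤-total h y′
    ... | inj₁ h≤ = from (upper (sym j≡r) h≤ q)
    ... | inj₂ ≤h with bot
    ...   | inj₁ refl = from (lower refl p ≤h)
    ...   | inj₂ refl = from (row (ℤ.≤-antisym ≤h p) l≤r ℤ.≤-refl)

-- Corner cuts pass to the polyomino before a tight step.

opposite : Direction → Direction
opposite right = left
opposite left  = right
opposite up    = down
opposite down  = up

data Perpendicular : Direction → Direction → Set where
  right-up   : Perpendicular right up
  right-down : Perpendicular right down
  left-up    : Perpendicular left up
  left-down  : Perpendicular left down
  up-right   : Perpendicular up right
  up-left    : Perpendicular up left
  down-right : Perpendicular down right
  down-left  : Perpendicular down left

Cuts : (Cell → Set) → Set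
Cuts S = ∀ {δ ε} → Perpendicular δ ε → CornerCut δ ε S

cut-sym : ∀ {δ ε S} → CornerCut δ ε S → CornerCut ε δ S
cut-sym cut s = Sum.swap (cut s)

private
  step-forward : ∀ δ c → coordinate δ (step δ c) ≡ coordinate δ c ℤ.+ 1ℤ
  step-forward right (x , y) = refl
  step-forward left  (x , y) = lia 1 (λ x → ⊢ :- (x :- # 1) := :- x :+ # 1) refl x
  step-forward up    (x , y) = refl
  step-forward down  (x , y) = lia 1 (λ x → ⊢ :- (x :- # 1) := :- x :+ # 1) refl y

  step-backward : ∀ δ c → coordinate (opposite δ) (step δ c) ≡ coordinate (opposite δ) c ℤ.- 1ℤ
  step-backward right (x , y) = lia 1 (λ x → ⊢ :- (x :+ # 1) := :- x :- # 1) refl x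
  step-backward left  (x , y) = refl
  step-backward up    (x , y) = lia 1 (λ x → ⊢ :- (x :+ # 1) := :- x :- # 1) refl y
  step-backward down  (x , y) = refl

  step-aside : ∀ {δ ε} → Perpendicular δ ε → ∀ c → coordinate ε (step δ c) ≡ coordinate ε c
  step-aside right-up   _ = refl
  step-aside right-down _ = refl
  step-aside left-up    _ = refl
  step-aside left-down  _ = refl
  step-aside up-right   _ = refl
  step-aside up-left    _ = refl
  step-aside down-right _ = refl
  step-aside down-left  _ = refl

module _ {S : Cell → Set} {δ c} (top : Extreme δ S c) where

  private
    restrict : ∀ ε {d} → Extreme ε (S ⊕ step δ c) d → S d → Extreme ε S d
    restrict ε (_ , max) s = s , λ e → max (inj₂ e)

    unstep : ∀ {ε} → Perpendicular δ ε → Extreme ε (S ⊕ step δ c) (step δ c) → Extreme ε S c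
    unstep {ε} p (_ , max) = proj₁ top , λ {e} s → subst (coordinate ε e ℤ.≤_) (step-aside p c) (max (inj₂ s))

    beyond : ∀ {d} → S d → coordinate δ d ℤ.< coordinate δ (step δ c)
    beyond {d} s = subst (coordinate δ d ℤ.<_) (sym (step-forward δ c))
      (lia 2 (λ a b → a :≤ b ⇒ ⊢ a :< b :+ # 1) refl (coordinate δ d) (coordinate δ c) (proj₂ top s))

  -- If the removed cell was the witness, the cell `c` before it takes over: it has the same
  -- `ε`-coordinate and is furthest towards `δ` among the old cells. No old cell was furthest
  -- towards `δ` while the new one was present.
  cut-forward : ∀ {ε} → Perpendicular δ ε → CornerCut δ ε (S ⊕ step δ c) → CornerCut δ ε S
  cut-forward {ε} p cut s with cut (inj₂ s)
  ... | inj₁ (d , ex@(inj₁ refl , _) , h) = inj₁ (c , unstep p ex , proj₂ top s)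
  ... | inj₁ (d , ex@(inj₂ s′ , _) , h)   = inj₁ (d , restrict ε ex s′ , h)
  ... | inj₂ (d , (inj₁ refl , _) , h)    = inj₂ (c , top , subst (_ ℤ.≤_) (step-aside p c) h)
  ... | inj₂ (d , (inj₂ s′ , max) , h)    = ⊥-< (max (inj₁ refl)) (beyond s′)

  -- The new cell is never furthest in the direction opposite to `δ`, so it can be a witness only by
  -- being furthest towards `ε`; then `c` has the same `ε`-coordinate and reaches one unit further
  -- back.
  cut-backward : ∀ {ε} → Perpendicular δ ε → CornerCut (opposite δ) ε (S ⊕ step δ c) → CornerCut (opposite δ) ε S
  cut-backward {ε} p cut {e} s with cut (inj₂ s)
  ... | inj₁ (d , ex@(inj₁ refl , _) , h) = inj₁ (c , unstep p ex ,
    lia 2 (λ a b → a :≤ b :- # 1 ⇒ ⊢ a :≤ b) refl (coordinate (opposite δ) e) (coordinate (opposite δ) c) (subst (_ ℤ.≤_) (step-backward δ c) h))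
  ... | inj₁ (d , ex@(inj₂ s′ , _) , h)   = inj₁ (d , restrict ε ex s′ , h)
  ... | inj₂ (d , (inj₁ refl , max) , h)  = ⊥-elim (lia 2 (λ a b → a :≤ b ⇒ b := a :- # 1 ⇒ ⊢ :⊥) refl
    (coordinate (opposite δ) c) (coordinate (opposite δ) (step δ c)) (max (inj₂ (proj₁ top))) (step-backward δ c))
  ... | inj₂ (d , ex@(inj₂ s′ , _) , h)   = inj₂ (d , restrict (opposite δ) ex s′ , h)

cuts-before : ∀ {S δ c} → Extreme δ S c → Cuts (S ⊕ step δ c) → Cuts S
cuts-before {S} {δ} {c} top cuts = go δ top cuts
  where
  go : ∀ δ {c} → Extreme δ S c → Cuts (S ⊕ step δ c) → Cuts S
  go right top cuts right-up   = cut-forward top right-up (cuts right-up)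
  go right top cuts right-down = cut-forward top right-down (cuts right-down)
  go right top cuts left-up    = cut-backward top right-up (cuts left-up)
  go right top cuts left-down  = cut-backward top right-down (cuts left-down)
  go right top cuts up-right   = cut-sym {right} {up} (cut-forward top right-up (cuts right-up))
  go right top cuts down-right = cut-sym {right} {down} (cut-forward top right-down (cuts right-down))
  go right top cuts up-left    = cut-sym {left} {up} (cut-backward top right-up (cuts left-up))
  go right top cuts down-left  = cut-sym {left} {down} (cut-backward top right-down (cuts left-down))
  go left  top cuts left-up    = cut-forward top left-up (cuts left-up)
  go left  top cuts left-down  = cut-forward top left-down (cuts left-down)
  go left  top cuts right-up   = cut-backward top left-up (cuts right-up)
  go left  top cuts right-down = cut-backward top left-down (cuts right-down)
  go left  top cuts up-left    = cut-sym {left} {up} (cut-forward top left-up (cuts left-up))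
  go left  top cuts down-left  = cut-sym {left} {down} (cut-forward top left-down (cuts left-down))
  go left  top cuts up-right   = cut-sym {right} {up} (cut-backward top left-up (cuts right-up))
  go left  top cuts down-right = cut-sym {right} {down} (cut-backward top left-down (cuts right-down))
  go up    top cuts up-right   = cut-forward top up-right (cuts up-right)
  go up    top cuts up-left    = cut-forward top up-left (cuts up-left)
  go up    top cuts down-right = cut-backward top up-right (cuts down-right)
  go up    top cuts down-left  = cut-backward top up-left (cuts down-left)
  go up    top cuts right-up   = cut-sym {up} {right} (cut-forward top up-right (cuts up-right))
  go up    top cuts left-up    = cut-sym {up} {left} (cut-forward top up-left (cuts up-left))
  go up    top cuts right-down = cut-sym {down} {right} (cut-backward top up-right (cuts down-right))
  go up    top cuts left-down  = cut-sym {down} {left} (cut-backward top up-left (cuts down-left))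
  go down  top cuts down-right = cut-forward top down-right (cuts down-right)
  go down  top cuts down-left  = cut-forward top down-left (cuts down-left)
  go down  top cuts up-right   = cut-backward top down-right (cuts up-right)
  go down  top cuts up-left    = cut-backward top down-left (cuts up-left)
  go down  top cuts right-down = cut-sym {down} {right} (cut-forward top down-right (cuts down-right))
  go down  top cuts left-down  = cut-sym {down} {left} (cut-forward top down-left (cuts down-left))
  go down  top cuts right-up   = cut-sym {up} {right} (cut-backward top down-right (cuts up-right))
  go down  top cuts left-up    = cut-sym {up} {left} (cut-backward top down-left (cuts up-left))

-- Symmetries of the set of directions

record Involution : Set where
  field
    ρ          : Cell → Cell
    σ          : Direction → Direction
    involutive : ∀ c → ρ (ρ c) ≡ c
    respects   : ∀ δ c → coordinate δ (ρ c) ≡ coordinate (σ δ) c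

module _ (I : Involution) where

  open Involution I

  extreme-ρ : ∀ {δ S c} → Extreme (σ δ) S c → Extreme δ (λ c → S (ρ c)) (ρ c)
  extreme-ρ {δ} {S} {c} (s , max) = subst S (sym (involutive c)) s , λ {e} s′ →
    subst₂ ℤ._≤_ (trans (sym (respects δ (ρ e))) (cong (coordinate δ) (involutive e))) (sym (respects δ c)) (max s′)

  cut-ρ : ∀ {δ ε S} → CornerCut (σ δ) (σ ε) S → CornerCut δ ε (λ c → S (ρ c))
  cut-ρ {δ} {ε} {S} cut {c} s with cut s
  ... | inj₁ (d , ex , h) = inj₁ (ρ d , extreme-ρ {ε} ex , subst₂ ℤ._≤_ (trans (sym (respects δ (ρ c))) (cong (coordinate δ) (involutive c))) (sym (respects δ d)) h)
  ... | inj₂ (d , ex , h) = inj₂ (ρ d , extreme-ρ {δ} ex , subst₂ ℤ._≤_ (trans (sym (respects ε (ρ c))) (cong (coordinate ε) (involutive c))) (sym (respects ε d)) h)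

mirrorX mirrorY mirrorXY : Involution
mirrorX = record
  { ρ = flipX ; σ = λ { right → left ; left → right ; up → up ; down → down }
  ; involutive = λ (x , y) → cong (_, y) (ℤ.neg-involutive x)
  ; respects = λ { right _ → refl ; left (x , y) → ℤ.neg-involutive x ; up _ → refl ; down _ → refl } }
mirrorY = record
  { ρ = flipY ; σ = λ { right → right ; left → left ; up → down ; down → up }
  ; involutive = λ (x , y) → cong (x ,_) (ℤ.neg-involutive y)
  ; respects = λ { right _ → refl ; left _ → refl ; up _ → refl ; down (x , y) → ℤ.neg-involutive y } }
mirrorXY = record
  { ρ = swap ; σ = λ { right → up ; left → down ; up → right ; down → left }
  ; involutive = λ _ → refl
  ; respects = λ { right _ → refl ; left _ → refl ; up _ → refl ; down _ → refl } }

cut-resp : ∀ {δ ε} {S T : Cell → Set} → (∀ {c} → S c → T c) → (∀ {c} → T c → S c) → CornerCut δ ε S → CornerCut δ ε T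
cut-resp f g cut t with cut (g t)
... | inj₁ (d , (s , max) , h) = inj₁ (d , (f s , λ e → max (g e)) , h)
... | inj₂ (d , (s , max) , h) = inj₂ (d , (f s , λ e → max (g e)) , h)

private
  swap-⊕ : ∀ {S : Cell → Set} {d c} → (S ⊕ swap d) (swap c) → ((λ c → S (swap c)) ⊕ d) c
  swap-⊕ (inj₁ refl) = inj₁ refl
  swap-⊕ (inj₂ s)    = inj₂ s

  swap-⊕⁻ : ∀ {S : Cell → Set} {d c} → ((λ c → S (swap c)) ⊕ d) c → (S ⊕ swap d) (swap c)
  swap-⊕⁻ (inj₁ refl) = inj₁ refl
  swap-⊕⁻ (inj₂ s)    = inj₂ s

  ρ-⊕ : ∀ (I : Involution) (let open Involution I) {S : Cell → Set} {d d′} → d′ ≡ ρ d → ∀ {c} → (S ⊕ d) (ρ c) → ((λ c → S (ρ c)) ⊕ d′) c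
  ρ-⊕ I d′≡ {c} (inj₁ eq) = inj₁ (trans (sym (Involution.involutive I c)) (trans (cong (Involution.ρ I) eq) (sym d′≡)))
  ρ-⊕ I d′≡     (inj₂ s)  = inj₂ s

  ρ-⊕⁻ : ∀ (I : Involution) (let open Involution I) {S : Cell → Set} {d d′} → d′ ≡ ρ d → ∀ {c} → ((λ c → S (ρ c)) ⊕ d′) c → (S ⊕ d) (ρ c)
  ρ-⊕⁻ I {d = d} d′≡ (inj₁ refl) = inj₁ (trans (cong (Involution.ρ I) d′≡) (Involution.involutive I d))
  ρ-⊕⁻ I         d′≡ (inj₂ s)    = inj₂ s

-- On a transposed shape a step to the right is a step upwards of the shape itself.
extend-right± : ∀ {S m n c} → IsZed± S m n → Extreme right S c →
  CornerCut right up (S ⊕ step right c) → CornerCut right down (S ⊕ step right c) →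
  IsZed± (S ⊕ step right c) (1ℤ ℤ.+ m) n
extend-right± (inj₁ s) top cut-up cut-down = extend-right s top cut-up cut-down
extend-right± {S} (inj₂ s) top _ _ = inj₂ (isZed-resp (λ {c} → swap-⊕⁻ {S} {c = c}) (λ {c} → swap-⊕ {S} {c = c})
  (extend-up s (extreme-ρ mirrorXY {up} top)))

extend-up± : ∀ {S m n c} → IsZed± S m n → Extreme up S c →
  CornerCut up right (S ⊕ step up c) → CornerCut up left (S ⊕ step up c) →
  IsZed± (S ⊕ step up c) m (1ℤ ℤ.+ n)
extend-up± (inj₁ s) top _ _ = inj₁ (extend-up s top)
extend-up± {S} {c = x , y} (inj₂ s) top cut-right cut-left = Sum.swap (Sum.map
  (isZed-resp (λ {c} → swap-⊕⁻ {S} {c = c}) (λ {c} → swap-⊕ {S} {c = c}))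
  (isZed-resp (λ {c} → swap-⊕⁻ {S} {c = swap c}) (λ {c} → swap-⊕ {S} {c = swap c}))
  (extend-right s (extreme-ρ mirrorXY {right} top)
    (cut-resp {right} {up} (λ {c} → swap-⊕ {S} {c = c}) (λ {c} → swap-⊕⁻ {S} {c = c}) (cut-ρ mirrorXY {right} {up} {S ⊕ step up (x , y)} cut-right))
    (cut-resp {right} {down} (λ {c} → swap-⊕ {S} {c = c}) (λ {c} → swap-⊕⁻ {S} {c = c}) (cut-ρ mirrorXY {right} {down} {S ⊕ step up (x , y)} cut-left))))

private
  unflip : ∀ (I : Involution) (let open Involution I) {S : Cell → Set} {c} → S (ρ (ρ c)) → S c
  unflip I {S} {c} = subst S (Involution.involutive I c)

  reflip : ∀ (I : Involution) (let open Involution I) {S : Cell → Set} {c} → S c → S (ρ (ρ c))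
  reflip I {S} {c} = subst S (sym (Involution.involutive I c))

extend± : ∀ δ {S a b c} → IsZed± S (+ a) (+ b) → Extreme δ S c → Cuts (S ⊕ step δ c) →
          IsZed± (S ⊕ step δ c) (+ across δ a) (+ along δ b)
extend± right s top cuts = extend-right± s top (cuts right-up) (cuts right-down)
extend± up    s top cuts = extend-up± s top (cuts up-right) (cuts up-left)
extend± left {S} {c = c@(x , y)} s top cuts =
  isZed±-resp {λ e → T (flipX (flipX e))} {T} (λ {e} → unflip mirrorX {T} {e}) (λ {e} → reflip mirrorX {T} {e})
    (isZed±-flipX {λ e → T (flipX e)}
      (isZed±-resp {T′} {λ e → T (flipX e)} (λ {e} → back {e}) (λ {e} → forth {e})
        (extend-right± (isZed±-flipX s) (extreme-ρ mirrorX {right} top)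
          (cut-resp {right} {up} {λ e → T (flipX e)} {T′} (λ {e} → forth {e}) (λ {e} → back {e}) (cut-ρ mirrorX {right} {up} {T} (cuts left-up)))
          (cut-resp {right} {down} {λ e → T (flipX e)} {T′} (λ {e} → forth {e}) (λ {e} → back {e}) (cut-ρ mirrorX {right} {down} {T} (cuts left-down))))))
  where
  T T′ : Cell → Set
  T  = S ⊕ step left c
  T′ = (λ e → S (flipX e)) ⊕ step right (flipX c)
  eq : step right (flipX c) ≡ flipX (step left c)
  eq = cong (_, y) (lia 1 (λ x → ⊢ :- x :+ # 1 := :- (x :- # 1)) refl x)
  back : ∀ {e} → T′ e → T (flipX e)
  back {e} = ρ-⊕⁻ mirrorX {S} {step left c} {step right (flipX c)} eq {e}
  forth : ∀ {e} → T (flipX e) → T′ e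
  forth {e} = ρ-⊕ mirrorX {S} {step left c} {step right (flipX c)} eq {e}
extend± down {S} {c = c@(x , y)} s top cuts =
  isZed±-resp {λ e → T (flipY (flipY e))} {T} (λ {e} → unflip mirrorY {T} {e}) (λ {e} → reflip mirrorY {T} {e})
    (isZed±-flipY {λ e → T (flipY e)}
      (isZed±-resp {T′} {λ e → T (flipY e)} (λ {e} → back {e}) (λ {e} → forth {e})
        (extend-up± (isZed±-flipY s) (extreme-ρ mirrorY {up} top)
          (cut-resp {up} {right} {λ e → T (flipY e)} {T′} (λ {e} → forth {e}) (λ {e} → back {e}) (cut-ρ mirrorY {up} {right} {T} (cuts down-right)))
          (cut-resp {up} {left} {λ e → T (flipY e)} {T′} (λ {e} → forth {e}) (λ {e} → back {e}) (cut-ρ mirrorY {up} {left} {T} (cuts down-left))))))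
  where
  T T′ : Cell → Set
  T  = S ⊕ step down c
  T′ = (λ e → S (flipY e)) ⊕ step up (flipY c)
  eq : step up (flipY c) ≡ flipY (step down c)
  eq = cong (x ,_) (lia 1 (λ x → ⊢ :- x :+ # 1 := :- (x :- # 1)) refl y)
  back : ∀ {e} → T′ e → T (flipY e)
  back {e} = ρ-⊕⁻ mirrorY {S} {step down c} {step up (flipY c)} eq {e}
  forth : ∀ {e} → T (flipY e) → T′ e
  forth {e} = ρ-⊕ mirrorY {S} {step down c} {step up (flipY c)} eq {e}

tight-zed : ∀ {cs a b} → Tight cs a b → Cuts (_∈ cs) → IsZed± (_∈ cs) (+ a) (+ b)
tight-zed (seed (x , y)) _ = inj₁ (isZed (zed x x y y y x x)
  (valid ℤ.≤-refl ℤ.≤-refl ℤ.≤-refl ℤ.≤-refl ℤ.≤-refl ℤ.≤-refl) (ℤ.+-inverseʳ x) (ℤ.+-inverseʳ y)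
  (λ { (here refl) → row refl ℤ.≤-refl ℤ.≤-refl })
  (λ { (row refl p q)    → here (cong (_, y) (ℤ.≤-antisym q p))
     ; (lower refl p q)  → here (cong (x ,_) (ℤ.≤-antisym q p))
     ; (upper refl p q)  → here (cong (x ,_) (ℤ.≤-antisym q p)) }))
tight-zed (grow δ {cs} {a} {b} {c} tight top) cuts = isZed±-resp from to
  (extend± δ (tight-zed tight (cuts-before top cuts′)) top cuts′)
  where
  to : ∀ {d} → d ∈ step δ c ∷ cs → ((_∈ cs) ⊕ step δ c) d
  to (here eq)  = inj₁ eq
  to (there d∈) = inj₂ d∈
  from : ∀ {d} → ((_∈ cs) ⊕ step δ c) d → d ∈ step δ c ∷ cs
  from (inj₁ eq) = here eq
  from (inj₂ d∈) = there d∈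
  cuts′ : Cuts ((_∈ cs) ⊕ step δ c)
  cuts′ {δ′} {ε′} p = cut-resp {δ′} {ε′} to from (cuts p)

private
  abs-1 : ∀ z → ℤ.∣ z ∣ ≡ 1 → z ≡ 1ℤ ⊎ z ≡ -[1+ 0 ]
  abs-1 (+ 1)      refl = inj₁ refl
  abs-1 (-[1+ 0 ]) refl = inj₂ refl

  sum-1-cases : ∀ m n → m ℕ.+ n ≡ 1 → (m ≡ 0 × n ≡ 1) ⊎ (m ≡ 1 × n ≡ 0)
  sum-1-cases 0 n       eq = inj₁ (refl , eq)
  sum-1-cases (suc m) n eq = inj₂ (cong suc (ℕ.m+n≡0⇒m≡0 m (ℕ.suc-injective eq)) , ℕ.m+n≡0⇒n≡0 m (ℕ.suc-injective eq))

adjacent-step : ∀ c d → EdgeAdjacent c d → ∃[ δ ] d ≡ step δ c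
adjacent-step (x , y) (x′ , y′) adj with sum-1-cases ℤ.∣ x ℤ.- x′ ∣ _ adj
... | inj₁ (e , f) with abs-1 (y ℤ.- y′) f
...   | inj₁ g = down , cong₂ _,_ (sym (ℤ.i-j≡0⇒i≡j x x′ (ℤ.∣i∣≡0⇒i≡0 e))) (lia 2 (λ y y′ → y :- y′ := # 1 ⇒ ⊢ y′ := y :- # 1) refl y y′ g)
...   | inj₂ g = up , cong₂ _,_ (sym (ℤ.i-j≡0⇒i≡j x x′ (ℤ.∣i∣≡0⇒i≡0 e))) (lia 2 (λ y y′ → y :- y′ := :- # 1 ⇒ ⊢ y′ := y :+ # 1) refl y y′ g)
adjacent-step (x , y) (x′ , y′) adj | inj₂ (f , e) with abs-1 (x ℤ.- x′) f
...   | inj₁ g = left , cong₂ _,_ (lia 2 (λ y y′ → y :- y′ := # 1 ⇒ ⊢ y′ := y :- # 1) refl x x′ g) (sym (ℤ.i-j≡0⇒i≡j y y′ (ℤ.∣i∣≡0⇒i≡0 e)))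
...   | inj₂ g = right , cong₂ _,_ (lia 2 (λ y y′ → y :- y′ := :- # 1 ⇒ ⊢ y′ := y :+ # 1) refl x x′ g) (sym (ℤ.i-j≡0⇒i≡j y y′ (ℤ.∣i∣≡0⇒i≡0 e)))

grown-length : ∀ {cs a b} → Grown cs a b → length cs ≡ suc (a ℕ.+ b)
grown-length (seed c)                 = refl
grown-length (grow right {a = a} {b} g _) = cong suc (grown-length g)
grown-length (grow left  {a = a} {b} g _) = cong suc (grown-length g)
grown-length (grow up    {a = a} {b} g _) = cong suc (trans (grown-length g) (sym (ℕ.+-suc a b)))
grown-length (grow down  {a = a} {b} g _) = cong suc (trans (grown-length g) (sym (ℕ.+-suc a b)))

private
  grown-head : ∀ {cs a b} → Grown cs a b → ∃[ c ] c ∈ cs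
  grown-head (seed c)     = c , here refl
  grown-head (grow _ _ _) = _ , here refl

  disjoint : ∀ cs {rest : List Cell} {c} → Unique (cs ++ rest) → c ∈ cs → c ∈ rest → ⊥
  disjoint (c ∷ cs) (h ∷ _) (here refl) c∈  = All.lookup h (∈-++⁺ʳ cs c∈) refl
  disjoint (c ∷ cs) (_ ∷ u) (there c∈) c∈′  = disjoint cs u c∈ c∈′

  leave : ∀ {ds cs rest c r} → ds ↭ cs ++ rest → Unique (cs ++ rest) → Star (StepWithin ds) c r → c ∈ cs → r ∈ rest →
          ∃[ d ] ∃[ e ] d ∈ cs × e ∈ rest × EdgeAdjacent d e
  leave {cs = cs} p u Star.ε c∈ r∈ = ⊥-elim (disjoint cs u c∈ r∈)
  leave {cs = cs} p u ((_ , d∈ , adj) ◅ path) c∈ r∈ with ∈-++⁻ cs (∈-resp-↭ p d∈)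
  ... | inj₁ d∈cs   = leave p u path d∈cs r∈
  ... | inj₂ d∈rest = _ , _ , c∈ , d∈rest , adj

  -- Connectedness supplies the order of growth: while cells remain, a path from the grown part to
  -- one of them leaves the grown part along an edge, and the cell behind that edge is added next.
  grow-all : ∀ {ds} → (∀ {c d} → c ∈ ds → d ∈ ds → Star (StepWithin ds) c d) → Unique ds →
             ∀ k {cs rest a b} → length rest ≡ k → Grown cs a b → ds ↭ cs ++ rest →
             ∃[ cs′ ] ∃[ a′ ] ∃[ b′ ] Grown cs′ a′ b′ × ds ↭ cs′
  grow-all conn u zero {cs} {[]} refl g p = cs , _ , _ , g , ↭-trans p (↭-reflexive (++-identityʳ cs))
  grow-all {ds} conn u (suc k) {cs} {rest@(r ∷ _)} eq g p
    with c₀ , c₀∈ ← grown-head g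
    with c , d , c∈ , d∈ , adj ← leave p (Permutation.Unique-resp-↭ (setoid Cell) (↭⇒↭ₛ p) u)
           (conn (∈-resp-↭ (↭-sym p) (∈-++⁺ˡ c₀∈)) (∈-resp-↭ (↭-sym p) (∈-++⁺ʳ cs (here refl)))) c₀∈ (here refl)
    with δ , refl ← adjacent-step c d adj
    with xs , ys , split ← ∈-∃++ d∈ =
    grow-all conn u k (ℕ.suc-injective (trans (sym (↭-length (shift d xs ys))) (trans (cong length (sym split)) eq)))
      (grow δ g c∈) (↭-trans p (↭-trans (++⁺ˡ cs (↭-trans (↭-reflexive split) (shift d xs ys))) (shift d cs (xs ++ ys))))

grown : ∀ {n} (P : Polyomino (suc n)) → ∃[ cs ] ∃[ a ] ∃[ b ] Grown cs a b × cells P ↭ cs × a ℕ.+ b ≡ n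
grown record { cells = c ∷ cs ; unique = u ; size = len ; connected = conn } =
  let cs′ , a , b , g , p = grow-all conn u (length cs) refl (seed c) ↭-refl
  in cs′ , a , b , g , p , ℕ.suc-injective (trans (sym (grown-length g)) (trans (sym (↭-length p)) len))

record Halves (m p q : ℕ) : Set where
  field
    sum  : p ℕ.+ q ≡ m
    near : q ≡ p ⊎ q ≡ suc p

halves : ∀ m → Halves m ⌊ m /2⌋ ⌊ suc m /2⌋
halves zero          = record { sum = refl ; near = inj₁ refl }
halves (suc zero)    = record { sum = refl ; near = inj₂ refl }
halves (suc (suc m)) = record
  { sum  = cong suc (trans (ℕ.+-suc ⌊ m /2⌋ ⌊ suc m /2⌋) (cong suc (Halves.sum (halves m))))
  ; near = Sum.map (cong suc) (cong suc) (Halves.near (halves m)) }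

0≤*-same : ∀ {s t} → 0ℤ ℤ.≤ s → 0ℤ ℤ.≤ t → 0ℤ ℤ.≤ s ℤ.* t
0≤*-same {s} {t} hs ht = subst (ℤ._≤ s ℤ.* t) (ℤ.*-zeroʳ s) (ℤ.*-monoˡ-≤-nonNeg s {{ℤ.nonNegative hs}} ht)

module _ {m p q a b : ℕ} (H : Halves m p q) (a+b≡m : a ℕ.+ b ≡ m) where

  open Halves H

  private
    b≡ : + b ≡ + p ℤ.+ + q ℤ.- + a
    b≡ = lia 4 (λ a b p q → a :+ b := p :+ q ⇒ ⊢ b := p :+ q :- a) refl (+ a) (+ b) (+ p) (+ q)
      (cong +_ (trans a+b≡m (sym sum)))

    between-none : 0ℤ ℤ.≤ (+ p ℤ.- + a) ℤ.* (+ q ℤ.- + a)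
    between-none with a ℕ.≤? p
    ... | yes a≤p = 0≤*-same (ℤ.i≤j⇒0≤j-i (ℤ.+≤+ a≤p)) (ℤ.i≤j⇒0≤j-i (ℤ.+≤+ (ℕ.≤-trans a≤p p≤q)))
      where
      p≤q : p ℕ.≤ q
      p≤q with near
      ... | inj₁ refl = ℕ.≤-refl
      ... | inj₂ refl = ℕ.n≤1+n p
    ... | no  a≰p = subst (0ℤ ℤ.≤_)
      (lia 3 (λ a p q → ⊢ (a :- p) :* (a :- q) := (p :- a) :* (q :- a)) refl (+ a) (+ p) (+ q))
      (0≤*-same (ℤ.i≤j⇒0≤j-i (ℤ.+≤+ (ℕ.<⇒≤ (ℕ.≰⇒> a≰p)))) (ℤ.i≤j⇒0≤j-i (ℤ.+≤+ q≤a)))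
      where
      q≤a : q ℕ.≤ a
      q≤a with near
      ... | inj₁ refl = ℕ.<⇒≤ (ℕ.≰⇒> a≰p)
      ... | inj₂ refl = ℕ.≰⇒> a≰p

  -- The numbers `p` and `q` differ by at most 1, so `a` is not strictly between them and (p - a) (q
  -- - a) is nonnegative. As a + b = p + q, this product equals p q - a b.
  product-≤ : + a ℤ.* + b ℤ.≤ + p ℤ.* + q
  product-≤ = subst (λ b → + a ℤ.* b ℤ.≤ + p ℤ.* + q) (sym b≡)
    (lia 3 (λ a p q → # 0 :≤ (p :- a) :* (q :- a) ⇒ ⊢ a :* (p :+ q :- a) :≤ p :* q) refl (+ a) (+ p) (+ q) between-none)

  product-≡ : + a ℤ.* + b ≡ + p ℤ.* + q → (a ≡ p × b ≡ q) ⊎ (a ≡ q × b ≡ p)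
  product-≡ eq with ℤ.i*j≡0⇒i≡0∨j≡0 (+ p ℤ.- + a) (lia 3 (λ a p q → a :* (p :+ q :- a) := p :* q ⇒ ⊢ (p :- a) :* (q :- a) := # 0) refl
    (+ a) (+ p) (+ q) (subst (λ b → + a ℤ.* b ≡ + p ℤ.* + q) b≡ eq))
  ... | inj₁ p≡ = let a≡p = ℤ.+-injective (sym (ℤ.i-j≡0⇒i≡j (+ p) (+ a) p≡)) in inj₁ (a≡p ,
    ℕ.+-cancelˡ-≡ a b q (trans a+b≡m (trans (sym sum) (cong (ℕ._+ q) (sym a≡p)))))
  ... | inj₂ q≡ = let a≡q = ℤ.+-injective (sym (ℤ.i-j≡0⇒i≡j (+ q) (+ a) q≡)) in inj₂ (a≡q ,
    ℕ.+-cancelˡ-≡ a b p (trans a+b≡m (trans (sym sum) (trans (ℕ.+-comm p q) (cong (ℕ._+ p) (sym a≡q))))))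

-- The maximum hull area

doubleMax : ℕ → ℕ → ℤ
doubleMax p q = + 2 ℤ.* (1ℤ ℤ.+ + p ℤ.+ + q) ℤ.+ + p ℤ.* + q

private
  half-double : ∀ x y → x ℚ.+ ½ ℚ.* y ≡ ½ ℚ.* (x ℚ.+ x ℚ.+ y)
  half-double x y = trans (cong (ℚ._+ ½ ℚ.* y) (sym (trans (sym (ℚ.*-assoc ½ (1ℚ ℚ.+ 1ℚ) x)) (ℚ.*-identityˡ x)))) (identity ½ x y)
    where
    identity : ∀ h x y → h ℚ.* ((1ℚ ℚ.+ 1ℚ) ℚ.* x) ℚ.+ h ℚ.* y ≡ h ℚ.* (x ℚ.+ x ℚ.+ y)
    identity = solve-∀ ℚ-ring

maxHullArea-suc : ∀ m → maxHullArea (suc m) ≡ ½ ℚ.* ι (doubleMax ⌊ m /2⌋ ⌊ suc m /2⌋)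
maxHullArea-suc m = trans (half-double (ι (+ suc m)) (ι (+ (p ℕ.* q))))
  (cong (½ ℚ.*_) (trans (cong (ℚ._+ ι (+ (p ℕ.* q))) (sym (ι-+ (+ suc m) (+ suc m))))
    (trans (sym (ι-+ (+ suc m ℤ.+ + suc m) (+ (p ℕ.* q)))) (cong ι eq))))
  where
  p = ⌊ m /2⌋
  q = ⌊ suc m /2⌋
  eq : + suc m ℤ.+ + suc m ℤ.+ + (p ℕ.* q) ≡ doubleMax p q
  eq = lia 4 (λ m p q pq → m := p :+ q ⇒ pq := p :* q ⇒ ⊢ # 1 :+ m :+ (# 1 :+ m) :+ pq := # 2 :* (# 1 :+ p :+ q) :+ p :* q) refl
    (+ m) (+ p) (+ q) (+ (p ℕ.* q)) (cong +_ (sym (Halves.sum (halves m)))) (ℤ.pos-* p q)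

private
  ½-mono : ∀ {x y} → x ℤ.≤ y → ½ ℚ.* ι x ℚ.≤ ½ ℚ.* ι y
  ½-mono {x} {y} h = ℚ.*-monoˡ-≤-nonNeg ½ {ι x} {ι y} (ι-mono-≤ h)

  ½-injective : ∀ {x y} → ½ ℚ.* ι x ≡ ½ ℚ.* ι y → x ≡ y
  ½-injective {x} {y} h = ι-injective {x} {y} (*½-cancel {ι x} {ι y} h)

-- The growth lists the cells in another order than the polyomino does. Corners depend only on the
-- set of cells, so growth and polygon can both refer to `cs`.
record Drawn {n} (P : Polyomino (suc n)) (area : ℚ) : Set where
  field
    cs               : List Cell
    a b              : ℕ
    growth           : Grown cs a b
    permutes         : cells P ↭ cs
    a+b≡n            : a ℕ.+ b ≡ n
    polygon          : List (ℤ × ℤ)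
    counterclockwise : Counterclockwiseℤ polygon
    corners          : All (Corner cs) polygon
    area≡            : area ≡ ½ ℚ.* ι (doubleArea polygon)

  open Tracked (tracked growth) using (profile; total; measure-≤; measure-tight) public

  area-≤ : doubleArea polygon ℤ.≤ total
  area-≤ = doubleArea-≤ profile counterclockwise corners

  double-bound : bound a b ℤ.≤ doubleMax ⌊ n /2⌋ ⌊ suc n /2⌋
  double-bound = lia 4 (λ a b p q → a :+ b := p :+ q ⇒ a :* b :≤ p :* q ⇒
      ⊢ # 2 :* (# 1 :+ a :+ b) :+ a :* b :≤ # 2 :* (# 1 :+ p :+ q) :+ p :* q) refl
    (+ a) (+ b) (+ ⌊ n /2⌋) (+ ⌊ suc n /2⌋) (cong +_ (trans a+b≡n (sym (Halves.sum (halves n))))) (product-≤ {a = a} {b} (halves n) a+b≡n)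

draw : ∀ {n} (P : Polyomino (suc n)) {area} → HasArea (hull P) area → Drawn P area
draw P h =
  let cs , a , b , g , p , eq = grown P
      open LatticePolygon (latticePolygon {cells P} h)
  in record
    { cs = cs ; a = a ; b = b ; growth = g ; permutes = p ; a+b≡n = eq ; polygon = vertices
    ; counterclockwise = counterclockwise
    ; corners = All.map (λ (c , c∈ , h) → c , ∈-resp-↭ p c∈ , h) corners ; area≡ = area≡ }

private
  drawn-≤ : ∀ {n} {P : Polyomino (suc n)} {area} → Drawn P area → area ℚ.≤ maxHullArea (suc n)
  drawn-≤ {n} d = subst₂ ℚ._≤_ (sym area≡) (sym (maxHullArea-suc n))
    (½-mono {doubleArea polygon} {doubleMax ⌊ n /2⌋ ⌊ suc n /2⌋} (ℤ.≤-trans area-≤ (ℤ.≤-trans measure-≤ double-bound)))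
    where open Drawn d

hullArea-≤ : ∀ {n} (P : Polyomino (suc n)) area → HasArea (hull P) area → area ℚ.≤ maxHullArea (suc n)
hullArea-≤ P area h = drawn-≤ (draw P h)

-- In the extremal case every inequality is an equality.

all-cuts : ∀ {S} → CornerCut right down S × CornerCut right up S × CornerCut left down S × CornerCut left up S → Cuts S
all-cuts (rd , ru , ld , lu) right-up   = ru
all-cuts (rd , ru , ld , lu) right-down = rd
all-cuts (rd , ru , ld , lu) left-up    = lu
all-cuts (rd , ru , ld , lu) left-down  = ld
all-cuts (rd , ru , ld , lu) up-right   = cut-sym {right} {up} ru
all-cuts (rd , ru , ld , lu) up-left    = cut-sym {left} {up} lu
all-cuts (rd , ru , ld , lu) down-right = cut-sym {right} {down} rd
all-cuts (rd , ru , ld , lu) down-left  = cut-sym {left} {down} ld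

drawn-zed : ∀ {n} {P : Polyomino (suc n)} → Drawn P (maxHullArea (suc n)) →
  ∃[ a ] ∃[ b ] ((a ≡ ⌊ n /2⌋ × b ≡ ⌊ suc n /2⌋) ⊎ (a ≡ ⌊ suc n /2⌋ × b ≡ ⌊ n /2⌋)) × IsZed± (_∈ cells P) (+ a) (+ b)
drawn-zed {n} {P} d = a , b , product-≡ {a = a} {b} (halves n) a+b≡n ab≡ ,
  isZed±-resp (∈-resp-↭ (↭-sym permutes)) (∈-resp-↭ permutes) (tight-zed (measure-tight tight₁) cuts)
  where
  open Drawn d
  double≡ : doubleArea polygon ≡ doubleMax ⌊ n /2⌋ ⌊ suc n /2⌋
  double≡ = ½-injective {doubleArea polygon} {doubleMax ⌊ n /2⌋ ⌊ suc n /2⌋} (trans (sym area≡) (maxHullArea-suc n))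
  -- The inequalities `area-≤`, `measure-≤` and `double-bound` lead from `doubleArea polygon` to
  -- `doubleMax`, and these two agree; the next facts are links of this chain read backwards.
  tight₁ : bound a b ℤ.≤ total
  tight₁ = ℤ.≤-trans double-bound (ℤ.≤-trans (ℤ.≤-reflexive (sym double≡)) area-≤)
  tight₂ : total ℤ.≤ doubleArea polygon
  tight₂ = ℤ.≤-trans measure-≤ (ℤ.≤-trans double-bound (ℤ.≤-reflexive (sym double≡)))
  bound≡ : bound a b ≡ doubleMax ⌊ n /2⌋ ⌊ suc n /2⌋
  bound≡ = ℤ.≤-antisym double-bound (ℤ.≤-trans (ℤ.≤-reflexive (sym double≡)) (ℤ.≤-trans area-≤ measure-≤))
  ab≡ : + a ℤ.* + b ≡ + ⌊ n /2⌋ ℤ.* + ⌊ suc n /2⌋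
  ab≡ = lia 4 (λ a b p q → a :+ b := p :+ q ⇒ # 2 :* (# 1 :+ a :+ b) :+ a :* b := # 2 :* (# 1 :+ p :+ q) :+ p :* q ⇒
      ⊢ a :* b := p :* q) refl
    (+ a) (+ b) (+ ⌊ n /2⌋) (+ ⌊ suc n /2⌋) (cong +_ (trans a+b≡n (sym (Halves.sum (halves n))))) bound≡
  cuts : Cuts (_∈ cs)
  cuts = all-cuts (corners-cut profile counterclockwise corners tight₂)

-- The shapes as polyominoes, and their hulls.

-- A row of a + 1 cells with a leg of d cells down from column i and a leg of u cells
-- up from column j.

record Frame : Set where
  constructor frame
  field
    a d u i j : ℕ

record Inside (f : Frame) : Set where
  constructor inside
  open Frame f
  field
    i≤a : i ℕ.≤ a
    j≤a : j ℕ.≤ a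

frameZed : Frame → Zed
frameZed (frame a d u i j) = zed 0ℤ (+ a) 0ℤ (ℤ.- + d) (+ u) (+ i) (+ j)

-- The legs start at the heights -1 and 1, so that no cell is listed twice; in `InZed` each leg also
-- contains its cell of the row.
frameCells : Frame → List Cell
frameCells (frame a d u i j) =
  map (λ k → + k , 0ℤ) (upTo (suc a)) ++ map (λ k → + i , -[1+ k ]) (upTo d) ++ map (λ k → + j , + suc k) (upTo u)

frame-length : ∀ f (let open Frame f) → length (frameCells f) ≡ suc (a ℕ.+ (d ℕ.+ u))
frame-length (frame a d u i j) = trans (length-++ (map _ (upTo (suc a)))) (cong₂ ℕ._+_ (trans (length-map _ (upTo (suc a))) (length-upTo (suc a)))
  (trans (length-++ (map _ (upTo d))) (cong₂ ℕ._+_ (trans (length-map _ (upTo d)) (length-upTo d)) (trans (length-map _ (upTo u)) (length-upTo u)))))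

frame-unique : ∀ f → Unique (frameCells f)
frame-unique (frame a d u i j) = Unique.++⁺
  (Unique.map⁺ (λ eq → ℤ.+-injective (cong proj₁ eq)) (Unique.upTo⁺ (suc a)))
  (Unique.++⁺
    (Unique.map⁺ (λ eq → ℤ.-[1+-injective (cong proj₂ eq)) (Unique.upTo⁺ d))
    (Unique.map⁺ (λ eq → ℕ.suc-injective (ℤ.+-injective (cong proj₂ eq))) (Unique.upTo⁺ u))
    λ (l , u) → legs l u)
  (λ (r , lu) → Sum.[ row-lower r , row-upper r ] (∈-++⁻ (map _ (upTo d)) lu))
  where
  legs : ∀ {c} → c ∈ map (λ k → + i , -[1+ k ]) (upTo d) → c ∈ map (λ k → + j , + suc k) (upTo u) → ⊥
  legs l u with ∈-map⁻ _ l | ∈-map⁻ _ u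
  ... | _ , _ , refl | _ , _ , ()
  row-lower : ∀ {c} → c ∈ map (λ k → + k , 0ℤ) (upTo (suc a)) → c ∈ map (λ k → + i , -[1+ k ]) (upTo d) → ⊥
  row-lower r l with ∈-map⁻ _ r | ∈-map⁻ _ l
  ... | _ , _ , refl | _ , _ , ()
  row-upper : ∀ {c} → c ∈ map (λ k → + k , 0ℤ) (upTo (suc a)) → c ∈ map (λ k → + j , + suc k) (upTo u) → ⊥
  row-upper r l with ∈-map⁻ _ r | ∈-map⁻ _ l
  ... | _ , _ , refl | _ , _ , ()

frame-∈⁻ : ∀ {f} → Inside f → ∀ {c} → c ∈ frameCells f → InZed (frameZed f) c
frame-∈⁻ {frame a d u i j} (inside i≤a j≤a) c∈ with ∈-++⁻ (map _ (upTo (suc a))) c∈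
... | inj₁ r with ∈-map⁻ _ r
...   | k , k∈ , refl = row refl (ℤ.+≤+ ℕ.z≤n) (ℤ.+≤+ (ℕ.≤-pred (∈-upTo⁻ k∈)))
frame-∈⁻ {frame a d u i j} (inside i≤a j≤a) c∈ | inj₂ lu with ∈-++⁻ (map _ (upTo d)) lu
... | inj₁ l with ∈-map⁻ _ l
...   | k , k∈ , refl = lower refl (ℤ.neg-mono-≤ (ℤ.+≤+ (∈-upTo⁻ k∈))) ℤ.-≤+
frame-∈⁻ {frame a d u i j} (inside i≤a j≤a) c∈ | inj₂ lu | inj₂ l with ∈-map⁻ _ l
...   | k , k∈ , refl = upper refl (ℤ.+≤+ ℕ.z≤n) (ℤ.+≤+ (∈-upTo⁻ k∈))

frame-∈⁺ : ∀ {f} → Inside f → ∀ {c} → InZed (frameZed f) c → c ∈ frameCells f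
frame-∈⁺ {frame a d u i j} _ {+ k , .(0ℤ)} (row refl _ (ℤ.+≤+ k≤a)) =
  ∈-++⁺ˡ (∈-map⁺ _ (∈-upTo⁺ (ℕ.s≤s k≤a)))
frame-∈⁺ {frame a d u i j} (inside i≤a j≤a) {_ , + zero} (lower refl _ _) = ∈-++⁺ˡ (∈-map⁺ _ (∈-upTo⁺ (ℕ.s≤s i≤a)))
frame-∈⁺ {frame a d u i j} _ {_ , + suc k} (lower refl _ (ℤ.+≤+ ()))
frame-∈⁺ {frame a d u i j} _ {_ , -[1+ k ]} (lower refl p _) =
  ∈-++⁺ʳ (map _ (upTo (suc a))) (∈-++⁺ˡ (∈-map⁺ _ (∈-upTo⁺ (ℤ.drop‿+≤+ (ℤ.neg-cancel-≤ {+ d} {+ suc k} p)))))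
frame-∈⁺ {frame a d u i j} (inside i≤a j≤a) {_ , + zero} (upper refl _ _) = ∈-++⁺ˡ (∈-map⁺ _ (∈-upTo⁺ (ℕ.s≤s j≤a)))
frame-∈⁺ {frame a d u i j} _ {_ , + suc k} (upper refl _ (ℤ.+≤+ p)) =
  ∈-++⁺ʳ (map _ (upTo (suc a))) (∈-++⁺ʳ (map _ (upTo d)) (∈-map⁺ _ (∈-upTo⁺ p)))

module _ {f : Frame} (ins : Inside f) where

  open Frame f
  open Inside ins

  private
    cs = frameCells f

    ∣1∣ : ∀ x x′ → x ≡ x′ ℤ.+ 1ℤ → ℤ.∣ x ℤ.- x′ ∣ ≡ 1
    ∣1∣ x x′ eq = cong ℤ.∣_∣ (lia 2 (λ x x′ → x := x′ :+ # 1 ⇒ ⊢ x :- x′ := # 1) refl x x′ eq)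

    ∣0∣ : ∀ x → ℤ.∣ x ℤ.- x ∣ ≡ 0
    ∣0∣ x = cong ℤ.∣_∣ (ℤ.+-inverseʳ x)

    reverse-adjacent : ∀ c d → EdgeAdjacent c d → EdgeAdjacent d c
    reverse-adjacent (x , y) (x′ , y′) = trans (cong₂ ℕ._+_ (ℤ.∣i-j∣≡∣j-i∣ x′ x) (ℤ.∣i-j∣≡∣j-i∣ y′ y))

    reverse-step : ∀ {c d} → StepWithin cs c d → StepWithin cs d c
    reverse-step {c} {d} (c∈ , d∈ , adj) = d∈ , c∈ , reverse-adjacent c d adj

    ∈⁺ : ∀ {c} → InZed (frameZed f) c → c ∈ cs
    ∈⁺ = frame-∈⁺ ins

    along-row : ∀ k → k ℕ.≤ a → Star (StepWithin cs) (+ k , 0ℤ) (0ℤ , 0ℤ)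
    along-row zero    _ = Star.ε
    along-row (suc k) h = (∈⁺ (row refl (ℤ.+≤+ ℕ.z≤n) (ℤ.+≤+ h)) , ∈⁺ (row refl (ℤ.+≤+ ℕ.z≤n) (ℤ.+≤+ (ℕ.<⇒≤ h))) ,
      cong (ℕ._+ 0) (∣1∣ (+ suc k) (+ k) (ℤ.+-comm 1ℤ (+ k)))) ◅ along-row k (ℕ.<⇒≤ h)

    up-leg : ∀ k → k ℕ.≤ d → Star (StepWithin cs) (+ i , ℤ.- + k) (+ i , 0ℤ)
    up-leg zero    _ = Star.ε
    up-leg (suc k) h = (∈⁺ (lower refl (ℤ.neg-mono-≤ (ℤ.+≤+ h)) (ℤ.neg-mono-≤ (ℤ.+≤+ {0} {suc k} ℕ.z≤n))) ,
      ∈⁺ (lower refl (ℤ.neg-mono-≤ (ℤ.+≤+ (ℕ.<⇒≤ h))) (ℤ.neg-mono-≤ (ℤ.+≤+ {0} {k} ℕ.z≤n))) ,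
      cong₂ ℕ._+_ (∣0∣ (+ i)) (trans (ℤ.∣i-j∣≡∣j-i∣ (ℤ.- + suc k) (ℤ.- + k)) (∣1∣ (ℤ.- + k) (ℤ.- + suc k) (lia 1 (λ k → ⊢ :- k := :- (# 1 :+ k) :+ # 1) refl (+ k))))) ◅ up-leg k (ℕ.<⇒≤ h)

    down-leg : ∀ k → k ℕ.≤ u → Star (StepWithin cs) (+ j , + k) (+ j , 0ℤ)
    down-leg zero    _ = Star.ε
    down-leg (suc k) h = (∈⁺ (upper refl (ℤ.+≤+ ℕ.z≤n) (ℤ.+≤+ h)) , ∈⁺ (upper refl (ℤ.+≤+ ℕ.z≤n) (ℤ.+≤+ (ℕ.<⇒≤ h))) ,
      cong₂ ℕ._+_ (∣0∣ (+ j)) (∣1∣ (+ suc k) (+ k) (ℤ.+-comm 1ℤ (+ k)))) ◅ down-leg k (ℕ.<⇒≤ h)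

    to-origin : ∀ {c} → InZed (frameZed f) c → Star (StepWithin cs) c (0ℤ , 0ℤ)
    to-origin {+ k , _} (row refl _ (ℤ.+≤+ h)) = along-row k h
    to-origin {_ , + zero}   (lower refl _ _)  = along-row i i≤a
    to-origin {_ , + suc k}  (lower refl _ (ℤ.+≤+ ()))
    to-origin {_ , -[1+ k ]} (lower refl p _)  = up-leg (suc k) (ℤ.drop‿+≤+ (ℤ.neg-cancel-≤ {+ d} {+ suc k} p)) ◅◅ along-row i i≤a
    to-origin {_ , + k} (upper refl _ (ℤ.+≤+ h)) = down-leg k h ◅◅ along-row j j≤a

  framePolyomino : ∀ {n} → suc (a ℕ.+ (d ℕ.+ u)) ≡ n → Polyomino n
  framePolyomino eq = record
    { cells = cs ; unique = frame-unique f ; size = trans (frame-length f) eq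
    ; connected = λ c∈ d∈ → to-origin (frame-∈⁻ ins c∈) ◅◅ Star.reverse reverse-step (to-origin (frame-∈⁻ ins d∈)) }

orientation-rotateℤ : ∀ p q r → orientationℤ p q r ≡ orientationℤ q r p
orientation-rotateℤ p q r = lia 3 (λ x y z → ⊢ x :+ y :+ z := y :+ z :+ x) refl (crossℤ p q) (crossℤ q r) (crossℤ r p)

private
  positive-* : ∀ {p q} → 0ℤ ℤ.< p → 0ℤ ℤ.< q → 0ℤ ℤ.< p ℤ.* q
  positive-* {p} {q} hp hq = subst (ℤ._< p ℤ.* q) (ℤ.*-zeroʳ p) (ℤ.*-monoˡ-<-pos p {{ℤ.positive hp}} hq)

  0<*+* : ∀ {p q r s} → (0ℤ ℤ.< p × 0ℤ ℤ.< q) ⊎ (0ℤ ℤ.< r × 0ℤ ℤ.< s) →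
          0ℤ ℤ.≤ p → 0ℤ ℤ.≤ q → 0ℤ ℤ.≤ r → 0ℤ ℤ.≤ s → 0ℤ ℤ.< p ℤ.* q ℤ.+ r ℤ.* s
  0<*+* (inj₁ (hp , hq)) _ _ r s = ℤ.+-mono-<-≤ (positive-* hp hq) (0≤*-same r s)
  0<*+* (inj₂ (hr , hs)) p q _ _ = ℤ.+-mono-≤-< (0≤*-same p q) (positive-* hr hs)

  0≤- : ∀ {x y} → x ℤ.≤ y → 0ℤ ℤ.≤ y ℤ.- x
  0≤- = ℤ.i≤j⇒0≤j-i

  0<- : ∀ {x y} → x ℤ.< y → 0ℤ ℤ.< y ℤ.- x
  0<- {x} {y} = lia 2 (λ x y → x :< y ⇒ ⊢ # 0 :< y :- x) refl x y

-- p is at the bottom, q on the right and r at the top of a box containing the three.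
turn : ∀ {xp yp xq yq xr yr} → xp ℤ.≤ xq → xr ℤ.≤ xq → yp ℤ.≤ yq → yq ℤ.≤ yr →
       (xp ℤ.< xq × yq ℤ.< yr) ⊎ (xr ℤ.< xq × yp ℤ.< yq) → 0ℤ ℤ.< orientationℤ (xp , yp) (xq , yq) (xr , yr)
turn {xp} {yp} {xq} {yq} {xr} {yr} a b c d strict = subst (0ℤ ℤ.<_)
  (lia 6 (λ xp yp xq yq xr yr → ⊢ (xq :- xp) :* (yr :- yq) :+ (xq :- xr) :* (yq :- yp) :=
     (xp :* yq :- xq :* yp) :+ (xq :* yr :- xr :* yq) :+ (xr :* yp :- xp :* yr)) refl xp yp xq yq xr yr)
  (0<*+* (Sum.map (λ (s , t) → 0<- s , 0<- t) (λ (s , t) → 0<- s , 0<- t) strict) (0≤- a) (0≤- d) (0≤- b) (0≤- c))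

-- Orientation is invariant under quarter turns, so the estimate `turn` serves for other triples of
-- consecutive sides of the box.
quarter : ℤ × ℤ → ℤ × ℤ
quarter (x , y) = y , ℤ.- x

orientation-quarter : ∀ p q r → orientationℤ (quarter p) (quarter q) (quarter r) ≡ orientationℤ p q r
orientation-quarter (xp , yp) (xq , yq) (xr , yr) = lia 6 (λ xp yp xq yq xr yr →
  ⊢ (yp :* (:- xq) :- yq :* (:- xp)) :+ (yq :* (:- xr) :- yr :* (:- xq)) :+ (yr :* (:- xp) :- yp :* (:- xr)) :=
    (xp :* yq :- xq :* yp) :+ (xq :* yr :- xr :* yq) :+ (xr :* yp :- xp :* yr)) refl xp yp xq yq xr yr

module Octagon {fr : Frame} (ins : Inside fr) where

  open Frame fr
  open Inside ins

  A = + a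
  D = ℤ.- + d
  U = + u
  I = + i
  J′ = + j

  -- The vertices on the four sides of the bounding box, counterclockwise.
  data Vertex : Set where
    B R T L : Bool → Vertex

  locate : Vertex → ℤ × ℤ
  locate (B false) = I , D
  locate (B true)  = I ℤ.+ 1ℤ , D
  locate (R false) = A ℤ.+ 1ℤ , 0ℤ
  locate (R true)  = A ℤ.+ 1ℤ , 1ℤ
  locate (T false) = J′ ℤ.+ 1ℤ , U ℤ.+ 1ℤ
  locate (T true)  = J′ , U ℤ.+ 1ℤ
  locate (L false) = 0ℤ , 1ℤ
  locate (L true)  = 0ℤ , 0ℤ

  -- The conditions for a strict vertex. Without a lower leg the points `B` lie on the lower side of
  -- the row, and the ends of that side are vertices. With a lower leg in the last column, `R false`
  -- lies inside a vertical side of the hull; the other ends of the row behave in the same way.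
  Kept : Vertex → Set
  Kept (B _)     = 0 ℕ.< d
  Kept (R false) = d ≡ 0 ⊎ i ℕ.< a
  Kept (R true)  = u ≡ 0 ⊎ j ℕ.< a
  Kept (T _)     = 0 ℕ.< u
  Kept (L false) = u ≡ 0 ⊎ 0 ℕ.< j
  Kept (L true)  = d ≡ 0 ⊎ 0 ℕ.< i

  kept? : ∀ v → Dec (Kept v)
  kept? (B _)     = 0 ℕ.<? d
  kept? (R false) = d ℕ.≟ 0 ⊎-dec i ℕ.<? a
  kept? (R true)  = u ℕ.≟ 0 ⊎-dec j ℕ.<? a
  kept? (T _)     = 0 ℕ.<? u
  kept? (L false) = u ℕ.≟ 0 ⊎-dec 0 ℕ.<? j
  kept? (L true)  = d ℕ.≟ 0 ⊎-dec 0 ℕ.<? i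

  -- The list starts with `B true`, so that consecutive pairs belong to the same corner of the box;
  -- the area is computed in these pairs.
  octagon : List Vertex
  octagon = B true ∷ R false ∷ R true ∷ T false ∷ T true ∷ L false ∷ L true ∷ B false ∷ []

  private
    I≤A : I ℤ.≤ A
    I≤A = ℤ.+≤+ i≤a
    J′≤A : J′ ℤ.≤ A
    J′≤A = ℤ.+≤+ j≤a
    0≤I : 0ℤ ℤ.≤ I
    0≤I = ℤ.+≤+ ℕ.z≤n
    0≤J′ : 0ℤ ℤ.≤ J′
    0≤J′ = ℤ.+≤+ ℕ.z≤n
    0≤A : 0ℤ ℤ.≤ A
    0≤A = ℤ.+≤+ ℕ.z≤n
    0≤U : 0ℤ ℤ.≤ U
    0≤U = ℤ.+≤+ ℕ.z≤n
    D≤0 : D ℤ.≤ 0ℤ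
    D≤0 = ℤ.neg-mono-≤ (ℤ.+≤+ {0} {d} ℕ.z≤n)
    D<0 : 0 ℕ.< d → D ℤ.< 0ℤ
    D<0 h = ℤ.neg-mono-< (ℤ.+<+ h)

    ≤⇒≤+1 : ∀ {x y} → x ℤ.≤ y → x ℤ.≤ y ℤ.+ 1ℤ
    ≤⇒≤+1 {x} {y} = lia 2 (λ x y → x :≤ y ⇒ ⊢ x :≤ y :+ # 1) refl x y
    ≤⇒<+1 : ∀ {x y} → x ℤ.≤ y → x ℤ.< y ℤ.+ 1ℤ
    ≤⇒<+1 {x} {y} = lia 2 (λ x y → x :≤ y ⇒ ⊢ x :< y :+ # 1) refl x y
    +1-mono-≤ : ∀ {x y} → x ℤ.≤ y → x ℤ.+ 1ℤ ℤ.≤ y ℤ.+ 1ℤ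
    +1-mono-≤ {x} {y} = lia 2 (λ x y → x :≤ y ⇒ ⊢ x :+ # 1 :≤ y :+ # 1) refl x y
    +1-mono-< : ∀ {x y} → x ℤ.< y → x ℤ.+ 1ℤ ℤ.< y ℤ.+ 1ℤ
    +1-mono-< {x} {y} = lia 2 (λ x y → x :< y ⇒ ⊢ x :+ # 1 :< y :+ # 1) refl x y

    xr≡ : ∀ e → proj₁ (locate (R e)) ≡ A ℤ.+ 1ℤ
    xr≡ false = refl
    xr≡ true  = refl
    xl≡ : ∀ e → proj₁ (locate (L e)) ≡ 0ℤ
    xl≡ false = refl
    xl≡ true  = refl
    yb≡ : ∀ e → proj₂ (locate (B e)) ≡ D
    yb≡ false = refl
    yb≡ true  = refl
    yt≡ : ∀ e → proj₂ (locate (T e)) ≡ U ℤ.+ 1ℤ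
    yt≡ false = refl
    yt≡ true  = refl

    record Box (v : Vertex) : Set where
      constructor box
      field
        0≤x : 0ℤ ℤ.≤ proj₁ (locate v)
        x≤A : proj₁ (locate v) ℤ.≤ A ℤ.+ 1ℤ
        D≤y : D ℤ.≤ proj₂ (locate v)
        y≤U : proj₂ (locate v) ℤ.≤ U ℤ.+ 1ℤ

    boxed : ∀ v → Box v
    boxed (B false) = box 0≤I (≤⇒≤+1 I≤A) ℤ.≤-refl (≤⇒≤+1 (ℤ.≤-trans D≤0 0≤U))
    boxed (B true)  = box (≤⇒≤+1 0≤I) (+1-mono-≤ I≤A) ℤ.≤-refl (≤⇒≤+1 (ℤ.≤-trans D≤0 0≤U))
    boxed (R false) = box (≤⇒≤+1 0≤A) ℤ.≤-refl D≤0 (≤⇒≤+1 0≤U)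
    boxed (R true)  = box (≤⇒≤+1 0≤A) ℤ.≤-refl (≤⇒≤+1 D≤0) (+1-mono-≤ 0≤U)
    boxed (T false) = box (≤⇒≤+1 0≤J′) (+1-mono-≤ J′≤A) (≤⇒≤+1 (ℤ.≤-trans D≤0 0≤U)) ℤ.≤-refl
    boxed (T true)  = box 0≤J′ (≤⇒≤+1 J′≤A) (≤⇒≤+1 (ℤ.≤-trans D≤0 0≤U)) ℤ.≤-refl
    boxed (L false) = box ℤ.≤-refl (≤⇒≤+1 0≤A) (≤⇒≤+1 D≤0) (+1-mono-≤ 0≤U)
    boxed (L true)  = box ℤ.≤-refl (≤⇒≤+1 0≤A) D≤0 (≤⇒≤+1 0≤U)

    open Box

    -- Left turns are claimed between kept vertices only. All 56 triples are thus settled once for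
    -- the full octagon, and every degenerate hull arises by dropping vertices.
    record Turn (p q r : Vertex) : Set where
      constructor turning
      field
        left-turn : Kept p → Kept q → Kept r → 0ℤ ℤ.< orientationℤ (locate p) (locate q) (locate r)

    open Turn

    rot : ∀ {p q r} → Turn r p q → Turn p q r
    rot {p} {q} {r} t .left-turn kp kq kr = subst (0ℤ ℤ.<_) (orientation-rotateℤ (locate r) (locate p) (locate q)) (left-turn t kr kp kq)

    pick : ∀ {A : Set} {n} → n ≡ 0 ⊎ A → 0 ℕ.< n → A
    pick (inj₁ refl) ()
    pick (inj₂ h)    _ = h

    f = false
    t = true

    -- The letters name the sides of the three points. The box supplies the weak inequalities of
    -- `turn`; the strict one is where `Kept` enters, since a kept end of the row is not in the
    -- column of a leg that is present on its side.
    brt : ∀ p q r → Turn (B p) (R q) (T r)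
    brt p q r .left-turn kp kq kr = turn
      (subst (_ ℤ.≤_) (sym (xr≡ q)) (x≤A (boxed (B p)))) (subst (_ ℤ.≤_) (sym (xr≡ q)) (x≤A (boxed (T r))))
      (subst (ℤ._≤ _) (sym (yb≡ p)) (D≤y (boxed (R q)))) (subst (_ ℤ.≤_) (sym (yt≡ r)) (y≤U (boxed (R q)))) (strict p q r kq)
      where
      0<U+1 : 0ℤ ℤ.< U ℤ.+ 1ℤ
      0<U+1 = ≤⇒<+1 0≤U
      strict : ∀ p q r → Kept (R q) →
        (proj₁ (locate (B p)) ℤ.< proj₁ (locate (R q)) × proj₂ (locate (R q)) ℤ.< proj₂ (locate (T r))) ⊎
        (proj₁ (locate (T r)) ℤ.< proj₁ (locate (R q)) × proj₂ (locate (B p)) ℤ.< proj₂ (locate (R q)))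
      strict false false r k = inj₁ (≤⇒<+1 I≤A , subst (0ℤ ℤ.<_) (sym (yt≡ r)) 0<U+1)
      strict true  false r k = inj₁ (+1-mono-< (ℤ.+<+ (pick k kp)) , subst (0ℤ ℤ.<_) (sym (yt≡ r)) 0<U+1)
      strict p true false k  = inj₂ (+1-mono-< (ℤ.+<+ (pick k kr)) , subst (ℤ._< 1ℤ) (sym (yb≡ p)) (≤⇒<+1 D≤0))
      strict p true true  k  = inj₂ (≤⇒<+1 J′≤A , subst (ℤ._< 1ℤ) (sym (yb≡ p)) (≤⇒<+1 D≤0))

    quartered : ∀ {p q r} → 0ℤ ℤ.< orientationℤ (quarter (locate p)) (quarter (locate q)) (quarter (locate r)) →
                0ℤ ℤ.< orientationℤ (locate p) (locate q) (locate r)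
    quartered {p} {q} {r} = subst (0ℤ ℤ.<_) (orientation-quarter (locate p) (locate q) (locate r))

    rtl : ∀ p q r → Turn (R p) (T q) (L r)
    rtl p q r .left-turn kp kq kr = quartered {R p} {T q} {L r} (turn
      (subst (_ ℤ.≤_) (sym (yt≡ q)) (y≤U (boxed (R p)))) (subst (_ ℤ.≤_) (sym (yt≡ q)) (y≤U (boxed (L r))))
      (ℤ.neg-mono-≤ (subst (_ ℤ.≤_) (sym (xr≡ p)) (x≤A (boxed (T q))))) (ℤ.neg-mono-≤ (subst (ℤ._≤ _) (sym (xl≡ r)) (0≤x (boxed (T q)))))
      (strict p q r))
      where
      0<U : 0ℤ ℤ.< U
      0<U = ℤ.+<+ kq
      yr< : ∀ p q → proj₂ (locate (R p)) ℤ.< proj₂ (locate (T q))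
      yr< false q = subst (0ℤ ℤ.<_) (sym (yt≡ q)) (≤⇒<+1 0≤U)
      yr< true  q = subst (1ℤ ℤ.<_) (sym (yt≡ q)) (+1-mono-< 0<U)
      yl< : ∀ r q → proj₂ (locate (L r)) ℤ.< proj₂ (locate (T q))
      yl< false q = subst (1ℤ ℤ.<_) (sym (yt≡ q)) (+1-mono-< 0<U)
      yl< true  q = subst (0ℤ ℤ.<_) (sym (yt≡ q)) (≤⇒<+1 0≤U)
      strict : ∀ p q r →
        (proj₂ (locate (R p)) ℤ.< proj₂ (locate (T q)) × ℤ.- proj₁ (locate (T q)) ℤ.< ℤ.- proj₁ (locate (L r))) ⊎
        (proj₂ (locate (L r)) ℤ.< proj₂ (locate (T q)) × ℤ.- proj₁ (locate (R p)) ℤ.< ℤ.- proj₁ (locate (T q)))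
      strict p false r = inj₁ (yr< p false , ℤ.neg-mono-< (subst (ℤ._< _) (sym (xl≡ r)) (≤⇒<+1 0≤J′)))
      strict p true  r = inj₂ (yl< r true , ℤ.neg-mono-< (subst (_ ℤ.<_) (sym (xr≡ p)) (≤⇒<+1 J′≤A)))

    tlb : ∀ p q r → Turn (T p) (L q) (B r)
    tlb p q r .left-turn kp kq kr = quartered {T p} {L q} {B r} (quartered′ (turn
      (ℤ.neg-mono-≤ (subst (ℤ._≤ _) (sym (xl≡ q)) (0≤x (boxed (T p))))) (ℤ.neg-mono-≤ (subst (ℤ._≤ _) (sym (xl≡ q)) (0≤x (boxed (B r)))))
      (ℤ.neg-mono-≤ (subst (_ ℤ.≤_) (sym (yt≡ p)) (y≤U (boxed (L q))))) (ℤ.neg-mono-≤ (subst (ℤ._≤ _) (sym (yb≡ r)) (D≤y (boxed (L q)))))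
      (strict p q r kq)))
      where
      quartered′ : 0ℤ ℤ.< orientationℤ (quarter (quarter (locate (T p)))) (quarter (quarter (locate (L q)))) (quarter (quarter (locate (B r)))) →
                   0ℤ ℤ.< orientationℤ (quarter (locate (T p))) (quarter (locate (L q))) (quarter (locate (B r)))
      quartered′ = subst (0ℤ ℤ.<_) (orientation-quarter (quarter (locate (T p))) (quarter (locate (L q))) (quarter (locate (B r))))
      strict : ∀ p q r → Kept (L q) →
        (ℤ.- proj₁ (locate (T p)) ℤ.< ℤ.- proj₁ (locate (L q)) × ℤ.- proj₂ (locate (L q)) ℤ.< ℤ.- proj₂ (locate (B r))) ⊎
        (ℤ.- proj₁ (locate (B r)) ℤ.< ℤ.- proj₁ (locate (L q)) × ℤ.- proj₂ (locate (T p)) ℤ.< ℤ.- proj₂ (locate (L q)))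
      strict false false r k = inj₁ (ℤ.neg-mono-< (≤⇒<+1 0≤J′) , ℤ.neg-mono-< (subst (ℤ._< 1ℤ) (sym (yb≡ r)) (≤⇒<+1 D≤0)))
      strict true  false r k = inj₁ (ℤ.neg-mono-< (ℤ.+<+ (pick k kp)) , ℤ.neg-mono-< (subst (ℤ._< 1ℤ) (sym (yb≡ r)) (≤⇒<+1 D≤0)))
      strict p true false k  = inj₂ (ℤ.neg-mono-< (ℤ.+<+ (pick k kr)) , ℤ.neg-mono-< (subst (0ℤ ℤ.<_) (sym (yt≡ p)) (≤⇒<+1 0≤U)))
      strict p true true  k  = inj₂ (ℤ.neg-mono-< (≤⇒<+1 0≤I) , ℤ.neg-mono-< (subst (0ℤ ℤ.<_) (sym (yt≡ p)) (≤⇒<+1 0≤U)))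

    btl : ∀ p q r → Turn (B p) (T q) (L r)
    btl p q r = rot {B p} {T q} {L r} (rot {L r} {B p} {T q} (tlb q r p))

    -- Here the box is turned so that its left side is at the bottom.
    brl : ∀ p q r → Turn (B p) (R q) (L r)
    brl p q r .left-turn kp kq kr = subst (0ℤ ℤ.<_) (sym (trans (sym (orientation-rotateℤ (locate (L r)) (locate (B p)) (locate (R q)))) refl))
      (subst (0ℤ ℤ.<_) (lia 6 (λ xp yp xq yq xr yr → ⊢ (yp :- yq) :* (xr :- xq) :+ (yr :- yq) :* (xq :- xp) :=
          (xp :* yq :- xq :* yp) :+ (xq :* yr :- xr :* yq) :+ (xr :* yp :- xp :* yr)) refl
          (proj₁ (locate (L r))) (proj₂ (locate (L r))) (proj₁ (locate (B p))) (proj₂ (locate (B p))) (proj₁ (locate (R q))) (proj₂ (locate (R q))))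
        (0<*+* (strict p q r) (0≤- (subst (ℤ._≤ proj₂ (locate (L r))) (sym (yb≡ p)) (D≤y (boxed (L r))))) (0≤- (subst (_ ℤ.≤_) (sym (xr≡ q)) (x≤A (boxed (B p)))))
          (0≤- (subst (ℤ._≤ proj₂ (locate (R q))) (sym (yb≡ p)) (D≤y (boxed (R q))))) (0≤- (subst (ℤ._≤ proj₁ (locate (B p))) (sym (xl≡ r)) (0≤x (boxed (B p)))))))
      where
      over : ∀ {y} p → 0ℤ ℤ.≤ y → proj₂ (locate (B p)) ℤ.< y
      over {y} p h = subst (ℤ._< y) (sym (yb≡ p)) (ℤ.<-≤-trans (D<0 kp) h)
      0≤yl : ∀ r → 0ℤ ℤ.≤ proj₂ (locate (L r))
      0≤yl false = ℤ.+≤+ ℕ.z≤n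
      0≤yl true  = ℤ.+≤+ ℕ.z≤n
      0≤yr : ∀ q → 0ℤ ℤ.≤ proj₂ (locate (R q))
      0≤yr false = ℤ.+≤+ ℕ.z≤n
      0≤yr true  = ℤ.+≤+ ℕ.z≤n
      strict : ∀ p q r →
        (0ℤ ℤ.< proj₂ (locate (L r)) ℤ.- proj₂ (locate (B p)) × 0ℤ ℤ.< proj₁ (locate (R q)) ℤ.- proj₁ (locate (B p))) ⊎
        (0ℤ ℤ.< proj₂ (locate (R q)) ℤ.- proj₂ (locate (B p)) × 0ℤ ℤ.< proj₁ (locate (B p)) ℤ.- proj₁ (locate (L r)))
      strict false q r = inj₁ (0<- (over false (0≤yl r)) , 0<- (subst (_ ℤ.<_) (sym (xr≡ q)) (≤⇒<+1 I≤A)))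
      strict true  q r = inj₂ (0<- (over true (0≤yr q)) , 0<- (subst (ℤ._< I ℤ.+ 1ℤ) (sym (xl≡ r)) (≤⇒<+1 0≤I)))

    bottom-pair : ∀ x y x₁ → y ℤ.< x₁ → ∀ x′ → 0ℤ ℤ.< orientationℤ (x , y) (x ℤ.+ 1ℤ , y) (x′ , x₁)
    bottom-pair x y y′ h x′ = subst (0ℤ ℤ.<_)
      (lia 4 (λ x y x′ y′ → ⊢ y′ :- y := (x :* y :- (x :+ # 1) :* y) :+ ((x :+ # 1) :* y′ :- x′ :* y) :+ (x′ :* y :- x :* y′)) refl x y x′ y′) (0<- h)

    top-pair : ∀ x y x′ y′ → y′ ℤ.< y → 0ℤ ℤ.< orientationℤ (x ℤ.+ 1ℤ , y) (x , y) (x′ , y′)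
    top-pair x y x′ y′ h = subst (0ℤ ℤ.<_)
      (lia 4 (λ x y x′ y′ → ⊢ y :- y′ := ((x :+ # 1) :* y :- x :* y) :+ (x :* y′ :- x′ :* y) :+ (x′ :* y :- (x :+ # 1) :* y′)) refl x y x′ y′) (0<- h)

    right-pair : ∀ x x′ y′ → x′ ℤ.< x → 0ℤ ℤ.< orientationℤ (x , 0ℤ) (x , 1ℤ) (x′ , y′)
    right-pair x x′ y′ h = subst (0ℤ ℤ.<_)
      (lia 3 (λ x x′ y′ → ⊢ x :- x′ := (x :* # 1 :- x :* # 0) :+ (x :* y′ :- x′ :* # 1) :+ (x′ :* # 0 :- x :* y′)) refl x x′ y′) (0<- h)

    left-pair : ∀ x′ y′ → 0ℤ ℤ.< x′ → 0ℤ ℤ.< orientationℤ (0ℤ , 1ℤ) (0ℤ , 0ℤ) (x′ , y′)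
    left-pair x′ y′ h = subst (0ℤ ℤ.<_)
      (lia 2 (λ x′ y′ → ⊢ x′ := (# 0 :* # 0 :- # 0 :* # 1) :+ (# 0 :* y′ :- x′ :* # 0) :+ (x′ :* # 1 :- # 0 :* y′)) refl x′ y′) h

    bbr : ∀ q → Turn (B f) (B t) (R q)
    bbr false .left-turn k _ _ = bottom-pair I D 0ℤ (D<0 k) (A ℤ.+ 1ℤ)
    bbr true  .left-turn k _ _ = bottom-pair I D 1ℤ (≤⇒<+1 D≤0) (A ℤ.+ 1ℤ)
    bbt : ∀ q → Turn (B f) (B t) (T q)
    bbt false .left-turn k _ _ = bottom-pair I D (U ℤ.+ 1ℤ) (≤⇒<+1 (ℤ.≤-trans D≤0 0≤U)) (J′ ℤ.+ 1ℤ)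
    bbt true  .left-turn k _ _ = bottom-pair I D (U ℤ.+ 1ℤ) (≤⇒<+1 (ℤ.≤-trans D≤0 0≤U)) J′
    bbl : ∀ q → Turn (B f) (B t) (L q)
    bbl false .left-turn k _ _ = bottom-pair I D 1ℤ (≤⇒<+1 D≤0) 0ℤ
    bbl true  .left-turn k _ _ = bottom-pair I D 0ℤ (D<0 k) 0ℤ

    brr : ∀ p → Turn (B p) (R f) (R t)
    brr false .left-turn k kf kt = subst (0ℤ ℤ.<_) (sym (orientation-rotateℤ (locate (B f)) (locate (R f)) (locate (R t)))) (right-pair (A ℤ.+ 1ℤ) I D (≤⇒<+1 I≤A))
    brr true  .left-turn k kf kt = subst (0ℤ ℤ.<_) (sym (orientation-rotateℤ (locate (B t)) (locate (R f)) (locate (R t))))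
      (right-pair (A ℤ.+ 1ℤ) (I ℤ.+ 1ℤ) D (+1-mono-< (ℤ.+<+ (pick kf k))))
    rrt : ∀ p → Turn (R f) (R t) (T p)
    rrt false .left-turn kf kt k = right-pair (A ℤ.+ 1ℤ) (J′ ℤ.+ 1ℤ) (U ℤ.+ 1ℤ) (+1-mono-< (ℤ.+<+ (pick kt k)))
    rrt true  .left-turn kf kt k = right-pair (A ℤ.+ 1ℤ) J′ (U ℤ.+ 1ℤ) (≤⇒<+1 J′≤A)
    rrl : ∀ p → Turn (R f) (R t) (L p)
    rrl false .left-turn _ _ _ = right-pair (A ℤ.+ 1ℤ) 0ℤ 1ℤ (≤⇒<+1 0≤A)
    rrl true  .left-turn _ _ _ = right-pair (A ℤ.+ 1ℤ) 0ℤ 0ℤ (≤⇒<+1 0≤A)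

    before-top : ∀ {v} → Turn (T f) (T t) v → Turn v (T f) (T t)
    before-top {v} h = rot {v} {T f} {T t} (rot {T t} {v} {T f} h)

    btt : ∀ p → Turn (B p) (T f) (T t)
    btt p = before-top {B p} (turning λ k _ _ → subst (λ y → 0ℤ ℤ.< orientationℤ (J′ ℤ.+ 1ℤ , U ℤ.+ 1ℤ) (J′ , U ℤ.+ 1ℤ) (proj₁ (locate (B p)) , y)) (sym (yb≡ p))
      (top-pair J′ (U ℤ.+ 1ℤ) (proj₁ (locate (B p))) D (≤⇒<+1 (ℤ.≤-trans D≤0 0≤U))))
    rtt : ∀ p → Turn (R p) (T f) (T t)
    rtt false = before-top {R f} (turning λ k _ _ → top-pair J′ (U ℤ.+ 1ℤ) (A ℤ.+ 1ℤ) 0ℤ (≤⇒<+1 0≤U))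
    rtt true  = before-top {R t} (turning λ k _ _ → top-pair J′ (U ℤ.+ 1ℤ) (A ℤ.+ 1ℤ) 1ℤ (+1-mono-< (ℤ.+<+ k)))
    ttl : ∀ p → Turn (T f) (T t) (L p)
    ttl false .left-turn k _ _ = top-pair J′ (U ℤ.+ 1ℤ) 0ℤ 1ℤ (+1-mono-< (ℤ.+<+ k))
    ttl true  .left-turn k _ _ = top-pair J′ (U ℤ.+ 1ℤ) 0ℤ 0ℤ (≤⇒<+1 0≤U)

    before-left : ∀ {v} → (Kept v → Kept (L f) → Kept (L t) → 0ℤ ℤ.< proj₁ (locate v)) → Turn v (L f) (L t)
    before-left {v} h .left-turn kv kf kt = subst (0ℤ ℤ.<_) (sym (orientation-rotateℤ (locate v) (locate (L f)) (locate (L t))))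
      (left-pair (proj₁ (locate v)) (proj₂ (locate v)) (h kv kf kt))

    bll : ∀ p → Turn (B p) (L f) (L t)
    bll false = before-left {B f} λ kv _ kt → ℤ.+<+ (pick kt kv)
    bll true  = before-left {B t} λ _ _ _ → ≤⇒<+1 0≤I
    rll : ∀ p → Turn (R p) (L f) (L t)
    rll false = before-left {R f} λ _ _ _ → ≤⇒<+1 0≤A
    rll true  = before-left {R t} λ _ _ _ → ≤⇒<+1 0≤A
    tll : ∀ p → Turn (T p) (L f) (L t)
    tll false = before-left {T f} λ _ _ _ → ≤⇒<+1 0≤J′
    tll true  = before-left {T t} λ kv kf _ → ℤ.+<+ (pick kf kv)

    Guarded : List Vertex → Set
    Guarded []       = ⊤
    Guarded (p ∷ ps) = AllPairs (λ q r → Turn p q r) ps × Guarded ps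

    guarded : Guarded octagon
    guarded =
      ((brr t ∷ brt t f f ∷ brt t f t ∷ brl t f f ∷ brl t f t ∷ rot (bbr f) ∷ []) ∷
       (brt t t f ∷ brt t t t ∷ brl t t f ∷ brl t t t ∷ rot (bbr t) ∷ []) ∷
       (btt t ∷ btl t f f ∷ btl t f t ∷ rot (bbt f) ∷ []) ∷
       (btl t t f ∷ btl t t t ∷ rot (bbt t) ∷ []) ∷
       (bll t ∷ rot (bbl f) ∷ []) ∷
       (rot (bbl t) ∷ []) ∷
       [] ∷
       []) ,
      ((rrt f ∷ rrt t ∷ rrl f ∷ rrl t ∷ rot (brr f) ∷ []) ∷
       (rtt f ∷ rtl f f f ∷ rtl f f t ∷ rot (brt f f f) ∷ []) ∷
       (rtl f t f ∷ rtl f t t ∷ rot (brt f f t) ∷ []) ∷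
       (rll f ∷ rot (brl f f f) ∷ []) ∷
       (rot (brl f f t) ∷ []) ∷
       [] ∷
       []) ,
      ((rtt t ∷ rtl t f f ∷ rtl t f t ∷ rot (brt f t f) ∷ []) ∷
       (rtl t t f ∷ rtl t t t ∷ rot (brt f t t) ∷ []) ∷
       (rll t ∷ rot (brl f t f) ∷ []) ∷
       (rot (brl f t t) ∷ []) ∷
       [] ∷
       []) ,
      ((ttl f ∷ ttl t ∷ rot (btt f) ∷ []) ∷
       (tll f ∷ rot (btl f f f) ∷ []) ∷
       (rot (btl f f t) ∷ []) ∷
       [] ∷
       []) ,
      ((tll t ∷ rot (btl f t f) ∷ []) ∷
       (rot (btl f t t) ∷ []) ∷
       [] ∷
       []) ,
      ((rot (bll f) ∷ []) ∷
       [] ∷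
       []) ,
      ([] ∷
       []) ,
      [] ,
      tt

  vertices : List (ℤ × ℤ)
  vertices = map locate (filter kept? octagon)

  private
    filter-pairs : ∀ {p} → Kept p → ∀ vs → AllPairs (Turn p) vs →
      AllPairs (λ q r → 0ℤ ℤ.< orientationℤ (locate p) q r) (map locate (filter kept? vs))
    filter-pairs kp []       _        = []
    filter-pairs kp (v ∷ vs) (h ∷ hs) with kept? v
    ... | no  _  = filter-pairs kp vs hs
    ... | yes kv = go kp kv vs h ∷ filter-pairs kp vs hs
      where
      go : ∀ {p v} → Kept p → Kept v → ∀ vs → All (Turn p v) vs →
           All (λ r → 0ℤ ℤ.< orientationℤ (locate p) (locate v) r) (map locate (filter kept? vs))
      go kp kv []       _           = []
      go kp kv (w ∷ vs) (turn ∷ ts) with kept? w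
      ... | no  _  = go kp kv vs ts
      ... | yes kw = left-turn turn kp kv kw ∷ go kp kv vs ts

    guarded-ccw : ∀ vs → Guarded vs → Counterclockwiseℤ (map locate (filter kept? vs))
    guarded-ccw []       _        = tt
    guarded-ccw (v ∷ vs) (h , hs) with kept? v
    ... | no  _  = guarded-ccw vs hs
    ... | yes kv = filter-pairs kv vs h , guarded-ccw vs hs

  vertices-ccw : Counterclockwiseℤ vertices
  vertices-ccw = guarded-ccw octagon guarded

-- The area of the octagon, as a sum of contributions of the corners of its box

data Segment : List Pt → Pt → Pt → ℤ → Set where
  one : ∀ p → Segment (p ∷ []) p p 0ℤ
  two : ∀ p q → Segment (p ∷ q ∷ []) p q (crossℤ p q)

segment-start : ∀ {ps p q s} → Segment ps p q s → ∀ rs → doubleArea (ps ++ rs) ≡ s ℤ.+ doubleAreaFrom p q rs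
segment-start (one p)   rs = sym (ℤ.+-identityˡ _)
segment-start (two p q) rs = refl

segment-next : ∀ {ps p q s} → Segment ps p q s → ∀ o r rs →
  doubleAreaFrom o r (ps ++ rs) ≡ crossℤ r p ℤ.+ s ℤ.+ doubleAreaFrom o q rs
segment-next (one p)   o r rs = cong (ℤ._+ doubleAreaFrom o p rs) (sym (ℤ.+-identityʳ (crossℤ r p)))
segment-next (two p q) o r rs = sym (ℤ.+-assoc (crossℤ r p) (crossℤ p q) (doubleAreaFrom o q rs))

segments-area : ∀ {ps₁ ps₂ ps₃ ps₄ p₁ q₁ s₁ p₂ q₂ s₂ p₃ q₃ s₃ p₄ q₄ s₄} →
  Segment ps₁ p₁ q₁ s₁ → Segment ps₂ p₂ q₂ s₂ → Segment ps₃ p₃ q₃ s₃ → Segment ps₄ p₄ q₄ s₄ →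
  doubleArea (ps₁ ++ ps₂ ++ ps₃ ++ ps₄) ≡
  s₁ ℤ.+ (crossℤ q₁ p₂ ℤ.+ s₂ ℤ.+ (crossℤ q₂ p₃ ℤ.+ s₃ ℤ.+ (crossℤ q₃ p₄ ℤ.+ s₄ ℤ.+ crossℤ q₄ p₁)))
segments-area {ps₁} {ps₂} {ps₃} {ps₄} {p₁} {q₁} {s₁} {p₂} {q₂} {s₂} {p₃} {q₃} {s₃} {p₄} {q₄} {s₄} g₁ g₂ g₃ g₄ =
  trans (segment-start g₁ (ps₂ ++ ps₃ ++ ps₄)) (cong (λ z → s₁ ℤ.+ z)
  (trans (segment-next g₂ p₁ q₁ (ps₃ ++ ps₄)) (cong (λ z → crossℤ q₁ p₂ ℤ.+ s₂ ℤ.+ z)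
  (trans (segment-next g₃ p₁ q₂ ps₄) (cong (λ z → crossℤ q₂ p₃ ℤ.+ s₃ ℤ.+ z)
  (trans (cong (doubleAreaFrom p₁ q₃) (sym (++-identityʳ ps₄))) (segment-next g₄ p₁ q₃ [])))))))

module Hull {fr : Frame} (ins : Inside fr) where

  open Frame fr
  open Inside ins
  open Octagon ins

  private
    kept : List Vertex → List Pt
    kept vs = map locate (filter kept? vs)

    0-or-0< : ∀ {n} → ¬ 0 ℕ.< n → n ≡ 0
    0-or-0< {zero}  _ = refl
    0-or-0< {suc n} h = ⊥-elim (h (ℕ.s≤s ℕ.z≤n))

    D≡0 : ¬ 0 ℕ.< d → D ≡ 0ℤ
    D≡0 h = cong (λ k → ℤ.- + k) (0-or-0< h)

    U≡0 : ¬ 0 ℕ.< u → U ≡ 0ℤ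
    U≡0 h = cong +_ (0-or-0< h)

    I≡A : ¬ (d ≡ 0 ⊎ i ℕ.< a) → I ≡ A
    I≡A h = cong +_ (ℕ.≤-antisym i≤a (ℕ.≮⇒≥ (λ k → h (inj₂ k))))

    J≡A : ¬ (u ≡ 0 ⊎ j ℕ.< a) → J′ ≡ A
    J≡A h = cong +_ (ℕ.≤-antisym j≤a (ℕ.≮⇒≥ (λ k → h (inj₂ k))))

    I≡0 : ¬ (d ≡ 0 ⊎ 0 ℕ.< i) → I ≡ 0ℤ
    I≡0 h = cong +_ (0-or-0< (λ k → h (inj₂ k)))

    J≡0 : ¬ (u ≡ 0 ⊎ 0 ℕ.< j) → J′ ≡ 0ℤ
    J≡0 h = cong +_ (0-or-0< (λ k → h (inj₂ k)))

    data Kept² (v w : Vertex) : List Pt → Set where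
      both    : Kept² v w (locate v ∷ locate w ∷ [])
      first   : ¬ Kept w → Kept² v w (locate v ∷ [])
      second  : ¬ Kept v → Kept² v w (locate w ∷ [])
      neither : ¬ Kept v → ¬ Kept w → Kept² v w []

    kept² : ∀ v w → Kept² v w (kept (v ∷ w ∷ []))
    kept² v w with kept? v
    ... | yes _ with kept? w
    ...   | yes _  = both
    ...   | no  kw = first kw
    kept² v w | no kv with kept? w
    ...   | yes _  = second kv
    ...   | no  kw = neither kv kw

    -- A path through the box corner `(A + 1 , D)` would give the first three terms; the last one
    -- takes away the doubled area of the triangle cut off there. If only one vertex is kept, the
    -- triangle is degenerate and the same formula holds. The other three corners follow this
    -- pattern.
    south-east : ∀ {ps} → Kept² (B true) (R false) ps → ∃[ x ] ∃[ y ] ∃[ s ] Segment ps (x , D) (A ℤ.+ 1ℤ , y) s ×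
      s ≡ x ℤ.* D ℤ.+ (A ℤ.+ 1ℤ) ℤ.* y ℤ.- + 2 ℤ.* D ℤ.* (A ℤ.+ 1ℤ) ℤ.+ (A ℤ.- I) ℤ.* D
    south-east both = I ℤ.+ 1ℤ , 0ℤ , _ , two _ _ ,
      lia 3 (λ A I D → ⊢ (I :+ # 1) :* # 0 :- (A :+ # 1) :* D := (I :+ # 1) :* D :+ (A :+ # 1) :* # 0 :- # 2 :* D :* (A :+ # 1) :+ (A :- I) :* D) refl A I D
    south-east (first k) = I ℤ.+ 1ℤ , D , _ , subst (λ z → Segment ((I ℤ.+ 1ℤ , D) ∷ []) (I ℤ.+ 1ℤ , D) (z ℤ.+ 1ℤ , D) 0ℤ) (I≡A k) (one (I ℤ.+ 1ℤ , D)) ,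
      subst (λ z → 0ℤ ≡ (I ℤ.+ 1ℤ) ℤ.* D ℤ.+ (z ℤ.+ 1ℤ) ℤ.* D ℤ.- + 2 ℤ.* D ℤ.* (z ℤ.+ 1ℤ) ℤ.+ (z ℤ.- I) ℤ.* D) (I≡A k)
        (lia 2 (λ I D → ⊢ # 0 := (I :+ # 1) :* D :+ (I :+ # 1) :* D :- # 2 :* D :* (I :+ # 1) :+ (I :- I) :* D) refl I D)
    south-east (second k) = A ℤ.+ 1ℤ , 0ℤ , _ , subst (λ z → Segment ((A ℤ.+ 1ℤ , 0ℤ) ∷ []) (A ℤ.+ 1ℤ , z) (A ℤ.+ 1ℤ , 0ℤ) 0ℤ) (sym (D≡0 k)) (one (A ℤ.+ 1ℤ , 0ℤ)) ,
      subst (λ z → 0ℤ ≡ (A ℤ.+ 1ℤ) ℤ.* z ℤ.+ (A ℤ.+ 1ℤ) ℤ.* 0ℤ ℤ.- + 2 ℤ.* z ℤ.* (A ℤ.+ 1ℤ) ℤ.+ (A ℤ.- I) ℤ.* z) (sym (D≡0 k))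
        (lia 2 (λ A I → ⊢ # 0 := (A :+ # 1) :* # 0 :+ (A :+ # 1) :* # 0 :- # 2 :* # 0 :* (A :+ # 1) :+ (A :- I) :* # 0) refl A I)
    south-east (neither k k′) = ⊥-elim (k′ (inj₁ (0-or-0< k)))

    north-east : ∀ {ps} → Kept² (R true) (T false) ps → ∃[ x ] ∃[ y ] ∃[ s ] Segment ps (A ℤ.+ 1ℤ , y) (x , U ℤ.+ 1ℤ) s ×
      s ≡ + 2 ℤ.* (A ℤ.+ 1ℤ) ℤ.* (U ℤ.+ 1ℤ) ℤ.- (A ℤ.- J′) ℤ.* U ℤ.- (A ℤ.+ 1ℤ) ℤ.* y ℤ.- x ℤ.* (U ℤ.+ 1ℤ)
    north-east both = J′ ℤ.+ 1ℤ , 1ℤ , _ , two _ _ ,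
      lia 3 (λ A J U → ⊢ (A :+ # 1) :* (U :+ # 1) :- (J :+ # 1) :* # 1 := # 2 :* (A :+ # 1) :* (U :+ # 1) :- (A :- J) :* U :- (A :+ # 1) :* # 1 :- (J :+ # 1) :* (U :+ # 1)) refl A J′ U
    north-east (second k) = J′ ℤ.+ 1ℤ , U ℤ.+ 1ℤ , _ , subst (λ z → Segment ((J′ ℤ.+ 1ℤ , U ℤ.+ 1ℤ) ∷ []) (z ℤ.+ 1ℤ , U ℤ.+ 1ℤ) (J′ ℤ.+ 1ℤ , U ℤ.+ 1ℤ) 0ℤ) (J≡A k) (one (J′ ℤ.+ 1ℤ , U ℤ.+ 1ℤ)) ,
      subst (λ z → 0ℤ ≡ + 2 ℤ.* (z ℤ.+ 1ℤ) ℤ.* (U ℤ.+ 1ℤ) ℤ.- (z ℤ.- J′) ℤ.* U ℤ.- (z ℤ.+ 1ℤ) ℤ.* (U ℤ.+ 1ℤ) ℤ.- (J′ ℤ.+ 1ℤ) ℤ.* (U ℤ.+ 1ℤ)) (J≡A k)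
        (lia 2 (λ J U → ⊢ # 0 := # 2 :* (J :+ # 1) :* (U :+ # 1) :- (J :- J) :* U :- (J :+ # 1) :* (U :+ # 1) :- (J :+ # 1) :* (U :+ # 1)) refl J′ U)
    north-east (first k) = A ℤ.+ 1ℤ , 1ℤ , _ , subst (λ z → Segment ((A ℤ.+ 1ℤ , 1ℤ) ∷ []) (A ℤ.+ 1ℤ , 1ℤ) (A ℤ.+ 1ℤ , z ℤ.+ 1ℤ) 0ℤ) (sym (U≡0 k)) (one (A ℤ.+ 1ℤ , 1ℤ)) ,
      subst (λ z → 0ℤ ≡ + 2 ℤ.* (A ℤ.+ 1ℤ) ℤ.* (z ℤ.+ 1ℤ) ℤ.- (A ℤ.- J′) ℤ.* z ℤ.- (A ℤ.+ 1ℤ) ℤ.* 1ℤ ℤ.- (A ℤ.+ 1ℤ) ℤ.* (z ℤ.+ 1ℤ)) (sym (U≡0 k))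
        (lia 2 (λ A J → ⊢ # 0 := # 2 :* (A :+ # 1) :* (# 0 :+ # 1) :- (A :- J) :* # 0 :- (A :+ # 1) :* # 1 :- (A :+ # 1) :* (# 0 :+ # 1)) refl A J′)
    north-east (neither k′ k) = ⊥-elim (k′ (inj₁ (0-or-0< k)))

    north-west : ∀ {ps} → Kept² (T true) (L false) ps → ∃[ x ] ∃[ y ] ∃[ s ] Segment ps (x , U ℤ.+ 1ℤ) (0ℤ , y) s ×
      s ≡ x ℤ.* (U ℤ.+ 1ℤ) ℤ.- J′ ℤ.* U
    north-west both = J′ , 1ℤ , _ , two _ _ , lia 2 (λ J U → ⊢ J :* # 1 :- # 0 :* (U :+ # 1) := J :* (U :+ # 1) :- J :* U) refl J′ U
    north-west (first k) = 0ℤ , U ℤ.+ 1ℤ , _ , subst (λ z → Segment (((z , U ℤ.+ 1ℤ)) ∷ []) (0ℤ , U ℤ.+ 1ℤ) (0ℤ , U ℤ.+ 1ℤ) 0ℤ) (sym (J≡0 k)) (one (0ℤ , U ℤ.+ 1ℤ)) ,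
      subst (λ z → 0ℤ ≡ 0ℤ ℤ.* (U ℤ.+ 1ℤ) ℤ.- z ℤ.* U) (sym (J≡0 k)) (lia 1 (λ U → ⊢ # 0 := # 0 :* (U :+ # 1) :- # 0 :* U) refl U)
    north-west (second k) = 0ℤ , 1ℤ , _ , subst (λ z → Segment ((0ℤ , 1ℤ) ∷ []) (0ℤ , z ℤ.+ 1ℤ) (0ℤ , 1ℤ) 0ℤ) (sym (U≡0 k)) (one (0ℤ , 1ℤ)) ,
      subst (λ z → 0ℤ ≡ 0ℤ ℤ.* (z ℤ.+ 1ℤ) ℤ.- J′ ℤ.* z) (sym (U≡0 k)) (lia 1 (λ J → ⊢ # 0 := # 0 :* (# 0 :+ # 1) :- J :* # 0) refl J′)
    north-west (neither k k′) = ⊥-elim (k′ (inj₁ (0-or-0< k)))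

    south-west : ∀ {ps} → Kept² (L true) (B false) ps → ∃[ x ] ∃[ y ] ∃[ s ] Segment ps (0ℤ , y) (x , D) s ×
      s ≡ I ℤ.* D ℤ.- x ℤ.* D
    south-west both = I , 0ℤ , _ , two _ _ , lia 2 (λ I D → ⊢ # 0 :* D :- I :* # 0 := I :* D :- I :* D) refl I D
    south-west (second k) = 0ℤ , D , _ , subst (λ z → Segment (((z , D)) ∷ []) (0ℤ , D) (0ℤ , D) 0ℤ) (sym (I≡0 k)) (one (0ℤ , D)) ,
      subst (λ z → 0ℤ ≡ z ℤ.* D ℤ.- 0ℤ ℤ.* D) (sym (I≡0 k)) (lia 1 (λ D → ⊢ # 0 := # 0 :* D :- # 0 :* D) refl D)
    south-west (first k) = 0ℤ , 0ℤ , _ , subst (λ z → Segment ((0ℤ , 0ℤ) ∷ []) (0ℤ , 0ℤ) (0ℤ , z) 0ℤ) (sym (D≡0 k)) (one (0ℤ , 0ℤ)) ,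
      subst (λ z → 0ℤ ≡ I ℤ.* z ℤ.- 0ℤ ℤ.* z) (sym (D≡0 k)) (lia 1 (λ I → ⊢ # 0 := I :* # 0 :- # 0 :* # 0) refl I)
    south-west (neither k′ k) = ⊥-elim (k′ (inj₁ (0-or-0< k)))

    kept-++ : ∀ vs ws → kept (vs ++ ws) ≡ kept vs ++ kept ws
    kept-++ vs ws = trans (cong (map locate) (filter-++ kept? vs ws)) (map-++ locate (filter kept? vs) (filter kept? ws))

    SE NE NW SW : List Vertex
    SE = B true ∷ R false ∷ []
    NE = R true ∷ T false ∷ []
    NW = T true ∷ L false ∷ []
    SW = L true ∷ B false ∷ []

    vertices-segments : vertices ≡ kept SE ++ kept NE ++ kept NW ++ kept SW
    vertices-segments = trans (kept-++ SE (NE ++ NW ++ SW)) (cong (kept SE ++_)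
      (trans (kept-++ NE (NW ++ SW)) (cong (kept NE ++_) (kept-++ NW SW))))

  -- The four corners add up to twice the box, 2 (a + 1) (d + u + 1), minus the doubled triangles, a
  -- (d + u). The coordinates left open by the corners cancel along the sides.
  vertices-area : doubleArea vertices ≡ doubleMax a (d ℕ.+ u)
  vertices-area =
    let x₁ , y₁ , s₁ , g₁ , e₁ = south-east (kept² (B true) (R false))
        x₂ , y₂ , s₂ , g₂ , e₂ = north-east (kept² (R true) (T false))
        x₃ , y₃ , s₃ , g₃ , e₃ = north-west (kept² (T true) (L false))
        x₄ , y₄ , s₄ , g₄ , e₄ = south-west (kept² (L true) (B false))
    in trans (cong doubleArea vertices-segments) (trans (segments-area g₁ g₂ g₃ g₄)
      (lia 17 (λ x₁ y₁ s₁ x₂ y₂ s₂ x₃ y₃ s₃ x₄ y₄ s₄ A I J U d →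
        s₁ := x₁ :* (:- d) :+ (A :+ # 1) :* y₁ :- # 2 :* (:- d) :* (A :+ # 1) :+ (A :- I) :* (:- d) ⇒
        s₂ := # 2 :* (A :+ # 1) :* (U :+ # 1) :- (A :- J) :* U :- (A :+ # 1) :* y₂ :- x₂ :* (U :+ # 1) ⇒
        s₃ := x₃ :* (U :+ # 1) :- J :* U ⇒ s₄ := I :* (:- d) :- x₄ :* (:- d) ⇒
        ⊢ s₁ :+ (((A :+ # 1) :* y₂ :- (A :+ # 1) :* y₁) :+ s₂ :+ ((x₂ :* (U :+ # 1) :- x₃ :* (U :+ # 1)) :+ s₃ :+
            ((# 0 :* y₄ :- # 0 :* y₃) :+ s₄ :+ (x₄ :* (:- d) :- x₁ :* (:- d))))) :=
          # 2 :* (# 1 :+ A :+ (d :+ U)) :+ A :* (d :+ U)) refl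
        x₁ y₁ s₁ x₂ y₂ s₂ x₃ y₃ s₃ x₄ y₄ s₄ A I J′ U (+ d) e₁ e₂ e₃ e₄))

private
  interpolation : ∀ {x₁ x₂ x} → x₁ ℚ.≤ x → x ℚ.≤ x₂ → ∃[ t ] 0ℚ ℚ.≤ t × t ℚ.≤ 1ℚ × (1ℚ ℚ.- t) ℚ.* x₁ ℚ.+ t ℚ.* x₂ ≡ x
  interpolation {x₁} {x₂} {x} h k with x₁ ℚ.<? x₂
  ... | no  x₁≮x₂ = 0ℚ , ℚ.≤-refl , ℚ.nonNegative⁻¹ 1ℚ ,
    trans (cong (λ z → z ℚ.+ 0ℚ ℚ.* x₂) (ℚ.*-identityˡ x₁)) (trans (cong (λ z → x₁ ℚ.+ z) (ℚ.*-zeroˡ x₂))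
      (trans (ℚ.+-identityʳ x₁) (ℚ.≤-antisym h (ℚ.≤-trans k (ℚ.≮⇒≥ x₁≮x₂)))))
  ... | yes x₁<x₂ = t , 0≤t , t≤1 , trans (regroup t x₁ x₂) (trans (cong (λ z → x₁ ℚ.+ z) t*e) (cancel x₁ x))
    where
    e = x₂ ℚ.- x₁
    0<e : 0ℚ ℚ.< e
    0<e = subst (ℚ._< e) (ℚ.+-inverseʳ x₁) (ℚ.+-monoˡ-< (ℚ.- x₁) x₁<x₂)
    instance
      e-positive : ℚ.Positive e
      e-positive = ℚ.positive 0<e
      e-nonZero : ℚ.NonZero e
      e-nonZero = ℚ.pos⇒nonZero e
    t = (x ℚ.- x₁) ℚ.* 1/ e
    t*e : t ℚ.* e ≡ x ℚ.- x₁
    t*e = trans (ℚ.*-assoc (x ℚ.- x₁) (1/ e) e) (trans (cong (λ z → (x ℚ.- x₁) ℚ.* z) (ℚ.*-inverseˡ e)) (ℚ.*-identityʳ (x ℚ.- x₁)))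
    0≤t : 0ℚ ℚ.≤ t
    0≤t = ℚ.*-cancelʳ-≤-pos e (subst₂ ℚ._≤_ (sym (ℚ.*-zeroˡ e)) (sym t*e)
      (subst (ℚ._≤ x ℚ.- x₁) (ℚ.+-inverseʳ x₁) (ℚ.+-monoˡ-≤ (ℚ.- x₁) h)))
    t≤1 : t ℚ.≤ 1ℚ
    t≤1 = ℚ.*-cancelʳ-≤-pos e (subst₂ ℚ._≤_ (sym t*e) (sym (ℚ.*-identityˡ e)) (ℚ.+-monoˡ-≤ (ℚ.- x₁) k))
    regroup : ∀ t a b → (1ℚ ℚ.- t) ℚ.* a ℚ.+ t ℚ.* b ≡ a ℚ.+ t ℚ.* (b ℚ.- a)
    regroup = solve-∀ ℚ-ring
    cancel : ∀ a b → a ℚ.+ (b ℚ.- a) ≡ b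
    cancel = solve-∀ ℚ-ring

  mean-same : ∀ t a → (1ℚ ℚ.- t) ℚ.* a ℚ.+ t ℚ.* a ≡ a
  mean-same = solve-∀ ℚ-ring

module _ {S : Pred Point 0ℓ} where

  horizontal-segment : ∀ {x₁ x₂ x y} → ConvexHull S (x₁ , y) → ConvexHull S (x₂ , y) → x₁ ℚ.≤ x → x ℚ.≤ x₂ → ConvexHull S (x , y)
  horizontal-segment {y = y} p q h k = let t , 0≤t , t≤1 , eq = interpolation h k in
    subst (ConvexHull S) (cong₂ _,_ eq (mean-same t y)) (between t 0≤t t≤1 p q)

  vertical-segment : ∀ {x y₁ y₂ y} → ConvexHull S (x , y₁) → ConvexHull S (x , y₂) → y₁ ℚ.≤ y → y ℚ.≤ y₂ → ConvexHull S (x , y)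
  vertical-segment {x} p q h k = let t , 0≤t , t≤1 , eq = interpolation h k in
    subst (ConvexHull S) (cong₂ _,_ (mean-same t x) eq) (between t 0≤t t≤1 p q)

  rectangle : ∀ {x₁ x₂ y₁ y₂ x y} → ConvexHull S (x₁ , y₁) → ConvexHull S (x₂ , y₁) → ConvexHull S (x₁ , y₂) → ConvexHull S (x₂ , y₂) →
    x₁ ℚ.≤ x → x ℚ.≤ x₂ → y₁ ℚ.≤ y → y ℚ.≤ y₂ → ConvexHull S (x , y)
  rectangle p q p′ q′ h k = vertical-segment (horizontal-segment p q h k) (horizontal-segment p′ q′ h k)

  hull-⊆ : ∀ {T : Pred Point 0ℓ} → T ⊆ ConvexHull S → ConvexHull T ⊆ ConvexHull S
  hull-⊆ h (contains s)            = h s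
  hull-⊆ h (between t 0≤t t≤1 x y) = between t 0≤t t≤1 (hull-⊆ h x) (hull-⊆ h y)

module FrameHull {fr : Frame} (ins : Inside fr) where

  open Frame fr
  open Inside ins
  open Octagon ins
  open Hull ins using (vertices-area)

  private
    cs = frameCells fr

    C : Pred Point 0ℓ
    C = ConvexHull (_∈ map ιP vertices)

    vertex∈ : ∀ {v} → Kept v → v ∈ octagon → C (ιP (locate v))
    vertex∈ k v∈ = contains (∈-map⁺ ιP (∈-map⁺ locate (∈-filter⁺ kept? v∈ k)))

    lr₀ : ∀ {z} → 0ℤ ℤ.≤ z → z ℤ.≤ A ℤ.+ 1ℤ → d ≡ 0 → C (ιP (z , 0ℤ))
    lr₀ h k d≡0 = horizontal-segment (vertex∈ {L true} (inj₁ d≡0) (there (there (there (there (there (there (here refl))))))))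
      (vertex∈ {R false} (inj₁ d≡0) (there (here refl))) (ι-mono-≤ h) (ι-mono-≤ k)

    lr₁ : ∀ {z} → 0ℤ ℤ.≤ z → z ℤ.≤ A ℤ.+ 1ℤ → u ≡ 0 → C (ιP (z , 1ℤ))
    lr₁ h k u≡0 = horizontal-segment (vertex∈ {L false} (inj₁ u≡0) (there (there (there (there (there (here refl)))))))
      (vertex∈ {R true} (inj₁ u≡0) (there (there (here refl)))) (ι-mono-≤ h) (ι-mono-≤ k)

    zero-if : ∀ {n} → ¬ 0 ℕ.< n → n ≡ 0
    zero-if {zero}  _ = refl
    zero-if {suc n} h = ⊥-elim (h (ℕ.s≤s ℕ.z≤n))

    0≤+1 : ∀ k → 0ℤ ℤ.≤ + k ℤ.+ 1ℤ
    0≤+1 k = ℤ.+≤+ ℕ.z≤n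

    +1-mono : ∀ {m n} → m ℕ.≤ n → + m ℤ.+ 1ℤ ℤ.≤ + n ℤ.+ 1ℤ
    +1-mono h = ℤ.+-monoˡ-≤ 1ℤ (ℤ.+≤+ h)

    ≤+1 : ∀ {m n} → m ℕ.≤ n → + m ℤ.≤ + n ℤ.+ 1ℤ
    ≤+1 {m} {n} h = lia 2 (λ m n → m :≤ n ⇒ ⊢ m :≤ n :+ # 1) refl (+ m) (+ n) (ℤ.+≤+ h)

    -- Without a lower leg these points are no vertices but lie on the lower side of the row,
    -- between its ends.
    bottom : ∀ e → C (ιP (locate (B e)))
    bottom e with 0 ℕ.<? d
    bottom false | yes k = vertex∈ {B false} k (there (there (there (there (there (there (there (here refl))))))))
    bottom true  | yes k = vertex∈ {B true} k (here refl)
    bottom false | no  k = subst (λ z → C (ιP (I , z))) (cong (λ k → ℤ.- + k) (sym (zero-if k))) (lr₀ (ℤ.+≤+ ℕ.z≤n) (≤+1 i≤a) (zero-if k))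
    bottom true  | no  k = subst (λ z → C (ιP (I ℤ.+ 1ℤ , z))) (cong (λ k → ℤ.- + k) (sym (zero-if k))) (lr₀ (0≤+1 i) (+1-mono i≤a) (zero-if k))

    top : ∀ e → C (ιP (locate (T e)))
    top e with 0 ℕ.<? u
    top false | yes k = vertex∈ {T false} k (there (there (there (here refl))))
    top true  | yes k = vertex∈ {T true} k (there (there (there (there (here refl)))))
    top false | no  k = subst (λ z → C (ιP (J′ ℤ.+ 1ℤ , z ℤ.+ 1ℤ))) (cong +_ (sym (zero-if k))) (lr₁ (0≤+1 j) (+1-mono j≤a) (zero-if k))
    top true  | no  k = subst (λ z → C (ιP (J′ , z ℤ.+ 1ℤ))) (cong +_ (sym (zero-if k))) (lr₁ (ℤ.+≤+ ℕ.z≤n) (≤+1 j≤a) (zero-if k))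

    -- The ends of the row lie on the sides of the box, between vertices.
    low-right : ∃[ y ] y ℤ.≤ 0ℤ × C (ιP (A ℤ.+ 1ℤ , y))
    low-right with kept? (R false)
    ... | yes k = 0ℤ , ℤ.≤-refl , vertex∈ {R false} k (there (here refl))
    ... | no  k = D , ℤ.neg-mono-≤ (ℤ.+≤+ {0} {d} ℕ.z≤n) ,
      subst (λ z → C (ιP (+ z ℤ.+ 1ℤ , D))) (ℕ.≤-antisym i≤a (ℕ.≮⇒≥ (λ h → k (inj₂ h)))) (bottom true)

    high-right : ∃[ y ] 1ℤ ℤ.≤ y × C (ιP (A ℤ.+ 1ℤ , y))
    high-right with kept? (R true)
    ... | yes k = 1ℤ , ℤ.≤-refl , vertex∈ {R true} k (there (there (here refl)))
    ... | no  k = U ℤ.+ 1ℤ , +1-mono (ℕ.z≤n {u}) ,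
      subst (λ z → C (ιP (+ z ℤ.+ 1ℤ , U ℤ.+ 1ℤ))) (ℕ.≤-antisym j≤a (ℕ.≮⇒≥ (λ h → k (inj₂ h)))) (top false)

    low-left : ∃[ y ] y ℤ.≤ 0ℤ × C (ιP (0ℤ , y))
    low-left with kept? (L true)
    ... | yes k = 0ℤ , ℤ.≤-refl , vertex∈ {L true} k (there (there (there (there (there (there (here refl)))))))
    ... | no  k = D , ℤ.neg-mono-≤ (ℤ.+≤+ {0} {d} ℕ.z≤n) ,
      subst (λ z → C (ιP (+ z , D))) (zero-if (λ h → k (inj₂ h))) (bottom false)

    high-left : ∃[ y ] 1ℤ ℤ.≤ y × C (ιP (0ℤ , y))
    high-left with kept? (L false)
    ... | yes k = 1ℤ , ℤ.≤-refl , vertex∈ {L false} k (there (there (there (there (there (here refl))))))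
    ... | no  k = U ℤ.+ 1ℤ , +1-mono (ℕ.z≤n {u}) ,
      subst (λ z → C (ιP (+ z , U ℤ.+ 1ℤ))) (zero-if (λ h → k (inj₂ h))) (top true)

    side : ∀ {x y} → (∃[ y₁ ] y₁ ℤ.≤ 0ℤ × C (ιP (x , y₁))) → (∃[ y₂ ] 1ℤ ℤ.≤ y₂ × C (ιP (x , y₂))) → 0ℤ ℤ.≤ y → y ℤ.≤ 1ℤ → C (ιP (x , y))
    side (y₁ , h₁ , c₁) (y₂ , h₂ , c₂) h k = vertical-segment c₁ c₂ (ι-mono-≤ (ℤ.≤-trans h₁ h)) (ι-mono-≤ (ℤ.≤-trans k h₂))

    row-⊆ : ∀ {x y} → ι 0ℤ ℚ.≤ x → x ℚ.≤ ι (A ℤ.+ 1ℤ) → ι 0ℤ ℚ.≤ y → y ℚ.≤ ι 1ℤ → C (x , y)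
    row-⊆ = rectangle (side {0ℤ} {0ℤ} low-left high-left ℤ.≤-refl (ℤ.+≤+ ℕ.z≤n))
      (side {A ℤ.+ 1ℤ} {0ℤ} low-right high-right ℤ.≤-refl (ℤ.+≤+ ℕ.z≤n))
      (side {0ℤ} {1ℤ} low-left high-left (ℤ.+≤+ ℕ.z≤n) ℤ.≤-refl)
      (side {A ℤ.+ 1ℤ} {1ℤ} low-right high-right (ℤ.+≤+ ℕ.z≤n) ℤ.≤-refl)

    row-ι : ∀ {x y} → 0ℤ ℤ.≤ x → x ℤ.≤ A ℤ.+ 1ℤ → 0ℤ ℤ.≤ y → y ℤ.≤ 1ℤ → C (ιP (x , y))
    row-ι h k h′ k′ = row-⊆ (ι-mono-≤ h) (ι-mono-≤ k) (ι-mono-≤ h′) (ι-mono-≤ k′)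

    suc-mono-ι : ∀ {x y} → x ℤ.≤ y → ι (x ℤ.+ 1ℤ) ℚ.≤ ι (y ℤ.+ 1ℤ)
    suc-mono-ι h = ι-mono-≤ (ℤ.+-monoˡ-≤ 1ℤ h)

    cell-⊆ : ∀ {x y p q} → InZed (frameZed fr) (x , y) → ι x ℚ.≤ p → p ℚ.≤ ι (x ℤ.+ 1ℤ) → ι y ℚ.≤ q → q ℚ.≤ ι (y ℤ.+ 1ℤ) → C (p , q)
    cell-⊆ (row refl h k) h₁ h₂ h₃ h₄ = row-⊆ (ℚ.≤-trans (ι-mono-≤ h) h₁) (ℚ.≤-trans h₂ (suc-mono-ι k)) h₃ h₄
    cell-⊆ {x} {y} (lower refl h k) h₁ h₂ h₃ h₄ = rectangle (bottom false) (bottom true)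
      (row-ι (ℤ.+≤+ ℕ.z≤n) (≤+1 i≤a) (ℤ.+≤+ ℕ.z≤n) ℤ.≤-refl) (row-ι (0≤+1 i) (+1-mono i≤a) (ℤ.+≤+ ℕ.z≤n) ℤ.≤-refl)
      h₁ h₂ (ℚ.≤-trans (ι-mono-≤ h) h₃) (ℚ.≤-trans h₄ (suc-mono-ι k))
    cell-⊆ {x} {y} (upper refl h k) h₁ h₂ h₃ h₄ = rectangle
      (row-ι (ℤ.+≤+ ℕ.z≤n) (≤+1 j≤a) ℤ.≤-refl (ℤ.+≤+ ℕ.z≤n)) (row-ι (0≤+1 j) (+1-mono j≤a) ℤ.≤-refl (ℤ.+≤+ ℕ.z≤n)) (top true) (top false)
      h₁ h₂ (ℚ.≤-trans (ι-mono-≤ h) h₃) (ℚ.≤-trans h₄ (suc-mono-ι k))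

    union-⊆ : InUnion cs ⊆ C
    union-⊆ ((x , y) , c∈ , ((h₁ , h₂) , (h₃ , h₄))) = cell-⊆ (frame-∈⁻ ins c∈) h₁ h₂ h₃ h₄

    corner : ∀ {x y X Y} → InZed (frameZed fr) (x , y) → x ℤ.≤ X → X ℤ.≤ x ℤ.+ 1ℤ → y ℤ.≤ Y → Y ℤ.≤ y ℤ.+ 1ℤ → InUnion cs (ιP (X , Y))
    corner {x} {y} z h₁ h₂ h₃ h₄ = (x , y) , frame-∈⁺ ins z , (ι-mono-≤ h₁ , ι-mono-≤ h₂) , (ι-mono-≤ h₃ , ι-mono-≤ h₄)

    ≤1 : ∀ {x} → x ℤ.≤ x ℤ.+ 1ℤ
    ≤1 {x} = ℤ.i≤i+j x 1ℤ

    D≤0 : D ℤ.≤ 0ℤ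
    D≤0 = ℤ.neg-mono-≤ (ℤ.+≤+ {0} {d} ℕ.z≤n)

    locate-∈ : ∀ v → InUnion cs (ιP (locate v))
    locate-∈ (B false) = corner (lower refl ℤ.≤-refl D≤0) ℤ.≤-refl ≤1 ℤ.≤-refl ≤1
    locate-∈ (B true)  = corner (lower refl ℤ.≤-refl D≤0) ≤1 ℤ.≤-refl ℤ.≤-refl ≤1
    locate-∈ (R false) = corner (row refl (ℤ.+≤+ (ℕ.z≤n {a})) ℤ.≤-refl) ≤1 ℤ.≤-refl ℤ.≤-refl (ℤ.+≤+ ℕ.z≤n)
    locate-∈ (R true)  = corner (row refl (ℤ.+≤+ (ℕ.z≤n {a})) ℤ.≤-refl) ≤1 ℤ.≤-refl (ℤ.+≤+ ℕ.z≤n) ℤ.≤-refl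
    locate-∈ (T false) = corner (upper refl (ℤ.+≤+ (ℕ.z≤n {u})) ℤ.≤-refl) ≤1 ℤ.≤-refl ≤1 ℤ.≤-refl
    locate-∈ (T true)  = corner (upper refl (ℤ.+≤+ (ℕ.z≤n {u})) ℤ.≤-refl) ℤ.≤-refl ≤1 ≤1 ℤ.≤-refl
    locate-∈ (L false) = corner (row refl ℤ.≤-refl (ℤ.+≤+ ℕ.z≤n)) ℤ.≤-refl (ℤ.+≤+ ℕ.z≤n) (ℤ.+≤+ ℕ.z≤n) ℤ.≤-refl
    locate-∈ (L true)  = corner (row refl ℤ.≤-refl (ℤ.+≤+ ℕ.z≤n)) ℤ.≤-refl (ℤ.+≤+ ℕ.z≤n) ℤ.≤-refl (ℤ.+≤+ ℕ.z≤n)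

    vertices-⊆ : (_∈ map ιP vertices) ⊆ ConvexHull (InUnion cs)
    vertices-⊆ p∈ with ∈-map⁻ ιP p∈
    ... | w , w∈ , refl with ∈-map⁻ locate w∈
    ...   | v , _ , refl = contains (locate-∈ v)

  frame-hasArea : HasArea (ConvexHull (InUnion cs)) (½ ℚ.* ι (doubleMax a (d ℕ.+ u)))
  frame-hasArea = map ιP vertices , ccw-ι⁺ vertices vertices-ccw ,
    ((λ {x} → hull-⊆ (λ {x} → union-⊆ {x}) {x}) , (λ {x} → hull-⊆ (λ {x} → vertices-⊆ {x}) {x})) ,
    trans (polygonArea-ι vertices) (cong (λ z → ½ ℚ.* ι z) vertices-area)
    where
    ccw-ι⁺ : ∀ ws → Counterclockwiseℤ ws → Counterclockwise (map ιP ws)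
    ccw-ι⁺ []       _       = tt
    ccw-ι⁺ (p ∷ ps) (h , k) =
      AllPairs.map⁺ (AllPairs.map (λ {q} {r} pos → subst (0ℚ ℚ.<_) (sym (orientation-ι p q r)) (ι-mono-< pos)) h) , ccw-ι⁺ ps k

-- Congruence

act-inverseˡ : ∀ g c → act (inverse g) (act g c) ≡ c
act-inverseˡ (translation a b) (x , y) = cong₂ _,_ (lia 2 (λ x a → ⊢ x :+ a :+ :- a := x) refl x a) (lia 2 (λ x a → ⊢ x :+ a :+ :- a := x) refl y b)
act-inverseˡ quarterTurn       (x , y) = cong₂ _,_ (lia 1 (λ x → ⊢ :- (:- x :- # 1) :- # 1 := x) refl x) (lia 1 (λ x → ⊢ :- (:- x :- # 1) :- # 1 := x) refl y)
act-inverseˡ reflection        (x , y) = cong (_, y) (lia 1 (λ x → ⊢ :- (:- x :- # 1) :- # 1 := x) refl x)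
act-inverseˡ (g after h)       c       = trans (cong (act (inverse h)) (act-inverseˡ g (act h c))) (act-inverseˡ h c)

act-inverseʳ : ∀ g c → act g (act (inverse g) c) ≡ c
act-inverseʳ (translation a b) (x , y) = cong₂ _,_ (lia 2 (λ x a → ⊢ x :+ :- a :+ a := x) refl x a) (lia 2 (λ x a → ⊢ x :+ :- a :+ a := x) refl y b)
act-inverseʳ quarterTurn       (x , y) = cong₂ _,_ (lia 1 (λ x → ⊢ :- (:- x :- # 1) :- # 1 := x) refl x) (lia 1 (λ x → ⊢ :- (:- x :- # 1) :- # 1 := x) refl y)
act-inverseʳ reflection        (x , y) = cong (_, y) (lia 1 (λ x → ⊢ :- (:- x :- # 1) :- # 1 := x) refl x)
act-inverseʳ (g after h)       c       = trans (cong (act g) (act-inverseʳ h (act (inverse g) c))) (act-inverseʳ g c)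

-- Congruence for sets given by predicates, so that a polyomino can be compared with a shape
-- described by inequalities.
record Similar (S T : Cell → Set) : Set where
  constructor similar
  field
    symmetry : GridSymmetry
    to       : ∀ {c} → S c → T (act symmetry c)
    from     : ∀ {c} → T (act symmetry c) → S c

similar-≐ : ∀ {S T : Cell → Set} → (∀ {c} → S c → T c) → (∀ {c} → T c → S c) → Similar S T
similar-≐ {S} {T} to from = similar (translation 0ℤ 0ℤ)
  (λ {c} s → subst T (sym (cong₂ _,_ (ℤ.+-identityʳ (proj₁ c)) (ℤ.+-identityʳ (proj₂ c)))) (to s))
  (λ {c} t → from (subst T (cong₂ _,_ (ℤ.+-identityʳ (proj₁ c)) (ℤ.+-identityʳ (proj₂ c))) t))

similar-refl : ∀ {S} → Similar S S
similar-refl {S} = similar-≐ {S} (λ s → s) (λ s → s)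

similar-sym : ∀ {S T} → Similar S T → Similar T S
similar-sym {S} {T} (similar g to from) = similar (inverse g)
  (λ {c} t → from (subst T (sym (act-inverseʳ g c)) t))
  (λ {c} s → subst T (act-inverseʳ g c) (to s))

similar-trans : ∀ {S T U} → Similar S T → Similar T U → Similar S U
similar-trans (similar g to from) (similar h to′ from′) = similar (h after g) (λ s → to′ (to s)) (λ u → from (from′ u))

similar-via : ∀ g (ρ : Cell → Cell) → (∀ c → act g c ≡ ρ c) → ∀ {S} → Similar (λ c → S (ρ c)) S
similar-via g ρ eq {S} = similar g (λ {c} → subst S (sym (eq c))) (λ {c} → subst S (eq c))

similar-flipX : ∀ {S} → Similar (λ c → S (flipX c)) S
similar-flipX = similar-via (translation 1ℤ 0ℤ after reflection) flipX
  (λ (x , y) → cong₂ _,_ (lia 1 (λ x → ⊢ :- x :- # 1 :+ # 1 := :- x) refl x) (ℤ.+-identityʳ y))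

similar-swap : ∀ {S} → Similar (λ c → S (swap c)) S
similar-swap = similar-via (reflection after quarterTurn) swap
  (λ (x , y) → cong (_, x) (lia 1 (λ y → ⊢ :- (:- y :- # 1) :- # 1 := y) refl y))

similar-flipY : ∀ {S} → Similar (λ c → S (flipY c)) S
similar-flipY {S} = similar-trans (similar-swap {λ c → S (flipY (swap c))})
  (similar-trans (similar-flipX {λ c → S (swap c)}) similar-swap)

congruent⇒similar : ∀ {n} {P Q : Polyomino n} → Congruent P Q → Similar (_∈ cells P) (_∈ cells Q)
congruent⇒similar {P = P} {Q} (g , p) = similar g
  (λ c∈ → ∈-resp-↭ p (∈-map⁺ (act g) c∈))
  (λ gc∈ → let d , d∈ , eq = ∈-map⁻ (act g) (∈-resp-↭ (↭-sym p) gc∈) in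
    subst (_∈ cells P) (trans (sym (act-inverseˡ g d)) (trans (cong (act (inverse g)) (sym eq)) (act-inverseˡ g _))) d∈)

similar⇒congruent : ∀ {n} {P Q : Polyomino n} → Similar (_∈ cells P) (_∈ cells Q) → Congruent P Q
similar⇒congruent {P = P} {Q} (similar g to from) = g , ∼bag⇒↭ (unique∧set⇒bag
  (Unique.map⁺ (λ {c} {d} eq → trans (sym (act-inverseˡ g c)) (trans (cong (act (inverse g)) eq) (act-inverseˡ g d))) (unique P)) (unique Q)
  (λ {c} → mk⇔
    (λ c∈ → let d , d∈ , eq = ∈-map⁻ (act g) c∈ in subst (_∈ cells Q) (sym eq) (to d∈))
    (λ c∈ → subst (_∈ map (act g) (cells P)) (act-inverseʳ g c)
      (∈-map⁺ (act g) (from (subst (_∈ cells Q) (sym (act-inverseʳ g c)) c∈))))))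

-- The differences α = i - l, α′ = r - i, β = j - l, β′ = r - j, δ = h - b, γ = t - h
-- of the parameters of a Zed determine it up to translation.

record Kind : Set where
  constructor kind
  field
    α α′ β β′ δ γ : ℤ

mirrorKindX mirrorKindY : Kind → Kind
mirrorKindX (kind α α′ β β′ δ γ) = kind α′ α β′ β δ γ
mirrorKindY (kind α α′ β β′ δ γ) = kind β β′ α α′ γ δ

kindOf : Zed → Kind
kindOf (zed l r h b t i j) = kind (i ℤ.- l) (r ℤ.- i) (j ℤ.- l) (r ℤ.- j) (h ℤ.- b) (t ℤ.- h)

record HasKind (S : Cell → Set) (k : Kind) : Set where
  constructor hasKind
  field
    z     : Zed
    ok    : Valid z
    kind≡ : kindOf z ≡ k
    to    : ∀ {c} → S c → InZed z c
    from  : ∀ {c} → InZed z c → S c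

kind-cong : ∀ {α α′ β β′ δ γ ᾱ ᾱ′ β̄ β̄′ δ̄ γ̄} → α ≡ ᾱ → α′ ≡ ᾱ′ → β ≡ β̄ → β′ ≡ β̄′ → δ ≡ δ̄ → γ ≡ γ̄ →
            kind α α′ β β′ δ γ ≡ kind ᾱ ᾱ′ β̄ β̄′ δ̄ γ̄
kind-cong refl refl refl refl refl refl = refl

private
  neg-difference₂ : ∀ x y → ℤ.- x ℤ.- (ℤ.- y) ≡ y ℤ.- x
  neg-difference₂ = λ x y → lia 2 (λ x y → ⊢ :- x :- :- y := y :- x) refl x y

hasKind-flipX : ∀ {S k} → HasKind S k → HasKind (λ c → S (flipX c)) (mirrorKindX k)
hasKind-flipX {S} (hasKind z ok refl to from) = hasKind (IsZed.z flipped) (IsZed.ok flipped) (kind-cong (neg-difference₂ i r) (neg-difference₂ l i) (neg-difference₂ j r) (neg-difference₂ l j) refl refl)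
  (IsZed.to flipped) (IsZed.from flipped)
  where
  open Zed z
  flipped = isZed-flipX {S} (isZed z ok refl refl to from)

hasKind-flipY : ∀ {S k} → HasKind S k → HasKind (λ c → S (flipY c)) (mirrorKindY k)
hasKind-flipY {S} (hasKind z ok refl to from) = hasKind (IsZed.z flipped) (IsZed.ok flipped) (kind-cong refl refl refl refl (neg-difference₂ h t) (neg-difference₂ b h))
  (IsZed.to flipped) (IsZed.from flipped)
  where
  open Zed z
  flipped = isZed-flipY {S} (isZed z ok refl refl to from)

shiftZed : ℤ → ℤ → Zed → Zed
shiftZed m n (zed l r h b t i j) = zed (l ℤ.- m) (r ℤ.- m) (h ℤ.- n) (b ℤ.- n) (t ℤ.- n) (i ℤ.- m) (j ℤ.- m)

private
  shift-≤ : ∀ {x y} m → x ℤ.+ m ℤ.≤ y → x ℤ.≤ y ℤ.- m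
  shift-≤ {x} {y} m = lia 3 (λ x y m → x :+ m :≤ y ⇒ ⊢ x :≤ y :- m) refl x y m

  shift-≤′ : ∀ {x y} m → y ℤ.≤ x ℤ.+ m → y ℤ.- m ℤ.≤ x
  shift-≤′ {x} {y} m = lia 3 (λ x y m → y :≤ x :+ m ⇒ ⊢ y :- m :≤ x) refl x y m

  shift-≡ : ∀ {x y} m → x ℤ.+ m ≡ y → x ≡ y ℤ.- m
  shift-≡ {x} {y} m = lia 3 (λ x y m → x :+ m := y ⇒ ⊢ x := y :- m) refl x y m

  unshift-≤ : ∀ {x y} m → x ℤ.≤ y ℤ.- m → x ℤ.+ m ℤ.≤ y
  unshift-≤ {x} {y} m = lia 3 (λ x y m → x :≤ y :- m ⇒ ⊢ x :+ m :≤ y) refl x y m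

  unshift-≤′ : ∀ {x y} m → y ℤ.- m ℤ.≤ x → y ℤ.≤ x ℤ.+ m
  unshift-≤′ {x} {y} m = lia 3 (λ x y m → y :- m :≤ x ⇒ ⊢ y :≤ x :+ m) refl x y m

  unshift-≡ : ∀ {x y} m → x ≡ y ℤ.- m → x ℤ.+ m ≡ y
  unshift-≡ {x} {y} m = lia 3 (λ x y m → x := y :- m ⇒ ⊢ x :+ m := y) refl x y m

shift-to : ∀ z m n {x y} → InZed z (x ℤ.+ m , y ℤ.+ n) → InZed (shiftZed m n z) (x , y)
shift-to z m n (row e p q)   = row (shift-≡ n e) (shift-≤′ m p) (shift-≤ m q)
shift-to z m n (lower e p q) = lower (shift-≡ m e) (shift-≤′ n p) (shift-≤ n q)
shift-to z m n (upper e p q) = upper (shift-≡ m e) (shift-≤′ n p) (shift-≤ n q)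

shift-from : ∀ z m n {x y} → InZed (shiftZed m n z) (x , y) → InZed z (x ℤ.+ m , y ℤ.+ n)
shift-from z m n (row e p q)   = row (unshift-≡ n e) (unshift-≤′ m p) (unshift-≤ m q)
shift-from z m n (lower e p q) = lower (unshift-≡ m e) (unshift-≤′ n p) (unshift-≤ n q)
shift-from z m n (upper e p q) = upper (unshift-≡ m e) (unshift-≤′ n p) (unshift-≤ n q)

private
  difference-shift : ∀ x y m → x ℤ.- m ℤ.- (y ℤ.- m) ≡ x ℤ.- y
  difference-shift = λ x y m → lia 3 (λ x y m → ⊢ x :- m :- (y :- m) := x :- y) refl x y m

shift-valid : ∀ {z} m n → Valid z → Valid (shiftZed m n z)
shift-valid m n (valid a b c d e f) = valid (mono m a) (mono m b) (mono m c) (mono m d) (mono n e) (mono n f)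
  where
  mono : ∀ {x y} m → x ℤ.≤ y → x ℤ.- m ℤ.≤ y ℤ.- m
  mono m = ℤ.+-monoˡ-≤ (ℤ.- m)

hasKind-shift : ∀ {S k} m n → HasKind S k → HasKind (λ (x , y) → S (x ℤ.+ m , y ℤ.+ n)) k
hasKind-shift m n (hasKind z ok refl to from) = hasKind (shiftZed m n z) (shift-valid m n ok)
  (kind-cong (difference-shift i l m) (difference-shift r i m) (difference-shift j l m) (difference-shift r j m)
    (difference-shift h b n) (difference-shift t h n))
  (λ s → shift-to z m n (to s)) (λ s → from (shift-from z m n s))
  where open Zed z

hasKind-resp : ∀ {S T : Cell → Set} {k} → (∀ {c} → S c → T c) → (∀ {c} → T c → S c) → HasKind S k → HasKind T k
hasKind-resp f g (hasKind z ok eq to from) = hasKind z ok eq (λ t → to (g t)) (λ s → f (from s))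

data Orbit (k : Kind) : Kind → Set where
  as-is   : Orbit k k
  flip-x  : Orbit k (mirrorKindX k)
  flip-y  : Orbit k (mirrorKindY k)
  flip-xy : Orbit k (mirrorKindX (mirrorKindY k))

private
  orbit-X : ∀ {k k′} → Orbit k k′ → Orbit k (mirrorKindX k′)
  orbit-X as-is   = flip-x
  orbit-X flip-x  = as-is
  orbit-X flip-y  = flip-xy
  orbit-X flip-xy = flip-y

  orbit-Y : ∀ {k k′} → Orbit k k′ → Orbit k (mirrorKindY k′)
  orbit-Y as-is   = flip-y
  orbit-Y flip-x  = flip-xy
  orbit-Y flip-y  = as-is
  orbit-Y flip-xy = flip-x

-- Up to translation the grid has the eight symmetries of the square: the four combinations of
-- mirror images in `Orbit`, with or without a transposition.
HasKind± : (Cell → Set) → Kind → Set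
HasKind± S k = ∃[ k′ ] Orbit k k′ × (HasKind S k′ ⊎ HasKind (λ c → S (swap c)) k′)

private
  ±-resp : ∀ {S T : Cell → Set} {k} → (∀ {c} → S c → T c) → (∀ {c} → T c → S c) → HasKind± S k → HasKind± T k
  ±-resp f g (k′ , o , inj₁ h) = k′ , o , inj₁ (hasKind-resp f g h)
  ±-resp f g (k′ , o , inj₂ h) = k′ , o , inj₂ (hasKind-resp f g h)

  ±-flipX : ∀ {S k} → HasKind± S k → HasKind± (λ c → S (flipX c)) k
  ±-flipX (k′ , o , inj₁ h) = _ , orbit-X o , inj₁ (hasKind-flipX h)
  ±-flipX (k′ , o , inj₂ h) = _ , orbit-Y o , inj₂ (hasKind-flipY h)

  ±-shift : ∀ {S k} m n → HasKind± S k → HasKind± (λ (x , y) → S (x ℤ.+ m , y ℤ.+ n)) k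
  ±-shift m n (k′ , o , inj₁ h) = k′ , o , inj₁ (hasKind-shift m n h)
  ±-shift m n (k′ , o , inj₂ h) = k′ , o , inj₂ (hasKind-shift n m h)

  ±-swap : ∀ {S k} → HasKind± S k → HasKind± (λ c → S (swap c)) k
  ±-swap (k′ , o , h) = k′ , o , Sum.swap h

  ±-reflection : ∀ {S k} → HasKind± S k → HasKind± (λ c → S (act reflection c)) k
  ±-reflection {S} h = ±-resp {λ (x , y) → S (ℤ.- x ℤ.+ -[1+ 0 ] , y ℤ.+ 0ℤ)}
    (λ { {x , y} → subst (λ z → S (ℤ.- x ℤ.- 1ℤ , z)) (ℤ.+-identityʳ y) })
    (λ { {x , y} → subst (λ z → S (ℤ.- x ℤ.- 1ℤ , z)) (sym (ℤ.+-identityʳ y)) })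
    (±-flipX (±-shift -[1+ 0 ] 0ℤ h))

-- A symmetry is an arbitrary word in the generators. Following a kind back through the word leaves
-- eight cases to be compared.
pull : ∀ g {S k} → HasKind± S k → HasKind± (λ c → S (act g c)) k
pull (translation a b) h = ±-shift a b h
pull reflection        h = ±-reflection h
pull quarterTurn   {S} h = ±-resp {λ c → S (act reflection (swap c))} (λ s → s) (λ s → s) (±-swap (±-reflection h))
pull (g after g′)      h = pull g′ (pull g h)

-- The legs of a code are attached l columns from the left and r columns from the
-- right end of the row, D columns apart; the lower leg is the left one.

record Code : Set where
  constructor code
  field
    l r D d u : ℕ

codeFrame : Code → Frame
codeFrame (code l r D d u) = frame (l ℕ.+ (D ℕ.+ r)) d u l (l ℕ.+ D)

code-inside : ∀ c → Inside (codeFrame c)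
code-inside (code l r D d u) = inside (ℕ.m≤m+n l (D ℕ.+ r)) (ℕ.+-monoʳ-≤ l (ℕ.m≤m+n D r))

InCode : Code → Cell → Set
InCode c = InZed (frameZed (codeFrame c))

codeKind : Code → Kind
codeKind (code l r D d u) = kind (+ l) (+ (D ℕ.+ r)) (+ (l ℕ.+ D)) (+ r) (+ d) (+ u)

code-hasKind : ∀ c → HasKind (InCode c) (codeKind c)
code-hasKind c@(code l r D d u) = hasKind (frameZed (codeFrame c))
  (valid (ℤ.+≤+ ℕ.z≤n) (ℤ.+≤+ (Inside.i≤a (code-inside c))) (ℤ.+≤+ ℕ.z≤n) (ℤ.+≤+ (Inside.j≤a (code-inside c)))
    (ℤ.neg-mono-≤ (ℤ.+≤+ {0} {d} ℕ.z≤n)) (ℤ.+≤+ ℕ.z≤n))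
  (kind-cong (ℤ.+-identityʳ (+ l)) (lia 3 (λ l r D → ⊢ l :+ (D :+ r) :- l := D :+ r) refl (+ l) (+ r) (+ D))
    (ℤ.+-identityʳ (+ (l ℕ.+ D))) (lia 3 (λ l r D → ⊢ l :+ (D :+ r) :- (l :+ D) := r) refl (+ l) (+ r) (+ D))
    (lia 1 (λ d → ⊢ # 0 :- (:- d) := d) refl (+ d)) (ℤ.+-identityʳ (+ u)))
  (λ s → s) (λ s → s)

private
  zed-cong : ∀ {l r h b t i j l̄ r̄ h̄ b̄ t̄ ī j̄} → l ≡ l̄ → r ≡ r̄ → h ≡ h̄ → b ≡ b̄ → t ≡ t̄ → i ≡ ī → j ≡ j̄ →
             zed l r h b t i j ≡ zed l̄ r̄ h̄ b̄ t̄ ī j̄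
  zed-cong refl refl refl refl refl refl refl = refl

kind-similar : ∀ {S} c → HasKind S (codeKind c) → Similar S (InCode c)
kind-similar {S} c@(code l₀ r₀ D d u) (hasKind z@(zed l r h b t i j) _ eq to from) = similar (translation (ℤ.- l) (ℤ.- h))
  (λ { {x , y} s → subst (λ z → InZed z (x ℤ.- l , y ℤ.- h)) shifted
         (shift-to z l h (subst (InZed z) (sym (cong₂ _,_ (cancel x l) (cancel y h))) (to s))) })
  (λ { {x , y} s → from (subst (InZed z) (cong₂ _,_ (cancel x l) (cancel y h))
         (shift-from z l h (subst (λ z → InZed z (x ℤ.- l , y ℤ.- h)) (sym shifted) s))) })
  where
  cancel : ∀ x l → x ℤ.- l ℤ.+ l ≡ x
  cancel = λ x l → lia 2 (λ x l → ⊢ x :- l :+ l := x) refl x l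
  shifted : shiftZed l h z ≡ frameZed (codeFrame c)
  shifted = zed-cong (ℤ.+-inverseʳ l)
    (lia 5 (λ i l r a b → i :- l := a ⇒ r :- i := b ⇒ ⊢ r :- l := a :+ b) refl i l r (+ l₀) (+ (D ℕ.+ r₀)) (cong Kind.α eq) (cong Kind.α′ eq))
    (ℤ.+-inverseʳ h)
    (lia 3 (λ h b d → h :- b := d ⇒ ⊢ b :- h := :- d) refl h b (+ d) (cong Kind.δ eq))
    (cong Kind.γ eq) (cong Kind.α eq) (cong Kind.β eq)

private
  kind-flipX : ∀ c c′ → mirrorKindX (codeKind c) ≡ codeKind c′ → Similar (InCode c) (InCode c′)
  kind-flipX c c′ eq = similar-trans (similar-sym similar-flipX)
    (kind-similar c′ (subst (HasKind (λ x → InCode c (flipX x))) eq (hasKind-flipX (code-hasKind c))))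

  kind-flipY : ∀ c c′ → mirrorKindY (codeKind c) ≡ codeKind c′ → Similar (InCode c) (InCode c′)
  kind-flipY c c′ eq = similar-trans (similar-sym similar-flipY)
    (kind-similar c′ (subst (HasKind (λ x → InCode c (flipY x))) eq (hasKind-flipY (code-hasKind c))))

  cross-flipX : ∀ l r d u → Similar (InCode (code l r 0 d u)) (InCode (code r l 0 d u))
  cross-flipX l r d u = kind-flipX _ _ (kind-cong refl refl (cong +_ (sym (ℕ.+-identityʳ r))) (cong +_ (ℕ.+-identityʳ l)) refl refl)

  cross-flipY : ∀ l r d u → Similar (InCode (code l r 0 d u)) (InCode (code l r 0 u d))
  cross-flipY l r d u = kind-flipY _ _ (kind-cong (cong +_ (ℕ.+-identityʳ l)) refl (cong +_ (sym (ℕ.+-identityʳ l))) refl refl refl)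

  -- The half turn keeps the lower leg on the left, while it exchanges the ends of the row and the
  -- two legs. The order required in `zee` chooses between a shape and its half turn.
  code-turn : ∀ l r D d u → Similar (InCode (code l r D d u)) (InCode (code r l D u d))
  code-turn l r D d u = similar-trans (similar-sym similar-flipY) (similar-trans (similar-sym similar-flipX)
    (kind-similar (code r l D u d) (subst (HasKind _) eq (hasKind-flipX (hasKind-flipY (code-hasKind (code l r D d u)))))))
    where
    eq : mirrorKindX (mirrorKindY (codeKind (code l r D d u))) ≡ codeKind (code r l D u d)
    eq = kind-cong refl (cong +_ (ℕ.+-comm l D)) (cong +_ (ℕ.+-comm D r)) refl refl refl

  -- Both legs stand in one column, so after reflection in the diagonal they form a row and the arms
  -- become its legs.
  cross-swap : ∀ l r d u → Similar (InCode (code l r 0 d u)) (InCode (code d u 0 l r))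
  cross-swap l r d u = similar-trans (similar-sym similar-swap) (kind-similar (code d u 0 l r) (hasKind
    (zed (ℤ.- + d) (+ u) (+ l) 0ℤ (+ (l ℕ.+ r)) 0ℤ 0ℤ)
    (valid d≤0 (ℤ.+≤+ ℕ.z≤n) d≤0 (ℤ.+≤+ ℕ.z≤n) (ℤ.+≤+ ℕ.z≤n) (ℤ.+≤+ (ℕ.m≤m+n l r)))
    (kind-cong (lia 1 (λ d → ⊢ # 0 :- :- d := d) refl (+ d)) (ℤ.+-identityʳ (+ u))
      (trans (lia 1 (λ d → ⊢ # 0 :- :- d := d) refl (+ d)) (cong +_ (sym (ℕ.+-identityʳ d)))) (ℤ.+-identityʳ (+ u))
      (ℤ.+-identityʳ (+ l)) (lia 2 (λ l r → ⊢ l :+ r :- l := r) refl (+ l) (+ r)))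
    (λ { (row e p q) → to-row e p q ; (lower e p q) → row (trans e refl) p (ℤ.≤-trans q (ℤ.+≤+ ℕ.z≤n))
       ; (upper e p q) → row (trans e (cong +_ (ℕ.+-identityʳ l))) (ℤ.≤-trans d≤0 p) q })
    λ { (row refl p q) → from-row p q ; (lower e p q) → row e p (ℤ.≤-trans q (ℤ.+≤+ (ℕ.m≤m+n l r)))
      ; (upper e p q) → row e (ℤ.≤-trans (ℤ.+≤+ ℕ.z≤n) p) q }))
    where
    d≤0 : ℤ.- + d ℤ.≤ 0ℤ
    d≤0 = ℤ.neg-mono-≤ (ℤ.+≤+ {0} {d} ℕ.z≤n)
    to-row : ∀ {x y} → x ≡ 0ℤ → 0ℤ ℤ.≤ y → y ℤ.≤ + (l ℕ.+ r) → InZed (zed (ℤ.- + d) (+ u) (+ l) 0ℤ (+ (l ℕ.+ r)) 0ℤ 0ℤ) (x , y)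
    to-row {x} {y} e p q with ℤ.≤-total y (+ l)
    ... | inj₁ y≤l = lower e p y≤l
    ... | inj₂ l≤y = upper e l≤y q
    from-row : ∀ {x} → ℤ.- + d ℤ.≤ x → x ℤ.≤ + u → InCode (code l r 0 d u) (+ l , x)
    from-row {x} p q with ℤ.≤-total x 0ℤ
    ... | inj₁ x≤0 = lower refl p x≤0
    ... | inj₂ 0≤x = upper (cong +_ (sym (ℕ.+-identityʳ l))) 0≤x q

-- Every shape has a canonical code.

private
  natural : ∀ {z} → 0ℤ ℤ.≤ z → ∃[ n ] z ≡ + n
  natural {+ n} _ = n , refl

  difference : ∀ {x y} → x ℤ.≤ y → ∃[ n ] y ℤ.- x ≡ + n
  difference h = natural (ℤ.i≤j⇒0≤j-i h)

Raw : Code → Set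
Raw c = D ≡ 0 ⊎ (0 ℕ.< D × 0 ℕ.< d × 0 ℕ.< u)
  where open Code c

record Coded (S : Cell → Set) (m n : ℤ) : Set where
  constructor coded
  field
    c    : Code
    raw  : Raw c
  open Code c
  field
    m≡   : m ≡ + (l ℕ.+ (D ℕ.+ r))
    n≡   : n ≡ + (d ℕ.+ u)
    like : Similar S (InCode c)

private
  straight : ∀ {S} (z : Zed) (let open Zed z) → Valid z → i ≡ j → (∀ {c} → S c → InZed z c) → (∀ {c} → InZed z c → S c) →
             Coded S (r ℤ.- l) (t ℤ.- b)
  straight {S} z@(zed l r h b t i j) ok@(valid l≤i i≤r _ _ b≤h h≤t) refl to from
    with α , eα ← difference l≤i | α′ , eα′ ← difference i≤r | δ , eδ ← difference b≤h | γ , eγ ← difference h≤t =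
    coded (code α α′ 0 δ γ) (inj₁ refl)
      (lia 5 (λ i l r a b → i :- l := a ⇒ r :- i := b ⇒ ⊢ r :- l := a :+ b) refl i l r (+ α) (+ α′) eα eα′)
      (lia 5 (λ h b t d u → h :- b := d ⇒ t :- h := u ⇒ ⊢ t :- b := d :+ u) refl h b t (+ δ) (+ γ) eδ eγ)
      (kind-similar (code α α′ 0 δ γ) (hasKind z ok
        (kind-cong eα eα′ (trans eα (cong +_ (sym (ℕ.+-identityʳ α)))) eα′ eδ eγ) to from))

  ascending : ∀ {S} (z : Zed) (let open Zed z) → Valid z → i ℤ.< j → b ℤ.< h → h ℤ.< t → (∀ {c} → S c → InZed z c) → (∀ {c} → InZed z c → S c) →
              Coded S (r ℤ.- l) (t ℤ.- b)
  ascending {S} z@(zed l r h b t i j) ok@(valid l≤i i≤r _ j≤r b≤h h≤t) i<j b<h h<t to from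
    with α , eα ← difference l≤i | β′ , eβ′ ← difference j≤r | δ , eδ ← difference b≤h | γ , eγ ← difference h≤t | D , eD ← difference (ℤ.<⇒≤ i<j) =
    coded (code α β′ D δ γ) (inj₂ (positive i<j eD , positive b<h eδ , positive h<t eγ))
      (lia 7 (λ i j l r a D b → i :- l := a ⇒ r :- j := b ⇒ j :- i := D ⇒ ⊢ r :- l := a :+ (D :+ b)) refl i j l r (+ α) (+ D) (+ β′) eα eβ′ eD)
      (lia 5 (λ h b t d u → h :- b := d ⇒ t :- h := u ⇒ ⊢ t :- b := d :+ u) refl h b t (+ δ) (+ γ) eδ eγ)
      (kind-similar (code α β′ D δ γ) (hasKind z ok (kind-cong eα
        (lia 5 (λ i j r D b → r :- j := b ⇒ j :- i := D ⇒ ⊢ r :- i := D :+ b) refl i j r (+ D) (+ β′) eβ′ eD)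
        (lia 5 (λ i j l a D → i :- l := a ⇒ j :- i := D ⇒ ⊢ j :- l := a :+ D) refl i j l (+ α) (+ D) eα eD) eβ′ eδ eγ) to from))
    where
    positive : ∀ {x y n} → x ℤ.< y → y ℤ.- x ≡ + n → 0 ℕ.< n
    positive {x} {y} {n} h e = ℤ.drop‿+<+ (lia 3 (λ x y n → x :< y ⇒ y :- x := n ⇒ ⊢ # 0 :< n) refl x y (+ n) h e)

coded-similar : ∀ {S T m n} → Similar S T → Coded T m n → Coded S m n
coded-similar s (coded c raw m≡ n≡ like) = coded c raw m≡ n≡ (similar-trans s like)

-- An absent leg may be given any column, so it is moved to that of the other leg and the shape
-- becomes a cross. With both legs present the order of their columns decides, and a mirror image
-- brings the lower leg to the left.
isZed-coded : ∀ {S m n} → IsZed S m n → Coded S m n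
isZed-coded {S} (isZed z@(zed l r h b t i j) ok@(valid l≤i i≤r l≤j j≤r b≤h h≤t) refl refl to from)
  with b ℤ.≟ h | h ℤ.≟ t | ℤ.<-cmp i j
... | yes refl | _        | _              = straight (zed l r h h t j j) (valid l≤j j≤r l≤j j≤r b≤h h≤t) refl
  (λ s → no-lower (to s)) (λ s → from (no-lower⁻ s))
  where
  no-lower : ∀ {c} → InZed z c → InZed (zed l r h h t j j) c
  no-lower (row e p q)      = row e p q
  no-lower (lower refl p q) = row (ℤ.≤-antisym q p) l≤i i≤r
  no-lower (upper e p q)    = upper e p q
  no-lower⁻ : ∀ {c} → InZed (zed l r h h t j j) c → InZed z c
  no-lower⁻ (row e p q)      = row e p q
  no-lower⁻ (lower refl p q) = row (ℤ.≤-antisym q p) l≤j j≤r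
  no-lower⁻ (upper e p q)    = upper e p q
... | no _     | yes refl | _              = straight (zed l r h b h i i) (valid l≤i i≤r l≤i i≤r b≤h h≤t) refl
  (λ s → no-upper (to s)) (λ s → from (no-upper⁻ s))
  where
  no-upper : ∀ {c} → InZed z c → InZed (zed l r h b h i i) c
  no-upper (row e p q)      = row e p q
  no-upper (lower e p q)    = lower e p q
  no-upper (upper refl p q) = row (ℤ.≤-antisym q p) l≤j j≤r
  no-upper⁻ : ∀ {c} → InZed (zed l r h b h i i) c → InZed z c
  no-upper⁻ (row e p q)      = row e p q
  no-upper⁻ (lower e p q)    = lower e p q
  no-upper⁻ (upper refl p q) = row (ℤ.≤-antisym q p) l≤i i≤r
... | no _     | no _     | tri≈ _ i≡j _   = straight z ok i≡j to from
... | no b≢h   | no h≢t   | tri< i<j _ _   = ascending z ok i<j (ℤ.≤∧≢⇒< b≤h b≢h) (ℤ.≤∧≢⇒< h≤t h≢t) to from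
... | no b≢h   | no h≢t   | tri> _ _ j<i   = coded-similar (similar-sym similar-flipX)
  (subst (λ m → Coded (λ c → S (flipX c)) m (t ℤ.- b)) (lia 2 (λ l r → ⊢ :- l :- :- r := r :- l) refl l r)
    (ascending (IsZed.z flipped) (IsZed.ok flipped) (ℤ.neg-mono-< j<i) (ℤ.≤∧≢⇒< b≤h b≢h) (ℤ.≤∧≢⇒< h≤t h≢t) (IsZed.to flipped) (IsZed.from flipped)))
  where
  flipped = isZed-flipX {S} (isZed z ok refl refl to from)

-- In a crossing the two legs meet in one column; the last condition chooses between a
-- square cross and its transpose.

data Canonical (p q : ℕ) : Code → Set where
  crossing : ∀ {l r d u} → l ℕ.≤ r → d ℕ.≤ u → l ℕ.+ r ≡ p → d ℕ.+ u ≡ q → (p ≡ q → l ℕ.≤ d) → Canonical p q (code l r 0 d u)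
  zee   : ∀ {l r D d u} → 0 ℕ.< D → 0 ℕ.< d → 0 ℕ.< u → l ℕ.< r ⊎ (l ≡ r × d ℕ.≤ u) →
          (l ℕ.+ (D ℕ.+ r) ≡ p × d ℕ.+ u ≡ q) ⊎ (l ℕ.+ (D ℕ.+ r) ≡ q × d ℕ.+ u ≡ p) → Canonical p q (code l r D d u)

Canonized : ℕ → ℕ → (Cell → Set) → Set
Canonized p q S = ∃[ c ] Canonical p q c × Similar S (InCode c)

private
  via : ∀ {p q S T} → Similar S T → Canonized p q T → Canonized p q S
  via s (c , can , like) = c , can , similar-trans s like

  -- Transposition is still free. If `p` and `q` differ, it makes the arms add up to `p`; if they
  -- agree, it makes the shorter arm at most as long as the shorter leg.
  canonize-sorted : ∀ {p q l r d u} → l ℕ.≤ r → d ℕ.≤ u → (l ℕ.+ r ≡ p × d ℕ.+ u ≡ q) ⊎ (l ℕ.+ r ≡ q × d ℕ.+ u ≡ p) →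
                    Canonized p q (InCode (code l r 0 d u))
  canonize-sorted {p} {q} {l} {r} {d} {u} l≤r d≤u dims with p ℕ.≟ q | dims
  ... | no p≢q   | inj₁ (e , f) = code l r 0 d u , crossing l≤r d≤u e f (λ p≡q → ⊥-elim (p≢q p≡q)) , similar-refl
  ... | no p≢q   | inj₂ (e , f) = code d u 0 l r , crossing d≤u l≤r f e (λ p≡q → ⊥-elim (p≢q p≡q)) , cross-swap l r d u
  ... | yes refl | dims with ℕ.≤-total l d
  ...   | inj₁ l≤d = code l r 0 d u , crossing l≤r d≤u (Sum.[ proj₁ , proj₁ ] dims) (Sum.[ proj₂ , proj₂ ] dims) (λ _ → l≤d) , similar-refl
  ...   | inj₂ d≤l = code d u 0 l r , crossing d≤u l≤r (Sum.[ proj₂ , proj₂ ] dims) (Sum.[ proj₁ , proj₁ ] dims) (λ _ → d≤l) , cross-swap l r d u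

  canonize-cross : ∀ {p q} l r d u → (l ℕ.+ r ≡ p × d ℕ.+ u ≡ q) ⊎ (l ℕ.+ r ≡ q × d ℕ.+ u ≡ p) → Canonized p q (InCode (code l r 0 d u))
  canonize-cross l r d u dims with ℕ.≤-total l r | ℕ.≤-total d u
  ... | inj₁ l≤r | inj₁ d≤u = canonize-sorted l≤r d≤u dims
  ... | inj₂ r≤l | inj₁ d≤u = via (cross-flipX l r d u) (canonize-sorted r≤l d≤u
    (Sum.map (λ (e , f) → trans (ℕ.+-comm r l) e , f) (λ (e , f) → trans (ℕ.+-comm r l) e , f) dims))
  ... | inj₁ l≤r | inj₂ u≤d = via (cross-flipY l r d u) (canonize-sorted l≤r u≤d
    (Sum.map (λ (e , f) → e , trans (ℕ.+-comm u d) f) (λ (e , f) → e , trans (ℕ.+-comm u d) f) dims))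
  ... | inj₂ r≤l | inj₂ u≤d = via (similar-trans (cross-flipX l r d u) (cross-flipY r l d u)) (canonize-sorted r≤l u≤d
    (Sum.map (λ (e , f) → trans (ℕ.+-comm r l) e , trans (ℕ.+-comm u d) f) (λ (e , f) → trans (ℕ.+-comm r l) e , trans (ℕ.+-comm u d) f) dims))

  turned-sum : ∀ l D r {a} → l ℕ.+ (D ℕ.+ r) ≡ a → r ℕ.+ (D ℕ.+ l) ≡ a
  turned-sum l D r = trans (liaℕ 3 (λ l D r → ⊢ r :+ (D :+ l) := l :+ (D :+ r)) refl l D r)

  canonize-zee : ∀ {p q l r D d u} → 0 ℕ.< D → 0 ℕ.< d → 0 ℕ.< u →
    (l ℕ.+ (D ℕ.+ r) ≡ p × d ℕ.+ u ≡ q) ⊎ (l ℕ.+ (D ℕ.+ r) ≡ q × d ℕ.+ u ≡ p) → Canonized p q (InCode (code l r D d u))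
  canonize-zee {p} {q} {l} {r} {D} {d} {u} 0<D 0<d 0<u dims with ℕ.<-cmp l r | ℕ.≤-total d u
  ... | tri< l<r _ _ | _        = _ , zee 0<D 0<d 0<u (inj₁ l<r) dims , similar-refl
  ... | tri≈ _ e _   | inj₁ d≤u = _ , zee 0<D 0<d 0<u (inj₂ (e , d≤u)) dims , similar-refl
  ... | tri≈ _ e _   | inj₂ u≤d = _ , zee 0<D 0<u 0<d (inj₂ (sym e , u≤d))
    (Sum.map (λ (e , f) → turned-sum l D r e , trans (ℕ.+-comm u d) f) (λ (e , f) → turned-sum l D r e , trans (ℕ.+-comm u d) f) dims) , code-turn l r D d u
  ... | tri> _ _ r<l | _        = _ , zee 0<D 0<u 0<d (inj₁ r<l)
    (Sum.map (λ (e , f) → turned-sum l D r e , trans (ℕ.+-comm u d) f) (λ (e , f) → turned-sum l D r e , trans (ℕ.+-comm u d) f) dims) , code-turn l r D d u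

canonize : ∀ {p q S m n} → (m ≡ + p × n ≡ + q) ⊎ (m ≡ + q × n ≡ + p) → Coded S m n → Canonized p q S
canonize dims (coded (code l r D d u) raw refl refl like) =
  via like (go raw (Sum.map (λ (e , f) → ℤ.+-injective e , ℤ.+-injective f) (λ (e , f) → ℤ.+-injective e , ℤ.+-injective f) dims))
  where
  go : ∀ {p q} → Raw (code l r D d u) → (l ℕ.+ (D ℕ.+ r) ≡ p × d ℕ.+ u ≡ q) ⊎ (l ℕ.+ (D ℕ.+ r) ≡ q × d ℕ.+ u ≡ p) → Canonized p q (InCode (code l r D d u))
  go (inj₁ refl)                dims = canonize-cross l r d u dims
  go (inj₂ (0<D , 0<d , 0<u)) dims = canonize-zee 0<D 0<d 0<u dims

isZed±-canonized : ∀ {p q S m n} → (m ≡ + p × n ≡ + q) ⊎ (m ≡ + q × n ≡ + p) → IsZed± S m n → Canonized p q S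
isZed±-canonized dims (inj₁ z) = canonize dims (isZed-coded z)
isZed±-canonized dims (inj₂ z) = via (similar-sym similar-swap) (canonize (Sum.map swap swap (Sum.swap dims)) (isZed-coded z))

-- What the set of cells reveals about the parameters of a shape.

row-height : ∀ z {x x′ y} → InZed z (x , y) → InZed z (x′ , y) → x ℤ.< x′ → y ≡ Zed.h z
row-height z (row e _ _)   _             _   = e
row-height z (lower _ _ _) (row e _ _)   _   = e
row-height z (upper _ _ _) (row e _ _)   _   = e
row-height z (lower _ _ p) (upper _ q _) _   = ℤ.≤-antisym p q
row-height z (upper _ q _) (lower _ _ p) _   = ℤ.≤-antisym p q
row-height z (lower e _ _) (lower f _ _) x<x′ = ⊥-elim (ℤ.<-irrefl (trans e (sym f)) x<x′)
row-height z (upper e _ _) (upper f _ _) x<x′ = ⊥-elim (ℤ.<-irrefl (trans e (sym f)) x<x′)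

private
  lower-column : ∀ z {x y} → InZed z (x , y) → y ℤ.< Zed.h z → x ≡ Zed.i z
  lower-column z (row e _ _)   y<h = ⊥-elim (ℤ.<-irrefl e y<h)
  lower-column z (lower e _ _) y<h = e
  lower-column z (upper _ p _) y<h = ⊥-elim (ℤ.<⇒≱ y<h p)

  upper-column : ∀ z {x y} → InZed z (x , y) → Zed.h z ℤ.< y → x ≡ Zed.j z
  upper-column z (row e _ _)   h<y = ⊥-elim (ℤ.<-irrefl (sym e) h<y)
  upper-column z (lower _ _ p) h<y = ⊥-elim (ℤ.<⇒≱ h<y p)
  upper-column z (upper e _ _) h<y = e

  record Bounded (z : Zed) (c : Cell) : Set where
    constructor bounded
    open Zed z
    field
      l≤x : l ℤ.≤ proj₁ c
      x≤r : proj₁ c ℤ.≤ r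
      b≤y : b ℤ.≤ proj₂ c
      y≤t : proj₂ c ℤ.≤ t

  zed-bounded : ∀ {z c} → Valid z → InZed z c → Bounded z c
  zed-bounded (valid _ _ _ _ b≤h h≤t)   (row refl p q)   = bounded p q b≤h h≤t
  zed-bounded (valid l≤i i≤r _ _ _ h≤t) (lower refl p q) = bounded l≤i i≤r p (ℤ.≤-trans q h≤t)
  zed-bounded (valid _ _ l≤j j≤r b≤h _) (upper refl p q) = bounded l≤j j≤r (ℤ.≤-trans b≤h p) q

module _ {z : Zed} (ok : Valid z) where

  open Zed z
  open Valid ok

  private
    row-start : InZed z (l , h)
    row-start = row refl ℤ.≤-refl (ℤ.≤-trans l≤i i≤r)
    row-end : InZed z (r , h)
    row-end = row refl (ℤ.≤-trans l≤i i≤r) ℤ.≤-refl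
    foot : InZed z (i , b)
    foot = lower refl ℤ.≤-refl b≤h
    lower-join : InZed z (i , h)
    lower-join = lower refl b≤h ℤ.≤-refl
    head : InZed z (j , t)
    head = upper refl h≤t ℤ.≤-refl
    upper-join : InZed z (j , h)
    upper-join = upper refl ℤ.≤-refl h≤t

  -- The box is always visible. The height of the row is visible from two cells side by side, hence
  -- not in a shape of one column, and the column of a leg only if the leg has positive length.
  record Equivalent (z̄ : Zed) : Set where
    module z̄ = Zed z̄
    field
      l≡ : l ≡ z̄.l
      r≡ : r ≡ z̄.r
      b≡ : b ≡ z̄.b
      t≡ : t ≡ z̄.t
      h≡ : l ℤ.< r → h ≡ z̄.h
      i≡ : l ℤ.< r → b ℤ.< h → i ≡ z̄.i
      j≡ : l ℤ.< r → h ℤ.< t → j ≡ z̄.j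

  equivalent : ∀ {z̄} → Valid z̄ → (∀ {c} → InZed z c → InZed z̄ c) → (∀ {c} → InZed z̄ c → InZed z c) → Equivalent z̄
  equivalent {z̄} ok̄@(valid l̄≤ī ī≤r̄ l̄≤j̄ j̄≤r̄ b̄≤h̄ h̄≤t̄) to from = record
    { l≡ = ℤ.≤-antisym (Bounded.l≤x (zed-bounded ok (from (row refl ℤ.≤-refl (ℤ.≤-trans l̄≤ī ī≤r̄))))) (Bounded.l≤x (zed-bounded ok̄ (to row-start)))
    ; r≡ = ℤ.≤-antisym (Bounded.x≤r (zed-bounded ok̄ (to row-end))) (Bounded.x≤r (zed-bounded ok (from (row refl (ℤ.≤-trans l̄≤ī ī≤r̄) ℤ.≤-refl))))
    ; b≡ = ℤ.≤-antisym (Bounded.b≤y (zed-bounded ok (from (lower refl ℤ.≤-refl b̄≤h̄)))) (Bounded.b≤y (zed-bounded ok̄ (to foot)))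
    ; t≡ = ℤ.≤-antisym (Bounded.y≤t (zed-bounded ok̄ (to head))) (Bounded.y≤t (zed-bounded ok (from (upper refl h̄≤t̄ ℤ.≤-refl))))
    ; h≡ = h≡
    ; i≡ = λ l<r b<h → lower-column z̄ (to foot) (subst (b ℤ.<_) (h≡ l<r) b<h)
    ; j≡ = λ l<r h<t → upper-column z̄ (to head) (subst (ℤ._< t) (h≡ l<r) h<t)
    }
    where
    h≡ : l ℤ.< r → h ≡ Zed.h z̄
    h≡ l<r = row-height z̄ (to row-start) (to row-end) l<r

  -- A leg of positive length has two cells in one column. In the transposed shape they are side by
  -- side and so belong to its row. All legs that are present therefore stand in the column given by
  -- the row of the other shape.
  record Transposed (z̄ : Zed) : Set where
    module z̄ = Zed z̄
    field
      l≡ : l ≡ z̄.b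
      r≡ : r ≡ z̄.t
      b≡ : b ≡ z̄.l
      t≡ : t ≡ z̄.r
      i≡ : b ℤ.< h → i ≡ z̄.h
      j≡ : h ℤ.< t → j ≡ z̄.h
      ī≡ : z̄.b ℤ.< z̄.h → z̄.i ≡ h
      j̄≡ : z̄.h ℤ.< z̄.t → z̄.j ≡ h

  transposed : ∀ {z̄} → Valid z̄ → (∀ {c} → InZed z c → InZed z̄ (swap c)) → (∀ {c} → InZed z̄ c → InZed z (swap c)) → Transposed z̄
  transposed {z̄} ok̄@(valid l̄≤ī ī≤r̄ l̄≤j̄ j̄≤r̄ b̄≤h̄ h̄≤t̄) to from = record
    { l≡ = ℤ.≤-antisym (Bounded.l≤x (zed-bounded ok (from (lower refl ℤ.≤-refl b̄≤h̄)))) (Bounded.b≤y (zed-bounded ok̄ (to row-start)))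
    ; r≡ = ℤ.≤-antisym (Bounded.y≤t (zed-bounded ok̄ (to row-end))) (Bounded.x≤r (zed-bounded ok (from (upper refl h̄≤t̄ ℤ.≤-refl))))
    ; b≡ = ℤ.≤-antisym (Bounded.b≤y (zed-bounded ok (from (row refl ℤ.≤-refl (ℤ.≤-trans l̄≤ī ī≤r̄))))) (Bounded.l≤x (zed-bounded ok̄ (to foot)))
    ; t≡ = ℤ.≤-antisym (Bounded.x≤r (zed-bounded ok̄ (to head))) (Bounded.y≤t (zed-bounded ok (from (row refl (ℤ.≤-trans l̄≤ī ī≤r̄) ℤ.≤-refl))))
    ; i≡ = λ b<h → row-height z̄ (to foot) (to lower-join) b<h
    ; j≡ = λ h<t → row-height z̄ (to upper-join) (to head) h<t
    ; ī≡ = λ b̄<h̄ → row-height z (from (lower refl ℤ.≤-refl b̄≤h̄)) (from (lower refl b̄≤h̄ ℤ.≤-refl)) b̄<h̄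
    ; j̄≡ = λ h̄<t̄ → row-height z (from (upper refl ℤ.≤-refl h̄≤t̄)) (from (upper refl h̄≤t̄ ℤ.≤-refl)) h̄<t̄
    }

record Same (k k̄ : Kind) : Set where
  open Kind k
  module k̄ = Kind k̄
  field
    width : α ℤ.+ α′ ≡ k̄.α ℤ.+ k̄.α′
    δ≡    : 0ℤ ℤ.< α ℤ.+ α′ → δ ≡ k̄.δ
    γ≡    : 0ℤ ℤ.< α ℤ.+ α′ → γ ≡ k̄.γ
    α≡    : 0ℤ ℤ.< α ℤ.+ α′ → 0ℤ ℤ.< δ → α ≡ k̄.α
    β≡    : 0ℤ ℤ.< α ℤ.+ α′ → 0ℤ ℤ.< γ → β ≡ k̄.β

record Crossed (k k̄ : Kind) : Set where
  open Kind k
  module k̄ = Kind k̄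
  field
    width : α ℤ.+ α′ ≡ k̄.δ ℤ.+ k̄.γ
    tall  : δ ℤ.+ γ ≡ k̄.α ℤ.+ k̄.α′
    α≡    : 0ℤ ℤ.< δ → α ≡ k̄.δ
    β≡    : 0ℤ ℤ.< γ → β ≡ k̄.δ
    ᾱ≡    : 0ℤ ℤ.< k̄.δ → k̄.α ≡ δ
    β̄≡    : 0ℤ ℤ.< k̄.γ → k̄.β ≡ δ

private
  two-parts : ∀ i l r → i ℤ.- l ℤ.+ (r ℤ.- i) ≡ r ℤ.- l
  two-parts = λ i l r → lia 3 (λ i l r → ⊢ i :- l :+ (r :- i) := r :- l) refl i l r

  positive-sum : ∀ {i l r} → 0ℤ ℤ.< i ℤ.- l ℤ.+ (r ℤ.- i) → l ℤ.< r
  positive-sum {i} {l} {r} = lia 3 (λ i l r → # 0 :< i :- l :+ (r :- i) ⇒ ⊢ l :< r) refl i l r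

  positive-difference : ∀ {x y} → 0ℤ ℤ.< y ℤ.- x → x ℤ.< y
  positive-difference {x} {y} = lia 2 (λ x y → # 0 :< y :- x ⇒ ⊢ x :< y) refl x y

  same-sum : ∀ i l r {ī l̄ r̄} → r ≡ r̄ → l ≡ l̄ → i ℤ.- l ℤ.+ (r ℤ.- i) ≡ ī ℤ.- l̄ ℤ.+ (r̄ ℤ.- ī)
  same-sum i l r {ī} {l̄} {r̄} e f = trans (two-parts i l r) (trans (cong₂ ℤ._-_ e f) (sym (two-parts ī l̄ r̄)))

same : ∀ {S k k̄} → HasKind S k → HasKind S k̄ → Same k k̄
same (hasKind z ok refl to from) (hasKind z̄ ok̄ refl tō from̄) = record
  { width = same-sum (Zed.i z) (Zed.l z) (Zed.r z) {Zed.i z̄} r≡ l≡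
  ; δ≡ = λ w → cong₂ ℤ._-_ (h≡ (positive-sum {Zed.i z} w)) b≡
  ; γ≡ = λ w → cong₂ ℤ._-_ t≡ (h≡ (positive-sum {Zed.i z} w))
  ; α≡ = λ w p → cong₂ ℤ._-_ (i≡ (positive-sum {Zed.i z} w) (positive-difference p)) l≡
  ; β≡ = λ w p → cong₂ ℤ._-_ (j≡ (positive-sum {Zed.i z} w) (positive-difference p)) l≡
  }
  where open Equivalent (equivalent ok ok̄ (λ c → tō (from c)) (λ c → to (from̄ c)))

crossed : ∀ {S k k̄} → HasKind S k → HasKind (λ c → S (swap c)) k̄ → Crossed k k̄
crossed (hasKind z ok refl to from) (hasKind z̄ ok̄ refl tō from̄) = record
  { width = same-sum (Zed.i z) (Zed.l z) (Zed.r z) {Zed.h z̄} r≡ l≡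
  ; tall  = same-sum (Zed.h z) (Zed.b z) (Zed.t z) {Zed.i z̄} t≡ b≡
  ; α≡ = λ p → cong₂ ℤ._-_ (i≡ (positive-difference p)) l≡
  ; β≡ = λ p → cong₂ ℤ._-_ (j≡ (positive-difference p)) l≡
  ; ᾱ≡ = λ p → cong₂ ℤ._-_ (ī≡ (positive-difference p)) (sym b≡)
  ; β̄≡ = λ p → cong₂ ℤ._-_ (j̄≡ (positive-difference p)) (sym b≡)
  }
  where open Transposed (transposed ok ok̄ (λ c → tō (from c)) (λ c → to (from̄ c)))

-- Uniqueness of canonical codes

private
  Match : Code → Code → Set
  Match c c̄ = ∃[ k ] Orbit (codeKind c̄) k × (Same (codeKind c) k ⊎ Crossed (codeKind c) k)

  similar-match : ∀ {c c̄} → Similar (InCode c) (InCode c̄) → Match c c̄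
  similar-match {c} {c̄} (similar g to from) with pull g {InCode c̄} (codeKind c̄ , as-is , inj₁ (code-hasKind c̄))
  ... | k , o , inj₁ h = k , o , inj₁ (same (code-hasKind c) (hasKind-resp from to h))
  ... | k , o , inj₂ h = k , o , inj₂ (crossed (code-hasKind c) (hasKind-resp from to h))

  code-cong : ∀ {l r D d u l̄ r̄ D̄ d̄ ū} → l ≡ l̄ → r ≡ r̄ → D ≡ D̄ → d ≡ d̄ → u ≡ ū → code l r D d u ≡ code l̄ r̄ D̄ d̄ ū
  code-cong refl refl refl refl refl = refl

  cross-code-cong : ∀ {p q l r d u l̄ r̄ d̄ ū} → l ℕ.+ r ≡ p → d ℕ.+ u ≡ q → l̄ ℕ.+ r̄ ≡ p → d̄ ℕ.+ ū ≡ q → l ≡ l̄ → d ≡ d̄ →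
                    code l r 0 d u ≡ code l̄ r̄ 0 d̄ ū
  cross-code-cong {l = l} {d = d} e f ē f̄ refl refl = code-cong refl (ℕ.+-cancelˡ-≡ l _ _ (trans e (sym ē))) refl refl (ℕ.+-cancelˡ-≡ d _ _ (trans f (sym f̄)))

  sorted : ∀ {p l r l̄ r̄} → l ℕ.≤ r → l̄ ℕ.≤ r̄ → l ℕ.+ r ≡ p → l̄ ℕ.+ r̄ ≡ p → l ≡ l̄ ⊎ l ≡ r̄ → l ≡ l̄
  sorted                  _   _   _ _ (inj₁ e) = e
  sorted {p} {l} {r} {l̄} {r̄} l≤r l̄≤r̄ s s̄ (inj₂ e) =
    liaℕ 5 (λ p l r l̄ r̄ → l :≤ r ⇒ l̄ :≤ r̄ ⇒ l :+ r := p ⇒ l̄ :+ r̄ := p ⇒ l := r̄ ⇒ ⊢ l := l̄) refl p l r l̄ r̄ l≤r l̄≤r̄ s s̄ e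

  larger-positive : ∀ {q d u} → 0 ℕ.< q → d ℕ.≤ u → d ℕ.+ u ≡ q → 0ℤ ℤ.< + u
  larger-positive {q} {d} {u} h d≤u e = ℤ.+<+ (liaℕ 3 (λ q d u → # 1 :≤ q ⇒ d :≤ u ⇒ d :+ u := q ⇒ ⊢ # 1 :≤ u) refl q d u h d≤u e)

  +inj : ∀ {m n} → + m ≡ + n → m ≡ n
  +inj = ℤ.+-injective

  +0 : ∀ {m n} → m ℕ.+ 0 ≡ n → m ≡ n
  +0 {m} = trans (sym (ℕ.+-identityʳ m))

  -- The longer leg is positive, so its column is always visible. Without transposition, sorting
  -- absorbs the mirror images. With it, p = q, l = d̄ and d = l̄, and the two tie-breaking
  -- inequalities turn these into equalities of all four.
  cross-cross : ∀ {p q l r d u l̄ r̄ d̄ ū} → 0 ℕ.< p → 0 ℕ.< q →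
    l ℕ.≤ r → d ℕ.≤ u → l ℕ.+ r ≡ p → d ℕ.+ u ≡ q → (p ≡ q → l ℕ.≤ d) →
    l̄ ℕ.≤ r̄ → d̄ ℕ.≤ ū → l̄ ℕ.+ r̄ ≡ p → d̄ ℕ.+ ū ≡ q → (p ≡ q → l̄ ℕ.≤ d̄) →
    Match (code l r 0 d u) (code l̄ r̄ 0 d̄ ū) → code l r 0 d u ≡ code l̄ r̄ 0 d̄ ū
  cross-cross {p} {q} {l} {r} {d} {u} {l̄} {r̄} {d̄} {ū} 0<p 0<q l≤r d≤u l+r d+u low l̄≤r̄ d̄≤ū l̄+r̄ d̄+ū low̄ (k , o , m) = match o m
    where
    wide : 0ℤ ℤ.< + (l ℕ.+ r)
    wide = ℤ.+<+ (subst (0 ℕ.<_) (sym l+r) 0<p)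
    0<u : 0ℤ ℤ.< + u
    0<u = larger-positive 0<q d≤u d+u
    0<ū : 0ℤ ℤ.< + ū
    0<ū = larger-positive 0<q d̄≤ū d̄+ū
    agree : d ≡ d̄ ⊎ d ≡ ū → l ≡ l̄ ⊎ l ≡ r̄ → code l r 0 d u ≡ code l̄ r̄ 0 d̄ ū
    agree e f = cross-code-cong l+r d+u l̄+r̄ d̄+ū (sorted l≤r l̄≤r̄ l+r l̄+r̄ f) (sorted d≤u d̄≤ū d+u d̄+ū e)
    exchange : p ≡ q → l ≡ d̄ ⊎ l ≡ ū → l̄ ≡ d ⊎ r̄ ≡ d → code l r 0 d u ≡ code l̄ r̄ 0 d̄ ū
    exchange p≡q e f = cross-code-cong l+r d+u l̄+r̄ d̄+ū (trans l≡d̄ (trans d̄≡l̄ refl)) (trans d≡l̄ (sym d̄≡l̄))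
      where
      l≡d̄ : l ≡ d̄
      l≡d̄ = sorted l≤r d̄≤ū l+r (trans d̄+ū (sym p≡q)) e
      d≡l̄ : d ≡ l̄
      d≡l̄ = sorted d≤u l̄≤r̄ d+u (trans l̄+r̄ p≡q) (Sum.map sym sym f)
      d̄≡l̄ : d̄ ≡ l̄
      d̄≡l̄ = ℕ.≤-antisym (subst₂ ℕ._≤_ l≡d̄ d≡l̄ (low p≡q)) (low̄ p≡q)
    p≡q : ∀ {x y} → + (l ℕ.+ r) ≡ + (x ℕ.+ y) → x ℕ.+ y ≡ q → p ≡ q
    p≡q e f = trans (sym l+r) (trans (+inj e) f)
    match : ∀ {k} → Orbit (codeKind (code l̄ r̄ 0 d̄ ū)) k → Same (codeKind (code l r 0 d u)) k ⊎ Crossed (codeKind (code l r 0 d u)) k →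
            code l r 0 d u ≡ code l̄ r̄ 0 d̄ ū
    match as-is   (inj₁ s) = agree (inj₁ (+inj (Same.δ≡ s wide))) (inj₁ (+0 (trans (+inj (Same.β≡ s wide 0<u)) (ℕ.+-identityʳ l̄))))
    match flip-x  (inj₁ s) = agree (inj₁ (+inj (Same.δ≡ s wide))) (inj₂ (+0 (+inj (Same.β≡ s wide 0<u))))
    match flip-y  (inj₁ s) = agree (inj₂ (+inj (Same.δ≡ s wide))) (inj₁ (+0 (+inj (Same.β≡ s wide 0<u))))
    match flip-xy (inj₁ s) = agree (inj₂ (+inj (Same.δ≡ s wide))) (inj₂ (+0 (+inj (Same.β≡ s wide 0<u))))
    match as-is   (inj₂ s) = exchange (p≡q {d̄} {ū} (Crossed.width s) d̄+ū) (inj₁ (+0 (+inj (Crossed.β≡ s 0<u)))) (inj₁ (+0 (+inj (Crossed.β̄≡ s 0<ū))))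
    match flip-x  (inj₂ s) = exchange (p≡q {d̄} {ū} (Crossed.width s) d̄+ū) (inj₁ (+0 (+inj (Crossed.β≡ s 0<u)))) (inj₂ (+inj (Crossed.β̄≡ s 0<ū)))
    match flip-y  (inj₂ s) = exchange (p≡q {ū} {d̄} (Crossed.width s) (trans (ℕ.+-comm ū d̄) d̄+ū)) (inj₂ (+0 (+inj (Crossed.β≡ s 0<u)))) (inj₁ (+0 (+inj (Crossed.ᾱ≡ s 0<ū))))
    match flip-xy (inj₂ s) = exchange (p≡q {ū} {d̄} (Crossed.width s) (trans (ℕ.+-comm ū d̄) d̄+ū)) (inj₂ (+0 (+inj (Crossed.β≡ s 0<u)))) (inj₂ (+inj (Crossed.ᾱ≡ s 0<ū)))

  shifted-columns : ∀ l {D} → 0 ℕ.< D → l ≢ l ℕ.+ D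
  shifted-columns l {D} 0<D e = liaℕ 2 (λ l D → # 1 :≤ D ⇒ l := l :+ D ⇒ ⊢ :⊥) refl l D 0<D e

  -- Both legs are present, so both of their columns would be the row of the transposed shape,
  -- although they are `D` apart.
  crossed-zee : ∀ {l r D d u k} → 0 ℕ.< D → 0 ℕ.< d → 0 ℕ.< u → Crossed (codeKind (code l r D d u)) k → ⊥
  crossed-zee {l} 0<D 0<d 0<u s = shifted-columns l 0<D (+inj (trans (Crossed.α≡ s (ℤ.+<+ 0<d)) (sym (Crossed.β≡ s (ℤ.+<+ 0<u)))))

  record ZeeKind (k : Kind) : Set where
    constructor zeeKind
    open Kind k
    field
      0<δ : 0ℤ ℤ.< δ
      0<γ : 0ℤ ℤ.< γ
      α≢β : α ≢ β
      α′≢β′ : α′ ≢ β′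

  orbit-zee : ∀ {k k̄} → Orbit k k̄ → ZeeKind k → ZeeKind k̄
  orbit-zee as-is   h = h
  orbit-zee flip-x  (zeeKind a b c d) = zeeKind a b d c
  orbit-zee flip-y  (zeeKind a b c d) = zeeKind b a (λ e → c (sym e)) (λ e → d (sym e))
  orbit-zee flip-xy (zeeKind a b c d) = zeeKind b a (λ e → d (sym e)) (λ e → c (sym e))

  cross-zee : ∀ {l r d u c̄} → 0 ℕ.< l ℕ.+ r → ZeeKind (codeKind c̄) → Match (code l r 0 d u) c̄ → ⊥
  cross-zee {l} {r} {d} {u} 0<l+r zk (k , o , m) = match (orbit-zee o zk) m
    where
    match : ∀ {k} → ZeeKind k → Same (codeKind (code l r 0 d u)) k ⊎ Crossed (codeKind (code l r 0 d u)) k → ⊥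
    match (zeeKind 0<δ 0<γ α≢β _) (inj₁ s) = α≢β (trans (sym (Same.α≡ s w (subst (0ℤ ℤ.<_) (sym (Same.δ≡ s w)) 0<δ)))
      (trans (cong +_ (sym (ℕ.+-identityʳ l))) (Same.β≡ s w (subst (0ℤ ℤ.<_) (sym (Same.γ≡ s w)) 0<γ))))
      where
      w : 0ℤ ℤ.< + (l ℕ.+ r)
      w = ℤ.+<+ 0<l+r
    match (zeeKind 0<δ 0<γ α≢β _) (inj₂ s) = α≢β (trans (Crossed.ᾱ≡ s 0<δ) (sym (Crossed.β̄≡ s 0<γ)))

  code-zeeKind : ∀ {l r D d u} → 0 ℕ.< D → 0 ℕ.< d → 0 ℕ.< u → ZeeKind (codeKind (code l r D d u))
  code-zeeKind {l} {r} {D} 0<D 0<d 0<u = zeeKind (ℤ.+<+ 0<d) (ℤ.+<+ 0<u) (λ e → shifted-columns l 0<D (+inj e))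
    (λ e → shifted-columns r 0<D (trans (sym (+inj e)) (ℕ.+-comm D r)))

  -- With both legs present all parameters are visible. Of the four mirror images only the identity
  -- and the half turn keep the lower leg on the left, and by the order on codes the half turn can
  -- only occur where it changes nothing.
  zee-zee : ∀ {l r D d u l̄ r̄ D̄ d̄ ū} → 0 ℕ.< D → 0 ℕ.< d → 0 ℕ.< u → l ℕ.< r ⊎ (l ≡ r × d ℕ.≤ u) →
    0 ℕ.< D̄ → l̄ ℕ.< r̄ ⊎ (l̄ ≡ r̄ × d̄ ℕ.≤ ū) →
    Match (code l r D d u) (code l̄ r̄ D̄ d̄ ū) → code l r D d u ≡ code l̄ r̄ D̄ d̄ ū
  zee-zee {l} {r} {D} {d} {u} {l̄} {r̄} {D̄} {d̄} {ū} 0<D 0<d 0<u ord 0<D̄ or̄d (k , o , m) = match o m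
    where
    w : 0ℤ ℤ.< + (l ℕ.+ (D ℕ.+ r))
    w = ℤ.+<+ (liaℕ 3 (λ l D r → # 1 :≤ D ⇒ ⊢ # 1 :≤ l :+ (D :+ r)) refl l D r 0<D)
    module _ {k} (s : Same (codeKind (code l r D d u)) k) where
      α≡ = Same.α≡ s w (ℤ.+<+ 0<d)
      β≡ = Same.β≡ s w (ℤ.+<+ 0<u)
    match : ∀ {k} → Orbit (codeKind (code l̄ r̄ D̄ d̄ ū)) k → Same (codeKind (code l r D d u)) k ⊎ Crossed (codeKind (code l r D d u)) k →
            code l r D d u ≡ code l̄ r̄ D̄ d̄ ū
    match _       (inj₂ s) = ⊥-elim (crossed-zee 0<D 0<d 0<u s)
    match as-is   (inj₁ s) = code-cong l≡ r≡ D≡ (+inj (Same.δ≡ s w)) (+inj (Same.γ≡ s w))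
      where
      l≡ : l ≡ l̄
      l≡ = +inj (α≡ s)
      D≡ : D ≡ D̄
      D≡ = ℕ.+-cancelˡ-≡ l _ _ (trans (+inj (β≡ s)) (cong (ℕ._+ D̄) (sym l≡)))
      r≡ : r ≡ r̄
      r≡ = liaℕ 6 (λ l D r l̄ D̄ r̄ → l := l̄ ⇒ D := D̄ ⇒ l :+ (D :+ r) := l̄ :+ (D̄ :+ r̄) ⇒ ⊢ r := r̄) refl l D r l̄ D̄ r̄ l≡ D≡ (+inj (Same.width s))
    match flip-x  (inj₁ s) = ⊥-elim (liaℕ 4 (λ l D D̄ r̄ → # 1 :≤ D ⇒ l := D̄ :+ r̄ ⇒ l :+ D := r̄ ⇒ ⊢ :⊥) refl l D D̄ r̄ 0<D (+inj (α≡ s)) (+inj (β≡ s)))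
    match flip-y  (inj₁ s) = ⊥-elim (liaℕ 4 (λ l D l̄ D̄ → # 1 :≤ D ⇒ l := l̄ :+ D̄ ⇒ l :+ D := l̄ ⇒ ⊢ :⊥) refl l D l̄ D̄ 0<D (+inj (α≡ s)) (+inj (β≡ s)))
    match flip-xy (inj₁ s) = turned ord or̄d
      where
      l≡ : l ≡ r̄
      l≡ = +inj (α≡ s)
      D≡ : D ≡ D̄
      D≡ = liaℕ 4 (λ l D r̄ D̄ → l := r̄ ⇒ l :+ D := D̄ :+ r̄ ⇒ ⊢ D := D̄) refl l D r̄ D̄ l≡ (+inj (β≡ s))
      r≡ : r ≡ l̄
      r≡ = liaℕ 6 (λ l D r l̄ D̄ r̄ → l := r̄ ⇒ D := D̄ ⇒ l :+ (D :+ r) := r̄ :+ (l̄ :+ D̄) ⇒ ⊢ r := l̄) refl l D r l̄ D̄ r̄ l≡ D≡ (+inj (Same.width s))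
      d≡ : d ≡ ū
      d≡ = +inj (Same.δ≡ s w)
      u≡ : u ≡ d̄
      u≡ = +inj (Same.γ≡ s w)
      turned : l ℕ.< r ⊎ (l ≡ r × d ℕ.≤ u) → l̄ ℕ.< r̄ ⊎ (l̄ ≡ r̄ × d̄ ℕ.≤ ū) → code l r D d u ≡ code l̄ r̄ D̄ d̄ ū
      turned (inj₁ l<r)       (inj₁ l̄<r̄)       = ⊥-elim (ℕ.<-asym l<r (subst₂ ℕ._<_ (sym r≡) (sym l≡) l̄<r̄))
      turned (inj₁ l<r)       (inj₂ (l̄≡r̄ , _)) = ⊥-elim (ℕ.<-irrefl (trans l≡ (trans (sym l̄≡r̄) (sym r≡))) l<r)
      turned (inj₂ (l≡r , _)) (inj₁ l̄<r̄)       = ⊥-elim (ℕ.<-irrefl (trans (sym r≡) (trans (sym l≡r) l≡)) l̄<r̄)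
      turned (inj₂ (l≡r , d≤u)) (inj₂ (_ , d̄≤ū)) =
        code-cong (trans l≡r r≡) (trans (sym l≡r) l≡) D≡ (trans d≡u u≡) (trans (sym d≡u) d≡)
        where
        d≡u : d ≡ u
        d≡u = ℕ.≤-antisym d≤u (subst₂ ℕ._≤_ (sym u≡) (sym d≡) d̄≤ū)

  no-zee : ∀ {q l D r d u} → q ℕ.≤ 1 → 0 ℕ.< D → 0 ℕ.< d → 0 ℕ.< u → (l ℕ.+ (D ℕ.+ r) ≡ 0 × d ℕ.+ u ≡ q) ⊎ (l ℕ.+ (D ℕ.+ r) ≡ q × d ℕ.+ u ≡ 0) → ⊥
  no-zee {q} {l} {D} {r} {d} {u} h 0<D 0<d 0<u (inj₁ (_ , e)) = liaℕ 3 (λ q d u → q :≤ # 1 ⇒ # 1 :≤ d ⇒ # 1 :≤ u ⇒ d :+ u := q ⇒ ⊢ :⊥) refl q d u h 0<d 0<u e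
  no-zee {q} {l} {D} {r} {d} {u} h 0<D 0<d 0<u (inj₂ (_ , e)) = liaℕ 2 (λ d u → # 1 :≤ d ⇒ d :+ u := # 0 ⇒ ⊢ :⊥) refl d u 0<d e

-- For p = 0 there are at most two cells and the row has width 0, where the invariants are silent;
-- the numerical conditions alone then leave one code. From p = 1 on the invariants apply.
canonical-injective : ∀ {p q c c̄} → p ℕ.≤ q → q ℕ.≤ suc p → Canonical p q c → Canonical p q c̄ → Similar (InCode c) (InCode c̄) → c ≡ c̄
canonical-injective {zero} _ q≤1 (crossing {l} {r} {d} {u} _ d≤u e f _) (crossing {l̄} {r̄} {d̄} {ū} _ d̄≤ū ē f̄ _) _ =
  cross-code-cong e f ē f̄ (trans (ℕ.m+n≡0⇒m≡0 l e) (sym (ℕ.m+n≡0⇒m≡0 l̄ ē))) (trans (short d≤u f) (sym (short d̄≤ū f̄)))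
  where
  short : ∀ {d u} → d ℕ.≤ u → d ℕ.+ u ≡ _ → d ≡ 0
  short {d} {u} d≤u f = liaℕ 3 (λ q d u → q :≤ # 1 ⇒ d :≤ u ⇒ d :+ u := q ⇒ ⊢ d := # 0) refl _ d u q≤1 d≤u f
canonical-injective {suc p} {q} p≤q _ (crossing a b c d e) (crossing ā b̄ c̄ d̄ ē) s =
  cross-cross (ℕ.s≤s ℕ.z≤n) (ℕ.<-≤-trans (ℕ.s≤s ℕ.z≤n) p≤q) a b c d e ā b̄ c̄ d̄ ē (similar-match s)
canonical-injective {suc p} _ _ (crossing _ _ l+r _ _) (zee 0<D 0<d 0<u _ _) s =
  ⊥-elim (cross-zee (subst (0 ℕ.<_) (sym l+r) (ℕ.s≤s ℕ.z≤n)) (code-zeeKind 0<D 0<d 0<u) (similar-match s))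
canonical-injective {suc p} _ _ (zee 0<D 0<d 0<u _ _) (crossing _ _ l+r _ _) s =
  ⊥-elim (cross-zee (subst (0 ℕ.<_) (sym l+r) (ℕ.s≤s ℕ.z≤n)) (code-zeeKind 0<D 0<d 0<u) (similar-match (similar-sym s)))
canonical-injective {suc p} _ _ (zee a b c d _) (zee ā _ _ d̄ _) s = zee-zee a b c d ā d̄ (similar-match s)
canonical-injective {zero} _ q≤1 (zee {l} {r} 0<D 0<d 0<u _ dims) _ _ = ⊥-elim (no-zee {l = l} {r = r} q≤1 0<D 0<d 0<u dims)
canonical-injective {zero} _ q≤1 (crossing _ _ _ _ _) (zee {l} {r} 0<D 0<d 0<u _ dims) _ = ⊥-elim (no-zee {l = l} {r = r} q≤1 0<D 0<d 0<u dims)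

-- Counting the canonical codes

record Counted {A : Set} (P : A → Set) (n : ℕ) : Set where
  constructor counted
  field
    elements : List A
    distinct : Unique elements
    sound    : ∀ {x} → x ∈ elements → P x
    complete : ∀ {x} → P x → x ∈ elements
    count≡   : length elements ≡ n

counted-below : ∀ n → Counted (ℕ._< n) n
counted-below n = counted (upTo n) (Unique.upTo⁺ n) ∈-upTo⁻ ∈-upTo⁺ (length-upTo n)

counted-⊎ : ∀ {A : Set} {P Q : A → Set} {m n} → Counted P m → Counted Q n → (∀ {x} → P x → Q x → ⊥) → Counted (λ x → P x ⊎ Q x) (m ℕ.+ n)
counted-⊎ (counted xs u s c e) (counted ys u′ s′ c′ e′) disjoint = counted (xs ++ ys)
  (Unique.++⁺ u u′ (λ (x∈ , y∈) → disjoint (s x∈) (s′ y∈)))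
  (λ z∈ → Sum.map s s′ (∈-++⁻ xs z∈))
  (λ { (inj₁ p) → ∈-++⁺ˡ (c p) ; (inj₂ q) → ∈-++⁺ʳ xs (c′ q) })
  (trans (length-++ xs) (cong₂ ℕ._+_ e e′))

private
  length-cartesianProduct : ∀ {A B : Set} (xs : List A) (ys : List B) → length (List.cartesianProduct xs ys) ≡ length xs ℕ.* length ys
  length-cartesianProduct []       ys = refl
  length-cartesianProduct (x ∷ xs) ys = trans (length-++ (map (x ,_) ys)) (cong₂ ℕ._+_ (length-map (x ,_) ys) (length-cartesianProduct xs ys))

counted-× : ∀ {A B : Set} {P : A → Set} {Q : B → Set} {m n} → Counted P m → Counted Q n → Counted (λ (x , y) → P x × Q y) (m ℕ.* n)
counted-× (counted xs u s c e) (counted ys u′ s′ c′ e′) = counted (List.cartesianProduct xs ys)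
  (Unique.cartesianProduct⁺ u u′)
  (λ z∈ → let x∈ , y∈ = ∈-cartesianProduct⁻ xs ys z∈ in s x∈ , s′ y∈)
  (λ (p , q) → ∈-cartesianProduct⁺ (c p) (c′ q))
  (trans (length-cartesianProduct xs ys) (cong₂ ℕ._*_ e e′))

counted-map : ∀ {A B : Set} {P : A → Set} {Q : B → Set} {n} (f : A → B) → (∀ {x y} → f x ≡ f y → x ≡ y) →
              (∀ {x} → P x → Q (f x)) → (∀ {y} → Q y → ∃[ x ] P x × f x ≡ y) → Counted P n → Counted Q n
counted-map {Q = Q} f injective to from (counted xs u s c e) = counted (map f xs) (Unique.map⁺ injective u)
  (λ y∈ → let x , x∈ , eq = ∈-map⁻ f y∈ in subst Q (sym eq) (to (s x∈)))
  (λ q → let x , p , eq = from q in subst (_∈ map f xs) eq (∈-map⁺ f (c p)))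
  (trans (length-map f xs) e)

counted-resp : ∀ {A : Set} {P Q : A → Set} {n} → (∀ {x} → P x → Q x) → (∀ {x} → Q x → P x) → Counted P n → Counted Q n
counted-resp to from (counted xs u s c e) = counted xs u (λ x∈ → to (s x∈)) (λ q → c (from q)) e

private
  double-half : ∀ n → ⌊ n /2⌋ ℕ.+ ⌊ n /2⌋ ℕ.≤ n
  double-half n = subst (⌊ n /2⌋ ℕ.+ ⌊ n /2⌋ ℕ.≤_) (ℕ.⌊n/2⌋+⌈n/2⌉≡n n) (ℕ.+-monoʳ-≤ ⌊ n /2⌋ (ℕ.⌊n/2⌋≤⌈n/2⌉ n))

  ≤-half : ∀ {k n} → k ℕ.+ k ℕ.≤ n → k ℕ.≤ ⌊ n /2⌋
  ≤-half {k} h = subst (ℕ._≤ _) (sym (ℕ.n≡⌊n+n/2⌋ k)) (ℕ.⌊n/2⌋-mono h)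

  half-≤ : ∀ {k n} → k ℕ.≤ ⌊ n /2⌋ → k ℕ.+ k ℕ.≤ n
  half-≤ {n = n} h = ℕ.≤-trans (ℕ.+-mono-≤ h h) (double-half n)

  split : ∀ {k n} → k ℕ.≤ n → k ℕ.+ (n ℕ.∸ k) ≡ n
  split = ℕ.m+[n∸m]≡n

  other : ∀ {k m n} → k ℕ.+ m ≡ n → n ℕ.∸ k ≡ m
  other {k} {m} refl = ℕ.m+n∸m≡n k m

counted-arms : ∀ n → Counted {ℕ × ℕ} (λ (k , m) → k ℕ.≤ m × k ℕ.+ m ≡ n) (suc ⌊ n /2⌋)
counted-arms n = counted-map (λ k → k , n ℕ.∸ k) (cong proj₁)
  (λ {k} h → let 2k≤n = half-≤ (ℕ.≤-pred h) in
    ℕ.m+n≤o⇒m≤o∸n k 2k≤n , split (ℕ.m+n≤o⇒m≤o k 2k≤n))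
  (λ {(k , m)} (k≤m , e) → k , ℕ.s≤s (≤-half (subst (k ℕ.+ k ℕ.≤_) e (ℕ.+-monoʳ-≤ k k≤m))) , cong (k ,_) (other e))
  (counted-below (suc ⌊ n /2⌋))

counted-legs : ∀ n → Counted {ℕ × ℕ} (λ (d , u) → (0 ℕ.< d × 0 ℕ.< u) × d ℕ.+ u ≡ n) (n ℕ.∸ 1)
counted-legs n = counted-map (λ k → suc k , n ℕ.∸ suc k) (λ e → ℕ.suc-injective (cong proj₁ e))
  (λ {k} h → let k+1<n = room n h in (ℕ.s≤s ℕ.z≤n , ℕ.m<n⇒0<n∸m k+1<n) , split (ℕ.<⇒≤ k+1<n))
  (λ { {suc k , u} ((_ , 0<u) , e) → k , below e 0<u , cong (suc k ,_) (other e) })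
  (counted-below (n ℕ.∸ 1))
  where
  room : ∀ n {k} → k ℕ.< n ℕ.∸ 1 → suc k ℕ.< n
  room (suc n) h = ℕ.s≤s h
  below : ∀ {k u n} → suc k ℕ.+ u ≡ n → 0 ℕ.< u → k ℕ.< n ℕ.∸ 1
  below {k} {u} refl 0<u = ℕ.m<m+n k 0<u

counted-sorted-legs : ∀ n → Counted {ℕ × ℕ} (λ (d , u) → (0 ℕ.< d × d ℕ.≤ u) × d ℕ.+ u ≡ n) ⌊ n /2⌋
counted-sorted-legs n = counted-map (λ k → suc k , n ℕ.∸ suc k) (λ e → ℕ.suc-injective (cong proj₁ e))
  (λ {k} h → let 2k≤n = half-≤ h in (ℕ.s≤s ℕ.z≤n , ℕ.m+n≤o⇒m≤o∸n (suc k) 2k≤n) , split (ℕ.m+n≤o⇒m≤o (suc k) 2k≤n))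
  (λ { {suc k , u} ((_ , d≤u) , e) → k , ≤-half (subst (suc k ℕ.+ suc k ℕ.≤_) e (ℕ.+-monoʳ-≤ (suc k) d≤u)) , cong (suc k ,_) (other e) })
  (counted-below ⌊ n /2⌋)

Row : ℕ → ℕ × ℕ × ℕ → Set
Row n (l , D , r) = 0 ℕ.< D × l ℕ.+ (D ℕ.+ r) ≡ n

counted-symmetric-rows : ∀ n → Counted (λ t@(l , D , r) → l ≡ r × Row n t) ⌈ n /2⌉
counted-symmetric-rows n = counted-map (λ k → k , n ℕ.∸ (k ℕ.+ k) , k) (cong proj₁)
  (λ {k} h → let 2k<n = short (half-≤ h) in refl , ℕ.m<n⇒0<n∸m 2k<n , trans (regroup k) (split (ℕ.<⇒≤ 2k<n)))
  (λ { {l , D , .l} (refl , 0<D , e) → l , ≤-half (subst (suc l ℕ.+ suc l ℕ.≤_) (cong suc e) (long l D 0<D)) ,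
       cong (λ D → l , D , l) (other (trans (sym (regroup l)) e)) })
  (counted-below ⌈ n /2⌉)
  where
  short : ∀ {k} → suc k ℕ.+ suc k ℕ.≤ suc n → k ℕ.+ k ℕ.< n
  short {k} h = subst (ℕ._≤ n) (ℕ.+-suc k k) (ℕ.≤-pred h)
  regroup : ∀ k {D} → k ℕ.+ (D ℕ.+ k) ≡ k ℕ.+ k ℕ.+ D
  regroup k {D} = liaℕ 2 (λ k D → ⊢ k :+ (D :+ k) := k :+ k :+ D) refl k D
  long : ∀ l D → 0 ℕ.< D → suc l ℕ.+ suc l ℕ.≤ suc (l ℕ.+ (D ℕ.+ l))
  long l D 0<D = liaℕ 2 (λ l D → # 1 :≤ D ⇒ ⊢ # 1 :+ l :+ (# 1 :+ l) :≤ # 1 :+ (l :+ (D :+ l))) refl l D 0<D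

-- Taking one column off both ends reduces the rows with positive `l` from n + 2 to n, and n + 1
-- rows have l = 0. The product formula follows from 1 + x + y + x y = (1 + x) (1 + y) with x + y =
-- n.
counted-asymmetric-rows : ∀ n → Counted (λ t@(l , D , r) → l ℕ.< r × Row n t) (⌊ n /2⌋ ℕ.* ⌈ n /2⌉)
counted-asymmetric-rows 0 = counted-map (λ k → k , k , k) (cong proj₁) (λ ()) absurd (counted-below 0)
  where
  absurd : ∀ {t} → (proj₁ t ℕ.< proj₂ (proj₂ t) × Row 0 t) → ∃[ k ] k ℕ.< 0 × (k , k , k) ≡ t
  absurd {l , D , r} (_ , 0<D , e) = ⊥-elim (liaℕ 3 (λ l D r → # 1 :≤ D ⇒ l :+ (D :+ r) := # 0 ⇒ ⊢ :⊥) refl l D r 0<D e)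
counted-asymmetric-rows 1 = counted-map (λ k → k , k , k) (cong proj₁) (λ ()) absurd (counted-below 0)
  where
  absurd : ∀ {t} → (proj₁ t ℕ.< proj₂ (proj₂ t) × Row 1 t) → ∃[ k ] k ℕ.< 0 × (k , k , k) ≡ t
  absurd {l , D , r} (l<r , 0<D , e) = ⊥-elim (liaℕ 3 (λ l D r → # 1 :+ l :≤ r ⇒ # 1 :≤ D ⇒ l :+ (D :+ r) := # 1 ⇒ ⊢ :⊥) refl l D r l<r 0<D e)
counted-asymmetric-rows (suc (suc n)) = subst (Counted _) total
  (counted-resp (Sum.[ (λ (l≡0 , p) → p) , (λ (_ , p) → p) ]) by-start
    (counted-⊎ starting-at-0
      (counted-map {Q = λ t@(l , D , r) → 0 ℕ.< l × l ℕ.< r × Row (suc (suc n)) t}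
        (λ (l , D , r) → suc l , D , suc r)
        (λ e → cong₂ _,_ (ℕ.suc-injective (cong proj₁ e)) (cong₂ _,_ (cong (λ t → proj₁ (proj₂ t)) e) (ℕ.suc-injective (cong (λ t → proj₂ (proj₂ t)) e))))
        (λ { {l , D , r} (l<r , 0<D , e) → ℕ.s≤s ℕ.z≤n , ℕ.s≤s l<r , 0<D , cong suc (trans (widen l D r) (cong suc e)) })
        (λ { {suc l , D , suc r} (_ , ℕ.s≤s l<r , 0<D , e) →
             (l , D , r) , (l<r , 0<D , ℕ.suc-injective (trans (sym (widen l D r)) (ℕ.suc-injective e))) , refl })
        (counted-asymmetric-rows n))
      (λ { (refl , _) (() , _) })))
  where
  widen : ∀ l D r → l ℕ.+ (D ℕ.+ suc r) ≡ suc (l ℕ.+ (D ℕ.+ r))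
  widen l D r = liaℕ 3 (λ l D r → ⊢ l :+ (D :+ (# 1 :+ r)) := # 1 :+ (l :+ (D :+ r))) refl l D r
  starting-at-0 : Counted (λ t@(l , D , r) → l ≡ 0 × l ℕ.< r × Row (suc (suc n)) t) (suc n)
  starting-at-0 = counted-map (λ k → 0 , suc n ℕ.∸ k , suc k) (λ e → ℕ.suc-injective (cong (λ t → proj₂ (proj₂ t)) e))
    (λ {k} h → refl , ℕ.s≤s ℕ.z≤n , ℕ.m<n⇒0<n∸m h ,
      trans (ℕ.+-comm (suc n ℕ.∸ k) (suc k)) (cong suc (split (ℕ.<⇒≤ h))))
    (λ { {zero , D , suc k} (refl , _ , 0<D , e) → k , fits D k 0<D e , cong (λ D → 0 , D , suc k) (other {k} {D} (ℕ.suc-injective (trans (ℕ.+-comm (suc k) D) e))) })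
    (counted-below (suc n))
    where
    fits : ∀ D k {n} → 0 ℕ.< D → D ℕ.+ suc k ≡ suc (suc n) → k ℕ.< suc n
    fits D k {n} h e = liaℕ 3 (λ D k n → # 1 :≤ D ⇒ D :+ (# 1 :+ k) := # 1 :+ (# 1 :+ n) ⇒ ⊢ # 1 :+ k :≤ # 1 :+ n) refl D k n h e
  by-start : ∀ {t} → proj₁ t ℕ.< proj₂ (proj₂ t) × Row (suc (suc n)) t →
             (proj₁ t ≡ 0 × proj₁ t ℕ.< proj₂ (proj₂ t) × Row (suc (suc n)) t) ⊎ (0 ℕ.< proj₁ t × proj₁ t ℕ.< proj₂ (proj₂ t) × Row (suc (suc n)) t)
  by-start {zero  , _} p = inj₁ (refl , p)
  by-start {suc l , _} p = inj₂ (ℕ.s≤s ℕ.z≤n , p)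
  total : suc n ℕ.+ ⌊ n /2⌋ ℕ.* ⌈ n /2⌉ ≡ suc ⌊ n /2⌋ ℕ.* suc ⌈ n /2⌉
  total = trans (cong (λ k → suc k ℕ.+ ⌊ n /2⌋ ℕ.* ⌈ n /2⌉) (sym (ℕ.⌊n/2⌋+⌈n/2⌉≡n n)))
    (liaℕ 2 (λ x y → ⊢ # 1 :+ (x :+ y) :+ x :* y := (# 1 :+ x) :* (# 1 :+ y)) refl ⌊ n /2⌋ ⌈ n /2⌉)

module _ (a b : ℕ) where

  Zee : Code → Set
  Zee (code l r D d u) = (0 ℕ.< D × 0 ℕ.< d × 0 ℕ.< u × (l ℕ.< r ⊎ (l ≡ r × d ℕ.≤ u))) × l ℕ.+ (D ℕ.+ r) ≡ a × d ℕ.+ u ≡ b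

  private
    zeeCode : (ℕ × ℕ × ℕ) × (ℕ × ℕ) → Code
    zeeCode ((l , D , r) , (d , u)) = code l r D d u

    zeeCode-injective : ∀ {s t} → zeeCode s ≡ zeeCode t → s ≡ t
    zeeCode-injective refl = refl

  -- Classes under the half turn: if the ends of the row differ, their order chooses the
  -- representative and the legs are arbitrary; if they agree, the legs are sorted instead.
  zees : ℕ
  zees = ⌊ a /2⌋ ℕ.* ⌈ a /2⌉ ℕ.* (b ℕ.∸ 1) ℕ.+ ⌈ a /2⌉ ℕ.* ⌊ b /2⌋

  counted-zees : Counted Zee zees
  counted-zees = counted-map zeeCode zeeCode-injective
    (λ { (inj₁ ((l<r , 0<D , e) , ((0<d , 0<u) , f))) → (0<D , 0<d , 0<u , inj₁ l<r) , e , f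
       ; (inj₂ ((l≡r , 0<D , e) , ((0<d , d≤u) , f))) → (0<D , 0<d , ℕ.<-≤-trans 0<d d≤u , inj₂ (l≡r , d≤u)) , e , f })
    (λ { {code l r D d u} ((0<D , 0<d , 0<u , inj₁ l<r) , e , f) → ((l , D , r) , (d , u)) , inj₁ ((l<r , 0<D , e) , ((0<d , 0<u) , f)) , refl
       ; {code l r D d u} ((0<D , 0<d , 0<u , inj₂ (l≡r , d≤u)) , e , f) → ((l , D , r) , (d , u)) , inj₂ ((l≡r , 0<D , e) , ((0<d , d≤u) , f)) , refl })
    (counted-⊎ (counted-× (counted-asymmetric-rows a) (counted-legs b)) (counted-× (counted-symmetric-rows a) (counted-sorted-legs b))
      (λ ((l<r , _) , _) ((l≡r , _) , _) → ℕ.<-irrefl l≡r l<r))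

triangle : ℕ → ℕ
triangle zero    = 0
triangle (suc n) = triangle n ℕ.+ suc n

counted-triangle : ∀ n → Counted {ℕ × ℕ} (λ (k , m) → k ℕ.≤ m × m ℕ.< n) (triangle n)
counted-triangle zero    = counted-map (λ k → k , k) (cong proj₁) (λ ()) (λ ()) (counted-below 0)
counted-triangle (suc n) = counted-resp
  (λ { (inj₁ (k≤m , m<n)) → k≤m , ℕ.m<n⇒m<1+n m<n ; (inj₂ (k≤n , refl)) → k≤n , ℕ.≤-refl })
  (λ { {k , m} (k≤m , m<1+n) → Sum.map (k≤m ,_) (λ m≡n → subst (k ℕ.≤_) m≡n k≤m , m≡n) (ℕ.m≤n⇒m<n∨m≡n (ℕ.≤-pred m<1+n)) })
  (counted-⊎ (counted-triangle n)
    (counted-map {B = ℕ × ℕ} {Q = λ (k , m) → k ℕ.≤ n × m ≡ n} (_, n) (cong proj₁) (λ h → ℕ.≤-pred h , refl) (λ { {k , m} (h , refl) → k , ℕ.s≤s h , refl })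
      (counted-below (suc n)))
    (λ (_ , m<n) (_ , m≡n) → ℕ.<-irrefl m≡n m<n))

private
  crossCode : (ℕ × ℕ) × (ℕ × ℕ) → Code
  crossCode ((l , r) , (d , u)) = code l r 0 d u

  crossCode-injective : ∀ {s t} → crossCode s ≡ crossCode t → s ≡ t
  crossCode-injective refl = refl

Crossing : ℕ → ℕ → Code → Set
Crossing p q (code l r D d u) = D ≡ 0 × (l ℕ.≤ r × l ℕ.+ r ≡ p) × (d ℕ.≤ u × d ℕ.+ u ≡ q) × (p ≡ q → l ℕ.≤ d)

crossings-≢ : ∀ {p q} → p ≢ q → Counted (Crossing p q) (suc ⌊ p /2⌋ ℕ.* suc ⌊ q /2⌋)
crossings-≢ {p} {q} p≢q = counted-map crossCode crossCode-injective
  (λ (f , g) → refl , f , g , λ p≡q → ⊥-elim (p≢q p≡q))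
  (λ { {code l r .0 d u} (refl , f , g , _) → ((l , r) , (d , u)) , (f , g) , refl })
  (counted-× (counted-arms p) (counted-arms q))

-- The shorter arm and the shorter leg, both at most half of `p`, may be exchanged by transposition,
-- so unordered pairs are counted.
crossings-≡ : ∀ p → Counted (Crossing p p) (triangle (suc ⌊ p /2⌋))
crossings-≡ p = counted-map (λ (l , d) → code l (p ℕ.∸ l) 0 d (p ℕ.∸ d))
  (λ e → cong₂ _,_ (cong Code.l e) (cong Code.d e))
  (λ (l≤d , d<) → refl , arm (ℕ.≤-trans l≤d (ℕ.≤-pred d<)) , arm (ℕ.≤-pred d<) , λ _ → l≤d)
  (λ { {code l r .0 d u} (refl , (l≤r , e) , (d≤u , f) , low) → (l , d) ,
       (low refl , ℕ.s≤s (≤-half (subst (d ℕ.+ d ℕ.≤_) f (ℕ.+-monoʳ-≤ d d≤u)))) ,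
       cong₂ (λ r u → code l r 0 d u) (other e) (other f) })
  (counted-triangle (suc ⌊ p /2⌋))
  where
  arm : ∀ {k} → k ℕ.≤ ⌊ p /2⌋ → k ℕ.≤ p ℕ.∸ k × k ℕ.+ (p ℕ.∸ k) ≡ p
  arm {k} h = ℕ.m+n≤o⇒m≤o∸n k (half-≤ h) , split (ℕ.m+n≤o⇒m≤o k (half-≤ h))

private
  straight-or-not : ∀ {a b p q} c → Crossing p q c → Zee a b c → ⊥
  straight-or-not (code l r .0 d u) (refl , _) ((() , _) , _)

canonical-≢ : ∀ {p q} → p ≢ q → Counted (Canonical p q) (suc ⌊ p /2⌋ ℕ.* suc ⌊ q /2⌋ ℕ.+ (zees p q ℕ.+ zees q p))
canonical-≢ {p} {q} p≢q = counted-resp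
  (λ { {code _ _ _ _ _} (inj₁ (refl , (a , b) , (c , d) , e)) → crossing a c b d e
     ; {code _ _ _ _ _} (inj₂ (inj₁ ((a , b , c , d) , e))) → zee a b c d (inj₁ e)
     ; {code _ _ _ _ _} (inj₂ (inj₂ ((a , b , c , d) , e))) → zee a b c d (inj₂ e) })
  (λ { (crossing a c b d e) → inj₁ (refl , (a , b) , (c , d) , e)
     ; (zee a b c d (inj₁ e)) → inj₂ (inj₁ ((a , b , c , d) , e))
     ; (zee a b c d (inj₂ e)) → inj₂ (inj₂ ((a , b , c , d) , e)) })
  (counted-⊎ (crossings-≢ p≢q)
    (counted-⊎ (counted-zees p q) (counted-zees q p) (λ (_ , e , _) (_ , e′ , _) → p≢q (trans (sym e) e′)))
    (λ {c} s t → Sum.[ straight-or-not c s , straight-or-not c s ] t))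

-- For equal dimensions the two alternatives in `zee` describe the same codes, which are counted
-- once; for different ones they are disjoint and both contribute.
canonical-≡ : ∀ p → Counted (Canonical p p) (triangle (suc ⌊ p /2⌋) ℕ.+ zees p p)
canonical-≡ p = counted-resp
  (λ { {code _ _ _ _ _} (inj₁ (refl , (a , b) , (c , d) , e)) → crossing a c b d e
     ; {code _ _ _ _ _} (inj₂ ((a , b , c , d) , e)) → zee a b c d (inj₁ e) })
  (λ { (crossing a c b d e) → inj₁ (refl , (a , b) , (c , d) , e)
     ; (zee a b c d (inj₁ e)) → inj₂ ((a , b , c , d) , e)
     ; (zee a b c d (inj₂ e)) → inj₂ ((a , b , c , d) , e) })
  (counted-⊎ (crossings-≡ p) (counted-zees p p) (λ {c} s t → straight-or-not c s t))

lookup-injective : ∀ {A : Set} {xs : List A} → Unique xs → ∀ i j → lookup xs i ≡ lookup xs j → i ≡ j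
lookup-injective (_ ∷ _)  zero    zero    _ = refl
lookup-injective (x∉ ∷ _) zero    (suc j) e = ⊥-elim (All.lookup x∉ (∈-lookup j) e)
lookup-injective (x∉ ∷ _) (suc i) zero    e = ⊥-elim (All.lookup x∉ (∈-lookup i) (sym e))
lookup-injective (_ ∷ u)  (suc i) (suc j) e = cong suc (lookup-injective u i j e)

-- Extremal polyominoes up to congruence correspond to canonical codes.

module _ (m : ℕ) where

  private
    n = suc m
    p = ⌊ m /2⌋
    q = ⌊ suc m /2⌋

    Extremal : Set
    Extremal = ∃[ P ] HasArea (hull {n} P) (maxHullArea n)

    dimensions : ∀ {c} (let open Code c) → Canonical p q c → (l ℕ.+ (D ℕ.+ r) ≡ p × d ℕ.+ u ≡ q) ⊎ (l ℕ.+ (D ℕ.+ r) ≡ q × d ℕ.+ u ≡ p)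
    dimensions (crossing _ _ e f _) = inj₁ (e , f)
    dimensions (zee _ _ _ _ dims)   = dims

    module _ {c : Code} (can : Canonical p q c) where

      open Code c

      private
        size≡ : ∀ {x y} → (x ≡ p × y ≡ q) ⊎ (x ≡ q × y ≡ p) → suc (x ℕ.+ y) ≡ n
        size≡ (inj₁ (refl , refl)) = cong suc (ℕ.⌊n/2⌋+⌈n/2⌉≡n m)
        size≡ (inj₂ (refl , refl)) = cong suc (trans (ℕ.+-comm q p) (ℕ.⌊n/2⌋+⌈n/2⌉≡n m))

        area≡ : ∀ {x y} → (x ≡ p × y ≡ q) ⊎ (x ≡ q × y ≡ p) → doubleMax x y ≡ doubleMax p q
        area≡ (inj₁ (refl , refl)) = refl
        area≡ (inj₂ (refl , refl)) = lia 2 (λ p q → ⊢ # 2 :* (# 1 :+ q :+ p) :+ q :* p := # 2 :* (# 1 :+ p :+ q) :+ p :* q) refl (+ p) (+ q)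

      canonicalPolyomino : Polyomino n
      canonicalPolyomino = framePolyomino (code-inside c) (size≡ (dimensions can))

      canonical-hasArea : HasArea (hull canonicalPolyomino) (maxHullArea n)
      canonical-hasArea = subst (HasArea (ConvexHull (InUnion (frameCells (codeFrame c)))))
        (trans (cong (λ z → ½ ℚ.* ι z) (area≡ (dimensions can))) (sym (maxHullArea-suc m)))
        (FrameHull.frame-hasArea (code-inside c))

      canonical-similar : Similar (_∈ cells canonicalPolyomino) (InCode c)
      canonical-similar = similar-≐ {_∈ frameCells (codeFrame c)} {InCode c} (frame-∈⁻ (code-inside c)) (frame-∈⁺ (code-inside c))

    zed-canonized : ∀ {S} → (∃[ a ] ∃[ b ] ((a ≡ p × b ≡ q) ⊎ (a ≡ q × b ≡ p)) × IsZed± S (+ a) (+ b)) → Canonized p q S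
    zed-canonized (a , b , dims , z) = isZed±-canonized (Sum.map (λ (e , f) → cong +_ e , cong +_ f) (λ (e , f) → cong +_ e , cong +_ f) dims) z

    codeOf : ((P , _) : Extremal) → Canonized p q (_∈ cells P)
    codeOf (P , h) = zed-canonized (drawn-zed (draw P h))

    similar⇒≡ : ∀ {S T} (s : Canonized p q S) (t : Canonized p q T) → Similar S T → proj₁ s ≡ proj₁ t
    similar⇒≡ (c , can , s) (c′ , can′ , s′) st = canonical-injective (ℕ.⌊n/2⌋-mono (ℕ.n≤1+n m)) (ℕ.⌊n/2⌋-mono (ℕ.n≤1+n (suc m))) can can′
      (similar-trans (similar-sym s) (similar-trans st s′))

  extremal : Extremal
  extremal = canonicalPolyomino can , canonical-hasArea can
    where
    -- An L: both shorter parts are 0, so all order conditions hold trivially.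
    can : Canonical p q (code 0 p 0 0 q)
    can = crossing ℕ.z≤n ℕ.z≤n refl refl (λ _ → ℕ.z≤n)

  -- The code is computed from a chosen growth and a given polygon; by `canonical-injective` it
  -- depends on the congruence class only. Conversely each canonical code is the code of its own
  -- polyomino.
  cardinality : ∀ {k} → Counted (Canonical p q) k → HasCardinality (polyominoesWithHullArea n (maxHullArea n)) k
  cardinality (counted cs distinct sound complete refl) = record
    { to        = index
    ; from      = λ k → canonicalPolyomino (at k) , canonical-hasArea (at k)
    ; to-cong   = λ {x} {y} x≈y → index≡ x (index y) (trans (similar⇒≡ (codeOf x) (codeOf y) (congruent⇒similar {P = proj₁ x} {proj₁ y} x≈y)) (sym (lookup-index y)))
    ; from-cong = λ { {k} refl → translation-refl k }
    ; inverse   = (λ {k} {y} y≈ → index≡ y k (similar⇒≡ (codeOf y) (canonized k) (congruent⇒similar {P = proj₁ y} {canonicalPolyomino (at k)} y≈)))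
                , (λ { {y} refl → similar⇒congruent {P = canonicalPolyomino (at (index y))} {proj₁ y} (back y) })
    }
    where
    index : Extremal → Fin (length cs)
    index x = Any.index (complete (proj₁ (proj₂ (codeOf x))))
    lookup-index : ∀ x → lookup cs (index x) ≡ proj₁ (codeOf x)
    lookup-index x = sym (Any.lookup-index (complete (proj₁ (proj₂ (codeOf x)))))
    index≡ : ∀ x k → proj₁ (codeOf x) ≡ lookup cs k → index x ≡ k
    index≡ x k e = lookup-injective distinct (index x) k (trans (lookup-index x) e)
    at : ∀ k → Canonical p q (lookup cs k)
    at k = sound (∈-lookup k)
    canonized : ∀ k → Canonized p q (_∈ cells (canonicalPolyomino (at k)))
    canonized k = lookup cs k , at k , canonical-similar (at k)
    translation-refl : ∀ k → Congruent (canonicalPolyomino (at k)) (canonicalPolyomino (at k))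
    translation-refl k = similar⇒congruent {P = canonicalPolyomino (at k)} {canonicalPolyomino (at k)} similar-refl
    back : ∀ y → Similar (_∈ cells (canonicalPolyomino (at (index y)))) (_∈ cells (proj₁ y))
    back y = similar-trans (canonical-similar (at (index y)))
      (subst (λ c → Similar (InCode c) (_∈ cells (proj₁ y))) (sym (lookup-index y)) (similar-sym (proj₂ (proj₂ (codeOf y)))))

-- The quasi-polynomial

private
  mod-4 : ∀ {n} r k → n ≡ r ℕ.+ k ℕ.* 4 → n mod 4 ≡ r mod 4
  mod-4 r k refl = Fin.toℕ-injective (trans (Fin.toℕ-fromℕ< (m%n<n (r ℕ.+ k ℕ.* 4) 4))
    (trans ([m+kn]%n≡m%n r k 4) (sym (Fin.toℕ-fromℕ< (m%n<n r 4)))))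

  -- The negative term is moved to the left in the hypothesis, so that the identities can be checked
  -- within the natural numbers.
  polynomial : ∀ {n c} a b d → c ℕ.* d ℕ.+ 2 ℕ.* (n ℕ.* n) ≡ n ℕ.* n ℕ.* n ℕ.+ a ℕ.* n ℕ.+ b →
               + c ℤ.* + d ≡ (+ n) ℤ.^ 3 ℤ.- + 2 ℤ.* (+ n) ℤ.^ 2 ℤ.+ + a ℤ.* (+ n) ℤ.+ + b
  polynomial {n} {c} a b d e = lia 5 (λ c d n a b → c :* d :+ # 2 :* (n :* n) := n :* n :* n :+ a :* n :+ b ⇒
      ⊢ c :* d := n :* (n :* (n :* # 1)) :- # 2 :* (n :* (n :* # 1)) :+ a :* n :+ b) refl (+ c) (+ d) (+ n) (+ a) (+ b)
    (trans (cong₂ ℤ._+_ (sym (ℤ.pos-* c d)) (trans (cong (+ 2 ℤ.*_) (sym (ℤ.pos-* n n))) (sym (ℤ.pos-* 2 (n ℕ.* n)))))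
      (trans (cong +_ e) (cong₂ (λ x y → x ℤ.+ y ℤ.+ + b) (trans (ℤ.pos-* (n ℕ.* n) n) (cong (ℤ._* + n) (ℤ.pos-* n n))) (ℤ.pos-* a n))))

  /-intro : ∀ {c z} d → + c ℤ.* + suc d ≡ z → + c / 1 ≡ z / suc d
  /-intro {c} {z} d e = ℚ.fromℚᵘ-cong {mkℚᵘ (+ c) 0} {mkℚᵘ z d} (*≡* (trans e (sym (ℤ.*-identityʳ z))))

  formula-0 : ∀ n c → n mod 4 ≡ 0F → c ℕ.* 16 ℕ.+ 2 ℕ.* (n ℕ.* n) ≡ n ℕ.* n ℕ.* n ℕ.+ 4 ℕ.* n ℕ.+ 0 → + c / 1 ≡ countFormula n
  formula-0 n c eq h rewrite eq = /-intro {c} 15 (trans (polynomial {n} {c} 4 0 16 h) (ℤ.+-identityʳ ((+ n) ℤ.^ 3 ℤ.- + 2 ℤ.* (+ n) ℤ.^ 2 ℤ.+ + 4 ℤ.* (+ n))))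

  formula-1 : ∀ n c → n mod 4 ≡ 1F → c ℕ.* 32 ℕ.+ 2 ℕ.* (n ℕ.* n) ≡ n ℕ.* n ℕ.* n ℕ.+ 13 ℕ.* n ℕ.+ 20 → + c / 1 ≡ countFormula n
  formula-1 n c eq h rewrite eq = /-intro {c} 31 (polynomial {n} {c} 13 20 32 h)

  formula-2 : ∀ n c → n mod 4 ≡ 2F → c ℕ.* 16 ℕ.+ 2 ℕ.* (n ℕ.* n) ≡ n ℕ.* n ℕ.* n ℕ.+ 4 ℕ.* n ℕ.+ 8 → + c / 1 ≡ countFormula n
  formula-2 n c eq h rewrite eq = /-intro {c} 15 (polynomial {n} {c} 4 8 16 h)

  formula-3 : ∀ n c → n mod 4 ≡ 3F → c ℕ.* 32 ℕ.+ 2 ℕ.* (n ℕ.* n) ≡ n ℕ.* n ℕ.* n ℕ.+ 5 ℕ.* n ℕ.+ 8 → + c / 1 ≡ countFormula n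
  formula-3 n c eq h rewrite eq = /-intro {c} 31 (polynomial {n} {c} 5 8 32 h)

  triangle-double : ∀ n → triangle n ℕ.+ triangle n ≡ n ℕ.* suc n
  triangle-double zero    = refl
  triangle-double (suc n) = liaℕ 2 (λ t n → t :+ t := n :* (# 1 :+ n) ⇒ ⊢ t :+ (# 1 :+ n) :+ (t :+ (# 1 :+ n)) := (# 1 :+ n) :* (# 1 :+ (# 1 :+ n)))
    refl (triangle n) n (triangle-double n)

Formula : ℕ → Set
Formula m = ∃[ c ] Counted (Canonical ⌊ m /2⌋ ⌊ suc m /2⌋) c × + c / 1 ≡ countFormula (suc m)

private
  module _ (k : ℕ) where

    h = k ℕ.+ k

    -- Halves of `k + k` equal `k` only by a proof, so counts are transported along it. `halve` does
    -- the same for the dimensions, which are halves of 4 k plus a remainder.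
    floor : ∀ {A : ℕ → ℕ → Set} → A ⌊ h /2⌋ ⌈ h /2⌉ → A k k
    floor {A} = subst₂ A (sym (ℕ.n≡⌊n+n/2⌋ k)) (sym (ℕ.n≡⌈n+n/2⌉ k))

    halve : ∀ {A : ℕ → ℕ → Set} → A h h → A ⌊ h ℕ.+ h /2⌋ ⌈ h ℕ.+ h /2⌉
    halve {A} = subst₂ A (ℕ.n≡⌊n+n/2⌋ h) (ℕ.n≡⌈n+n/2⌉ h)

  formula₁ : ∀ k → Formula (h k ℕ.+ h k)
  formula₁ k = N k ,
    halve k {λ p q → Counted (Canonical p q) (N k)} (floor k {λ f c → Counted (Canonical (h k) (h k)) (triangle (suc f) ℕ.+ (f ℕ.* c ℕ.* (h k ℕ.∸ 1) ℕ.+ c ℕ.* f))} (canonical-≡ (h k))) ,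
    formula-1 (suc (h k ℕ.+ h k)) (N k) (mod-4 1 k (liaℕ 1 (λ k → ⊢ # 1 :+ (k :+ k :+ (k :+ k)) := # 1 :+ k :* # 4) refl k)) (eq k)
    where
    N : ℕ → ℕ
    N k = triangle (suc k) ℕ.+ (k ℕ.* k ℕ.* (h k ℕ.∸ 1) ℕ.+ k ℕ.* k)
    eq : ∀ k (let n = suc (h k ℕ.+ h k)) → N k ℕ.* 32 ℕ.+ 2 ℕ.* (n ℕ.* n) ≡ n ℕ.* n ℕ.* n ℕ.+ 13 ℕ.* n ℕ.+ 20
    -- The case k = 0 is separate because of the truncated subtraction in `h k ∸ 1`.
    eq zero    = refl
    eq (suc j) = liaℕ 2 (λ t j → let k = # 1 :+ j; n = # 1 :+ (k :+ k :+ (k :+ k)) in t :+ t := (# 1 :+ k) :* (# 1 :+ (# 1 :+ k)) ⇒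
      ⊢ (t :+ (k :* k :* (j :+ k) :+ k :* k)) :* # 32 :+ # 2 :* (n :* n) := n :* n :* n :+ # 13 :* n :+ # 20)
      refl (triangle (suc (suc j))) j (triangle-double (suc (suc j)))

  formula₂ : ∀ k → Formula (suc (h k ℕ.+ h k))
  formula₂ k = N k ,
    halve k {λ p q → Counted (Canonical q (suc p)) (N k)} (floor k {λ f c → Counted (Canonical (h k) (suc (h k)))
      (suc f ℕ.* suc c ℕ.+ ((f ℕ.* c ℕ.* h k ℕ.+ c ℕ.* c) ℕ.+ (c ℕ.* suc f ℕ.* (h k ℕ.∸ 1) ℕ.+ suc f ℕ.* f)))} (canonical-≢ (λ e → ℕ.1+n≢n (sym e)))) ,
    formula-2 (suc (suc (h k ℕ.+ h k))) (N k) (mod-4 2 k (liaℕ 1 (λ k → ⊢ # 1 :+ (# 1 :+ (k :+ k :+ (k :+ k))) := # 2 :+ k :* # 4) refl k)) (eq k)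
    where
    N : ℕ → ℕ
    N k = suc k ℕ.* suc k ℕ.+ ((k ℕ.* k ℕ.* h k ℕ.+ k ℕ.* k) ℕ.+ (k ℕ.* suc k ℕ.* (h k ℕ.∸ 1) ℕ.+ suc k ℕ.* k))
    eq : ∀ k (let n = suc (suc (h k ℕ.+ h k))) → N k ℕ.* 16 ℕ.+ 2 ℕ.* (n ℕ.* n) ≡ n ℕ.* n ℕ.* n ℕ.+ 4 ℕ.* n ℕ.+ 8
    eq zero    = refl
    eq (suc j) = liaℕ 1 (λ j → let k = # 1 :+ j; s = # 1 :+ k; n = # 1 :+ (# 1 :+ (k :+ k :+ (k :+ k))) in
      ⊢ (s :* s :+ ((k :* k :* (k :+ k) :+ k :* k) :+ (k :* s :* (j :+ k) :+ s :* k))) :* # 16 :+ # 2 :* (n :* n) := n :* n :* n :+ # 4 :* n :+ # 8)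
      refl j

  formula₃ : ∀ k → Formula (suc (suc (h k ℕ.+ h k)))
  formula₃ k = N ,
    halve k {λ p q → Counted (Canonical (suc p) (suc q)) N} (floor k {λ f c → Counted (Canonical (suc (h k)) (suc (h k)))
      (triangle (suc c) ℕ.+ (c ℕ.* suc f ℕ.* h k ℕ.+ suc f ℕ.* c))} (canonical-≡ (suc (h k)))) ,
    formula-3 (suc (suc (suc (h k ℕ.+ h k)))) N (mod-4 3 k (liaℕ 1 (λ k → ⊢ # 1 :+ (# 1 :+ (# 1 :+ (k :+ k :+ (k :+ k)))) := # 3 :+ k :* # 4) refl k))
      (liaℕ 2 (λ t k → let n = # 1 :+ (# 1 :+ (# 1 :+ (k :+ k :+ (k :+ k)))); s = # 1 :+ k in t :+ t := s :* (# 1 :+ s) ⇒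
        ⊢ (t :+ (k :* s :* (k :+ k) :+ s :* k)) :* # 32 :+ # 2 :* (n :* n) := n :* n :* n :+ # 5 :* n :+ # 8)
        refl (triangle (suc k)) k (triangle-double (suc k)))
    where
    N : ℕ
    N = triangle (suc k) ℕ.+ (k ℕ.* suc k ℕ.* h k ℕ.+ suc k ℕ.* k)

  formula₄ : ∀ k → Formula (suc (suc (suc (h k ℕ.+ h k))))
  formula₄ k = N ,
    halve k {λ p q → Counted (Canonical (suc q) (suc (suc p))) N} (floor k {λ f c → Counted (Canonical (suc (h k)) (suc (suc (h k))))
      (suc c ℕ.* suc (suc f) ℕ.+ ((c ℕ.* suc f ℕ.* suc (h k) ℕ.+ suc f ℕ.* suc f) ℕ.+ (suc f ℕ.* suc c ℕ.* h k ℕ.+ suc c ℕ.* c)))} (canonical-≢ (λ e → ℕ.1+n≢n (sym e)))) ,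
    formula-0 (suc (suc (suc (suc (h k ℕ.+ h k))))) N (mod-4 0 (suc k) (liaℕ 1 (λ k → ⊢ # 1 :+ (# 1 :+ (# 1 :+ (# 1 :+ (k :+ k :+ (k :+ k))))) := (# 1 :+ k) :* # 4) refl k))
      (liaℕ 1 (λ k → let n = # 1 :+ (# 1 :+ (# 1 :+ (# 1 :+ (k :+ k :+ (k :+ k))))); s = # 1 :+ k; h = k :+ k in
        ⊢ (s :* (# 1 :+ s) :+ ((k :* s :* (# 1 :+ h) :+ s :* s) :+ (s :* s :* h :+ s :* k))) :* # 16 :+ # 2 :* (n :* n) := n :* n :* n :+ # 4 :* n :+ # 0)
        refl k)
    where
    N : ℕ
    N = suc k ℕ.* suc (suc k) ℕ.+ ((k ℕ.* suc k ℕ.* suc (h k) ℕ.+ suc k ℕ.* suc k) ℕ.+ (suc k ℕ.* suc k ℕ.* h k ℕ.+ suc k ℕ.* k))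

formula : ∀ m → Formula m
formula m with m divMod 4
... | result k r refl = subst Formula (liaℕ 2 (λ r k → ⊢ r :+ (k :+ k :+ (k :+ k)) := r :+ k :* # 4) refl (toℕ r) k) (by-remainder r)
  where
  by-remainder : ∀ r → Formula (toℕ r ℕ.+ (h k ℕ.+ h k))
  -- The remainder is that of n - 1, so the residues of n appear here in the order 1, 2, 3, 0.
  by-remainder 0F = formula₁ k
  by-remainder 1F = formula₂ k
  by-remainder 2F = formula₃ k
  by-remainder 3F = formula₄ k

theorem1 : (n : ℕ) → n ≥ 1 →
    IsMaximumHullArea n (maxHullArea n) ×
    (∃[ c₂ ] HasCardinality (polyominoesWithHullArea n (maxHullArea n)) c₂ ×
             + c₂ / 1 ≡ countFormula n)
theorem1 (suc m) _ = let c , counts , eq = formula m in (extremal m , hullArea-≤) , c , cardinality m counts , eq
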